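{- Let $\lambda$ be an integer partition and let $w\in\mathfrak{S}_n$ (for some $n$) be a vexillary permutation of shape $\lambda$. (a) The lower intervals $[\varnothing,\lambda]$ in Young's lattice and $[e,w]$ in the right weak Bruhat order on $\mathfrak{S}_n$ satisfy $\mathbb{E}(Y_{[\varnothing,\lambda]})=\mathbb{E}(Y_{[e,w]})$. (b) If $w$ is either Grassmannian or inverse Grassmannian, then also $\mathbb{E}(X_{[\varnothing,\lambda]})=\mathbb{E}(X_{[e,w]})$. (c) If $\lambda=\delta_d\circ b^a$ is a rectangular staircase (for positive integers $d,a,b$) and $w$ is dominant, Grassmannian, or inverse Grassmannian, then the four posets $[\varnothing,\lambda]$, $[e,w]$, $[\varnothing,\lambda]^*$ and $[e,w]^*$ are all CDE, and in each case $$\mathbb{E}(X)=\mathbb{E}(Y)=\frac{(d-1)ab}{a+b}.$$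
   Context: For a finite poset $P$ and $p\in P$, the down-degree of $p$ is $\#\{q\in P: q\lessdot p\}$ (number of elements covered by $p$). $X_P$ is the down-degree random variable on $P$ with the uniform distribution. $Y_P$ is the down-degree random variable on $P$ with the distribution assigning to $p$ probability proportional to the number of maximal (inclusion-maximal) chains of $P$ containing $p$. $P$ is called CDE (coincidental down-degree expectations) if $\mathbb{E}(X_P)=\mathbb{E}(Y_P)$. $P^*$ denotes the dual poset. Young's lattice: partitions ordered by containment of Ferrers diagrams; $[\varnothing,\lambda]$ is the set of partitions $\mu\subseteq\lambda$. Right weak Bruhat order on $\mathfrak{S}_n$: the transitive closure of $u\lessdot w$ whenever $w=u\sigma_i$ with $\sigma_i=(i,i+1)$ and $u(i)<u(i+1)$ (i.e. $w$ is obtained from $u$ by swapping the entries in positions $i,i+1$ to create a descent); $e$ is the identity. The Lehmer code of $w$ is $c(w)=(c_1(w),c_2(w),\dots)$ with $c_i(w)=\#\{j>i: w(i)>w(j)\}$. A permutation is vexillary if it avoids $2143$ (no $i_1<i_2<i_3<i_4$ with $w(i_2)<w(i_1)<w(i_4)<w(i_3)$); the shape of a vexillary $w$ is the weakly decreasing rearrangement of $c(w)$. $w$ is dominant if it avoids $132$; Grassmannian if it has at most one descent ($w(i)>w(i+1)$ for at most one $i$); inverse Grassmannian if $w^{ -1}$ is Grassmannian. The rectangular staircase $\delta_d\circ b^a$ is the partition obtained from the staircase $\delta_d=(d-1,d-2,\dots,1)$ by replacing each cell by an $a\times b$ block, i.e. the partition with $a$ parts equal to $(d-1)b$, then $a$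 parts equal to $(d-2)b$, ..., then $a$ parts equal to $b$. -}

module Defs where

open import Data.Nat using (ℕ; zero; suc; _+_; _*_; _∸_; _<_; _≤_; _≤ᵇ_; _<ᵇ_)
import Data.Nat.Properties as ℕP
open import Data.Bool using (Bool; true; false; _∧_; _∨_; not; if_then_else_)
open import Data.List using (List; []; _∷_; length; filterᵇ; map; concatMap; replicate; upTo; reverse; drop; _++_)
open import Data.Bool.ListAction using (any; all)
open import Data.Nat.ListAction using (sum)
open import Data.List.Properties using (≡-dec)
open import Data.Product using (∃; _×_; _,_)
open import Data.Rational using (ℚ; 0ℚ; _/_)
open import Data.Integer using (+_)
open import Relation.Nullary using (¬_)
open import Relation.Nullary.Decidable using (⌊_⌋)
open import Relation.Binary.PropositionalEquality using (_≡_)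

-- Finite posets, given by a duplicate-free list of elements and a
-- boolean order relation.

record FinPoset : Set₁ where
  field
    Carrier : Set
    elems   : List Carrier
    leq     : Carrier → Carrier → Bool

module _ (P : FinPoset) where
  open FinPoset P

  lt : Carrier → Carrier → Bool
  lt x y = leq x y ∧ not (leq y x)

  covers : Carrier → Carrier → Bool
  covers q p = lt q p ∧ not (any (λ r → lt q r ∧ lt r p) elems)

  downDeg : Carrier → ℕ
  downDeg p = length (filterᵇ (λ q → covers q p) elems)

  memb : Carrier → List Carrier → Bool
  memb x S = any (λ y → leq x y ∧ leq y x) S

  comparable : Carrier → Carrier → Bool
  comparable x y = leq x y ∨ leq y x

  isChain : List Carrier → Bool
  isChain S = all (λ x → all (λ y → comparable x y) S) S

  isMaxChain : List Carrier → Bool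
  isMaxChain S = isChain S ∧ all (λ x → not (all (comparable x) S) ∨ memb x S) elems

  subsets : List Carrier → List (List Carrier)
  subsets []       = [] ∷ []
  subsets (x ∷ xs) = let r = subsets xs in map (x ∷_) r ++ r

  maxChains : List (List Carrier)
  maxChains = filterᵇ isMaxChain (subsets elems)

  numMaxChainsThrough : Carrier → ℕ
  numMaxChainsThrough p = length (filterᵇ (memb p) maxChains)

-- a / b as a rational number (only used with b ≠ 0; 0 if b = 0)
frac : ℕ → ℕ → ℚ
frac a zero    = 0ℚ
frac a (suc b) = (+ a) / suc b

EX : FinPoset → ℚ
EX P = frac (sum (map (downDeg P) elems)) (length elems)
  where open FinPoset P

EY : FinPoset → ℚ
EY P = frac (sum (map (λ p → downDeg P p * numMaxChainsThrough P p) elems))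
            (sum (map (numMaxChainsThrough P) elems))
  where open FinPoset P

IsCDE : FinPoset → Set
IsCDE P = EX P ≡ EY P

dual : FinPoset → FinPoset
dual P = record { Carrier = Carrier ; elems = elems ; leq = λ x y → leq y x }
  where open FinPoset P

eqL : List ℕ → List ℕ → Bool
eqL u v = ⌊ ≡-dec ℕP._≟_ u v ⌋

at : List ℕ → ℕ → ℕ
at []       _       = 0
at (x ∷ xs) zero    = x
at (x ∷ xs) (suc i) = at xs i

-- Young's lattice: [∅, λ]
-- A partition μ ⊆ λ is represented by the length-ℓ(λ) list (μ₁,…,μ_ℓ(λ))
-- padded with zeros; containment of Ferrers diagrams = pointwise ≤.

boxes : List ℕ → List (List ℕ)
boxes []       = [] ∷ []
boxes (l ∷ ls) = concatMap (λ m → map (m ∷_) (boxes ls)) (upTo (suc l))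

weaklyDecr : List ℕ → Bool
weaklyDecr []           = true
weaklyDecr (x ∷ [])     = true
weaklyDecr (x ∷ y ∷ xs) = (y ≤ᵇ x) ∧ weaklyDecr (y ∷ xs)

pointwiseLe : List ℕ → List ℕ → Bool
pointwiseLe []       []       = true
pointwiseLe (x ∷ xs) (y ∷ ys) = (x ≤ᵇ y) ∧ pointwiseLe xs ys
pointwiseLe _        _        = false

YoungInterval : List ℕ → FinPoset
YoungInterval lam = record
  { Carrier = List ℕ
  ; elems   = filterᵇ weaklyDecr (boxes lam)
  ; leq     = pointwiseLe }

-- Permutations of {0,…,n-1} in one-line notation, as lists.

insertAll : ℕ → List ℕ → List (List ℕ)
insertAll x []       = (x ∷ []) ∷ []
insertAll x (y ∷ ys) = (x ∷ y ∷ ys) ∷ map (y ∷_) (insertAll x ys)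

permsOf : List ℕ → List (List ℕ)
permsOf []       = [] ∷ []
permsOf (x ∷ xs) = concatMap (insertAll x) (permsOf xs)

perms : ℕ → List (List ℕ)
perms n = permsOf (upTo n)

identity : ℕ → List ℕ
identity n = upTo n

ascentAt : List ℕ → ℕ → Bool
ascentAt (x ∷ y ∷ xs) zero    = x <ᵇ y
ascentAt (x ∷ xs)     (suc i) = ascentAt xs i
ascentAt _            _       = false

swapAt : List ℕ → ℕ → List ℕ
swapAt (x ∷ y ∷ xs) zero    = y ∷ x ∷ xs
swapAt (x ∷ xs)     (suc i) = x ∷ swapAt xs i
swapAt xs           _       = xs

reach : ℕ → List ℕ → List ℕ → Bool
reach zero    u v = eqL u v
reach (suc k) u v = eqL u v ∨ any (λ i → ascentAt u i ∧ reach k (swapAt u i) v) (upTo (length u))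

-- right weak order: reflexive-transitive closure of the covers.  Each cover
-- step increases the number of inversions by one, so chains have length
-- ≤ n(n-1)/2 ≤ n*n; fuel n*n therefore computes the full closure.
weakLe : List ℕ → List ℕ → Bool
weakLe u v = reach (length u * length u) u v

WeakInterval : ℕ → List ℕ → FinPoset
WeakInterval n w = record
  { Carrier = List ℕ
  ; elems   = filterᵇ (λ u → weakLe (identity n) u ∧ weakLe u w) (perms n)
  ; leq     = weakLe }

lehmer : List ℕ → List ℕ
lehmer []       = []
lehmer (x ∷ xs) = length (filterᵇ (λ y → y <ᵇ x) xs) ∷ lehmer xs

insertDecr : ℕ → List ℕ → List ℕ
insertDecr x []       = x ∷ []
insertDecr x (y ∷ ys) = if y ≤ᵇ x then x ∷ y ∷ ys else y ∷ insertDecr x ys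

sortDecr : List ℕ → List ℕ
sortDecr []       = []
sortDecr (x ∷ xs) = insertDecr x (sortDecr xs)

shape : List ℕ → List ℕ
shape w = filterᵇ (λ c → 0 <ᵇ c) (sortDecr (lehmer w))

Contains2143 : List ℕ → Set
Contains2143 w = ∃ λ i1 → ∃ λ i2 → ∃ λ i3 → ∃ λ i4 →
  i1 < i2 × i2 < i3 × i3 < i4 × i4 < length w ×
  at w i2 < at w i1 × at w i1 < at w i4 × at w i4 < at w i3

Vexillary : List ℕ → Set
Vexillary w = ¬ Contains2143 w

Contains132 : List ℕ → Set
Contains132 w = ∃ λ i → ∃ λ j → ∃ λ k →
  i < j × j < k × k < length w × at w i < at w k × at w k < at w j

Dominant : List ℕ → Set
Dominant w = ¬ Contains132 w

DescentAt : List ℕ → ℕ → Set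
DescentAt w i = suc i < length w × at w (suc i) < at w i

Grassmannian : List ℕ → Set
Grassmannian w = ∀ i j → DescentAt w i → DescentAt w j → i ≡ j

indexOf : ℕ → List ℕ → ℕ
indexOf v []       = 0
indexOf v (x ∷ xs) = if eqL (v ∷ []) (x ∷ []) then 0 else suc (indexOf v xs)

inverse : List ℕ → List ℕ
inverse w = map (λ v → indexOf v w) (upTo (length w))

InverseGrassmannian : List ℕ → Set
InverseGrassmannian w = Grassmannian (inverse w)

rectStaircase : ℕ → ℕ → ℕ → List ℕ
rectStaircase d a b = concatMap (λ k → replicate a (k * b)) (reverse (drop 1 (upTo d)))

-- A maximal chain of [e, w] is a reduced word of w, and a maximal chain with a marked down-cover of
-- one of its elements is a word with one letter more whose 0-Hecke product is w. So E(Y) depends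
-- only on the numbers of 0-Hecke words of lengths ℓ and ℓ + 1. By Lascoux's transition formula,
-- proved by commuting it with the 0-Hecke operators, these numbers do not change when a vexillary w
-- with a 132 pattern is moved one step towards a dominant permutation with the same code up to
-- order. Hence they depend only on the shape, and for an inverse Grassmannian permutation the
-- interval is Young's lattice itself. Grassmannian permutations give the dual of Young's lattice.
--
-- For E(X) and E(Y) of a staircase and for duality the point is toggle symmetry: an inversion x < y
-- of w is as often an ascent x y as a descent y x, uniformly over the interval and over the elements
-- of maximal chains. The second case comes from a commutation relation between removing descents and
-- going up in Bruhat order. For lattice paths below a rectangular staircase the weights a i - b j of
-- the turns telescope, so toggle symmetry determines the expected number of turns.
--
-- For dominant w the interval consists of the linear extensions of a forest, where the expected
-- number of descents obeys a recursion that the forests of rectangular staircases solve.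
module Submission where

open import Defs
open import Data.Nat using (ℕ; zero; suc; _+_; _*_; _∸_; _<_; _≤_; _≤ᵇ_; _<ᵇ_; z≤n; s≤s; s≤s⁻¹; _≟_; _<?_; _≤?_)
import Data.Nat.Properties as ℕ
open import Data.Nat.Tactic.RingSolver using (solve-∀)
open import Data.Nat.ListAction using (sum)
open import Data.Nat.ListAction.Properties using (sum-++; sum-↭)
open import Data.Bool using (Bool; true; false; _∧_; _∨_; not; if_then_else_; T)
import Data.Bool.Properties as Bool
open import Data.Bool.ListAction using (any; all)
open import Data.List using (List; []; _∷_; [_]; length; filterᵇ; map; concatMap; filter; replicate; upTo; applyUpTo; applyDownFrom; reverse; drop; take; _++_; _ʳ++_)
import Data.List.Properties as List
open import Data.List.Membership.Propositional using (_∈_; _∉_; find; lose)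
import Data.List.Membership.Propositional.Properties as Mem
open import Data.List.Membership.Propositional.Properties.WithK using (unique∧set⇒bag)
open import Data.List.Relation.Binary.BagAndSetEquality using (∼bag⇒↭)
open import Data.List.Relation.Binary.Disjoint.Propositional using (Disjoint)
open import Data.List.Relation.Binary.Pointwise as Pointwise using (Pointwise; []; _∷_)
open import Data.List.Relation.Binary.Permutation.Propositional using (_↭_; ↭-refl; ↭-sym; ↭-trans; ↭-reflexive; ↭-swap; refl; prep; swap; trans)
import Data.List.Relation.Binary.Permutation.Propositional.Properties as Perm
open import Data.List.Relation.Unary.All as All using (All; []; _∷_)
import Data.List.Relation.Unary.All.Properties as All
open import Data.List.Relation.Unary.AllPairs as AllPairs using (AllPairs; []; _∷_)
import Data.List.Relation.Unary.AllPairs.Properties as AllPairs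
open import Data.List.Relation.Unary.Any as Any using (Any; here; there)
import Data.List.Relation.Unary.Any.Properties as Any
open import Data.List.Relation.Unary.Unique.Propositional using (Unique)
import Data.List.Relation.Unary.Unique.Propositional.Properties as Unique
open import Data.Product using (∃; ∃₂; _×_; _,_; proj₁; proj₂)
open import Data.Sum using (_⊎_; inj₁; inj₂; [_,_]′)
open import Data.Empty using (⊥; ⊥-elim)
open import Data.Unit using (⊤; tt)
open import Function using (_∘_; id; mk⇔; Equivalence)
open import Relation.Nullary using (¬_; ¬?; yes; no; Dec; contradiction)
open import Relation.Nullary.Decidable using (⌊_⌋; _×-dec_; dec-true; dec-false)
open import Relation.Binary using (tri<; tri≈; tri>)
open import Relation.Binary.PropositionalEquality using (_≡_; _≢_; refl; sym; cong; cong₂; subst; subst₂) renaming (trans to ≡-trans)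
import Data.Integer as ℤ
import Data.Integer.Properties as ℤ
import Data.Rational.Properties as ℚ
open import Data.Rational.Unnormalised using (mkℚᵘ; *≡*)

-- The transition formula for 0-Hecke words

-- The transition formula becomes an equality of two word counts when the marked entry has exactly
-- one Bruhat cover on each side. Both sides are then 1 + t for a single transposition t, and the
-- common term cancels. The entries are chosen extremally so that three of the four stretches around
-- them cause no further cover; avoidance of 2143 takes care of the fourth. Avoidance survives the
-- move because the Rothe diagram only has its rows and columns permuted. Chains of Young's lattice
-- are never counted directly. Inverse Grassmannian permutations realise every lower interval of it
-- inside a weak order, so one count for weak intervals serves both kinds of posets. Such a
-- permutation may need more letters than w has, so w is first extended by fixed points. All
-- arithmetic takes place in the natural numbers. Hence a formal sum is a functional, a signed
-- weight is a pair of weights on the two sides of an equation, and an expectation is stated by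
-- cross-multiplication.

variable
  X Y : Set

infixr 5 _∙_
_∙_ : {x y z : X} → x ≡ y → y ≡ z → x ≡ z
_∙_ = ≡-trans

false≢true : {P : Set} {b : Bool} → b ≡ false → b ≡ true → P
false≢true refl ()

+-interchange : ∀ a b c d → (a + b) + (c + d) ≡ (a + c) + (b + d)
+-interchange = solve-∀

-- Formal sums of lists are represented by the linear functionals they induce: an operator takes a
-- weight function and returns the total weight of its terms.
module Exchange (gt : ℕ → ℕ → Bool) where

  swapHead : ℕ → List ℕ → (List ℕ → ℕ) → ℕ
  swapHead a []       k = 0
  swapHead a (b ∷ bs) k = if gt a b then k (b ∷ a ∷ bs) + k (a ∷ b ∷ bs) else 0

  -- A 0-Hecke word ends in a descent of its product, and before that letter the product was either
  -- the swapped list or the list itself; hence two terms for each descent. The order is a parameter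
  -- because prefixes are stored reversed, where a descent reads as an ascent.
  demazure : List ℕ → (List ℕ → ℕ) → ℕ
  demazure []       k = 0
  demazure (a ∷ as) k = swapHead a as k + demazure as (λ l → k (a ∷ l))

  -- The product of the operators 1 + t over the transpositions t of the marked entry x with a
  -- later position, where t acts as zero unless it is a Bruhat cover.
  exchange : ℕ → List ℕ → (ℕ → List ℕ → ℕ) → ℕ
  exchange x []       k = k x []
  exchange x (b ∷ bs) k =
    if gt x b then exchange x bs (λ y l → k y (b ∷ l))
    -- Here b lies above x. If the focus y already exceeds b, some exchange jumped over b and was no
    -- Bruhat cover. The value 0 discards such a term: the cover condition is tested only when the
    -- entries in between are reached.
    else exchange x bs (λ y l → if gt b y then k y (b ∷ l) + k b (y ∷ l) else 0)

  -- What is known of every term of `exchange`. The focus never goes down, so entries below x stay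
  -- below the focus; and a focus that has moved leaves x behind it, which forms an inversion.
  ExchangeTerm : ℕ → List ℕ → ℕ → List ℕ → Set
  ExchangeTerm x bs y l = (y ∷ l ↭ x ∷ bs) × ((y ≡ x × l ≡ bs) ⊎ (gt y x ≡ true × x ∈ l))

  swapHead-cong : ∀ a as {k k′ : List ℕ → ℕ} → (∀ l → l ↭ a ∷ as → k l ≡ k′ l) → swapHead a as k ≡ swapHead a as k′
  swapHead-cong a []       e = refl
  swapHead-cong a (b ∷ as) e with gt a b
  ... | true  = cong₂ _+_ (e _ (↭-swap b a ↭-refl)) (e _ ↭-refl)
  ... | false = refl

  demazure-cong : ∀ as {k k′ : List ℕ → ℕ} → (∀ l → l ↭ as → k l ≡ k′ l) → demazure as k ≡ demazure as k′
  demazure-cong []       e = refl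
  demazure-cong (a ∷ as) e = cong₂ _+_ (swapHead-cong a as e) (demazure-cong as (λ l p → e _ (prep a p)))

  swapHead-+ : ∀ a as (k k′ : List ℕ → ℕ) → swapHead a as (λ l → k l + k′ l) ≡ swapHead a as k + swapHead a as k′
  swapHead-+ a []       k k′ = refl
  swapHead-+ a (b ∷ as) k k′ with gt a b
  ... | true  = +-interchange (k (b ∷ a ∷ as)) _ _ _
  ... | false = refl

  demazure-+ : ∀ as (k k′ : List ℕ → ℕ) → demazure as (λ l → k l + k′ l) ≡ demazure as k + demazure as k′
  demazure-+ []       k k′ = refl
  demazure-+ (a ∷ as) k k′ = cong₂ _+_ (swapHead-+ a as k k′) (demazure-+ as _ _) ∙ +-interchange (swapHead a as k) _ _ _

  swapHead-0 : ∀ a as → swapHead a as (λ _ → 0) ≡ 0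
  swapHead-0 a []       = refl
  swapHead-0 a (b ∷ as) = Bool.if-eta (gt a b)

  demazure-0 : ∀ as → demazure as (λ _ → 0) ≡ 0
  demazure-0 []       = refl
  demazure-0 (a ∷ as) = cong₂ _+_ (swapHead-0 a as) (demazure-0 as)

module ExchangeProperties (gt : ℕ → ℕ → Bool)
  (gt-asym : ∀ {a b} → gt a b ≡ true → gt b a ≡ false)
  (gt-total : ∀ {a b} → a ≢ b → gt a b ≡ false → gt b a ≡ true)
  (gt-trans : ∀ {a b c} → gt a b ≡ true → gt b c ≡ true → gt a c ≡ true) where

  open Exchange gt

  exchange-cong : ∀ x bs {k k′ : ℕ → List ℕ → ℕ} → Unique (x ∷ bs) →
    (∀ y l → ExchangeTerm x bs y l → k y l ≡ k′ y l) → exchange x bs k ≡ exchange x bs k′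
  exchange-cong x []       u e = e x [] (↭-refl , inj₁ (refl , refl))
  exchange-cong x (b ∷ bs) {k} {k′} ((x≢b ∷ x∉) ∷ u₁ ∷ u) e with gt x b in xb
  ... | true  = exchange-cong x bs (x∉ ∷ u) λ y l (p , c) → e y (b ∷ l)
          (trans (↭-swap y b ↭-refl) (trans (prep b p) (↭-swap b x ↭-refl)) , [ (λ (q , r) → inj₁ (q , cong (b ∷_) r)) , (λ (q , r) → inj₂ (q , there r)) ]′ c)
  ... | false = exchange-cong x bs (x∉ ∷ u) λ y l (p , c) → branch y l p c
    where
    branch : ∀ y l → y ∷ l ↭ x ∷ bs → (y ≡ x × l ≡ bs) ⊎ (gt y x ≡ true × x ∈ l) →
      (if gt b y then k y (b ∷ l) + k b (y ∷ l) else 0) ≡ (if gt b y then k′ y (b ∷ l) + k′ b (y ∷ l) else 0)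
    branch y l p c with gt b y in by
    ... | false = refl
    ... | true  = cong₂ _+_
      (e y (b ∷ l) (trans (↭-swap y b ↭-refl) (trans (prep b p) (↭-swap b x ↭-refl)) , [ (λ (q , r) → inj₁ (q , cong (b ∷_) r)) , (λ (q , r) → inj₂ (q , there r)) ]′ c))
      (e b (y ∷ l) (trans (prep b p) (↭-swap b x ↭-refl) , inj₂ (gt-total x≢b xb , Perm.∈-resp-↭ (↭-sym p) (here refl))))

  exchange-+ : ∀ x bs (k k′ : ℕ → List ℕ → ℕ) → Unique (x ∷ bs) →
    exchange x bs (λ y l → k y l + k′ y l) ≡ exchange x bs k + exchange x bs k′
  exchange-+ x []       k k′ u = refl
  exchange-+ x (b ∷ bs) k k′ ((x≢b ∷ x∉) ∷ u₁ ∷ u) with gt x b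
  ... | true  = exchange-+ x bs _ _ (x∉ ∷ u)
  ... | false = exchange-cong x bs (x∉ ∷ u) (λ y l _ → branch y l) ∙ exchange-+ x bs _ _ (x∉ ∷ u)
    where
    branch : ∀ y l → (if gt b y then (k y (b ∷ l) + k′ y (b ∷ l)) + (k b (y ∷ l) + k′ b (y ∷ l)) else 0)
      ≡ (if gt b y then k y (b ∷ l) + k b (y ∷ l) else 0) + (if gt b y then k′ y (b ∷ l) + k′ b (y ∷ l) else 0)
    branch y l with gt b y
    ... | true  = +-interchange (k y (b ∷ l)) _ _ _
    ... | false = refl

  exchange-0 : ∀ x bs → Unique (x ∷ bs) → exchange x bs (λ _ _ → 0) ≡ 0
  exchange-0 x []       u = refl
  exchange-0 x (b ∷ bs) ((x≢b ∷ x∉) ∷ u₁ ∷ u) with gt x b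
  ... | true  = exchange-0 x bs (x∉ ∷ u)
  ... | false = exchange-cong x bs (x∉ ∷ u) (λ y l _ → Bool.if-eta (gt b y)) ∙ exchange-0 x bs (x∉ ∷ u)

  exchange-zero : ∀ x bs {k : ℕ → List ℕ → ℕ} → Unique (x ∷ bs) → (∀ y l → ExchangeTerm x bs y l → k y l ≡ 0) → exchange x bs k ≡ 0
  exchange-zero x bs u e = exchange-cong x bs u e ∙ exchange-0 x bs u

  term≥ : ∀ {x bs y l b} → ExchangeTerm x bs y l → gt x b ≡ true → gt y b ≡ true
  term≥ (_ , inj₁ (refl , _)) xb = xb
  term≥ (_ , inj₂ (yx , _))   xb = gt-trans yx xb

  private
    if-true : ∀ {b} {m n : ℕ} → b ≡ true → (if b then m else n) ≡ m
    if-true refl = refl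
    if-false : ∀ {b} {m n : ℕ} → b ≡ false → (if b then m else n) ≡ n
    if-false refl = refl

  -- The entry b lies below every focus, so exchanges pass over its position. If the next entry c
  -- lies above x, then b is below both c and any focus that could take the place of c, and both
  -- sides are 0.
  exchange-swapHead< : ∀ x b bs (k : ℕ → List ℕ → ℕ) → Unique (x ∷ b ∷ bs) → gt x b ≡ true →
    exchange x bs (λ y l → swapHead b l (k y)) ≡ swapHead b bs (λ l → exchange x l k)
  exchange-swapHead< x b []       k u xb = refl
  exchange-swapHead< x b (c ∷ bs) k ((x≢b ∷ x≢c ∷ x∉) ∷ (b≢c ∷ b∉) ∷ c∉ ∷ u) xb with gt x c in xc
  ... | true with gt b c in bc
  ...   | true  rewrite xb = exchange-+ x bs _ _ (x∉ ∷ u)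
  ...   | false = exchange-0 x bs (x∉ ∷ u)
  exchange-swapHead< x b (c ∷ bs) k ((x≢b ∷ x≢c ∷ x∉) ∷ (b≢c ∷ b∉) ∷ c∉ ∷ u) xb | false
    rewrite gt-asym (gt-trans (gt-total x≢c xc) xb) = exchange-zero x bs (x∉ ∷ u) branch
    where
    branch : ∀ y l → ExchangeTerm x bs y l → (if gt c y then 0 + (if gt b y then k c (y ∷ b ∷ l) + k c (b ∷ y ∷ l) else 0) else 0) ≡ 0
    branch y l t rewrite gt-asym (term≥ t xb) = Bool.if-eta (gt c y)

  -- Now the positions of b and of its right neighbour c both take part in the exchanges. The
  -- identity is local in the three values b, c and y; for b above c above y it matches six terms on
  -- either side.
  exchange-swapHead> : ∀ x b bs (k : ℕ → List ℕ → ℕ) → Unique (x ∷ b ∷ bs) → gt x b ≡ false →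
    exchange x bs (λ y l → if gt b y then swapHead b l (k y) + swapHead y l (k b) else 0) ≡ swapHead b bs (λ l → exchange x l k)
  exchange-swapHead> x b []       k u xb = Bool.if-eta (gt b x)
  exchange-swapHead> x b (c ∷ bs) k ((x≢b ∷ x≢c ∷ x∉) ∷ (b≢c ∷ b∉) ∷ c∉ ∷ u) xb with gt x c in xc
  ... | true rewrite gt-trans (gt-total x≢b xb) xc | xb =
    exchange-cong x bs (x∉ ∷ u) branch ∙ exchange-+ x bs _ _ (x∉ ∷ u)
    where
    branch : ∀ y l → ExchangeTerm x bs y l → (if gt b y then (k y (c ∷ b ∷ l) + k y (b ∷ c ∷ l)) + swapHead y (c ∷ l) (k b) else 0)
      ≡ (if gt b y then k y (c ∷ b ∷ l) + k b (c ∷ y ∷ l) else 0) + (if gt b y then k y (b ∷ c ∷ l) + k b (y ∷ c ∷ l) else 0)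
    branch y l t with gt b y
    ... | false = refl
    ... | true rewrite term≥ t xc = +-interchange (k y (c ∷ b ∷ l)) _ _ _
  ... | false with gt b c in bc
  ...   | false = exchange-zero x bs (x∉ ∷ u) branch
    where
    branch : ∀ y l → ExchangeTerm x bs y l → (if gt c y then (if gt b y then 0 + swapHead y (c ∷ l) (k b) else 0) + 0 else 0) ≡ 0
    branch y l t with gt c y in cy
    ... | false = refl
    ... | true rewrite gt-asym cy | Bool.if-eta (gt b y) {0} = refl
  ...   | true rewrite xb = exchange-cong x bs (x∉ ∷ u) branch ∙ exchange-+ x bs _ _ (x∉ ∷ u)
    where
    branch : ∀ y l → ExchangeTerm x bs y l →
      (if gt c y then (if gt b y then (k y (c ∷ b ∷ l) + k y (b ∷ c ∷ l)) + swapHead y (c ∷ l) (k b) else 0)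
                      + (swapHead b (y ∷ l) (k c) + swapHead c (y ∷ l) (k b)) else 0)
      ≡ (if gt b y then (if gt c y then k y (c ∷ b ∷ l) + k c (y ∷ b ∷ l) else 0) + (if gt c b then k b (c ∷ y ∷ l) + k c (b ∷ y ∷ l) else 0) else 0)
        + (if gt c y then (if gt b y then k y (b ∷ c ∷ l) + k b (y ∷ c ∷ l) else 0) + (k c (b ∷ y ∷ l) + k b (c ∷ y ∷ l)) else 0)
    branch y l t with gt c y in cy
    ... | true rewrite gt-trans bc cy | gt-asym cy | gt-asym bc =
      rearrange (k y (c ∷ b ∷ l)) (k y (b ∷ c ∷ l)) (k c (y ∷ b ∷ l)) (k c (b ∷ y ∷ l)) (k b (y ∷ c ∷ l)) (k b (c ∷ y ∷ l))
      where
      rearrange : ∀ p q r s t u → (p + q + 0) + ((r + s) + (t + u)) ≡ (p + r + 0) + ((q + t) + (s + u))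
      rearrange = solve-∀
    ... | false rewrite gt-asym bc = sym (cong (_+ 0) (Bool.if-eta (gt b y)))

  -- Descents strictly to the right of the focus: induction along the list, where the descent at the
  -- front is handled by one of the two preceding lemmas according to the side of x on which b lies.
  exchange-demazure : ∀ x bs (k : ℕ → List ℕ → ℕ) → Unique (x ∷ bs) →
    exchange x bs (λ y l → demazure l (k y)) ≡ demazure bs (λ l → exchange x l k)
  exchange-demazure x []       k u = refl
  exchange-demazure x (b ∷ bs) k u@((x≢b ∷ x∉) ∷ b∉ ∷ u′) with gt x b in xb
  ... | true  = exchange-+ x bs _ _ (x∉ ∷ u′) ∙ cong₂ _+_ (exchange-swapHead< x b bs k u xb) (exchange-demazure x bs _ (x∉ ∷ u′))
  ... | false = exchange-cong x bs (x∉ ∷ u′) branch ∙ exchange-+ x bs _ _ (x∉ ∷ u′)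
      ∙ cong₂ _+_ (exchange-swapHead> x b bs k u xb) (exchange-demazure x bs (λ y l → if gt b y then k y (b ∷ l) + k b (y ∷ l) else 0) (x∉ ∷ u′))
    where
    branch : ∀ y l → ExchangeTerm x bs y l →
      (if gt b y then demazure (b ∷ l) (k y) + demazure (y ∷ l) (k b) else 0)
      ≡ (if gt b y then swapHead b l (k y) + swapHead y l (k b) else 0) + demazure l (λ l′ → if gt b y then k y (b ∷ l′) + k b (y ∷ l′) else 0)
    branch y l t with gt b y
    ... | true  = +-interchange (swapHead b l (k y)) _ _ _ ∙ cong (swapHead b l (k y) + swapHead y l (k b) +_) (sym (demazure-+ l _ _))
    ... | false = sym (demazure-0 l)


  -- For words of length 0: a moved focus leaves an inversion, so only the unmoved term can be the
  -- identity permutation.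
  exchange-dominated : ∀ x bs (k : ℕ → List ℕ → ℕ) → Unique (x ∷ bs) →
    (∀ y l → gt y x ≡ true → x ∈ l → k y l ≡ 0) → exchange x bs k ≡ k x bs
  exchange-dominated x []       k u e = refl
  exchange-dominated x (b ∷ bs) k ((x≢b ∷ x∉) ∷ _ ∷ u) e with gt x b in xb
  ... | true  = exchange-dominated x bs _ (x∉ ∷ u) (λ y l yx x∈ → e y (b ∷ l) yx (there x∈))
  ... | false = exchange-dominated x bs _ (x∉ ∷ u) tail
      ∙ if-true (gt-total x≢b xb) ∙ cong (k x (b ∷ bs) +_) (e b (x ∷ bs) (gt-total x≢b xb) (here refl)) ∙ ℕ.+-identityʳ _
    where
    tail : ∀ y l → gt y x ≡ true → x ∈ l → (if gt b y then k y (b ∷ l) + k b (y ∷ l) else 0) ≡ 0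
    tail y l yx x∈ = cong₂ (λ m n → if gt b y then m + n else 0) (e y (b ∷ l) yx (there x∈)) (e b (y ∷ l) (gt-total x≢b xb) (there x∈)) ∙ Bool.if-eta (gt b y)

  private module ᵒ = Exchange (λ a b → gt b a)

  -- The descents that involve the focus. The mark travels with its entry, so y remains in focus
  -- after the swap.
  leftJunction rightJunction : List ℕ → ℕ → List ℕ → (List ℕ → ℕ → List ℕ → ℕ) → ℕ
  leftJunction []       y bs Φ = 0
  leftJunction (a ∷ as) y bs Φ = if gt a y then Φ as y (a ∷ bs) + Φ (a ∷ as) y bs else 0
  rightJunction as y []       Φ = 0
  rightJunction as y (b ∷ bs) Φ = if gt y b then Φ (b ∷ as) y bs + Φ as y (b ∷ bs) else 0

  -- The part as of the zipper before the focus y is reversed.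
  zipDemazure : List ℕ → ℕ → List ℕ → (List ℕ → ℕ → List ℕ → ℕ) → ℕ
  zipDemazure as y bs Φ =
    (ᵒ.demazure as (λ as′ → Φ as′ y bs) + leftJunction as y bs Φ) + (rightJunction as y bs Φ + demazure bs (λ bs′ → Φ as y bs′))

  exchange-demazureᵒ : ∀ as x bs (Φ : List ℕ → ℕ → List ℕ → ℕ) → Unique (x ∷ bs) →
    exchange x bs (λ y l → ᵒ.demazure as (λ as′ → Φ as′ y l)) ≡ ᵒ.demazure as (λ as′ → exchange x bs (Φ as′))
  exchange-demazureᵒ []            x bs Φ u = exchange-0 x bs u
  exchange-demazureᵒ (a ∷ [])      x bs Φ u = exchange-0 x bs u
  exchange-demazureᵒ (a ∷ a′ ∷ as) x bs Φ u = exchange-+ x bs _ _ u ∙ cong₂ _+_ head (exchange-demazureᵒ (a′ ∷ as) x bs (λ l → Φ (a ∷ l)) u)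
    where
    head : exchange x bs (λ y l → ᵒ.swapHead a (a′ ∷ as) (λ as′ → Φ as′ y l)) ≡ ᵒ.swapHead a (a′ ∷ as) (λ as′ → exchange x bs (Φ as′))
    head with gt a′ a
    ... | true  = exchange-+ x bs _ _ u
    ... | false = exchange-0 x bs u

  -- The recursion in the word length for one side of the transition formula. It is its own mirror
  -- image: an entry above x crosses from left to right, one below x from right to left, and one
  -- more copy of the exchange itself appears whichever of x and b is larger. The hypothesis on Φ
  -- says that it depends on the underlying list and not on the position of the mark.
  exchange-zipDemazure : ∀ a as x b bs (Φ : List ℕ → ℕ → List ℕ → ℕ) → Unique (x ∷ a ∷ b ∷ bs) →
    (∀ c cs y l → Φ (c ∷ cs) y l ≡ Φ cs c (y ∷ l)) →
    exchange x (b ∷ bs) (λ y l → zipDemazure (a ∷ as) y l Φ)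
    ≡ (ᵒ.demazure (a ∷ as) (λ as′ → exchange x (b ∷ bs) (Φ as′)) + (if gt a x then exchange x (a ∷ b ∷ bs) (Φ as) else 0))
      + (((if gt x b then exchange x bs (Φ (b ∷ a ∷ as)) else 0) + exchange x (b ∷ bs) (Φ (a ∷ as))) + demazure (b ∷ bs) (λ bs′ → exchange x bs′ (Φ (a ∷ as))))
  exchange-zipDemazure a as x b bs Φ ((x≢a ∷ x≢b ∷ x∉) ∷ a∉ ∷ b∉ ∷ u) shift =
    exchange-+ x (b ∷ bs) (λ y l → K₁ y l + K₂ y l) (λ y l → K₃ y l + K₄ y l) ub ∙ cong₂ _+_
      (exchange-+ x (b ∷ bs) K₁ K₂ ub ∙ cong₂ _+_ (exchange-demazureᵒ (a ∷ as) x (b ∷ bs) Φ ub) left)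
      (exchange-+ x (b ∷ bs) K₃ K₄ ub ∙ cong₂ _+_ right (exchange-demazure x (b ∷ bs) (Φ (a ∷ as)) ub))
    where
    K₁ K₂ K₃ K₄ : ℕ → List ℕ → ℕ
    K₁ y l = ᵒ.demazure (a ∷ as) (λ as′ → Φ as′ y l)
    K₂ y l = leftJunction (a ∷ as) y l Φ
    K₃ y l = rightJunction (a ∷ as) y l Φ
    K₄ y l = demazure l (Φ (a ∷ as) y)
    ub : Unique (x ∷ b ∷ bs)
    ub = (x≢b ∷ x∉) ∷ b∉ ∷ u
    left : exchange x (b ∷ bs) (λ y l → leftJunction (a ∷ as) y l Φ) ≡ (if gt a x then exchange x (a ∷ b ∷ bs) (Φ as) else 0)
    left with gt a x in ax
    ... | false = exchange-zero x (b ∷ bs) ub (λ y l t → if-false {m = Φ as y (a ∷ l) + Φ (a ∷ as) y l} (gt-asym (term≥ t (gt-total (x≢a ∘ sym) ax))))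
    -- The junction with a above x is the final step of an exchange that has a on the right; `shift`
    -- moves the mark from y to a in its second term.
    ... | true  = exchange-cong x (b ∷ bs) ub (λ y l _ → cong (λ m → if gt a y then Φ as y (a ∷ l) + m else 0) (shift a as y l))
                ∙ sym (if-false (gt-asym ax))
    right : exchange x (b ∷ bs) (λ y l → rightJunction (a ∷ as) y l Φ)
      ≡ (if gt x b then exchange x bs (Φ (b ∷ a ∷ as)) else 0) + exchange x (b ∷ bs) (Φ (a ∷ as))
    right with gt x b in xb
    ... | true  = exchange-cong x bs (x∉ ∷ u) (λ y l t → if-true (term≥ t xb)) ∙ exchange-+ x bs _ _ (x∉ ∷ u)
    -- With b above x the exchange creates the descent b y. Undoing it gives the unexchanged term
    -- and keeping it gives the exchanged one, so the junction reproduces the whole exchange.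
    ... | false = exchange-cong x bs (x∉ ∷ u) branch
      where
      branch : ∀ y l → ExchangeTerm x bs y l →
        (if gt b y then rightJunction (a ∷ as) y (b ∷ l) Φ + rightJunction (a ∷ as) b (y ∷ l) Φ else 0)
        ≡ (if gt b y then Φ (a ∷ as) y (b ∷ l) + Φ (a ∷ as) b (y ∷ l) else 0)
      branch y l t with gt b y in by
      ... | false = refl
      ... | true rewrite gt-asym by = cong (_+ Φ (a ∷ as) b (y ∷ l)) (shift y (a ∷ as) b l)

<ᵇ-true : ∀ {m n} → m < n → (m <ᵇ n) ≡ true
<ᵇ-true m<n = dec-true (_ <? _) m<n

<ᵇ-false : ∀ {m n} → ¬ m < n → (m <ᵇ n) ≡ false
<ᵇ-false m≮n = dec-false (_ <? _) m≮n

<ᵇ-sound : ∀ {m n} → (m <ᵇ n) ≡ true → m < n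
<ᵇ-sound {m} {n} e = ℕ.<ᵇ⇒< m n (subst T (sym e) tt)

<ᵇ-unsound : ∀ {m n} → (m <ᵇ n) ≡ false → ¬ m < n
<ᵇ-unsound {m} {n} e m<n = false≢true e (<ᵇ-true {m} {n} m<n)

infix 4 _>ᵇ_
_>ᵇ_ : ℕ → ℕ → Bool
m >ᵇ n = n <ᵇ m

module Down = Exchange _>ᵇ_
module Up = Exchange _<ᵇ_

<ᵇ-asym : ∀ {a b} → (a <ᵇ b) ≡ true → (b <ᵇ a) ≡ false
<ᵇ-asym {a} {b} ab = <ᵇ-false {b} {a} (ℕ.<⇒≯ (<ᵇ-sound {a} {b} ab))

<ᵇ-total : ∀ {a b} → a ≢ b → (a <ᵇ b) ≡ false → (b <ᵇ a) ≡ true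
<ᵇ-total {a} {b} a≢b ab = <ᵇ-true {b} {a} (ℕ.≤∧≢⇒< (ℕ.≮⇒≥ (<ᵇ-unsound {a} {b} ab)) (a≢b ∘ sym))

<ᵇ-trans : ∀ {a b c} → (a <ᵇ b) ≡ true → (b <ᵇ c) ≡ true → (a <ᵇ c) ≡ true
<ᵇ-trans {a} {b} {c} ab bc = <ᵇ-true {a} {c} (ℕ.<-trans (<ᵇ-sound {a} {b} ab) (<ᵇ-sound {b} {c} bc))

module DownP = ExchangeProperties _>ᵇ_ (λ {a} {b} → <ᵇ-asym {b} {a}) (λ {a} {b} a≢b → <ᵇ-total {b} {a} (a≢b ∘ sym)) (λ {a} {b} {c} ab bc → <ᵇ-trans {c} {b} {a} bc ab)
module UpP = ExchangeProperties _<ᵇ_ (λ {a} {b} → <ᵇ-asym {a} {b}) (λ {a} {b} → <ᵇ-total {a} {b}) (λ {a} {b} {c} → <ᵇ-trans {a} {b} {c})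

open Down using (demazure; swapHead; demazure-cong)

inv : List ℕ → ℕ
inv l = sum (lehmer l)

-- The number of 0-Hecke words of length n with product l.
heckeWords : ℕ → List ℕ → ℕ
heckeWords zero    l = if inv l ≤ᵇ 0 then 1 else 0
heckeWords (suc n) l = demazure l (heckeWords n)

junction : List ℕ → List ℕ → (List ℕ → ℕ) → ℕ
junction []       bs k = 0
junction (a ∷ as) bs k = swapHead a bs (λ l → k (as ʳ++ l))

demazure-ʳ++ : ∀ as bs k → demazure (as ʳ++ bs) k
  ≡ (Up.demazure as (λ l → k (l ʳ++ bs)) + junction as bs k) + demazure bs (λ l → k (as ʳ++ l))
demazure-ʳ++ []       bs k = refl
demazure-ʳ++ (a ∷ as) bs k = demazure-ʳ++ as (a ∷ bs) k ∙ cong (λ m → (Up.demazure as (λ l → k (l ʳ++ a ∷ bs)) + m) + (swapHead a bs (λ l → k (as ʳ++ l)) + demazure bs (λ l → k (as ʳ++ a ∷ l)))) (flip as)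
    ∙ rearrange (Up.demazure as (λ l → k (l ʳ++ a ∷ bs))) (Up.swapHead a as (λ l → k (l ʳ++ bs))) (swapHead a bs (λ l → k (as ʳ++ l))) (demazure bs (λ l → k (as ʳ++ a ∷ l)))
  where
  flip : ∀ as → junction as (a ∷ bs) k ≡ Up.swapHead a as (λ l → k (l ʳ++ bs))
  flip []       = refl
  flip (c ∷ as) = refl
  rearrange : ∀ p q r s → (p + q) + (r + s) ≡ ((q + p) + r) + s
  rearrange = solve-∀

demazure-zip : ∀ as y bs k → demazure (as ʳ++ y ∷ bs) k ≡ DownP.zipDemazure as y bs (λ as y bs → k (as ʳ++ y ∷ bs))
demazure-zip as y bs k = demazure-ʳ++ as (y ∷ bs) k ∙ cong₂ _+_ (cong (Up.demazure as (λ l → k (l ʳ++ y ∷ bs)) +_) (left as)) (cong (_+ demazure bs (λ l → k (as ʳ++ y ∷ l))) (right bs))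
  where
  Φ : List ℕ → ℕ → List ℕ → ℕ
  Φ as y bs = k (as ʳ++ y ∷ bs)
  left : ∀ as → junction as (y ∷ bs) k ≡ DownP.leftJunction as y bs Φ
  left []       = refl
  left (a ∷ as) = refl
  right : ∀ bs → swapHead y bs (λ l → k (as ʳ++ l)) ≡ DownP.rightJunction as y bs Φ
  right []       = refl
  right (b ∷ bs) = refl

-- Reading the zipper from the other end reverses the order and swaps the two junctions, so the
-- recursion for exchanges to the right also holds for exchanges to the left.
zip-mirror : ∀ as y bs (Φ : List ℕ → ℕ → List ℕ → ℕ) → DownP.zipDemazure as y bs Φ ≡ UpP.zipDemazure bs y as (λ bs y as → Φ as y bs)
zip-mirror as y bs Φ = cong₂ (λ m n → (Up.demazure as (λ l → Φ l y bs) + m) + (n + demazure bs (λ l → Φ as y l))) (left as) (right bs)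
    ∙ rearrange (Up.demazure as (λ l → Φ l y bs)) (UpP.rightJunction bs y as (λ bs y as → Φ as y bs)) (UpP.leftJunction bs y as (λ bs y as → Φ as y bs)) (demazure bs (λ l → Φ as y l))
  where
  left : ∀ as → DownP.leftJunction as y bs Φ ≡ UpP.rightJunction bs y as (λ bs y as → Φ as y bs)
  left []       = refl
  left (a ∷ as) = refl
  right : ∀ bs → DownP.rightJunction as y bs Φ ≡ UpP.leftJunction bs y as (λ bs y as → Φ as y bs)
  right []       = refl
  right (b ∷ bs) = refl
  rearrange : ∀ p q r s → (p + q) + (r + s) ≡ (s + r) + (q + p)
  rearrange = solve-∀

∈⇒filterᵇ-pos : ∀ {x : ℕ} {l} (p : ℕ → Bool) → x ∈ l → p x ≡ true → 0 < length (filterᵇ p l)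
∈⇒filterᵇ-pos p (here refl) px rewrite px = s≤s z≤n
∈⇒filterᵇ-pos {l = y ∷ l} p (there x∈) px with p y
... | true  = s≤s z≤n
... | false = ∈⇒filterᵇ-pos p x∈ px

inv-pos : ∀ as {x y} bs → x ∈ bs → x < y → 0 < inv (as ++ y ∷ bs)
inv-pos []       bs x∈ x<y = ℕ.≤-trans (∈⇒filterᵇ-pos _ x∈ (<ᵇ-true x<y)) (ℕ.m≤m+n _ _)
inv-pos (a ∷ as) bs x∈ x<y = ℕ.≤-trans (inv-pos as bs x∈ x<y) (ℕ.m≤n+m _ _)

heckeWords-0 : ∀ l → 0 < inv l → heckeWords 0 l ≡ 0
heckeWords-0 l p with inv l
... | suc _ = refl

Unique-↭ : {xs ys : List X} → xs ↭ ys → Unique xs → Unique ys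
Unique-↭ refl         u       = u
Unique-↭ (prep x p)   (x∉ ∷ u) = Perm.All-resp-↭ p x∉ ∷ Unique-↭ p u
Unique-↭ (swap x y p) ((x≢y ∷ x∉) ∷ y∉ ∷ u) = ((x≢y ∘ sym) ∷ Perm.All-resp-↭ p y∉) ∷ Perm.All-resp-↭ p x∉ ∷ Unique-↭ p u
Unique-↭ (trans p q)  u       = Unique-↭ q (Unique-↭ p u)

Unique-++ˡ : (xs : List X) {ys : List X} → Unique (xs ++ ys) → Unique xs
Unique-++ˡ []       u        = []
Unique-++ˡ (x ∷ xs) (x∉ ∷ u) = All.++⁻ˡ xs x∉ ∷ Unique-++ˡ xs u

Unique-++ʳ : (xs : List X) {ys : List X} → Unique (xs ++ ys) → Unique ys
Unique-++ʳ []       u       = u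
Unique-++ʳ (x ∷ xs) (_ ∷ u) = Unique-++ʳ xs u

-- Lascoux's transition formula for the numbers of 0-Hecke words: right multiplication by 1 + x_r
-- relates the chains of covers to the left of the focus to those to the right of it.
transition : ∀ n as x bs → Unique (x ∷ as ++ bs) → Any (x <_) bs → Any (_< x) as →
  Down.exchange x bs (λ y l → heckeWords n (as ʳ++ y ∷ l)) ≡ Up.exchange x as (λ z l → heckeWords n (l ʳ++ z ∷ bs))
transition zero as x bs u r l =
  DownP.exchange-dominated x bs _ (Unique-++ʳ as (Unique-↭ (↭-sym (Perm.shift x as bs)) u)) down
  ∙ sym (UpP.exchange-dominated x as _ (Unique-++ˡ (x ∷ as) u) up)
  where
  down : ∀ y l → (y >ᵇ x) ≡ true → x ∈ l → heckeWords 0 (as ʳ++ y ∷ l) ≡ 0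
  down y l yx x∈ = heckeWords-0 (as ʳ++ y ∷ l) (subst (λ m → 0 < inv m) (sym (List.ʳ++-defn as)) (inv-pos (reverse as) l x∈ (<ᵇ-sound {x} {y} yx)))
  up : ∀ z l → (z <ᵇ x) ≡ true → x ∈ l → heckeWords 0 (l ʳ++ z ∷ bs) ≡ 0
  up z l zx x∈ with p , q , e ← Mem.∈-∃++ (Any.reverse⁺ x∈) =
    heckeWords-0 (l ʳ++ z ∷ bs) (subst (λ m → 0 < inv m) (sym (List.ʳ++-defn l ∙ cong (_++ z ∷ bs) e ∙ List.++-assoc p (x ∷ q) _))
      (inv-pos p (q ++ z ∷ bs) (Mem.∈-++⁺ʳ q (here refl)) (<ᵇ-sound {z} {x} zx)))
-- Both sides obey the recursion of `exchange-zipDemazure`, and its summands are matched by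
-- induction on n. The two `Any` hypotheses guarantee a neighbour of the focus on either side. They
-- persist because only entries above x leave the left and only entries below x leave the right.
transition (suc n) (a ∷ as) x (b ∷ bs) u r l =
  DownP.exchange-cong x B ub (λ y l _ → demazure-zip A y l F)
  ∙ DownP.exchange-zipDemazure a as x b bs Φ (Unique-↭ (↭-swap a x refl) (Unique-++ʳ as (Unique-↭ (↭-trans (prep x (↭-sym (Perm.shift a as B))) (↭-trans (↭-sym (Perm.shift x as (a ∷ B))) (Perm.++⁺ˡ as (↭-swap x a refl)))) u))) (λ _ _ _ _ → refl)
  ∙ cong₂ _+_
      (cong₂ _+_ (Up.demazure-cong A λ A′ p → transition n A′ x B (Unique-↭ (prep x (Perm.++⁺ʳ B (↭-sym p))) u) r (Perm.Any-resp-↭ (↭-sym p) l)) left)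
      (cong₂ _+_ (cong₂ _+_ right (transition n A x B u r l))
                 (demazure-cong B λ B′ p → transition n A x B′ (Unique-↭ (prep x (Perm.++⁺ˡ A (↭-sym p))) u) (Perm.Any-resp-↭ (↭-sym p) r) l))
  ∙ rearrange (Up.demazure A (λ A′ → Up.exchange x A′ (λ z l → F (l ʳ++ z ∷ B))))
      (if x <ᵇ a then Up.exchange x as (λ z l → Φ l z (a ∷ B)) else 0)
      (if b <ᵇ x then Up.exchange x (b ∷ A) (λ z l → Φ l z bs) else 0)
      (Up.exchange x A (λ z l → F (l ʳ++ z ∷ B)))
      (demazure B (λ B′ → Up.exchange x A (λ z l → F (l ʳ++ z ∷ B′))))
  ∙ sym (UpP.exchange-zipDemazure b bs x a as (λ bs y as → Φ as y bs) (Unique-++ˡ (x ∷ b ∷ A) u-right) (λ _ _ _ _ → refl))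
  ∙ sym (UpP.exchange-cong x A (Unique-++ˡ (x ∷ A) u) (λ z l _ → demazure-zip l z B F ∙ zip-mirror l z B Φ))
  where
  A B : List ℕ
  A = a ∷ as
  B = b ∷ bs
  F : List ℕ → ℕ
  F = heckeWords n
  Φ : List ℕ → ℕ → List ℕ → ℕ
  Φ as y bs = F (as ʳ++ y ∷ bs)
  ub : Unique (x ∷ B)
  ub = Unique-++ʳ A (Unique-↭ (↭-sym (Perm.shift x A B)) u)
  u-right : Unique (x ∷ b ∷ A ++ bs)
  u-right = Unique-↭ (prep x (Perm.shift b A bs)) u
  left : (if a >ᵇ x then Down.exchange x (a ∷ B) (Φ as) else 0) ≡ (if x <ᵇ a then Up.exchange x as (λ z l → Φ l z (a ∷ B)) else 0)
  left with x <ᵇ a in xa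
  ... | false = refl
  ... | true  = transition n as x (a ∷ B) (Unique-↭ (prep x (↭-sym (Perm.shift a as B))) u) (there r) (Any.tail (ℕ.<⇒≯ (<ᵇ-sound {x} {a} xa)) l)
  right : (if x >ᵇ b then Down.exchange x bs (Φ (b ∷ A)) else 0) ≡ (if b <ᵇ x then Up.exchange x (b ∷ A) (λ z l → Φ l z bs) else 0)
  right with b <ᵇ x in bx
  ... | false = refl
  ... | true  = transition n (b ∷ A) x bs u-right (Any.tail (ℕ.<⇒≯ (<ᵇ-sound {b} {x} bx)) r) (there l)
  rearrange : ∀ p q r s t → (p + q) + ((r + s) + t) ≡ (t + r) + ((q + s) + p)
  rearrange = solve-∀

module UniqueCover (gt : ℕ → ℕ → Bool)
  (gt-asym : ∀ {a b} → gt a b ≡ true → gt b a ≡ false)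
  (gt-trans : ∀ {a b c} → gt a b ≡ true → gt b c ≡ true → gt a c ≡ true) where

  open Exchange gt

  -- Entries positioned beyond y lie below x and are skipped, or lie above y, and then exchanging x
  -- with them would jump over y. The vanishing of `k` encodes the latter.
  exchange-bounded : ∀ x y cs (k : ℕ → List ℕ → ℕ) → gt y x ≡ true → All (λ c → gt x c ≡ true ⊎ gt c y ≡ true) cs →
    (∀ y′ l → gt y y′ ≡ false → k y′ l ≡ 0) → exchange x cs k ≡ k x cs
  exchange-bounded x y []       k yx []       e = refl
  exchange-bounded x y (c ∷ cs) k yx (p ∷ ps) e with gt x c in xc
  ... | true  = exchange-bounded x y cs _ yx ps (λ y′ l → e y′ (c ∷ l))
  ... | false with p
  ...   | inj₁ ()
  ...   | inj₂ cy = exchange-bounded x y cs _ yx ps tail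
      ∙ cong (λ b → if b then k x (c ∷ cs) + k c (x ∷ cs) else 0) (gt-trans cy yx)
      ∙ cong (k x (c ∷ cs) +_) (e c (x ∷ cs) (gt-asym cy)) ∙ ℕ.+-identityʳ _
    where
    tail : ∀ y′ l → gt y y′ ≡ false → (if gt c y′ then k y′ (c ∷ l) + k c (y′ ∷ l) else 0) ≡ 0
    tail y′ l q = cong₂ (λ m n → if gt c y′ then m + n else 0) (e y′ (c ∷ l) q) (e c (y′ ∷ l) (gt-asym cy)) ∙ Bool.if-eta (gt c y′)

  exchange-uniqueCover : ∀ x ns y cs (k : ℕ → List ℕ → ℕ) → All (λ n → gt x n ≡ true) ns → gt y x ≡ true →
    All (λ c → gt x c ≡ true ⊎ gt c y ≡ true) cs → exchange x (ns ++ y ∷ cs) k ≡ k x (ns ++ y ∷ cs) + k y (ns ++ x ∷ cs)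
  exchange-uniqueCover x []       y cs k []       yx qs rewrite gt-asym yx =
    exchange-bounded x y cs _ yx qs (λ y′ l e → cong (λ b → if b then k y′ (y ∷ l) + k y (y′ ∷ l) else 0) e)
    ∙ cong (λ b → if b then k x (y ∷ cs) + k y (x ∷ cs) else 0) yx
  exchange-uniqueCover x (n ∷ ns) y cs k (p ∷ ps) yx qs rewrite p = exchange-uniqueCover x ns y cs _ ps yx qs

module DownU = UniqueCover _>ᵇ_ (λ {a} {b} → <ᵇ-asym {b} {a}) (λ {a} {b} {c} ab bc → <ᵇ-trans {c} {b} {a} bc ab)
module UpU = UniqueCover _<ᵇ_ (λ {a} {b} → <ᵇ-asym {a} {b}) (λ {a} {b} {c} → <ᵇ-trans {a} {b} {c})

-- Rothe diagrams and the reduction of vexillary permutations to dominant ones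

data Before (x y : ℕ) : List ℕ → Set where
  here  : ∀ {l} → y ∈ l → Before x y (x ∷ l)
  there : ∀ {a l} → Before x y l → Before x y (a ∷ l)

Before-∈ˡ : ∀ {x y l} → Before x y l → x ∈ l
Before-∈ˡ (here _)  = here refl
Before-∈ˡ (there b) = there (Before-∈ˡ b)

Before-∈ʳ : ∀ {x y l} → Before x y l → y ∈ l
Before-∈ʳ (here y∈) = there y∈
Before-∈ʳ (there b) = there (Before-∈ʳ b)

Before-++⁻ : ∀ {x y} as {bs} → Before x y (as ++ bs) → Before x y as ⊎ (x ∈ as × y ∈ bs) ⊎ Before x y bs
Before-++⁻ []       b = inj₂ (inj₂ b)
Before-++⁻ (a ∷ as) (here y∈) with Mem.∈-++⁻ as y∈
... | inj₁ y∈as = inj₁ (here y∈as)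
... | inj₂ y∈bs = inj₂ (inj₁ (here refl , y∈bs))
Before-++⁻ (a ∷ as) (there b) with Before-++⁻ as b
... | inj₁ b′               = inj₁ (there b′)
... | inj₂ (inj₁ (x∈ , y∈)) = inj₂ (inj₁ (there x∈ , y∈))
... | inj₂ (inj₂ b′)        = inj₂ (inj₂ b′)

Before-++ˡ : ∀ {x y as bs} → Before x y as → Before x y (as ++ bs)
Before-++ˡ (here y∈) = here (Mem.∈-++⁺ˡ y∈)
Before-++ˡ (there b) = there (Before-++ˡ b)

Before-++ʳ : ∀ {x y} as {bs} → Before x y bs → Before x y (as ++ bs)
Before-++ʳ []       b = b
Before-++ʳ (a ∷ as) b = there (Before-++ʳ as b)

Before-across : ∀ {x y as bs} → x ∈ as → y ∈ bs → Before x y (as ++ bs)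
Before-across {as = a ∷ as} (here refl) y∈ = here (Mem.∈-++⁺ʳ as y∈)
Before-across (there x∈)  y∈ = there (Before-across x∈ y∈)

Before-total : ∀ {x y l} → x ∈ l → y ∈ l → x ≢ y → Before x y l ⊎ Before y x l
Before-total (here refl) (here refl) x≢y = contradiction refl x≢y
Before-total (here refl) (there y∈)  x≢y = inj₁ (here y∈)
Before-total (there x∈)  (here refl) x≢y = inj₂ (here x∈)
Before-total (there x∈)  (there y∈)  x≢y = [ inj₁ ∘ there , inj₂ ∘ there ]′ (Before-total x∈ y∈ x≢y)

Before-asym : ∀ {x y l} → Unique l → Before x y l → ¬ Before y x l
Before-asym (x∉ ∷ u) (here y∈) (here x∈)  = All.lookup x∉ x∈ refl
Before-asym (x∉ ∷ u) (here y∈) (there b)  = All.lookup x∉ (Before-∈ʳ b) refl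
Before-asym (x∉ ∷ u) (there b) (here x∈)  = All.lookup x∉ (Before-∈ʳ b) refl
Before-asym (x∉ ∷ u) (there b) (there b′) = Before-asym u b b′

Before-trans : ∀ {x y z l} → Unique l → Before x y l → Before y z l → Before x z l
Before-trans (x∉ ∷ u) (here y∈) (here z∈)  = here z∈
Before-trans (x∉ ∷ u) (here y∈) (there b)  = here (Before-∈ʳ b)
Before-trans (x∉ ∷ u) (there b) (here z∈)  = contradiction refl (All.lookup x∉ (Before-∈ʳ b))
Before-trans (x∉ ∷ u) (there b) (there b′) = there (Before-trans u b b′)

-- The cell in row p and column u of the Rothe diagram of w, both labelled by entries.
Inversion : List ℕ → ℕ → ℕ → Set
Inversion w p u = u < p × Before p u w

-- A permutation is vexillary iff the rows of its diagram form a chain under inclusion.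
NoCrossing : List ℕ → Set
NoCrossing w = ∀ {i j u t} → Inversion w i u → Inversion w j t → Inversion w i t ⊎ Inversion w j u

-- The graph of the transposition of x and y. As a relation it can be matched on when rows and
-- columns of diagrams are compared, in either direction.
data Swaps (x y : ℕ) : ℕ → ℕ → Set where
  swapˡ : ∀ {p q} → p ≡ x → q ≡ y → Swaps x y p q
  swapʳ : ∀ {p q} → p ≡ y → q ≡ x → Swaps x y p q
  fixed : ∀ {p q} → p ≢ x → p ≢ y → p ≡ q → Swaps x y p q

Swaps-sym : ∀ {x y p q} → Swaps x y p q → Swaps x y q p
Swaps-sym (swapˡ p q)        = swapʳ q p
Swaps-sym (swapʳ p q)        = swapˡ q p
Swaps-sym (fixed p q refl) = fixed p q refl

Swaps-total : ∀ x y p → ∃ (Swaps x y p)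
Swaps-total x y p with p ≟ x
... | yes p≡x = y , swapˡ p≡x refl
... | no  p≢x with p ≟ y
...   | yes p≡y = x , swapʳ p≡y refl
...   | no  p≢y = p , fixed p≢x p≢y refl

Swaps-fixed : ∀ {x y p q} → p ≢ x → p ≢ y → Swaps x y p q → p ≡ q
Swaps-fixed p≢x p≢y (swapˡ p≡x _)   = contradiction p≡x p≢x
Swaps-fixed p≢x p≢y (swapʳ p≡y _)   = contradiction p≡y p≢y
Swaps-fixed p≢x p≢y (fixed _ _ p≡q) = p≡q

Swaps-ˡ : ∀ {x y q} → Swaps x y x q → q ≡ y
Swaps-ˡ (swapˡ _ e)     = e
Swaps-ˡ (swapʳ e e′)    = e′ ∙ e
Swaps-ˡ (fixed x≢x _ _) = contradiction refl x≢x

Swaps-ʳ : ∀ {x y q} → Swaps x y y q → q ≡ x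
Swaps-ʳ s = Swaps-ˡ (flip s)
  where
  flip : ∀ {x y p q} → Swaps x y p q → Swaps y x p q
  flip (swapˡ p q)   = swapʳ p q
  flip (swapʳ p q)   = swapˡ p q
  flip (fixed p q r) = fixed q p r

⟦_⟧ : Bool → ℕ
⟦ true ⟧  = 1
⟦ false ⟧ = 0

count : (X → Bool) → List X → ℕ
count p l = length (filterᵇ p l)

count-∷ : (p : X → Bool) (x : X) (l : List X) → count p (x ∷ l) ≡ ⟦ p x ⟧ + count p l
count-∷ p x l with p x
... | true  = refl
... | false = refl

count-++ : (p : X → Bool) (l m : List X) → count p (l ++ m) ≡ count p l + count p m
count-++ p l m = cong length (List.filter-++ _ l m) ∙ List.length-++ (filterᵇ p l)

count-↭ : (p : X → Bool) {l m : List X} → l ↭ m → count p l ≡ count p m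
count-↭ p l↭m = Perm.↭-length (Perm.filter-↭ _ l↭m)

⟦⟧-mono : ∀ b c → (b ≡ true → c ≡ true) → ⟦ b ⟧ ≤ ⟦ c ⟧
⟦⟧-mono false c e = z≤n
⟦⟧-mono true  c e rewrite e refl = s≤s z≤n

count-mono : (p q : X → Bool) (l : List X) → (∀ x → x ∈ l → p x ≡ true → q x ≡ true) → count p l ≤ count q l
count-mono p q []      e = z≤n
count-mono p q (x ∷ l) e rewrite count-∷ p x l | count-∷ q x l =
  ℕ.+-mono-≤ (⟦⟧-mono (p x) (q x) (e x (here refl))) (count-mono p q l (λ y y∈ → e y (there y∈)))

count-cong : (p q : X → Bool) (l : List X) → (∀ x → x ∈ l → p x ≡ q x) → count p l ≡ count q l
count-cong p q l e = ℕ.≤-antisym (count-mono p q l (λ x x∈ px → sym (e x x∈) ∙ px)) (count-mono q p l (λ x x∈ qx → e x x∈ ∙ qx))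

count-none : (p : X → Bool) (l : List X) → (∀ x → x ∈ l → p x ≡ false) → count p l ≡ 0
count-none p l e = count-cong p (λ _ → false) l e ∙ zero′ l
  where
  zero′ : ∀ l → count (λ _ → false) l ≡ 0
  zero′ []      = refl
  zero′ (x ∷ l) = zero′ l

smaller : ℕ → List ℕ → ℕ
smaller x l = count (λ y → y <ᵇ x) l

prefixCode : List ℕ → List ℕ → List ℕ
prefixCode []       bs = []
prefixCode (a ∷ as) bs = smaller a (as ++ bs) ∷ prefixCode as bs

lehmer-++ : ∀ as bs → lehmer (as ++ bs) ≡ prefixCode as bs ++ lehmer bs
lehmer-++ []       bs = refl
lehmer-++ (a ∷ as) bs = cong (smaller a (as ++ bs) ∷_) (lehmer-++ as bs)

prefixCode-cong : ∀ as {bs cs} → (∀ a → a ∈ as → smaller a bs ≡ smaller a cs) → prefixCode as bs ≡ prefixCode as cs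
prefixCode-cong []       e = refl
prefixCode-cong (a ∷ as) {bs} {cs} e = cong₂ _∷_
  (count-++ _ as bs ∙ cong (smaller a as +_) (e a (here refl)) ∙ sym (count-++ _ as cs)) (prefixCode-cong as (λ x x∈ → e x (there x∈)))

smaller-∷-< : ∀ {a b} l → b < a → smaller a (b ∷ l) ≡ suc (smaller a l)
smaller-∷-< {a} {b} l b<a = count-∷ _ b l ∙ cong (λ c → ⟦ c ⟧ + smaller a l) (<ᵇ-true {b} {a} b<a)

smaller-∷-≮ : ∀ {a b} l → ¬ b < a → smaller a (b ∷ l) ≡ smaller a l
smaller-∷-≮ {a} {b} l b≮a = count-∷ _ b l ∙ cong (λ c → ⟦ c ⟧ + smaller a l) (<ᵇ-false {b} {a} b≮a)

smaller-none : ∀ a l → All (a <_) l → smaller a l ≡ 0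
smaller-none a l ps = count-none _ l (λ x x∈ → <ᵇ-false {x} {a} (ℕ.<⇒≯ (All.lookup ps x∈)))

smaller-mono : ∀ {a b} l → a ≤ b → smaller a l ≤ smaller b l
smaller-mono {a} {b} l a≤b = count-mono _ _ l (λ x _ e → <ᵇ-true {x} {b} (ℕ.<-≤-trans (<ᵇ-sound {x} {a} e) a≤b))

smaller-gap : ∀ {x y} l → x < y → All (λ c → c < x ⊎ y < c) l → smaller x l ≡ smaller y l
smaller-gap {x} {y} l x<y gap = ℕ.≤-antisym (smaller-mono l (ℕ.<⇒≤ x<y))
  (count-mono _ _ l (λ c c∈ e → [ <ᵇ-true {c} {x} , (λ y<c → contradiction y<c (ℕ.<⇒≯ (<ᵇ-sound {c} {y} e))) ]′ (All.lookup gap c∈)))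

-- The vexillary case of the transition formula: the entry x, which covers only z to its left and
-- is covered only by y to its right, is exchanged with one or the other.
module Move (A M N C : List ℕ) (x y z : ℕ)
  (z<x : z < x) (x<y : x < y) (x<M : All (x <_) M) (N<x : All (_< x) N)
  (gapA : All (λ a → a < z ⊎ x < a) A) (gapC : All (λ c → c < x ⊎ y < c) C)
  (unique : Unique (A ++ z ∷ M ++ y ∷ N ++ x ∷ C)) where

  before after : List ℕ
  before = A ++ z ∷ M ++ y ∷ N ++ x ∷ C
  after  = A ++ x ∷ M ++ z ∷ N ++ y ∷ C

  private
    tail↭ : ∀ {x y z : ℕ} → z ∷ M ++ y ∷ N ++ x ∷ C ↭ x ∷ y ∷ z ∷ M ++ N ++ C
    tail↭ {x} {y} {z} =
      ↭-trans (prep z (↭-trans (Perm.shift y M (N ++ x ∷ C)) (prep y (↭-trans (Perm.++⁺ˡ M (Perm.shift x N C)) (Perm.shift x M (N ++ C))))))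
      (↭-trans (prep z (↭-swap y x refl)) (↭-trans (↭-swap z x refl) (prep x (↭-swap z y refl))))

    rotate : ∀ {l : List ℕ} → x ∷ y ∷ z ∷ l ↭ y ∷ z ∷ x ∷ l
    rotate = ↭-trans (↭-swap x y refl) (prep y (↭-swap x z refl))

    tails↭ : z ∷ M ++ y ∷ N ++ x ∷ C ↭ x ∷ M ++ z ∷ N ++ y ∷ C
    tails↭ = ↭-trans tail↭ (↭-trans rotate (↭-sym tail↭))

  before↭after : before ↭ after
  before↭after = Perm.++⁺ˡ A tails↭

  private
    u′ : Unique (x ∷ y ∷ z ∷ A ++ M ++ N ++ C)
    u′ = Unique-↭ (↭-trans (Perm.++⁺ˡ A tail↭) (Perm.shifts A (x ∷ y ∷ z ∷ []))) unique

    distinct : ∀ {v} → v ∈ A ++ M ++ N ++ C → v ≢ x × v ≢ y × v ≢ z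
    distinct v∈ with (_ ∷ _ ∷ x∉) ∷ (_ ∷ y∉) ∷ z∉ ∷ _ ← u′ =
      All.lookup x∉ v∈ ∘ sym , All.lookup y∉ v∈ ∘ sym , All.lookup z∉ v∈ ∘ sym

    ∈A : ∀ {v} → v ∈ A → v ∈ A ++ M ++ N ++ C
    ∈A = Mem.∈-++⁺ˡ
    ∈M : ∀ {v} → v ∈ M → v ∈ A ++ M ++ N ++ C
    ∈M = Mem.∈-++⁺ʳ A ∘ Mem.∈-++⁺ˡ
    ∈N : ∀ {v} → v ∈ N → v ∈ A ++ M ++ N ++ C
    ∈N = Mem.∈-++⁺ʳ A ∘ Mem.∈-++⁺ʳ M ∘ Mem.∈-++⁺ˡ
    ∈C : ∀ {v} → v ∈ C → v ∈ A ++ M ++ N ++ C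
    ∈C = Mem.∈-++⁺ʳ A ∘ Mem.∈-++⁺ʳ M ∘ Mem.∈-++⁺ʳ N

    row : ∀ {p q} → p ∈ A ++ M ++ N ++ C → Swaps x y p q → p ≡ q
    row p∈ with ≢x , ≢y , ≢z ← distinct p∈ = Swaps-fixed ≢x ≢y
    col : ∀ {p q} → p ∈ A ++ M ++ N ++ C → Swaps x z p q → p ≡ q
    col p∈ with ≢x , ≢y , ≢z ← distinct p∈ = Swaps-fixed ≢x ≢z

    unzip : ∀ z l → (reverse M ++ z ∷ reverse A) ʳ++ l ≡ A ++ z ∷ M ++ l
    unzip z l = List.++-ʳ++ (reverse M) ∙ cong ((z ∷ reverse A) ʳ++_) (List.ʳ++-defn (reverse M) ∙ cong (_++ l) (List.reverse-involutive M))
      ∙ List.ʳ++-defn (reverse A) ∙ cong (_++ z ∷ M ++ l) (List.reverse-involutive A)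

  -- The transition formula is applied to the word `A ++ z ∷ M ++ x ∷ N ++ y ∷ C`, with x in the
  -- middle place. There y is the only cover of x to the right and z the only one to the left, so
  -- the two sides are this word plus `before` and this word plus `after`.
  heckeWords-move : ∀ n → heckeWords n before ≡ heckeWords n after
  heckeWords-move n = ℕ.+-cancelˡ-≡ _ _ _
    (cong (λ l → heckeWords n (as ʳ++ x ∷ bs) + heckeWords n l) (sym (unzip z _))
    ∙ sym (DownU.exchange-uniqueCover x N y C k (All.map (λ {v} → <ᵇ-true {v} {x}) N<x) (<ᵇ-true x<y)
        (All.map (λ {v} → [ inj₁ ∘ <ᵇ-true {v} {x} , inj₂ ∘ <ᵇ-true {y} {v} ]′) gapC))
    ∙ transition n as x bs u″ (Any.++⁺ʳ N (here x<y)) (Any.++⁺ʳ (reverse M) (here z<x))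
    ∙ UpU.exchange-uniqueCover x (reverse M) z (reverse A) (λ v l → heckeWords n (l ʳ++ v ∷ bs))
        (All.map (λ {v} → <ᵇ-true {x} {v}) (reverse-All x<M)) (<ᵇ-true z<x)
        (All.map (λ {v} → [ inj₂ ∘ <ᵇ-true {v} {z} , inj₁ ∘ <ᵇ-true {x} {v} ]′) (reverse-All gapA))
    ∙ cong (λ l → heckeWords n (as ʳ++ x ∷ bs) + heckeWords n l) (unzip x _))
    where
    as bs : List ℕ
    as = reverse M ++ z ∷ reverse A
    bs = N ++ y ∷ C
    k : ℕ → List ℕ → ℕ
    k v l = heckeWords n (as ʳ++ v ∷ l)
    reverse-All : ∀ {P : ℕ → Set} {l} → All P l → All P (reverse l)
    reverse-All {l = l} ps = Perm.All-resp-↭ (↭-sym (Perm.↭-reverse l)) ps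
    u″ : Unique (x ∷ as ++ bs)
    u″ = Unique-↭ (↭-trans before↭after (↭-trans (↭-reflexive (sym (unzip x (z ∷ bs)))) (↭-trans (↭-sym (Perm.++↭ʳ++ (reverse M ++ x ∷ reverse A) (z ∷ bs))) mid))) unique
      where
      mid : (reverse M ++ x ∷ reverse A) ++ z ∷ bs ↭ x ∷ as ++ bs
      mid = ↭-trans (Perm.++⁺ʳ (z ∷ bs) (Perm.shift x (reverse M) (reverse A))) (prep x (↭-trans (Perm.shift z (reverse M ++ reverse A) bs) (Perm.++⁺ʳ bs (↭-sym (Perm.shift z (reverse M) (reverse A))))))

  -- The codes at the first two of the three places trade values and all others stay. The code `q`
  -- of y counts the later entry x, which `p`, the code of z, does not; hence `p < q`.
  code-swap : ∃ λ P → ∃ λ Q → ∃ λ R → ∃₂ λ p q → p < q × lehmer before ≡ P ++ p ∷ Q ++ q ∷ R × lehmer after ≡ P ++ q ∷ Q ++ p ∷ R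
  code-swap = prefixCode A (z ∷ M ++ y ∷ N ++ x ∷ C) , prefixCode M (y ∷ N ++ x ∷ C) , prefixCode N (x ∷ C) ++ smaller x C ∷ lehmer C
    , smaller z N + smaller z C , suc (smaller x N + smaller x C)
    , s≤s (ℕ.+-mono-≤ (smaller-mono N (ℕ.<⇒≤ z<x)) (smaller-mono C (ℕ.<⇒≤ z<x)))
    , lehmer-++ A _ ∙ cong (prefixCode A (z ∷ M ++ y ∷ N ++ x ∷ C) ++_) (cong₂ _∷_ code-z (lehmer-++ M _ ∙ cong (prefixCode M (y ∷ N ++ x ∷ C) ++_) (cong₂ _∷_ code-y (lehmer-++ N _))))
    , lehmer-++ A _ ∙ cong₂ _++_ (prefixCode-cong A (λ a _ → count-↭ (λ v → v <ᵇ a) (↭-sym tails↭)))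
        (cong₂ _∷_ code-x (lehmer-++ M _ ∙ cong₂ _++_ (prefixCode-cong M code-M)
          (cong₂ _∷_ code-z′ (lehmer-++ N _ ∙ cong₂ _++_ (prefixCode-cong N code-N) (cong (_∷ lehmer C) (sym gap))))))
    where
    gap : smaller x C ≡ smaller y C
    gap = smaller-gap C x<y gapC
    z<M : All (z <_) M
    z<M = All.map (ℕ.<-trans z<x) x<M
    code-z : smaller z (M ++ y ∷ N ++ x ∷ C) ≡ smaller z N + smaller z C
    code-z = count-++ _ M _ ∙ cong₂ _+_ (smaller-none z M z<M)
      (smaller-∷-≮ (N ++ x ∷ C) (ℕ.<⇒≯ (ℕ.<-trans z<x x<y)) ∙ count-++ _ N _ ∙ cong (smaller z N +_) (smaller-∷-≮ C (ℕ.<⇒≯ z<x)))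
    code-z′ : smaller z (N ++ y ∷ C) ≡ smaller z N + smaller z C
    code-z′ = count-++ _ N _ ∙ cong (smaller z N +_) (smaller-∷-≮ C (ℕ.<⇒≯ (ℕ.<-trans z<x x<y)))
    code-y : smaller y (N ++ x ∷ C) ≡ suc (smaller x N + smaller x C)
    code-y = count-++ _ N _ ∙ cong₂ _+_ (sym (smaller-gap N x<y (All.map inj₁ N<x))) (smaller-∷-< C x<y ∙ cong suc (sym gap)) ∙ ℕ.+-suc _ _
    code-x : smaller x (M ++ z ∷ N ++ y ∷ C) ≡ suc (smaller x N + smaller x C)
    code-x = count-++ _ M _ ∙ cong₂ _+_ (smaller-none x M x<M)
      (smaller-∷-< (N ++ y ∷ C) z<x ∙ cong suc (count-++ _ N _ ∙ cong (smaller x N +_) (smaller-∷-≮ C (ℕ.<⇒≯ x<y))))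
    code-M : ∀ m → m ∈ M → smaller m (z ∷ N ++ y ∷ C) ≡ smaller m (y ∷ N ++ x ∷ C)
    code-M m m∈ = smaller-∷-< (N ++ y ∷ C) (ℕ.<-trans z<x x<m) ∙ sym (smaller-∷-< (N ++ y ∷ C) x<m)
        ∙ count-↭ (λ v → v <ᵇ m) (↭-trans (prep x (Perm.shift y N C)) (↭-trans (↭-swap x y refl) (prep y (↭-sym (Perm.shift x N C)))))
      where
      x<m : x < m
      x<m = All.lookup x<M m∈
    code-N : ∀ n → n ∈ N → smaller n (y ∷ C) ≡ smaller n (x ∷ C)
    code-N n n∈ = smaller-∷-≮ C (ℕ.<⇒≯ (ℕ.<-trans n<x x<y)) ∙ sym (smaller-∷-≮ C (ℕ.<⇒≯ n<x))
      where
      n<x : n < x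
      n<x = All.lookup N<x n∈

  private
    x≢y : x ≢ y
    x≢y = ℕ.<⇒≢ x<y
    z≢x : z ≢ x
    z≢x = ℕ.<⇒≢ z<x
    z≢y : z ≢ y
    z≢y = ℕ.<⇒≢ (ℕ.<-trans z<x x<y)

    data Cases (x y z p u : ℕ) : Set where
      in-A  : Before p u A → Cases x y z p u
      A-out : p ∈ A → u ∈ z ∷ M ++ y ∷ N ++ x ∷ C → Cases x y z p u
      at-z  : p ≡ z → u ∈ M ⊎ u ≡ y ⊎ u ∈ N ⊎ u ≡ x ⊎ u ∈ C → Cases x y z p u
      in-M  : Before p u M → Cases x y z p u
      M-out : p ∈ M → u ≡ y ⊎ u ∈ N ⊎ u ≡ x ⊎ u ∈ C → Cases x y z p u
      at-y  : p ≡ y → u ∈ N ⊎ u ≡ x ⊎ u ∈ C → Cases x y z p u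
      in-N  : Before p u N → Cases x y z p u
      N-out : p ∈ N → u ≡ x ⊎ u ∈ C → Cases x y z p u
      at-x  : p ≡ x → u ∈ C → Cases x y z p u
      in-C  : Before p u C → Cases x y z p u

    split : ∀ {v a : ℕ} as {bs} → v ∈ as ++ a ∷ bs → v ∈ as ⊎ v ≡ a ⊎ v ∈ bs
    split as v∈ with Mem.∈-++⁻ as v∈
    ... | inj₁ v∈as         = inj₁ v∈as
    ... | inj₂ (here e)     = inj₂ (inj₁ e)
    ... | inj₂ (there v∈bs) = inj₂ (inj₂ v∈bs)

    split₂ : ∀ {x y v : ℕ} → v ∈ M ++ y ∷ N ++ x ∷ C → v ∈ M ⊎ v ≡ y ⊎ v ∈ N ⊎ v ≡ x ⊎ v ∈ C
    split₂ v∈ with split M v∈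
    ... | inj₁ v∈M         = inj₁ v∈M
    ... | inj₂ (inj₁ e)    = inj₂ (inj₁ e)
    ... | inj₂ (inj₂ v∈′)  = inj₂ (inj₂ (split N v∈′))

    split₁ : ∀ {x y v : ℕ} → v ∈ y ∷ N ++ x ∷ C → v ≡ y ⊎ v ∈ N ⊎ v ≡ x ⊎ v ∈ C
    split₁ (here e)  = inj₁ e
    split₁ (there i) = inj₂ (split N i)

    cases : ∀ {x y z p u} → Before p u (A ++ z ∷ M ++ y ∷ N ++ x ∷ C) → Cases x y z p u
    cases b with Before-++⁻ A b
    ... | inj₁ b′               = in-A b′
    ... | inj₂ (inj₁ (i , j))   = A-out i j
    ... | inj₂ (inj₂ (here j))  = at-z refl (split₂ j)
    ... | inj₂ (inj₂ (there b₁)) with Before-++⁻ M b₁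
    ...   | inj₁ b′               = in-M b′
    ...   | inj₂ (inj₁ (i , j))   = M-out i (split₁ j)
    ...   | inj₂ (inj₂ (here j))  = at-y refl (split N j)
    ...   | inj₂ (inj₂ (there b₂)) with Before-++⁻ N b₂
    ...     | inj₁ b′                    = in-N b′
    ...     | inj₂ (inj₁ (i , here j))   = N-out i (inj₁ j)
    ...     | inj₂ (inj₁ (i , there j))  = N-out i (inj₂ j)
    ...     | inj₂ (inj₂ (here j))       = at-x refl j
    ...     | inj₂ (inj₂ (there b₃))     = in-C b₃

    ∈C₁ : ∀ {x y v} → v ∈ C → v ∈ y ∷ N ++ x ∷ C
    ∈C₁ i = there (Mem.∈-++⁺ʳ N (there i))
    from-z : ∀ {x y z u} → u ∈ y ∷ N ++ x ∷ C → Before z u (A ++ z ∷ M ++ y ∷ N ++ x ∷ C)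
    from-z i = Before-++ʳ A (here (Mem.∈-++⁺ʳ M i))
    from-M : ∀ {x y z p u} → p ∈ M → u ∈ y ∷ N ++ x ∷ C → Before p u (A ++ z ∷ M ++ y ∷ N ++ x ∷ C)
    from-M i j = Before-++ʳ A (there (Before-across i j))
    from-y : ∀ {x y z u} → u ∈ N ++ x ∷ C → Before y u (A ++ z ∷ M ++ y ∷ N ++ x ∷ C)
    from-y i = Before-++ʳ A (there (Before-++ʳ M (here i)))
    from-N : ∀ {x y z p u} → p ∈ N → u ∈ x ∷ C → Before p u (A ++ z ∷ M ++ y ∷ N ++ x ∷ C)
    from-N i j = Before-++ʳ A (there (Before-++ʳ M (there (Before-across i j))))
    from-x : ∀ {x y z u} → u ∈ C → Before x u (A ++ z ∷ M ++ y ∷ N ++ x ∷ C)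
    from-x i = Before-++ʳ A (there (Before-++ʳ M (there (Before-++ʳ N (here i)))))

    absurd-< : ∀ {P : Set} {a b} → a < b → b < a → P
    absurd-< a<b b<a = contradiction b<a (ℕ.<⇒≯ a<b)

    -- The two diagrams agree after exchanging the rows of x and y and the columns of x and z.
    forward : ∀ {p u p′ u′} → Inversion before p u → Swaps x y p p′ → Swaps x z u u′ → Inversion after p′ u′
    forward (u<p , b) r c with cases b
    ... | in-A b′ with refl ← row (∈A (Before-∈ˡ b′)) r | refl ← col (∈A (Before-∈ʳ b′)) c = u<p , Before-++ˡ b′
    ... | A-out p∈ u∈ with refl ← row (∈A p∈) r with c
    ...   | swapˡ refl refl = ℕ.<-trans z<x u<p , Before-across p∈ (there (Mem.∈-++⁺ʳ M (here refl)))
    -- An entry of A above z is above x by `gapA`, so it keeps its inversion when column z becomes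
    -- column x.
    ...   | swapʳ refl refl = [ absurd-< u<p , (λ x<p → x<p , Before-across p∈ (here refl)) ]′ (All.lookup gapA p∈)
    ...   | fixed _ _ refl  = u<p , Before-across p∈ (Perm.∈-resp-↭ tails↭ u∈)
    forward (u<p , b) r c | at-z refl cs with refl ← Swaps-fixed z≢x z≢y r with cs
    ... | inj₁ u∈ = absurd-< (ℕ.<-trans z<x (All.lookup x<M u∈)) u<p
    ... | inj₂ (inj₁ refl) = absurd-< (ℕ.<-trans z<x x<y) u<p
    ... | inj₂ (inj₂ (inj₁ u∈)) with refl ← col (∈N u∈) c = u<p , from-y (Mem.∈-++⁺ˡ u∈)
    ... | inj₂ (inj₂ (inj₂ (inj₁ refl))) = absurd-< z<x u<p
    ... | inj₂ (inj₂ (inj₂ (inj₂ u∈))) with refl ← col (∈C u∈) c = u<p , from-y (Mem.∈-++⁺ʳ N (there u∈))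
    forward (u<p , b) r c | in-M b′ with refl ← row (∈M (Before-∈ˡ b′)) r | refl ← col (∈M (Before-∈ʳ b′)) c =
      u<p , Before-++ʳ A (there (Before-++ˡ b′))
    forward (u<p , b) r c | M-out p∈ cs with refl ← row (∈M p∈) r with cs
    ... | inj₁ refl with refl ← Swaps-fixed (x≢y ∘ sym) (z≢y ∘ sym) c = u<p , from-M p∈ (there (Mem.∈-++⁺ʳ N (here refl)))
    ... | inj₂ (inj₁ u∈) with refl ← col (∈N u∈) c = u<p , from-M p∈ (there (Mem.∈-++⁺ˡ u∈))
    ... | inj₂ (inj₂ (inj₁ refl)) with refl ← Swaps-ˡ c = ℕ.<-trans z<x u<p , from-M p∈ (here refl)
    ... | inj₂ (inj₂ (inj₂ u∈)) with refl ← col (∈C u∈) c = u<p , from-M p∈ (∈C₁ u∈)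
    forward (u<p , b) r c | at-y refl cs with refl ← Swaps-ʳ r with cs
    ... | inj₁ u∈ with refl ← col (∈N u∈) c = All.lookup N<x u∈ , from-z (there (Mem.∈-++⁺ˡ u∈))
    ... | inj₂ (inj₁ refl) with refl ← Swaps-ˡ c = z<x , from-z (here refl)
    ... | inj₂ (inj₂ u∈) with refl ← col (∈C u∈) c = [ id , absurd-< u<p ]′ (All.lookup gapC u∈) , from-z (∈C₁ u∈)
    forward (u<p , b) r c | in-N b′ with refl ← row (∈N (Before-∈ˡ b′)) r | refl ← col (∈N (Before-∈ʳ b′)) c =
      u<p , Before-++ʳ A (there (Before-++ʳ M (there (Before-++ˡ b′))))
    forward (u<p , b) r c | N-out p∈ (inj₁ refl) = absurd-< u<p (All.lookup N<x p∈)
    forward (u<p , b) r c | N-out p∈ (inj₂ u∈) with refl ← row (∈N p∈) r | refl ← col (∈C u∈) c = u<p , from-N p∈ (there u∈)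
    forward (u<p , b) r c | at-x refl u∈ with refl ← Swaps-ˡ r | refl ← col (∈C u∈) c = ℕ.<-trans u<p x<y , from-x u∈
    forward (u<p , b) r c | in-C b′ with refl ← row (∈C (Before-∈ˡ b′)) r | refl ← col (∈C (Before-∈ʳ b′)) c =
      u<p , Before-++ʳ A (there (Before-++ʳ M (there (Before-++ʳ N (there b′)))))

    backward : ∀ {p u p′ u′} → Inversion after p u → Swaps x y p p′ → Swaps x z u u′ → Inversion before p′ u′
    backward (u<p , b) r c with cases b
    ... | in-A b′ with refl ← row (∈A (Before-∈ˡ b′)) r | refl ← col (∈A (Before-∈ʳ b′)) c = u<p , Before-++ˡ b′
    ... | A-out p∈ u∈ with refl ← row (∈A p∈) r with c
    ...   | swapˡ refl refl = ℕ.<-trans z<x u<p , Before-across p∈ (here refl)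
    ...   | swapʳ refl refl = [ absurd-< u<p , (λ x<p → x<p , Before-across p∈ (there (Mem.∈-++⁺ʳ M (there (Mem.∈-++⁺ʳ N (here refl)))))) ]′ (All.lookup gapA p∈)
    ...   | fixed _ _ refl  = u<p , Before-across p∈ (Perm.∈-resp-↭ (↭-sym tails↭) u∈)
    backward (u<p , b) r c | at-z refl cs with refl ← Swaps-ˡ r with cs
    ... | inj₁ u∈ = absurd-< (All.lookup x<M u∈) u<p
    ... | inj₂ (inj₁ refl) with refl ← Swaps-ʳ c = x<y , from-y (Mem.∈-++⁺ʳ N (here refl))
    ... | inj₂ (inj₂ (inj₁ u∈)) with refl ← col (∈N u∈) c = ℕ.<-trans u<p x<y , from-y (Mem.∈-++⁺ˡ u∈)
    ... | inj₂ (inj₂ (inj₂ (inj₁ refl))) = absurd-< x<y u<p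
    ... | inj₂ (inj₂ (inj₂ (inj₂ u∈))) with refl ← col (∈C u∈) c = ℕ.<-trans u<p x<y , from-y (Mem.∈-++⁺ʳ N (there u∈))
    backward (u<p , b) r c | in-M b′ with refl ← row (∈M (Before-∈ˡ b′)) r | refl ← col (∈M (Before-∈ʳ b′)) c =
      u<p , Before-++ʳ A (there (Before-++ˡ b′))
    backward (u<p , b) r c | M-out p∈ cs with refl ← row (∈M p∈) r with cs
    ... | inj₁ refl with refl ← Swaps-ʳ c = All.lookup x<M p∈ , from-M p∈ (there (Mem.∈-++⁺ʳ N (here refl)))
    ... | inj₂ (inj₁ u∈) with refl ← col (∈N u∈) c = u<p , from-M p∈ (there (Mem.∈-++⁺ˡ u∈))
    ... | inj₂ (inj₂ (inj₁ refl)) with refl ← Swaps-fixed (x≢y ∘ sym) (z≢y ∘ sym) c = u<p , from-M p∈ (here refl)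
    ... | inj₂ (inj₂ (inj₂ u∈)) with refl ← col (∈C u∈) c = u<p , from-M p∈ (∈C₁ u∈)
    backward (u<p , b) r c | at-y refl cs with refl ← Swaps-fixed z≢x z≢y r with cs
    ... | inj₁ u∈ with refl ← col (∈N u∈) c = u<p , from-z (there (Mem.∈-++⁺ˡ u∈))
    ... | inj₂ (inj₁ refl) = absurd-< (ℕ.<-trans z<x x<y) u<p
    ... | inj₂ (inj₂ u∈) with refl ← col (∈C u∈) c = u<p , from-z (∈C₁ u∈)
    backward (u<p , b) r c | in-N b′ with refl ← row (∈N (Before-∈ˡ b′)) r | refl ← col (∈N (Before-∈ʳ b′)) c =
      u<p , Before-++ʳ A (there (Before-++ʳ M (there (Before-++ˡ b′))))
    backward (u<p , b) r c | N-out p∈ (inj₁ refl) = absurd-< u<p (ℕ.<-trans (All.lookup N<x p∈) x<y)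
    backward (u<p , b) r c | N-out p∈ (inj₂ u∈) with refl ← row (∈N p∈) r | refl ← col (∈C u∈) c = u<p , from-N p∈ (there u∈)
    backward (u<p , b) r c | at-x refl u∈ with refl ← Swaps-ʳ r | refl ← col (∈C u∈) c = [ id , absurd-< u<p ]′ (All.lookup gapC u∈) , from-x u∈
    backward (u<p , b) r c | in-C b′ with refl ← row (∈C (Before-∈ˡ b′)) r | refl ← col (∈C (Before-∈ʳ b′)) c =
      u<p , Before-++ʳ A (there (Before-++ʳ M (there (Before-++ʳ N (there b′)))))

  -- `NoCrossing` speaks only of the incidence of rows and columns, so it is invariant under
  -- permuting either.
  noCrossing-move : NoCrossing before → NoCrossing after
  noCrossing-move nc {i} {j} {u} {t} iu jt
    with _ , i′ ← Swaps-total x y i | _ , j′ ← Swaps-total x y j | _ , u′ ← Swaps-total x z u | _ , t′ ← Swaps-total x z t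
    with nc (backward iu i′ u′) (backward jt j′ t′)
  ... | inj₁ it = inj₁ (forward it (Swaps-sym i′) (Swaps-sym t′))
  ... | inj₂ ju = inj₂ (forward ju (Swaps-sym j′) (Swaps-sym u′))

AllPairs-↭-≡ : {R : X → X → Set} → (∀ {x y} → R x y → R y x → x ≡ y) →
  ∀ {xs ys} → AllPairs R xs → AllPairs R ys → xs ↭ ys → xs ≡ ys
AllPairs-↭-≡ antisym {[]}     {ys}     ps qs p = sym (Perm.↭-empty-inv (↭-sym p))
AllPairs-↭-≡ antisym {x ∷ xs} {[]}     ps qs p = contradiction p Perm.¬x∷xs↭[]
AllPairs-↭-≡ {R = R} antisym {x ∷ xs} {y ∷ ys} (p ∷ ps) (q ∷ qs) xs↭ys = helper x≡y xs↭ys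
  where
  x≡y : x ≡ y
  x≡y with Perm.∈-resp-↭ xs↭ys (here refl) | Perm.∈-resp-↭ (↭-sym xs↭ys) (here refl)
  ... | here e   | _         = e
  ... | there x∈ | here e    = sym e
  ... | there x∈ | there y∈  = antisym (All.lookup p y∈) (All.lookup q x∈)
  helper : x ≡ y → x ∷ xs ↭ y ∷ ys → x ∷ xs ≡ y ∷ ys
  helper refl r = cong (x ∷_) (AllPairs-↭-≡ antisym ps qs (Perm.drop-∷ r))

Decreasing : List ℕ → Set
Decreasing = AllPairs (λ a b → b ≤ a)

Decreasing-↭-≡ : ∀ {xs ys} → Decreasing xs → Decreasing ys → xs ↭ ys → xs ≡ ys
Decreasing-↭-≡ = AllPairs-↭-≡ (λ y≤x x≤y → ℕ.≤-antisym x≤y y≤x)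

-- Among the rearrangements of one list the head is determined by its rank, which is the first entry
-- of the code.
lehmer-injective : ∀ {v w} → v ↭ w → lehmer v ≡ lehmer w → v ≡ w
lehmer-injective {[]}    {w}     p e = sym (Perm.↭-empty-inv (↭-sym p))
lehmer-injective {x ∷ v} {[]}    p e = contradiction p Perm.¬x∷xs↭[]
lehmer-injective {x ∷ v} {y ∷ w} p e = cons x≡y p
  where
  smaller-total : ∀ a l → smaller a (a ∷ l) ≡ smaller a l
  smaller-total a l = smaller-∷-≮ l (ℕ.n≮n a)
  same : smaller x (x ∷ v) ≡ smaller y (y ∷ w)
  same = smaller-total x v ∙ List.∷-injectiveˡ e ∙ sym (smaller-total y w)
  strict : ∀ {a b l} → a < b → a ∈ l → smaller a l < smaller b l
  strict {a} {b} a<b a∈ with P , Q , refl ← Mem.∈-∃++ a∈ =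
    subst₂′ (count-++ _ P _ ∙ cong (smaller a P +_) (smaller-total a Q)) (count-++ _ P _ ∙ cong (smaller b P +_) (smaller-∷-< Q a<b) ∙ ℕ.+-suc _ _)
      (s≤s (ℕ.+-mono-≤ (smaller-mono P (ℕ.<⇒≤ a<b)) (smaller-mono Q (ℕ.<⇒≤ a<b))))
    where
    subst₂′ : ∀ {m m′ n n′} → m ≡ m′ → n ≡ n′ → m′ < n′ → m < n
    subst₂′ refl refl q = q
  x≡y : x ≡ y
  x≡y with ℕ.<-cmp x y
  ... | tri≈ _ e′ _ = e′
  ... | tri< x<y _ _ = contradiction (same ∙ sym (count-↭ (_<ᵇ y) p)) (ℕ.<⇒≢ (strict x<y (here refl)))
  ... | tri> _ _ y<x = contradiction (sym same ∙ count-↭ (_<ᵇ x) p) (ℕ.<⇒≢ (strict y<x (here refl)))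
  cons : x ≡ y → x ∷ v ↭ y ∷ w → x ∷ v ≡ y ∷ w
  cons refl p = cong (x ∷_) (lehmer-injective (Perm.drop-∷ p) (List.∷-injectiveʳ e))

-- Each code entry is counted as often as there are entries before it. Bringing a larger entry
-- forward lowers the total, which makes the reduction terminate.
weight : List ℕ → ℕ
weight []       = 0
weight (c ∷ cs) = sum cs + weight cs

sum-mid : ∀ P c Q → sum (P ++ c ∷ Q) ≡ c + sum (P ++ Q)
sum-mid P c Q = sum-↭ (Perm.shift c P Q)

weight-mono : ∀ P {p q} R → p ≤ q → weight (P ++ p ∷ R) ≤ weight (P ++ q ∷ R)
weight-mono []      R p≤q = ℕ.≤-refl
weight-mono (c ∷ P) {p} {q} R p≤q = ℕ.+-mono-≤
  (ℕ.≤-trans (ℕ.≤-reflexive (sum-mid P p R)) (ℕ.≤-trans (ℕ.+-monoˡ-≤ (sum (P ++ R)) p≤q) (ℕ.≤-reflexive (sym (sum-mid P q R)))))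
  (weight-mono P R p≤q)

weight-swap : ∀ P {p q} Q R → p < q → weight (P ++ q ∷ Q ++ p ∷ R) < weight (P ++ p ∷ Q ++ q ∷ R)
weight-swap []      {p} {q} Q R p<q = ℕ.+-mono-<-≤
  (ℕ.<-≤-trans (ℕ.≤-<-trans (ℕ.≤-reflexive (sum-mid Q p R)) (ℕ.+-monoˡ-< (sum (Q ++ R)) p<q)) (ℕ.≤-reflexive (sym (sum-mid Q q R))))
  (weight-mono Q R (ℕ.<⇒≤ p<q))
weight-swap (c ∷ P) {p} {q} Q R p<q = ℕ.+-mono-≤-<
  (ℕ.≤-reflexive (sum-mid P q (Q ++ p ∷ R) ∙ cong (q +_) (sum-mid₂ p) ∙ swap₃ q p (sum (P ++ Q ++ R)) ∙ cong (p +_) (sym (sum-mid₂ q)) ∙ sym (sum-mid P p (Q ++ q ∷ R))))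
  (weight-swap P Q R p<q)
  where
  sum-mid₂ : ∀ v → sum (P ++ Q ++ v ∷ R) ≡ v + sum (P ++ Q ++ R)
  sum-mid₂ v = cong sum (sym (List.++-assoc P Q _)) ∙ sum-mid (P ++ Q) v R ∙ cong (λ l → v + sum l) (List.++-assoc P Q R)
  swap₃ : ∀ a b c → a + (b + c) ≡ b + (a + c)
  swap₃ = solve-∀

split-max : ∀ {y} B → Any (_< y) B → ∃ λ N → ∃₂ λ x C → B ≡ N ++ x ∷ C × x < y × All (λ b → b ≤ x ⊎ y ≤ b) N × All (λ b → b ≤ x ⊎ y ≤ b) C
split-max {y} (b ∷ B) any with Any.any? (_<? y) B
... | no ¬any with any
...   | there p = contradiction p ¬any
...   | here b<y = [] , b , B , refl , b<y , [] , All.map (inj₂ ∘ ℕ.≮⇒≥) (All.¬Any⇒All¬ B ¬any)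
split-max {y} (b ∷ B) any | yes p with split-max B p
... | N , x , C , refl , x<y , pN , pC with b ≤? x
...   | yes b≤x = b ∷ N , x , C , refl , x<y , inj₁ b≤x ∷ pN , pC
...   | no  b≰x with b <? y
...     | no  b≮y = b ∷ N , x , C , refl , x<y , inj₂ (ℕ.≮⇒≥ b≮y) ∷ pN , pC
...     | yes b<y = [] , b , N ++ x ∷ C , refl , b<y , [] , All.map weaken (All.++⁺ pN (inj₁ ℕ.≤-refl ∷ pC))
  where
  weaken : ∀ {v} → v ≤ x ⊎ y ≤ v → v ≤ b ⊎ y ≤ v
  weaken (inj₁ v≤x) = inj₁ (ℕ.≤-trans v≤x (ℕ.<⇒≤ (ℕ.≰⇒> b≰x)))
  weaken (inj₂ y≤v) = inj₂ y≤v

split-first : ∀ {x} B → Any (_< x) B → ∃ λ M → ∃₂ λ z A → B ≡ M ++ z ∷ A × z < x × All (x ≤_) M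
split-first {x} (b ∷ B) any with b <? x
... | yes b<x = [] , b , B , refl , b<x , []
... | no  b≮x with M , z , A , refl , z<x , p ← split-first B (Any.tail b≮x any) = b ∷ M , z , A , refl , z<x , ℕ.≮⇒≥ b≮x ∷ p

-- No 132 pattern has its largest entry in the second list, where as is the reversed prefix.
No132 : List ℕ → List ℕ → Set
No132 as []      = ⊤
No132 as (r ∷ B) = (∀ {z x} → z ∈ as → x ∈ B → z < x → ¬ x < r) × No132 (r ∷ as) B

No132-at : ∀ as N {r B} → No132 as (N ++ r ∷ B) → ∀ {z x} → z ∈ as → x ∈ B → z < x → ¬ x < r
No132-at as []      (p , _) = p
No132-at as (n ∷ N) (_ , p) z∈ = No132-at (n ∷ as) N p (there z∈)

-- If the code rose from b to a later r, some entry x after r would satisfy b < x < r, and b r x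
-- would be a 132 pattern.
lehmer-decreasing : ∀ as B → Unique (as ʳ++ B) → No132 as B → Decreasing (lehmer B)
lehmer-decreasing as []      u p = []
lehmer-decreasing as (b ∷ B) u (_ , p) = bound B (r∉ u) (here refl) p ℕ.≤-refl ∷ lehmer-decreasing (b ∷ as) B u p
  where
  r∉ : Unique (as ʳ++ b ∷ B) → All (b ≢_) B
  r∉ u with b∉ ∷ _ ← Unique-++ʳ (reverse as) (subst Unique (List.ʳ++-defn as) u) = b∉
  bound : ∀ {as b c} B → All (b ≢_) B → b ∈ as → No132 as B → smaller b B ≤ c → All (_≤ c) (lehmer B)
  bound []      b∉ b∈ p q = []
  bound {b = b} {c} (r ∷ B) (b≢r ∷ b∉) b∈ (p , p′) q =
    ℕ.≤-trans (count-mono (_<ᵇ r) (_<ᵇ b) B below) tail≤ ∷ bound B b∉ (there b∈) p′ tail≤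
    where
    tail≤ : smaller b B ≤ c
    tail≤ = ℕ.≤-trans (subst (smaller b B ≤_) (sym (count-∷ (_<ᵇ b) r B)) (ℕ.m≤n+m (smaller b B) _)) q
    below : ∀ x → x ∈ B → (x <ᵇ r) ≡ true → (x <ᵇ b) ≡ true
    below x x∈ e with ℕ.<-cmp x b
    ... | tri< x<b _ _ = <ᵇ-true {x} {b} x<b
    ... | tri≈ _ x≡b _ = contradiction (sym x≡b) (All.lookup b∉ x∈)
    ... | tri> _ _ b<x = contradiction (<ᵇ-sound {x} {r} e) (p b∈ x∈ b<x)

record Reduction (w : List ℕ) : Set where
  field
    result      : List ℕ
    permutation : w ↭ result
    crossing    : NoCrossing w → NoCrossing result
    words       : ∀ n → heckeWords n w ≡ heckeWords n result
    code        : lehmer w ↭ lehmer result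
    lighter     : weight (lehmer result) < weight (lehmer w)

module _ (as : List ℕ) (y : ℕ) (B : List ℕ) (u : Unique (as ʳ++ y ∷ B)) (nc : NoCrossing (as ʳ++ y ∷ B)) (no132 : No132 (y ∷ as) B) where

  -- The entry y is the last that can be the largest of a 132 pattern, x is the largest entry below
  -- y to its right, and z is the last entry before y that lies below x. These choices yield all
  -- hypotheses of `Move` except `gapA`.
  reduce-at : ∀ {z₀ x₀} → z₀ ∈ as → x₀ ∈ B → z₀ < x₀ → x₀ < y → Reduction (as ʳ++ y ∷ B)
  reduce-at {z₀} {x₀} z₀∈ x₀∈ z₀<x₀ x₀<y with split-max B (Any.map (λ { refl → x₀<y }) x₀∈)
  ... | N , x , C , refl , x<y , pN , pC with split-first {x} as (Any.map (λ { refl → ℕ.<-≤-trans z₀<x₀ x₀≤x }) z₀∈)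
    where
    x₀≤x : x₀ ≤ x
    x₀≤x = [ id , (λ y≤x₀ → contradiction x₀<y (ℕ.≤⇒≯ y≤x₀)) ]′ (All.lookup (All.++⁺ pN (inj₁ ℕ.≤-refl ∷ pC)) x₀∈)
  ... | Mʳ , z , Aʳ , refl , z<x , pM = subst Reduction (sym shape≡) (record
      { result = after ; permutation = before↭after ; crossing = noCrossing-move ; words = heckeWords-move
      ; code = code↭ code-swap ; lighter = lighter′ code-swap })
    where
    A M : List ℕ
    A = reverse Aʳ
    M = reverse Mʳ
    shape≡ : (Mʳ ++ z ∷ Aʳ) ʳ++ y ∷ N ++ x ∷ C ≡ A ++ z ∷ M ++ y ∷ N ++ x ∷ C
    shape≡ = List.++-ʳ++ Mʳ ∙ cong ((z ∷ Aʳ) ʳ++_) (List.ʳ++-defn Mʳ) ∙ List.ʳ++-defn Aʳ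
    unique : Unique (A ++ z ∷ M ++ y ∷ N ++ x ∷ C)
    unique = subst Unique shape≡ u
    crossing : NoCrossing (A ++ z ∷ M ++ y ∷ N ++ x ∷ C)
    crossing = subst NoCrossing shape≡ nc
    ∈split : ∀ {v} P {a} {Q} → v ∈ P ⊎ v ∈ Q → Unique (P ++ a ∷ Q) → v ≢ a
    ∈split P {a} {Q} v∈ u refl with a∉ ∷ _ ← Unique-↭ (Perm.shift a P Q) u =
      All.lookup a∉ ([ Mem.∈-++⁺ˡ , Mem.∈-++⁺ʳ P ]′ v∈) refl
    u₁ : Unique (z ∷ M ++ y ∷ N ++ x ∷ C)
    u₁ = Unique-++ʳ A unique
    u₂ : Unique (y ∷ N ++ x ∷ C)
    u₂ = Unique-++ʳ (z ∷ M) u₁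
    reassoc : A ++ z ∷ M ++ y ∷ N ++ x ∷ C ≡ (A ++ z ∷ M ++ y ∷ N) ++ x ∷ C
    reassoc = cong (λ l → A ++ z ∷ l) (sym (List.++-assoc M (y ∷ N) _)) ∙ sym (List.++-assoc A _ _)
    ≢x : ∀ {v} → v ∈ A ++ z ∷ M ++ y ∷ N ⊎ v ∈ C → v ≢ x
    ≢x v∈ = ∈split (A ++ z ∷ M ++ y ∷ N) v∈ (subst Unique reassoc unique)
    x<M : All (x <_) M
    x<M = All.tabulate λ v∈ → ℕ.≤∧≢⇒< (All.lookup pM (Any.reverse⁻ v∈)) (≢x (inj₁ (Mem.∈-++⁺ʳ A (there (Mem.∈-++⁺ˡ v∈)))) ∘ sym)
    N<x : All (_< x) N
    N<x = All.tabulate λ {v} v∈ → [ (λ v≤x → ℕ.≤∧≢⇒< v≤x (≢x (inj₁ (Mem.∈-++⁺ʳ A (there (Mem.∈-++⁺ʳ M (there v∈)))))))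
                                  , (λ y≤v → ⊥-elim (big v∈ (ℕ.≤∧≢⇒< y≤v (All.lookup (AllPairs.head u₂) (Mem.∈-++⁺ˡ v∈))))) ]′ (All.lookup pN v∈)
      where
      -- An entry v of N above y would be the largest of the 132 pattern z v x, which comes later
      -- than y.
      big : ∀ {v} → v ∈ N → ¬ y < v
      big {v} v∈ y<v with P , Q , e ← Mem.∈-∃++ v∈ =
        No132-at (y ∷ Mʳ ++ z ∷ Aʳ) P
          (subst (No132 (y ∷ Mʳ ++ z ∷ Aʳ)) (cong (_++ x ∷ C) e ∙ List.++-assoc P (v ∷ Q) _) no132)
          (there (Mem.∈-++⁺ʳ Mʳ (here refl))) (Mem.∈-++⁺ʳ Q (here refl)) z<x (ℕ.<-trans x<y y<v)
    gapC : All (λ c → c < x ⊎ y < c) C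
    gapC = All.tabulate λ c∈ → [ (λ c≤x → inj₁ (ℕ.≤∧≢⇒< c≤x (≢x (inj₂ c∈))))
                               , (λ y≤c → inj₂ (ℕ.≤∧≢⇒< y≤c (All.lookup (AllPairs.head u₂) (Mem.∈-++⁺ʳ N (there c∈))))) ]′ (All.lookup pC c∈)
    gapA : All (λ a → a < z ⊎ x < a) A
    gapA = All.tabulate λ {a} a∈ → gap a a∈
      where
      gap : ∀ a → a ∈ A → a < z ⊎ x < a
      gap a a∈ with ℕ.<-cmp a z | ℕ.<-cmp a x
      ... | tri< a<z _ _ | _            = inj₁ a<z
      ... | tri≈ _ a≡z _ | _            = contradiction a≡z (∈split A (inj₁ a∈) unique)
      ... | _            | tri> _ _ x<a = inj₂ x<a
      ... | _            | tri≈ _ a≡x _ = contradiction a≡x (≢x (inj₁ (Mem.∈-++⁺ˡ a∈)))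
      -- The place where the vexillary hypothesis enters: a z y x would be a 2143 pattern.
      ... | tri> _ _ z<a | tri< a<x _ _
        with crossing {a} {y} {z} {x} (z<a , Before-across a∈ (here refl))
               (x<y , Before-++ʳ A (there (Before-++ʳ M (here (Mem.∈-++⁺ʳ N (here refl))))))
      ...   | inj₁ (x<a , _) = contradiction x<a (ℕ.<⇒≯ a<x)
      ...   | inj₂ (_ , yz)  = contradiction yz (Before-asym unique (Before-++ʳ A (here (Mem.∈-++⁺ʳ M (here refl)))))
    open Move A M N C x y z z<x x<y x<M N<x gapA gapC unique
    CodeSwap : Set
    CodeSwap = ∃ λ P → ∃ λ Q → ∃ λ R → ∃₂ λ p q → p < q × lehmer before ≡ P ++ p ∷ Q ++ q ∷ R × lehmer after ≡ P ++ q ∷ Q ++ p ∷ R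
    code↭ : CodeSwap → lehmer before ↭ lehmer after
    code↭ (P , Q , R , p , q , _ , e , e′) = ↭-trans (↭-reflexive e) (↭-trans (Perm.++⁺ˡ P
      (↭-trans (prep p (Perm.shift q Q R)) (↭-trans (↭-swap p q refl) (prep q (↭-sym (Perm.shift p Q R)))))) (↭-reflexive (sym e′)))
    lighter′ : CodeSwap → weight (lehmer after) < weight (lehmer before)
    lighter′ (P , Q , R , p , q , p<q , e , e′) rewrite e | e′ = weight-swap P Q R p<q

-- The tail is searched first, so that the pattern found has its largest entry as far right as
-- possible.
find-reduction : ∀ as B → Unique (as ʳ++ B) → NoCrossing (as ʳ++ B) → Reduction (as ʳ++ B) ⊎ No132 as B
find-reduction as []      u nc = inj₂ tt
find-reduction as (y ∷ B) u nc with find-reduction (y ∷ as) B u nc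
... | inj₁ r = inj₁ r
... | inj₂ p with Any.any? (λ x → Any.any? (λ z → z <? x) as) (filterᵇ (_<ᵇ y) B)
...   | no ¬q = inj₂ ((λ {z} {x} z∈ x∈ z<x x<y → ¬q (lose (Mem.∈-filter⁺ _ x∈ (ℕ.<⇒<ᵇ x<y)) (lose z∈ z<x))) , p)
...   | yes q with x , x∈ , q′ ← find q with z , z∈ , z<x ← find q′ with x∈B , x<ᵇy ← Mem.∈-filter⁻ _ {xs = B} x∈ =
  inj₁ (reduce-at as y B u nc p z∈ x∈B z<x (ℕ.<ᵇ⇒< x y x<ᵇy))

record DominantForm (w : List ℕ) : Set where
  field
    result      : List ℕ
    permutation : w ↭ result
    words       : ∀ n → heckeWords n w ≡ heckeWords n result
    code        : lehmer w ↭ lehmer result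
    dominant    : Decreasing (lehmer result)

dominantForm : ∀ w → Unique w → NoCrossing w → DominantForm w
dominantForm w u nc = go (suc (weight (lehmer w))) w ℕ.≤-refl u nc
  where
  go : ∀ k w → weight (lehmer w) < k → Unique w → NoCrossing w → DominantForm w
  go (suc k) w (s≤s le) u nc with find-reduction [] w u nc
  ... | inj₂ p = record { result = w ; permutation = refl ; words = λ _ → refl ; code = refl ; dominant = lehmer-decreasing [] w u p }
  ... | inj₁ r = record { result = D.result ; permutation = ↭-trans R.permutation D.permutation
      ; words = λ n → R.words n ∙ D.words n ; code = ↭-trans R.code D.code ; dominant = D.dominant }
    where
    module R = Reduction r
    module D = DominantForm (go k R.result (ℕ.<-≤-trans R.lighter le) (Unique-↭ R.permutation u) (R.crossing nc))

-- A dominant permutation is determined by its code, so the number of 0-Hecke words of a vexillary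
-- permutation depends only on its shape.
heckeWords-vexillary : ∀ {v w} → Unique v → NoCrossing v → NoCrossing w → v ↭ w → lehmer v ↭ lehmer w → ∀ n → heckeWords n v ≡ heckeWords n w
heckeWords-vexillary {v} {w} u nv nw v↭w c n = V.words n ∙ cong (heckeWords n) same ∙ sym (W.words n)
  where
  module V = DominantForm (dominantForm v u nv)
  module W = DominantForm (dominantForm w (Unique-↭ v↭w u) nw)
  same : V.result ≡ W.result
  same = lehmer-injective (↭-trans (↭-sym V.permutation) (↭-trans v↭w W.permutation))
    (Decreasing-↭-≡ V.dominant W.dominant (↭-trans (↭-sym V.code) (↭-trans c W.code)))

-- Sums and isomorphisms of posets

∑ : List X → (X → ℕ) → ℕ
∑ xs f = sum (map f xs)

∑-cong : ∀ (xs : List X) {f g : X → ℕ} → (∀ x → x ∈ xs → f x ≡ g x) → ∑ xs f ≡ ∑ xs g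
∑-cong []       e = refl
∑-cong (x ∷ xs) e = cong₂ _+_ (e x (here refl)) (∑-cong xs (λ y y∈ → e y (there y∈)))

∑-map : (f : X → Y) (xs : List X) (g : Y → ℕ) → ∑ (map f xs) g ≡ ∑ xs (g ∘ f)
∑-map f xs g = cong sum (sym (List.map-∘ xs))

∑-↭ : {xs ys : List X} (f : X → ℕ) → xs ↭ ys → ∑ xs f ≡ ∑ ys f
∑-↭ f p = sum-↭ (Perm.map⁺ f p)

∑-++ : (xs ys : List X) (f : X → ℕ) → ∑ (xs ++ ys) f ≡ ∑ xs f + ∑ ys f
∑-++ xs ys f = cong sum (List.map-++ f xs ys) ∙ sum-++ (map f xs) (map f ys)

∑-+ : (xs : List X) (f g : X → ℕ) → ∑ xs (λ x → f x + g x) ≡ ∑ xs f + ∑ xs g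
∑-+ []       f g = refl
∑-+ (x ∷ xs) f g = cong (f x + g x +_) (∑-+ xs f g) ∙ +-interchange (f x) (g x) (∑ xs f) (∑ xs g)

∑-0 : (xs : List X) → ∑ xs (λ _ → 0) ≡ 0
∑-0 []       = refl
∑-0 (x ∷ xs) = ∑-0 xs

∑-zero : (xs : List X) {f : X → ℕ} → (∀ x → x ∈ xs → f x ≡ 0) → ∑ xs f ≡ 0
∑-zero xs e = ∑-cong xs e ∙ ∑-0 xs

∑-* : (c : ℕ) (xs : List X) (f : X → ℕ) → ∑ xs (λ x → c * f x) ≡ c * ∑ xs f
∑-* c []       f = sym (ℕ.*-zeroʳ c)
∑-* c (x ∷ xs) f = cong (c * f x +_) (∑-* c xs f) ∙ sym (ℕ.*-distribˡ-+ c (f x) (∑ xs f))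

∑-swap : (xs : List X) (ys : List Y) (f : X → Y → ℕ) → ∑ xs (λ x → ∑ ys (f x)) ≡ ∑ ys (λ y → ∑ xs (λ x → f x y))
∑-swap []       ys f = sym (∑-0 ys)
∑-swap (x ∷ xs) ys f = cong (∑ ys (f x) +_) (∑-swap xs ys f) ∙ sym (∑-+ ys (f x) (λ y → ∑ xs (λ x → f x y)))

count-∑ : (p : X → Bool) (xs : List X) → count p xs ≡ ∑ xs (λ x → ⟦ p x ⟧)
count-∑ p []       = refl
count-∑ p (x ∷ xs) = count-∷ p x xs ∙ cong (⟦ p x ⟧ +_) (count-∑ p xs)

∑-filterᵇ : (p : X → Bool) (xs : List X) (f : X → ℕ) → ∑ (filterᵇ p xs) f ≡ ∑ xs (λ x → ⟦ p x ⟧ * f x)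
∑-filterᵇ p []       f = refl
∑-filterᵇ p (x ∷ xs) f with p x
... | true  = cong₂ _+_ (sym (ℕ.+-identityʳ (f x))) (∑-filterᵇ p xs f)
... | false = ∑-filterᵇ p xs f

∑-unique : ∀ {xs : List X} {a} → Unique xs → a ∈ xs → {f : X → ℕ} → (∀ x → x ∈ xs → x ≢ a → f x ≡ 0) → ∑ xs f ≡ f a
∑-unique {xs = x ∷ xs} (x∉ ∷ u) (here refl) {f} e =
  cong (f x +_) (∑-zero xs (λ y y∈ → e y (there y∈) (All.lookup x∉ y∈ ∘ sym))) ∙ ℕ.+-identityʳ (f x)
∑-unique {xs = x ∷ xs} (x∉ ∷ u) (there a∈) {f} e =
  cong (_+ ∑ xs f) (e x (here refl) (All.lookup x∉ a∈)) ∙ ∑-unique u a∈ (λ y y∈ → e y (there y∈))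

unique-↭ : {xs ys : List X} → Unique xs → Unique ys → (∀ {x} → x ∈ xs → x ∈ ys) → (∀ {x} → x ∈ ys → x ∈ xs) → xs ↭ ys
unique-↭ u v f g = ∼bag⇒↭ (unique∧set⇒bag u v (mk⇔ f g))

Bool-ext : ∀ {a b} → (a ≡ true → b ≡ true) → (b ≡ true → a ≡ true) → a ≡ b
Bool-ext {true}  {b}     f g = sym (f refl)
Bool-ext {false} {false} f g = refl
Bool-ext {false} {true}  f g = g refl

∧-true⁻ : ∀ {a b} → a ∧ b ≡ true → a ≡ true × b ≡ true
∧-true⁻ {true} {true} e = refl , refl

∧-true⁺ : ∀ {a b} → a ≡ true → b ≡ true → a ∧ b ≡ true
∧-true⁺ refl refl = refl

not-true⁺ : ∀ {a} → ¬ a ≡ true → not a ≡ true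
not-true⁺ {true}  n = contradiction refl n
not-true⁺ {false} n = refl

not-true⁻ : ∀ {a} → not a ≡ true → ¬ a ≡ true
not-true⁻ {false} e ()

∨-true⁻ : ∀ {a b} → a ∨ b ≡ true → a ≡ true ⊎ b ≡ true
∨-true⁻ {true}  e = inj₁ refl
∨-true⁻ {false} e = inj₂ e

∨-true⁺ : ∀ {a b} → a ≡ true ⊎ b ≡ true → a ∨ b ≡ true
∨-true⁺ (inj₁ refl) = refl
∨-true⁺ {a} (inj₂ refl) = Bool.∨-zeroʳ a

any-true⁺ : (p : X → Bool) {x : X} {xs : List X} → x ∈ xs → p x ≡ true → any p xs ≡ true
any-true⁺ p (here refl) e = ∨-true⁺ (inj₁ e)
any-true⁺ p (there x∈)  e = ∨-true⁺ (inj₂ (any-true⁺ p x∈ e))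

any-true⁻ : (p : X → Bool) (xs : List X) → any p xs ≡ true → ∃ λ x → x ∈ xs × p x ≡ true
any-true⁻ p (x ∷ xs) e with ∨-true⁻ {p x} e
... | inj₁ px = x , here refl , px
... | inj₂ e′ with y , y∈ , py ← any-true⁻ p xs e′ = y , there y∈ , py

all-true⁺ : (p : X → Bool) (xs : List X) → (∀ x → x ∈ xs → p x ≡ true) → all p xs ≡ true
all-true⁺ p []       e = refl
all-true⁺ p (x ∷ xs) e = ∧-true⁺ (e x (here refl)) (all-true⁺ p xs (λ y y∈ → e y (there y∈)))

all-true⁻ : (p : X → Bool) {xs : List X} → all p xs ≡ true → ∀ {x} → x ∈ xs → p x ≡ true
all-true⁻ p e (here refl) = proj₁ (∧-true⁻ e)
all-true⁻ p e (there x∈)  = all-true⁻ p (proj₂ (∧-true⁻ {p _} e)) x∈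

any-cong : (xs : List X) {p q : X → Bool} → (∀ x → p x ≡ q x) → any p xs ≡ any q xs
any-cong []       e = refl
any-cong (x ∷ xs) e = cong₂ _∨_ (e x) (any-cong xs e)

all-cong : (xs : List X) {p q : X → Bool} → (∀ x → p x ≡ q x) → all p xs ≡ all q xs
all-cong []       e = refl
all-cong (x ∷ xs) e = cong₂ _∧_ (e x) (all-cong xs e)

module _ {to : X → Y} {xs : List X} {ys : List Y} (map↭ : map to xs ↭ ys) where

  private
    image : ∀ {y} → y ∈ ys → ∃ λ x → x ∈ xs × y ≡ to x
    image y∈ = Mem.∈-map⁻ to (Perm.∈-resp-↭ (↭-sym map↭) y∈)
    ∈image : ∀ {x} → x ∈ xs → to x ∈ ys
    ∈image x∈ = Perm.∈-resp-↭ map↭ (Mem.∈-map⁺ to x∈)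

  any-image : {f : X → Bool} {g : Y → Bool} → (∀ x → x ∈ xs → f x ≡ g (to x)) → any f xs ≡ any g ys
  any-image {f} {g} e = Bool-ext
    (λ t → let x , x∈ , fx = any-true⁻ f xs t in any-true⁺ g (∈image x∈) (sym (e x x∈) ∙ fx))
    (λ t → let y , y∈ , gy = any-true⁻ g ys t ; x , x∈ , y≡ = image y∈ in any-true⁺ f x∈ (e x x∈ ∙ cong g (sym y≡) ∙ gy))

  all-image : {f : X → Bool} {g : Y → Bool} → (∀ x → x ∈ xs → f x ≡ g (to x)) → all f xs ≡ all g ys
  all-image {f} {g} e = Bool-ext
    (λ t → all-true⁺ g ys λ y y∈ → let x , x∈ , y≡ = image y∈ in cong g y≡ ∙ sym (e x x∈) ∙ all-true⁻ f t x∈)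
    (λ t → all-true⁺ f xs λ x x∈ → e x x∈ ∙ all-true⁻ g t (∈image x∈))

  ∑-image : {f : X → ℕ} {g : Y → ℕ} → (∀ x → x ∈ xs → f x ≡ g (to x)) → ∑ xs f ≡ ∑ ys g
  ∑-image {f} {g} e = ∑-cong xs e ∙ sym (∑-map to xs g) ∙ ∑-↭ g map↭

open FinPoset

∑-subsets-map : (P Q : FinPoset) (to : Carrier P → Carrier Q) (xs : List (Carrier P)) (f : List (Carrier Q) → ℕ) →
  ∑ (subsets Q (map to xs)) f ≡ ∑ (subsets P xs) (f ∘ map to)
∑-subsets-map P Q to []       f = refl
∑-subsets-map P Q to (x ∷ xs) f =
  ∑-++ (map (to x ∷_) (subsets Q (map to xs))) _ f
  ∙ cong₂ _+_ (∑-map (to x ∷_) (subsets Q (map to xs)) f ∙ ∑-subsets-map P Q to xs (λ S → f (to x ∷ S)) ∙ sym (∑-map (x ∷_) (subsets P xs) (f ∘ map to))) (∑-subsets-map P Q to xs f)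
  ∙ sym (∑-++ (map (x ∷_) (subsets P xs)) _ (f ∘ map to))

∑-subsets-∷ : (P : FinPoset) (x : Carrier P) (xs : List (Carrier P)) (f : List (Carrier P) → ℕ) →
  ∑ (subsets P (x ∷ xs)) f ≡ ∑ (subsets P xs) (λ S → f (x ∷ S)) + ∑ (subsets P xs) f
∑-subsets-∷ P x xs f = ∑-++ (map (x ∷_) (subsets P xs)) (subsets P xs) f ∙ cong (_+ ∑ (subsets P xs) f) (∑-map (x ∷_) (subsets P xs) f)

-- `subsets` produces sublists in the order of the given list, so the summand has to ignore the
-- order of its argument.
∑-subsets-↭ : (P : FinPoset) {xs ys : List (Carrier P)} (f : List (Carrier P) → ℕ) →
  (∀ {S T} → S ↭ T → f S ≡ f T) → xs ↭ ys → ∑ (subsets P xs) f ≡ ∑ (subsets P ys) f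
∑-subsets-↭ P f inv refl = refl
∑-subsets-↭ P {x ∷ xs} {_ ∷ ys} f inv (prep x p) = ∑-subsets-∷ P x xs f
  ∙ cong₂ _+_ (∑-subsets-↭ P (λ S → f (x ∷ S)) (λ q → inv (prep x q)) p) (∑-subsets-↭ P f inv p) ∙ sym (∑-subsets-∷ P x ys f)
∑-subsets-↭ P {x ∷ y ∷ xs} {_ ∷ _ ∷ ys} f inv (swap x y p) =
  expand x y xs ∙ cong₂ _+_ (cong₂ _+_ (∑-cong (subsets P xs) (λ S _ → inv (swap x y refl)) ∙ ∑-subsets-↭ P (λ S → f (y ∷ x ∷ S)) (λ q → inv (prep y (prep x q))) p)
      (∑-subsets-↭ P (λ S → f (x ∷ S)) (λ q → inv (prep x q)) p)) (cong₂ _+_ (∑-subsets-↭ P (λ S → f (y ∷ S)) (λ q → inv (prep y q)) p) (∑-subsets-↭ P f inv p))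
  ∙ +-interchange (∑ (subsets P ys) (λ S → f (y ∷ x ∷ S))) _ _ _ ∙ sym (expand y x ys)
  where
  expand : ∀ x y xs → ∑ (subsets P (x ∷ y ∷ xs)) f
    ≡ (∑ (subsets P xs) (λ S → f (x ∷ y ∷ S)) + ∑ (subsets P xs) (λ S → f (x ∷ S))) + (∑ (subsets P xs) (λ S → f (y ∷ S)) + ∑ (subsets P xs) f)
  expand x y xs = ∑-subsets-∷ P x (y ∷ xs) f ∙ cong₂ _+_ (∑-subsets-∷ P y xs (λ S → f (x ∷ S))) (∑-subsets-∷ P y xs f)
∑-subsets-↭ P f inv (trans p q) = ∑-subsets-↭ P f inv p ∙ ∑-subsets-↭ P f inv q

subsets-All : (P : FinPoset) {xs S : List (Carrier P)} → S ∈ subsets P xs → All (_∈ xs) S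
subsets-All P {[]} (here refl) = []
subsets-All P {x ∷ xs} S∈ with Mem.∈-++⁻ (map (x ∷_) (subsets P xs)) S∈
... | inj₂ S∈′ = All.map there (subsets-All P S∈′)
... | inj₁ S∈′ with T , T∈ , refl ← Mem.∈-map⁻ (x ∷_) S∈′ = here refl ∷ All.map there (subsets-All P T∈)

through-∑ : (P : FinPoset) (p : Carrier P) → numMaxChainsThrough P p ≡ ∑ (subsets P (elems P)) (λ S → ⟦ isMaxChain P S ⟧ * ⟦ memb P p S ⟧)
through-∑ P p = count-∑ (memb P p) (maxChains P) ∙ ∑-filterᵇ (isMaxChain P) (subsets P (elems P)) (λ S → ⟦ memb P p S ⟧)

-- The orders are compared on `elems` only, since the carriers also contain lists outside the
-- intervals.
record _≅_ (P Q : FinPoset) : Set where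
  field
    to     : Carrier P → Carrier Q
    elems↭ : map to (elems P) ↭ elems Q
    leq≡   : ∀ {x y} → x ∈ elems P → y ∈ elems P → leq P x y ≡ leq Q (to x) (to y)

≅-dual : ∀ {P Q} → P ≅ Q → dual P ≅ dual Q
≅-dual i = record { to = to ; elems↭ = elems↭ ; leq≡ = λ x∈ y∈ → leq≡ y∈ x∈ }
  where open _≅_ i

module Isomorphism {P Q : FinPoset} (i : P ≅ Q) where
  open _≅_ i

  lt-≅ : ∀ {x y} → x ∈ elems P → y ∈ elems P → lt P x y ≡ lt Q (to x) (to y)
  lt-≅ x∈ y∈ = cong₂ (λ a b → a ∧ not b) (leq≡ x∈ y∈) (leq≡ y∈ x∈)

  covers-≅ : ∀ {x y} → x ∈ elems P → y ∈ elems P → covers P x y ≡ covers Q (to x) (to y)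
  covers-≅ x∈ y∈ = cong₂ (λ a b → a ∧ not b) (lt-≅ x∈ y∈) (any-image elems↭ (λ r r∈ → cong₂ _∧_ (lt-≅ x∈ r∈) (lt-≅ r∈ y∈)))

  downDeg-≅ : ∀ x → x ∈ elems P → downDeg P x ≡ downDeg Q (to x)
  downDeg-≅ x x∈ = count-∑ _ (elems P) ∙ ∑-image elems↭ (λ q q∈ → cong ⟦_⟧ (covers-≅ q∈ x∈)) ∙ sym (count-∑ _ (elems Q))

  memb-≅ : ∀ {x S} → x ∈ elems P → All (_∈ elems P) S → memb P x S ≡ memb Q (to x) (map to S)
  memb-≅ x∈ S⊆ = any-image refl (λ y y∈ → cong₂ _∧_ (leq≡ x∈ (All.lookup S⊆ y∈)) (leq≡ (All.lookup S⊆ y∈) x∈))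

  isMaxChain-≅ : ∀ {S} → All (_∈ elems P) S → isMaxChain P S ≡ isMaxChain Q (map to S)
  isMaxChain-≅ S⊆ = cong₂ _∧_
    (all-image refl (λ x x∈ → all-image refl (λ y y∈ → comparable≡ (All.lookup S⊆ x∈) (All.lookup S⊆ y∈))))
    (all-image elems↭ (λ x x∈ → cong₂ (λ a b → not a ∨ b) (all-image refl (λ y y∈ → comparable≡ x∈ (All.lookup S⊆ y∈))) (memb-≅ x∈ S⊆)))
    where
    comparable≡ : ∀ {x y} → x ∈ elems P → y ∈ elems P → comparable P x y ≡ comparable Q (to x) (to y)
    comparable≡ x∈ y∈ = cong₂ _∨_ (leq≡ x∈ y∈) (leq≡ y∈ x∈)

  through-≅ : ∀ x → x ∈ elems P → numMaxChainsThrough P x ≡ numMaxChainsThrough Q (to x)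
  through-≅ x x∈ = through-∑ P x
    ∙ ∑-cong (subsets P (elems P)) (λ S S∈ → cong₂ (λ a b → ⟦ a ⟧ * ⟦ b ⟧) (isMaxChain-≅ (subsets-All P S∈)) (memb-≅ x∈ (subsets-All P S∈)))
    ∙ sym (∑-subsets-map P Q to (elems P) φ) ∙ ∑-subsets-↭ Q φ φ-↭ elems↭ ∙ sym (through-∑ Q (to x))
    where
    φ : List (Carrier Q) → ℕ
    φ S = ⟦ isMaxChain Q S ⟧ * ⟦ memb Q (to x) S ⟧
    id↭ : ∀ {S T : List (Carrier Q)} → S ↭ T → map id S ↭ T
    id↭ {S} p = ↭-trans (↭-reflexive (List.map-id S)) p
    φ-↭ : ∀ {S T} → S ↭ T → φ S ≡ φ T
    φ-↭ {S} {T} p = cong₂ (λ a b → ⟦ a ⟧ * ⟦ b ⟧)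
      (cong₂ _∧_ (all-image (id↭ p) (λ y _ → all-image (id↭ p) (λ _ _ → refl)))
        (all-image (id↭ (↭-refl {x = elems Q})) (λ y _ → cong₂ (λ a b → not a ∨ b) (all-image (id↭ p) (λ _ _ → refl)) (any-image (id↭ p) (λ _ _ → refl)))))
      (any-image (id↭ p) (λ _ _ → refl))

  EX-≅ : EX P ≡ EX Q
  EX-≅ = cong₂ frac (∑-image elems↭ downDeg-≅) (sym (List.length-map to (elems P)) ∙ Perm.↭-length elems↭)

  EY-≅ : EY P ≡ EY Q
  EY-≅ = cong₂ frac (∑-image elems↭ (λ p p∈ → cong₂ _*_ (downDeg-≅ p p∈) (through-≅ p p∈))) (∑-image elems↭ through-≅)

covers-dual : ∀ P p q → covers (dual P) q p ≡ covers P p q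
covers-dual P p q = cong (λ b → lt P p q ∧ not b) (any-cong (elems P) (λ r → Bool.∧-comm (lt P r q) (lt P p r)))

-- Both sums count all cover relations, grouped by their upper or by their lower ends.
EX-dual : ∀ P → EX (dual P) ≡ EX P
EX-dual P = cong (λ m → frac m (length (elems P)))
  (∑-cong (elems P) (λ p _ → count-∑ _ (elems P)) ∙ ∑-cong (elems P) (λ p _ → ∑-cong (elems P) (λ q _ → cong ⟦_⟧ (covers-dual P p q)))
  ∙ ∑-swap (elems P) (elems P) (λ p q → ⟦ covers P p q ⟧) ∙ sym (∑-cong (elems P) (λ p _ → count-∑ _ (elems P))))

through-dual : ∀ P p → numMaxChainsThrough (dual P) p ≡ numMaxChainsThrough P p
through-dual P p = through-∑ (dual P) p
  ∙ ∑-subsets-id (elems P) ∙ ∑-cong (subsets P (elems P)) (λ S _ → cong₂ (λ a b → ⟦ a ⟧ * ⟦ b ⟧) (isMaxChain-dual S) (memb-dual p S)) ∙ sym (through-∑ P p)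
  where
  φ : List (Carrier P) → ℕ
  φ S = ⟦ isMaxChain (dual P) S ⟧ * ⟦ memb (dual P) p S ⟧
  ∑-subsets-id : ∀ xs → ∑ (subsets (dual P) xs) φ ≡ ∑ (subsets P xs) φ
  ∑-subsets-id xs = cong (λ l → ∑ (subsets (dual P) l) φ) (sym (List.map-id xs)) ∙ ∑-subsets-map P (dual P) id xs φ ∙ ∑-cong (subsets P xs) (λ S _ → cong φ (List.map-id S))
  memb-dual : ∀ p S → memb (dual P) p S ≡ memb P p S
  memb-dual p S = any-cong S (λ y → Bool.∧-comm (leq P y p) (leq P p y))
  isMaxChain-dual : ∀ S → isMaxChain (dual P) S ≡ isMaxChain P S
  isMaxChain-dual S = cong₂ _∧_ (all-cong S (λ x → all-cong S (λ y → Bool.∨-comm (leq P y x) (leq P x y))))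
    (all-cong (elems P) (λ x → cong₂ (λ a b → not a ∨ b) (all-cong S (λ y → Bool.∨-comm (leq P y x) (leq P x y))) (memb-dual x S)))

-- Sums over the maximal chains of a ranked poset

insertBy : (ρ : X → ℕ) (x : X) (ys : List X) → AllPairs (λ x y → ρ y ≤ ρ x) ys → ∃ λ zs → x ∷ ys ↭ zs × AllPairs (λ x y → ρ y ≤ ρ x) zs
insertBy ρ x []       []       = [ x ] , refl , [] ∷ []
insertBy ρ x (y ∷ ys) (b ∷ s) with ρ y ≤? ρ x
... | yes y≤x = x ∷ y ∷ ys , refl , (y≤x ∷ All.map (λ v → ℕ.≤-trans v y≤x) b) ∷ b ∷ s
... | no  y≰x with zs , p , t ← insertBy ρ x ys s =
  y ∷ zs , ↭-trans (↭-swap x y refl) (prep y p) , Perm.All-resp-↭ p (ℕ.<⇒≤ (ℕ.≰⇒> y≰x) ∷ b) ∷ t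

sortedBy : (ρ : X → ℕ) (xs : List X) → ∃ λ ys → xs ↭ ys × AllPairs (λ x y → ρ y ≤ ρ x) ys
sortedBy ρ []       = [] , refl , []
sortedBy ρ (x ∷ xs) with ys , p , s ← sortedBy ρ xs with zs , q , t ← insertBy ρ x ys s = zs , ↭-trans (prep x p) q , t

record IsPartialOrder (P : FinPoset) : Set where
  field
    unique  : Unique (elems P)
    ≤-refl  : ∀ {x} → x ∈ elems P → leq P x x ≡ true
    ≤-anti  : ∀ {x y} → x ∈ elems P → y ∈ elems P → leq P x y ≡ true → leq P y x ≡ true → x ≡ y
    ≤-trans : ∀ {x y z} → x ∈ elems P → y ∈ elems P → z ∈ elems P → leq P x y ≡ true → leq P y z ≡ true → leq P x z ≡ true

-- Summation over the maximal chains of a bounded ranked poset whose elements are listed by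
-- decreasing rank: a maximal chain is then a sublist that starts at the top, ends at the bottom
-- and descends by covers.
module SortedChains (P : FinPoset) (po : IsPartialOrder P)
  (ρ : Carrier P → ℕ) (ρ-mono : ∀ {x y} → x ∈ elems P → y ∈ elems P → lt P x y ≡ true → ρ x < ρ y)
  (⊤ₚ ⊥ₚ : Carrier P) (⊤∈ : ⊤ₚ ∈ elems P) (⊥∈ : ⊥ₚ ∈ elems P)
  (≤⊤ : ∀ {x} → x ∈ elems P → leq P x ⊤ₚ ≡ true) (⊥≤ : ∀ {x} → x ∈ elems P → leq P ⊥ₚ x ≡ true)
  (sorted : AllPairs (λ x y → ρ y ≤ ρ x) (elems P)) where

  open IsPartialOrder po

  private
    E : List (Carrier P)
    E = elems P

  saturated : Carrier P → List (Carrier P) → Bool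
  saturated p []      = leq P p ⊥ₚ
  saturated p (q ∷ S) = covers P q p ∧ saturated q S

  saturatedFromTop : List (Carrier P) → Bool
  saturatedFromTop []      = false
  saturatedFromTop (p ∷ S) = leq P ⊤ₚ p ∧ saturated p S

  private
    lt⁺ : ∀ {x y} → leq P x y ≡ true → ¬ leq P y x ≡ true → lt P x y ≡ true
    lt⁺ l n = ∧-true⁺ l (not-true⁺ n)
    lt⁻ : ∀ {x y} → lt P x y ≡ true → leq P x y ≡ true × ¬ leq P y x ≡ true
    lt⁻ e with l , n ← ∧-true⁻ e = l , not-true⁻ n
    covers⁻ : ∀ {q p} → covers P q p ≡ true → lt P q p ≡ true × (∀ {r} → r ∈ E → lt P q r ≡ true → ¬ lt P r p ≡ true)
    covers⁻ e with l , n ← ∧-true⁻ e = l , λ r∈ a b → not-true⁻ n (any-true⁺ _ r∈ (∧-true⁺ a b))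
    covers⁺ : ∀ {q p} → lt P q p ≡ true → (∀ {r} → r ∈ E → lt P q r ≡ true → ¬ lt P r p ≡ true) → covers P q p ≡ true
    covers⁺ l n = ∧-true⁺ l (not-true⁺ λ t → let r , r∈ , e = any-true⁻ _ E t ; a , b = ∧-true⁻ e in n r∈ a b)
    lt-irrefl : ∀ {x} → ¬ lt P x x ≡ true
    lt-irrefl e = proj₂ (lt⁻ e) (proj₁ (lt⁻ e))
    lt-trans : ∀ {x y z} → x ∈ E → y ∈ E → z ∈ E → lt P x y ≡ true → lt P y z ≡ true → lt P x z ≡ true
    lt-trans x∈ y∈ z∈ a b = lt⁺ (≤-trans x∈ y∈ z∈ (proj₁ (lt⁻ a)) (proj₁ (lt⁻ b)))
      (λ c → proj₂ (lt⁻ a) (≤-trans y∈ z∈ x∈ (proj₁ (lt⁻ b)) c))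
    lt-asym : ∀ {x y} → lt P x y ≡ true → ¬ lt P y x ≡ true
    lt-asym a b = proj₂ (lt⁻ a) (proj₁ (lt⁻ b))
    comparable⁺ : ∀ {x y} → leq P x y ≡ true ⊎ leq P y x ≡ true → comparable P x y ≡ true
    comparable⁺ = ∨-true⁺
    memb⁺ : ∀ {x S} → x ∈ E → x ∈ S → memb P x S ≡ true
    memb⁺ x∈E x∈S = any-true⁺ _ x∈S (∧-true⁺ (≤-refl x∈E) (≤-refl x∈E))
    memb⁻ : ∀ {x S} → x ∈ E → All (_∈ E) S → memb P x S ≡ true → x ∈ S
    memb⁻ {S = S} x∈ S⊆ t with y , y∈ , e ← any-true⁻ _ S t with a , b ← ∧-true⁻ e
      with refl ← ≤-anti x∈ (All.lookup S⊆ y∈) a b = y∈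

    Chain : List (Carrier P) → Set
    Chain = AllPairs (λ x y → lt P y x ≡ true)

    chain-sound : ∀ {S} → All (_∈ E) S → Chain S → isChain P S ≡ true
    chain-sound {S} S⊆ c = all-true⁺ _ S λ x x∈ → all-true⁺ _ S λ y y∈ → comparable⁺ (comp S⊆ c x∈ y∈)
      where
      comp : ∀ {S x y} → All (_∈ E) S → Chain S → x ∈ S → y ∈ S → leq P x y ≡ true ⊎ leq P y x ≡ true
      comp (p ∷ _)  _       (here refl) (here refl) = inj₁ (≤-refl p)
      comp _        (b ∷ _) (here refl) (there y∈)  = inj₂ (proj₁ (lt⁻ (All.lookup b y∈)))
      comp _        (b ∷ _) (there x∈)  (here refl) = inj₁ (proj₁ (lt⁻ (All.lookup b x∈)))
      comp (_ ∷ ps) (_ ∷ c) (there x∈)  (there y∈)  = comp ps c x∈ y∈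

    chain-complete : ∀ {S} → All (_∈ E) S → Unique S → AllPairs (λ x y → ρ y ≤ ρ x) S → isChain P S ≡ true → Chain S
    chain-complete {S} S⊆ u s c = go S⊆ u s (λ x∈ y∈ → ∨-true⁻ (all-true⁻ _ (all-true⁻ _ c x∈) y∈))
      where
      go : ∀ {S} → All (_∈ E) S → Unique S → AllPairs (λ x y → ρ y ≤ ρ x) S →
        (∀ {x y} → x ∈ S → y ∈ S → leq P x y ≡ true ⊎ leq P y x ≡ true) → Chain S
      go []       []       []      k = []
      go {x ∷ S} (x∈ ∷ S⊆) (x∉ ∷ u) (b ∷ s) k = All.tabulate (λ y∈ → below y∈ (k (here refl) (there y∈))) ∷ go S⊆ u s (λ a b → k (there a) (there b))
        where
        below : ∀ {y} → y ∈ S → leq P x y ≡ true ⊎ leq P y x ≡ true → lt P y x ≡ true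
        below y∈ (inj₂ y≤x) = lt⁺ y≤x (λ x≤y → All.lookup x∉ y∈ (≤-anti x∈ (All.lookup S⊆ y∈) x≤y y≤x))
        below y∈ (inj₁ x≤y) = contradiction (ρ-mono x∈ (All.lookup S⊆ y∈) (lt⁺ x≤y (λ y≤x → All.lookup x∉ y∈ (≤-anti x∈ (All.lookup S⊆ y∈) x≤y y≤x)))) (ℕ.≤⇒≯ (All.lookup b y∈))

    Maximal : List (Carrier P) → Set
    Maximal S = ∀ {x} → x ∈ E → (∀ {y} → y ∈ S → leq P x y ≡ true ⊎ leq P y x ≡ true) → x ∈ S

    -- An element strictly between two neighbours of a maximal chain is comparable with the whole
    -- chain and hence belongs to it, but there is no place for it. In the same way the bottom
    -- element has to be the last one.
    saturated-complete : ∀ {T} U p S → T ≡ U ++ p ∷ S → All (_∈ E) T → Chain T → Maximal T → saturated p S ≡ true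
    saturated-complete U p [] refl T⊆ c m with Mem.∈-++⁻ U (m ⊥∈ (λ y∈ → inj₁ (⊥≤ (All.lookup T⊆ y∈))))
    ... | inj₂ (here refl) = ≤-refl ⊥∈
    ... | inj₁ ⊥∈U = contradiction (⊥≤ (All.lookup T⊆ (Mem.∈-++⁺ʳ U (here refl)))) (proj₂ (lt⁻ (across U ⊥∈U (here refl) c)))
      where
      across : ∀ U {x y V} → x ∈ U → y ∈ V → Chain (U ++ V) → lt P y x ≡ true
      across (u ∷ U) (here refl) y∈ (b ∷ c) = All.lookup b (Mem.∈-++⁺ʳ U y∈)
      across (u ∷ U) (there x∈)  y∈ (b ∷ c) = across U x∈ y∈ c
    saturated-complete {T} U p (q ∷ S) refl T⊆ c m = ∧-true⁺ (covers⁺ (across [ p ] (here refl) (here refl) (suffix U c)) between)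
        (saturated-complete (U ++ p ∷ []) q S (sym (List.++-assoc U (p ∷ []) (q ∷ S))) T⊆ c m)
      where
      across : ∀ U {x y V} → x ∈ U → y ∈ V → Chain (U ++ V) → lt P y x ≡ true
      across (u ∷ U) (here refl) y∈ (b ∷ c) = All.lookup b (Mem.∈-++⁺ʳ U y∈)
      across (u ∷ U) (there x∈)  y∈ (b ∷ c) = across U x∈ y∈ c
      suffix : ∀ U {V} → Chain (U ++ V) → Chain V
      suffix []      c       = c
      suffix (u ∷ U) (_ ∷ c) = suffix U c
      between : ∀ {r} → r ∈ E → lt P q r ≡ true → ¬ lt P r p ≡ true
      between {r} r∈ q<r r<p = position (Mem.∈-++⁻ U r∈T)
        where
        ∈E : ∀ {x} → x ∈ T → x ∈ E
        ∈E = All.lookup T⊆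
        p∈ : p ∈ T
        p∈ = Mem.∈-++⁺ʳ U (here refl)
        q∈ : q ∈ T
        q∈ = Mem.∈-++⁺ʳ U (there (here refl))
        related : ∀ {y} → y ∈ U ⊎ y ∈ p ∷ q ∷ S → leq P r y ≡ true ⊎ leq P y r ≡ true
        related (inj₁ y∈) = inj₁ (proj₁ (lt⁻ (lt-trans r∈ (∈E p∈) (∈E (Mem.∈-++⁺ˡ y∈)) r<p (across U y∈ (here refl) c))))
        related (inj₂ (here refl)) = inj₁ (proj₁ (lt⁻ r<p))
        related (inj₂ (there (here refl))) = inj₂ (proj₁ (lt⁻ q<r))
        related (inj₂ (there (there y∈))) = inj₂ (proj₁ (lt⁻ (lt-trans (∈E (Mem.∈-++⁺ʳ U (there (there y∈)))) (∈E q∈) r∈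
          (across [ q ] (here refl) y∈ (suffix [ p ] (suffix U c))) q<r)))
        r∈T : r ∈ T
        r∈T = m r∈ (λ y∈ → related (Mem.∈-++⁻ U y∈))
        position : r ∈ U ⊎ r ∈ p ∷ q ∷ S → ⊥
        position (inj₁ r∈U) = lt-asym r<p (across U r∈U (here refl) c)
        position (inj₂ (here refl)) = lt-irrefl r<p
        position (inj₂ (there (here refl))) = lt-irrefl q<r
        position (inj₂ (there (there r∈S))) = lt-asym q<r (across [ q ] (here refl) r∈S (suffix [ p ] (suffix U c)))

    saturated-chain : ∀ p S → All (_∈ E) (p ∷ S) → saturated p S ≡ true → Chain (p ∷ S)
    saturated-chain p []      S⊆ e = [] ∷ []
    saturated-chain p (q ∷ S) (p∈ ∷ q∈ ∷ S⊆) e with c , s ← ∧-true⁻ e with b ∷ ch ← saturated-chain q S (q∈ ∷ S⊆) s =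
      (q<p ∷ All.tabulate (λ y∈ → lt-trans (All.lookup S⊆ y∈) q∈ p∈ (All.lookup b y∈) q<p)) ∷ b ∷ ch
      where
      q<p : lt P q p ≡ true
      q<p = proj₁ (covers⁻ c)

    saturated-maximal : ∀ p S → All (_∈ E) (p ∷ S) → saturated p S ≡ true → ∀ {x} → x ∈ E → leq P x p ≡ true →
      (∀ {y} → y ∈ p ∷ S → leq P x y ≡ true ⊎ leq P y x ≡ true) → x ∈ p ∷ S
    saturated-maximal p S S⊆ e {x} x∈ x≤p k with leq P p x in p≤x
    ... | true = here (≤-anti x∈ (All.lookup S⊆ (here refl)) x≤p p≤x)
    saturated-maximal p []      (p∈ ∷ _) e {x} x∈ x≤p k | false = false≢true p≤x (≤-trans p∈ ⊥∈ x∈ e (⊥≤ x∈))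
    saturated-maximal p (q ∷ S) (p∈ ∷ q∈ ∷ S⊆) e {x} x∈ x≤p k | false with c , s ← ∧-true⁻ e with leq P x q in x≤q
    ... | true  = there (saturated-maximal q S (q∈ ∷ S⊆) s x∈ x≤q (λ y∈ → k (there y∈)))
    ... | false with k (there (here refl))
    ...   | inj₁ l = false≢true x≤q l
    ...   | inj₂ q≤x = contradiction (lt⁺ x≤p (λ p≤x′ → false≢true p≤x p≤x′)) (proj₂ (covers⁻ c) x∈ (lt⁺ q≤x (λ l → false≢true x≤q l)))

  -- Maximality quantifies over the whole poset; this replaces it by a condition on neighbours,
  -- which a recursion along the sublist can follow.
  isMaxChain-saturated : ∀ S → All (_∈ E) S → Unique S → AllPairs (λ x y → ρ y ≤ ρ x) S → isMaxChain P S ≡ saturatedFromTop S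
  isMaxChain-saturated S S⊆ u s = Bool-ext (to S S⊆ u s) (from S S⊆)
    where
    to : ∀ S → All (_∈ E) S → Unique S → AllPairs (λ x y → ρ y ≤ ρ x) S → isMaxChain P S ≡ true → saturatedFromTop S ≡ true
    to S S⊆ u s e with isC , isM ← ∧-true⁻ e = start S refl (max ⊤∈ (λ y∈ → inj₂ (≤⊤ (All.lookup S⊆ y∈))))
      where
      c : Chain S
      c = chain-complete S⊆ u s isC
      max : Maximal S
      max {x} x∈ k = [ (λ n → contradiction (all-true⁺ _ S (λ y y∈ → comparable⁺ (k y∈))) (not-true⁻ n)) , memb⁻ x∈ S⊆ ]′ (∨-true⁻ (all-true⁻ _ isM x∈))
      start : ∀ T → S ≡ T → ⊤ₚ ∈ T → saturatedFromTop T ≡ true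
      start (p ∷ T) refl i = ∧-true⁺ (top i) (saturated-complete [] p T refl S⊆ c max)
        where
        top : ⊤ₚ ∈ p ∷ T → leq P ⊤ₚ p ≡ true
        top (here refl) = ≤-refl ⊤∈
        top (there i′)  = proj₁ (lt⁻ (All.lookup (AllPairs.head c) i′))
    from : ∀ S → All (_∈ E) S → saturatedFromTop S ≡ true → isMaxChain P S ≡ true
    from (p ∷ S) S⊆@(p∈ ∷ _) e with t , sat ← ∧-true⁻ e = ∧-true⁺ (chain-sound S⊆ (saturated-chain p S S⊆ sat))
      (all-true⁺ _ E λ x x∈ → maximal x x∈ (all (comparable P x) (p ∷ S)) refl)
      where
      maximal : ∀ x → x ∈ E → ∀ b → all (comparable P x) (p ∷ S) ≡ b → not b ∨ memb P x (p ∷ S) ≡ true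
      maximal x x∈ false _ = refl
      maximal x x∈ true  k = memb⁺ x∈ (saturated-maximal p S S⊆ sat x∈ (≤-trans x∈ ⊤∈ p∈ (≤⊤ x∈) t) (λ y∈ → ∨-true⁻ (all-true⁻ _ k y∈)))

  private
    subsets-AllPairs : ∀ {R : Carrier P → Carrier P → Set} {xs S} → AllPairs R xs → S ∈ subsets P xs → AllPairs R S
    subsets-AllPairs {xs = []}     ps       (here refl) = []
    subsets-AllPairs {xs = x ∷ xs} (b ∷ ps) S∈ with Mem.∈-++⁻ (map (x ∷_) (subsets P xs)) S∈
    ... | inj₂ S∈′ = subsets-AllPairs ps S∈′
    ... | inj₁ S∈′ with T , T∈ , refl ← Mem.∈-map⁻ (x ∷_) S∈′ = All.map (All.lookup b) (subsets-All P T∈) ∷ subsets-AllPairs ps T∈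

    memb-∑ : ∀ {xs S} (f : Carrier P → ℕ) → All (_∈ E) xs → Unique xs → S ∈ subsets P xs → ∑ xs (λ p → f p * ⟦ memb P p S ⟧) ≡ ∑ S f
    memb-∑ {[]}     f xs⊆ u (here refl) = refl
    memb-∑ {x ∷ xs} f (x∈ ∷ xs⊆) (x∉ ∷ u) S∈ with Mem.∈-++⁻ (map (x ∷_) (subsets P xs)) S∈
    ... | inj₂ S∈′ = cong₂ _+_ (cong (λ b → f x * ⟦ b ⟧) (notMember S∈′) ∙ ℕ.*-zeroʳ (f x)) (memb-∑ f xs⊆ u S∈′)
      where
      notMember : ∀ {S} → S ∈ subsets P xs → memb P x S ≡ false
      notMember {S} S∈ with memb P x S in m
      ... | false = refl
      ... | true  = contradiction refl (All.lookup x∉ (All.lookup (subsets-All P S∈) (memb⁻ x∈ (All.map (All.lookup xs⊆) (subsets-All P S∈)) m)))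
    ... | inj₁ S∈′ with T , T∈ , refl ← Mem.∈-map⁻ (x ∷_) S∈′ =
      cong₂ _+_ (cong (λ b → f x * ⟦ b ⟧) (memb⁺ {S = x ∷ T} x∈ (here refl)) ∙ ℕ.*-identityʳ (f x))
        (∑-cong xs (λ p p∈ → cong (λ b → f p * ⟦ b ∨ memb P p T ⟧) (other p p∈)) ∙ memb-∑ f xs⊆ u T∈)
      where
      other : ∀ p → p ∈ xs → leq P p x ∧ leq P x p ≡ false
      other p p∈ with leq P p x ∧ leq P x p in e
      ... | false = refl
      ... | true with a , b ← ∧-true⁻ e = contradiction (≤-anti x∈ (All.lookup xs⊆ p∈) b a) (All.lookup x∉ p∈)

  module _ (f N W : Carrier P → ℕ)
    (N-rec : ∀ {p} → p ∈ E → N p ≡ ⟦ leq P p ⊥ₚ ⟧ + ∑ E (λ q → ⟦ covers P q p ⟧ * N q))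
    (W-rec : ∀ {p} → p ∈ E → W p ≡ f p * N p + ∑ E (λ q → ⟦ covers P q p ⟧ * W q)) where

    private
      chains weighted : Carrier P → List (Carrier P) → ℕ
      chains p xs   = ∑ (subsets P xs) (λ S → ⟦ saturated p S ⟧)
      weighted p xs = ∑ (subsets P xs) (λ S → ⟦ saturated p S ⟧ * ∑ S f)

      ⟦∧⟧ : ∀ a b → ⟦ a ∧ b ⟧ ≡ ⟦ a ⟧ * ⟦ b ⟧
      ⟦∧⟧ true  b = sym (ℕ.+-identityʳ ⟦ b ⟧)
      ⟦∧⟧ false b = refl

      chains-∷ : ∀ p x xs → chains p (x ∷ xs) ≡ ⟦ covers P x p ⟧ * chains x xs + chains p xs
      chains-∷ p x xs = ∑-subsets-∷ P x xs _
        ∙ cong (_+ chains p xs) (∑-cong (subsets P xs) (λ S _ → ⟦∧⟧ (covers P x p) (saturated x S)) ∙ ∑-* ⟦ covers P x p ⟧ (subsets P xs) (λ S → ⟦ saturated x S ⟧))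

      ∑-weighted : ∀ c x xs → ∑ (subsets P xs) (λ S → ⟦ c ∧ saturated x S ⟧ * (f x + ∑ S f)) ≡ ⟦ c ⟧ * (f x * chains x xs + weighted x xs)
      ∑-weighted c x xs = ∑-cong (subsets P xs) (λ S _ → cong (_* (f x + ∑ S f)) (⟦∧⟧ c (saturated x S)) ∙ rearrange ⟦ c ⟧ ⟦ saturated x S ⟧ (f x) (∑ S f))
        ∙ ∑-* ⟦ c ⟧ (subsets P xs) (λ S → f x * ⟦ saturated x S ⟧ + ⟦ saturated x S ⟧ * ∑ S f)
        ∙ cong (⟦ c ⟧ *_) (∑-+ (subsets P xs) (λ S → f x * ⟦ saturated x S ⟧) (λ S → ⟦ saturated x S ⟧ * ∑ S f)
            ∙ cong (_+ weighted x xs) (∑-* (f x) (subsets P xs) (λ S → ⟦ saturated x S ⟧)))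
        where
        rearrange : ∀ a b c d → (a * b) * (c + d) ≡ a * (c * b + b * d)
        rearrange = solve-∀

      -- Lower covers have smaller rank and so come later in the sorted list. A sum over all lower
      -- covers therefore sees only the remaining suffix.
      covers-suffix : ∀ {us x xs} → E ≡ us ++ x ∷ xs → (g : Carrier P → ℕ) → ∑ E (λ q → ⟦ covers P q x ⟧ * g q) ≡ ∑ xs (λ q → ⟦ covers P q x ⟧ * g q)
      covers-suffix {us} {x} {xs} e g = cong (λ l → ∑ l h) e ∙ ∑-++ us (x ∷ xs) h
          ∙ cong₂ _+_ (∑-zero us (λ q q∈ → zero-at (subst (q ∈_) (sym e) (Mem.∈-++⁺ˡ q∈)) (above us q∈ (subst (AllPairs _) e sorted))))
                      (cong (_+ ∑ xs h) (zero-at x∈ ℕ.≤-refl))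
        where
        h : Carrier P → ℕ
        h q = ⟦ covers P q x ⟧ * g q
        x∈ : x ∈ E
        x∈ = subst (x ∈_) (sym e) (Mem.∈-++⁺ʳ us (here refl))
        above : ∀ us {q} → q ∈ us → AllPairs (λ x y → ρ y ≤ ρ x) (us ++ x ∷ xs) → ρ x ≤ ρ q
        above (_ ∷ us) (here refl) (b ∷ _) = All.lookup b (Mem.∈-++⁺ʳ us (here refl))
        above (_ ∷ us) (there q∈)  (_ ∷ s) = above us q∈ s
        zero-at : ∀ {q} → q ∈ E → ρ x ≤ ρ q → h q ≡ 0
        zero-at {q} q∈ x≤q with covers P q x in c
        ... | false = refl
        ... | true  = contradiction (ρ-mono q∈ x∈ (proj₁ (covers⁻ c))) (ℕ.≤⇒≯ x≤q)

      chains-suffix : ∀ us xs → E ≡ us ++ xs → ∀ p → chains p xs ≡ ⟦ leq P p ⊥ₚ ⟧ + ∑ xs (λ q → ⟦ covers P q p ⟧ * N q)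
      weighted-suffix : ∀ us xs → E ≡ us ++ xs → ∀ p → weighted p xs ≡ ∑ xs (λ q → ⟦ covers P q p ⟧ * W q)

      ∈suffix : ∀ {us x xs} → E ≡ us ++ x ∷ xs → x ∈ E
      ∈suffix {us} e = subst (_ ∈_) (sym e) (Mem.∈-++⁺ʳ us (here refl))

      shiftSplit : ∀ us {x xs} → E ≡ us ++ x ∷ xs → E ≡ (us ++ [ x ]) ++ xs
      shiftSplit us {x} {xs} e = e ∙ sym (List.++-assoc us [ x ] xs)

      chains-N : ∀ us x xs → E ≡ us ++ x ∷ xs → chains x xs ≡ N x
      chains-N us x xs e = chains-suffix (us ++ [ x ]) xs (shiftSplit us e) x ∙ cong (⟦ leq P x ⊥ₚ ⟧ +_) (sym (covers-suffix {us} e N)) ∙ sym (N-rec (∈suffix {us} e))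

      weighted-W : ∀ us x xs → E ≡ us ++ x ∷ xs → f x * chains x xs + weighted x xs ≡ W x
      weighted-W us x xs e = cong₂ _+_ (cong (f x *_) (chains-N us x xs e)) (weighted-suffix (us ++ [ x ]) xs (shiftSplit us e) x ∙ sym (covers-suffix {us} e W)) ∙ sym (W-rec (∈suffix {us} e))

      chains-suffix us []       e p = refl
      chains-suffix us (x ∷ xs) e p = chains-∷ p x xs ∙ cong₂ _+_ (cong (⟦ covers P x p ⟧ *_) (chains-N us x xs e)) (chains-suffix (us ++ [ x ]) xs (shiftSplit us e) p)
        ∙ swap₃ (⟦ covers P x p ⟧ * N x) ⟦ leq P p ⊥ₚ ⟧ (∑ xs (λ q → ⟦ covers P q p ⟧ * N q))
        where
        swap₃ : ∀ a b c → a + (b + c) ≡ b + (a + c)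
        swap₃ = solve-∀
      weighted-suffix us []       e p = cong (_+ 0) (ℕ.*-zeroʳ ⟦ leq P p ⊥ₚ ⟧)
      weighted-suffix us (x ∷ xs) e p = ∑-subsets-∷ P x xs _
        ∙ cong₂ _+_ (∑-weighted (covers P x p) x xs ∙ cong (⟦ covers P x p ⟧ *_) (weighted-W us x xs e)) (weighted-suffix (us ++ [ x ]) xs (shiftSplit us e) p)

      total : List (Carrier P) → ℕ
      total xs = ∑ (subsets P xs) (λ S → ⟦ saturatedFromTop S ⟧ * ∑ S f)

      total-suffix : ∀ us xs → E ≡ us ++ xs → total xs ≡ ∑ xs (λ x → ⟦ leq P ⊤ₚ x ⟧ * W x)
      total-suffix us []       e = refl
      total-suffix us (x ∷ xs) e = ∑-subsets-∷ P x xs _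
        ∙ cong₂ _+_ (∑-weighted (leq P ⊤ₚ x) x xs ∙ cong (⟦ leq P ⊤ₚ x ⟧ *_) (weighted-W us x xs e)) (total-suffix (us ++ [ x ]) xs (shiftSplit us e))

    -- After exchanging the summations each maximal chain contributes the sum of `f` over its
    -- elements. `N` and `W` are solutions of the recursions for the number of saturated chains down
    -- from p and for their total weight, so that counts of words can be inserted directly.
    sorted-through-sum : ∑ E (λ p → f p * numMaxChainsThrough P p) ≡ W ⊤ₚ
    sorted-through-sum = ∑-cong E (λ p _ → cong (f p *_) (through-∑ P p) ∙ sym (∑-* (f p) (subsets P E) (λ S → ⟦ isMaxChain P S ⟧ * ⟦ memb P p S ⟧)))
      ∙ ∑-swap E (subsets P E) (λ p S → f p * (⟦ isMaxChain P S ⟧ * ⟦ memb P p S ⟧))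
      ∙ ∑-cong (subsets P E) (λ S S∈ → ∑-cong E (λ p _ → swap₃ (f p) ⟦ isMaxChain P S ⟧ ⟦ memb P p S ⟧) ∙ ∑-* ⟦ isMaxChain P S ⟧ E (λ p → f p * ⟦ memb P p S ⟧)
          ∙ cong₂ (λ b m → ⟦ b ⟧ * m) (isMaxChain-saturated S (subsets-All P S∈) (subsets-AllPairs unique S∈) (subsets-AllPairs sorted S∈)) (memb-∑ f (All.tabulate id) unique S∈))
      ∙ total-suffix [] E refl
      ∙ ∑-unique unique ⊤∈ (λ x x∈ x≢⊤ → not-top x x∈ x≢⊤)
      ∙ cong (λ b → ⟦ b ⟧ * W ⊤ₚ) (≤-refl ⊤∈) ∙ ℕ.+-identityʳ (W ⊤ₚ)
      where
      swap₃ : ∀ a b c → a * (b * c) ≡ b * (a * c)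
      swap₃ = solve-∀
      not-top : ∀ x → x ∈ E → x ≢ ⊤ₚ → ⟦ leq P ⊤ₚ x ⟧ * W x ≡ 0
      not-top x x∈ x≢⊤ with leq P ⊤ₚ x in t
      ... | false = refl
      ... | true  = contradiction (≤-anti x∈ ⊤∈ (≤⊤ x∈) t) x≢⊤

reorder : (P : FinPoset) → List (Carrier P) → FinPoset
reorder P xs = record { Carrier = Carrier P ; elems = xs ; leq = leq P }

reorder-≅ : (P : FinPoset) {xs : List (Carrier P)} → elems P ↭ xs → P ≅ reorder P xs
reorder-≅ P p = record { to = id ; elems↭ = ↭-trans (↭-reflexive (List.map-id (elems P))) p ; leq≡ = λ _ _ → refl }

-- Neither side depends on the order in which the elements are listed, so they may be sorted by
-- rank.
through-sum : (P : FinPoset) → IsPartialOrder P →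
  (ρ : Carrier P → ℕ) → (∀ {x y} → x ∈ elems P → y ∈ elems P → lt P x y ≡ true → ρ x < ρ y) →
  (t b : Carrier P) → t ∈ elems P → b ∈ elems P →
  (∀ {x} → x ∈ elems P → leq P x t ≡ true) → (∀ {x} → x ∈ elems P → leq P b x ≡ true) →
  (f N W : Carrier P → ℕ) →
  (∀ {p} → p ∈ elems P → N p ≡ ⟦ leq P p b ⟧ + ∑ (elems P) (λ q → ⟦ covers P q p ⟧ * N q)) →
  (∀ {p} → p ∈ elems P → W p ≡ f p * N p + ∑ (elems P) (λ q → ⟦ covers P q p ⟧ * W q)) →
  ∑ (elems P) (λ p → f p * numMaxChainsThrough P p) ≡ W t
through-sum P po ρ ρ-mono t b t∈ b∈ ≤t b≤ f N W N-rec W-rec with E′ , E↭ , sorted ← sortedBy ρ (elems P) =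
  ∑-cong (elems P) (λ p p∈ → cong (f p *_) (through-≅ p p∈)) ∙ ∑-↭ (λ p → f p * numMaxChainsThrough P′ p) E↭
  ∙ SortedChains.sorted-through-sum P′ po′ ρ (λ x∈ y∈ → ρ-mono (back x∈) (back y∈)) t b (Perm.∈-resp-↭ E↭ t∈) (Perm.∈-resp-↭ E↭ b∈)
      (≤t ∘ back) (b≤ ∘ back) sorted f N W
      (λ p∈ → N-rec (back p∈) ∙ cong (⟦ leq P _ b ⟧ +_) (covers-sum (back p∈) N))
      (λ {p} p∈ → W-rec (back p∈) ∙ cong (f p * N p +_) (covers-sum (back p∈) W))
  where
  P′ : FinPoset
  P′ = reorder P E′
  open Isomorphism (reorder-≅ P E↭)
  back : ∀ {x} → x ∈ E′ → x ∈ elems P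
  back = Perm.∈-resp-↭ (↭-sym E↭)
  po′ : IsPartialOrder P′
  po′ = record { unique = Unique-↭ E↭ unique ; ≤-refl = ≤-refl ∘ back
    ; ≤-anti = λ x∈ y∈ → ≤-anti (back x∈) (back y∈) ; ≤-trans = λ x∈ y∈ z∈ → ≤-trans (back x∈) (back y∈) (back z∈) }
    where open IsPartialOrder po
  covers-sum : ∀ {p} → p ∈ elems P → (g : Carrier P → ℕ) → ∑ (elems P) (λ q → ⟦ covers P q p ⟧ * g q) ≡ ∑ E′ (λ q → ⟦ covers P′ q p ⟧ * g q)
  covers-sum p∈ g = ∑-cong (elems P) (λ q q∈ → cong (λ c → ⟦ c ⟧ * g q) (covers-≅ q∈ p∈)) ∙ ∑-↭ (λ q → ⟦ covers P′ q _ ⟧ * g q) E↭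

-- Weak order

insertAll-↭ : ∀ x ys {zs} → zs ∈ insertAll x ys → zs ↭ x ∷ ys
insertAll-↭ x []       (here refl) = refl
insertAll-↭ x (y ∷ ys) (here refl) = refl
insertAll-↭ x (y ∷ ys) (there z∈) with zs , zs∈ , refl ← Mem.∈-map⁻ (y ∷_) z∈ =
  ↭-trans (prep y (insertAll-↭ x ys zs∈)) (↭-swap y x refl)

∈-insertAll : ∀ x P Q → P ++ x ∷ Q ∈ insertAll x (P ++ Q)
∈-insertAll x []      []      = here refl
∈-insertAll x []      (q ∷ Q) = here refl
∈-insertAll x (p ∷ P) Q       = there (Mem.∈-map⁺ (p ∷_) (∈-insertAll x P Q))

permsOf-↭ : ∀ xs {u} → u ∈ permsOf xs → u ↭ xs
permsOf-↭ []       (here refl) = refl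
permsOf-↭ (x ∷ xs) u∈ with ys , ys∈ , i ← find (Mem.∈-concatMap⁻ (insertAll x) u∈) =
  ↭-trans (insertAll-↭ x ys i) (prep x (permsOf-↭ xs ys∈))

∈-permsOf : ∀ xs {u} → u ↭ xs → u ∈ permsOf xs
∈-permsOf []       p with refl ← Perm.↭-empty-inv p = here refl
∈-permsOf (x ∷ xs) p with P , Q , refl ← Mem.∈-∃++ (Perm.∈-resp-↭ (↭-sym p) (here refl)) =
  Mem.∈-concatMap⁺ (insertAll x) (lose (∈-permsOf xs (Perm.drop-∷ (↭-trans (↭-sym (Perm.shift x P Q)) p))) (∈-insertAll x P Q))

insertAll-unique : ∀ x ys → x ∉ ys → Unique (insertAll x ys)
insertAll-unique x []       x∉ = [] ∷ []
insertAll-unique x (y ∷ ys) x∉ = All.map⁺ (All.tabulate λ _ e → x∉ (here (List.∷-injectiveˡ e))) ∷ Unique.map⁺ List.∷-injectiveʳ (insertAll-unique x ys (x∉ ∘ there))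

erase : ℕ → List ℕ → List ℕ
erase x = filter (λ v → ¬? (x ≟ v))

erase-∷ : ∀ x l → erase x (x ∷ l) ≡ erase x l
erase-∷ x l = List.filter-reject (λ v → ¬? (x ≟ v)) {x = x} {xs = l} (λ n → n refl)

erase-∉ : ∀ x l → x ∉ l → erase x l ≡ l
erase-∉ x l x∉ = List.filter-all (λ v → ¬? (x ≟ v)) (All.tabulate (λ { v∈ refl → x∉ v∈ }))

insertAll-erase : ∀ x ys {zs} → x ∉ ys → zs ∈ insertAll x ys → erase x zs ≡ ys
insertAll-erase x []       x∉ (here refl) = erase-∷ x []
insertAll-erase x (y ∷ ys) x∉ (here refl) = erase-∷ x (y ∷ ys) ∙ erase-∉ x (y ∷ ys) x∉
insertAll-erase x (y ∷ ys) x∉ (there z∈) with zs , zs∈ , refl ← Mem.∈-map⁻ (y ∷_) z∈ =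
  List.filter-accept (λ v → ¬? (x ≟ v)) {x = y} {xs = zs} (x∉ ∘ here) ∙ cong (y ∷_) (insertAll-erase x ys (x∉ ∘ there) zs∈)

-- Erasing x recovers the permutation into which it was inserted, so insertions into different
-- permutations are disjoint.
permsOf-unique : ∀ xs → Unique xs → Unique (permsOf xs)
permsOf-unique []       u        = [] ∷ []
permsOf-unique (x ∷ xs) (x∉ ∷ u) = Unique.concat⁺
  (All.map⁺ (All.tabulate λ ys∈ → insertAll-unique x _ (avoid ys∈)))
  (AllPairs.map⁺ (disjoint (All.tabulate avoid) (permsOf-unique xs u)))
  where
  avoid : ∀ {ys} → ys ∈ permsOf xs → x ∉ ys
  avoid ys∈ x∈ = All.lookup x∉ (Perm.∈-resp-↭ (permsOf-↭ xs ys∈) x∈) refl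
  disjoint : ∀ {yss} → All (x ∉_) yss → Unique yss → AllPairs (λ ys zs → Disjoint (insertAll x ys) (insertAll x zs)) yss
  disjoint []       []       = []
  disjoint (a ∷ as) (b ∷ u) = All.zipWith (λ { (x∉zs , ys≢zs) (v∈ , v∈′) → ys≢zs (sym (insertAll-erase x _ a v∈) ∙ insertAll-erase x _ x∉zs v∈′) }) (as , b) ∷ disjoint as u

upTo-increasing : ∀ n → AllPairs _<_ (upTo n)
upTo-increasing n = AllPairs.applyUpTo⁺₁ id n (λ i<j _ → i<j)

perms-unique : ∀ n → Unique (perms n)
perms-unique n = permsOf-unique (upTo n) (Unique.upTo⁺ n)

perm-unique : ∀ {n u} → u ↭ upTo n → Unique u
perm-unique {n} p = Unique-↭ (↭-sym p) (Unique.upTo⁺ n)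

eqL-refl : ∀ {u v} → u ≡ v → eqL u v ≡ true
eqL-refl {u} {v} e with List.≡-dec _≟_ u v
... | yes _   = refl
... | no  u≢v = contradiction e u≢v

eqL-sound : ∀ u v → eqL u v ≡ true → u ≡ v
eqL-sound u v e with List.≡-dec _≟_ u v
... | yes u≡v = u≡v

data Step : List ℕ → List ℕ → Set where
  here  : ∀ {x y l} → x < y → Step (x ∷ y ∷ l) (y ∷ x ∷ l)
  there : ∀ {x l m} → Step l m → Step (x ∷ l) (x ∷ m)

Step-↭ : ∀ {u v} → Step u v → u ↭ v
Step-↭ (here _)  = ↭-swap _ _ refl
Step-↭ (there s) = prep _ (Step-↭ s)

Step-inv : ∀ {u v} → Step u v → inv v ≡ suc (inv u)
Step-inv (here {x} {y} {l} x<y) =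
  cong₂ _+_ (smaller-∷-< l x<y) (cong (_+ inv l) (sym (smaller-∷-≮ l (ℕ.<⇒≯ x<y)))) ∙ cong suc (rearrange (smaller y l) (smaller x (y ∷ l)) (inv l))
  where
  rearrange : ∀ a b c → a + (b + c) ≡ b + (a + c)
  rearrange = solve-∀
Step-inv (there {x} s) = cong₂ _+_ (count-↭ (_<ᵇ x) (↭-sym (Step-↭ s))) (Step-inv s) ∙ ℕ.+-suc _ _

ascent-Step : ∀ u i → ascentAt u i ≡ true → Step u (swapAt u i)
ascent-Step (x ∷ y ∷ u) zero    e = here (<ᵇ-sound {x} {y} e)
ascent-Step (x ∷ y ∷ u) (suc i) e = there (ascent-Step (y ∷ u) i e)
ascent-Step (x ∷ [])    (suc i) e = contradiction e (empty i)
  where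
  empty : ∀ i → ¬ ascentAt [] i ≡ true
  empty i ()

Step-index : ∀ {u v} → Step u v → ∃ λ i → i < length u × ascentAt u i ≡ true × swapAt u i ≡ v
Step-index (here {x} {y} x<y) = 0 , s≤s z≤n , <ᵇ-true {x} {y} x<y , refl
Step-index (there {x} {y ∷ l} s) with i , i< , a , e ← Step-index s = suc i , s≤s i< , a , cong (x ∷_) e

Step-ascent : ∀ {u v} → Step u v → ∃ λ i → i ∈ upTo (length u) × ascentAt u i ≡ true × swapAt u i ≡ v
Step-ascent s with i , i< , a , e ← Step-index s = i , Mem.∈-upTo⁺ i< , a , e

Step-Before : ∀ {u v p q} → Step u v → Before p q u → Before p q v ⊎ p < q
Step-Before (here x<y) (here (here refl))  = inj₂ x<y
Step-Before (here x<y) (here (there q∈))   = inj₁ (there (here q∈))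
Step-Before (here x<y) (there (here q∈))   = inj₁ (here (there q∈))
Step-Before (here x<y) (there (there b))   = inj₁ (there (there b))
Step-Before (there s)  (here q∈)           = inj₁ (here (Perm.∈-resp-↭ (Step-↭ s) q∈))
Step-Before (there s)  (there b)           = [ inj₁ ∘ there , inj₂ ]′ (Step-Before s b)

InvSub : List ℕ → List ℕ → Set
InvSub u v = ∀ {p q} → Inversion u p q → Inversion v p q

Step-InvSub : ∀ {u v} → Step u v → InvSub u v
Step-InvSub s (q<p , b) = q<p , [ id , (λ p<q → contradiction p<q (ℕ.<⇒≯ q<p)) ]′ (Step-Before s b)

reach-sound : ∀ k u v → reach k u v ≡ true → u ↭ v × InvSub u v × (u ≡ v ⊎ inv u < inv v)
reach-sound zero    u v e with refl ← eqL-sound u v e = refl , id , inj₁ refl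
reach-sound (suc k) u v e with ∨-true⁻ {eqL u v} e
... | inj₁ e′ with refl ← eqL-sound u v e′ = refl , id , inj₁ refl
... | inj₂ e′ with i , _ , a ← any-true⁻ _ (upTo (length u)) e′ with asc , r ← ∧-true⁻ {ascentAt u i} a
  with s ← ascent-Step u i asc with p , sub , le ← reach-sound k (swapAt u i) v r =
  ↭-trans (Step-↭ s) p , sub ∘ Step-InvSub s , inj₂ (ℕ.≤-trans (ℕ.≤-reflexive (sym (Step-inv s))) ([ (λ { refl → ℕ.≤-refl }) , ℕ.<⇒≤ ]′ le))

Before-self : ∀ l → AllPairs (λ x y → Before x y l) l
Before-self []      = []
Before-self (x ∷ l) = All.tabulate here ∷ AllPairs.map there (Before-self l)

module _ {v : List ℕ} (u-v : Unique v) where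

  -- An adjacent pair of u in the wrong order for v must be an ascent, since inversions of u are
  -- inversions of v; swapping it adds an inversion that v has. If no adjacent pair is wrong,
  -- transitivity puts all of u in the order of v.
  find-step : ∀ u → (∀ {x} → x ∈ u → x ∈ v) → Unique u → InvSub u v → (∃ λ u′ → Step u u′ × InvSub u′ v) ⊎ AllPairs (λ x y → Before x y v) u
  find-step []          u⊆ uu sub = inj₂ []
  find-step (x ∷ [])    u⊆ uu sub = inj₂ ([] ∷ [])
  find-step (x ∷ y ∷ u) u⊆ uu@((x≢y ∷ x∉) ∷ uu′) sub with find-step (y ∷ u) (u⊆ ∘ there) uu′ (λ (a , b) → sub (a , there b))
  ... | inj₁ (u′ , s , sub′) = inj₁ (x ∷ u′ , there s , extend)
    where
    extend : InvSub (x ∷ u′) v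
    extend (q<p , here q∈) = sub (q<p , here (Perm.∈-resp-↭ (↭-sym (Step-↭ s)) q∈))
    extend (q<p , there b) = sub′ (q<p , b)
  ... | inj₂ (b ∷ bs) with Before-total (u⊆ (here refl)) (u⊆ (there (here refl))) x≢y
  ...   | inj₁ xy = inj₂ ((xy ∷ All.map (Before-trans u-v xy) b) ∷ b ∷ bs)
  ...   | inj₂ yx with ℕ.<-cmp x y
  ...     | tri≈ _ x≡y _ = contradiction x≡y x≢y
  ...     | tri> _ _ y<x = contradiction yx (Before-asym u-v (proj₂ (sub (y<x , here (here refl)))))
  ...     | tri< x<y _ _ = inj₁ (y ∷ x ∷ u , here x<y , extend)
    where
    extend : InvSub (y ∷ x ∷ u) v
    extend (q<p , here (here refl))  = q<p , yx
    extend (q<p , here (there q∈))   = sub (q<p , there (here q∈))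
    extend (q<p , there (here q∈))   = sub (q<p , here (there q∈))
    extend (q<p , there (there b))   = sub (q<p , there (there b))

  step-towards : ∀ {u} → u ↭ v → InvSub u v → u ≢ v → ∃ λ u′ → Step u u′ × InvSub u′ v
  step-towards {u} p sub u≢v with find-step u (Perm.∈-resp-↭ p) (Unique-↭ (↭-sym p) u-v) sub
  ... | inj₁ s  = s
  ... | inj₂ ps = contradiction (AllPairs-↭-≡ (λ a b → contradiction b (Before-asym u-v a)) ps (Before-self v) p) u≢v

  -- Each step towards v raises `inv` by one and uses one unit of fuel, which preserves the bound.
  -- As `inv` never exceeds the square of the length, the fuel cannot run out before v is reached.
  reach-complete : ∀ k u → u ↭ v → InvSub u v → length v * length v ≤ k + inv u → reach k u v ≡ true
  reach-complete k u p sub le with List.≡-dec _≟_ u v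
  reach-complete zero    u p sub le | yes u≡v = eqL-refl u≡v
  reach-complete (suc k) u p sub le | yes u≡v = ∨-true⁺ (inj₁ (eqL-refl u≡v))
  ... | no u≢v with u′ , s , sub′ ← step-towards p sub u≢v = continue k le
    where
    p′ : u′ ↭ v
    p′ = ↭-trans (↭-sym (Step-↭ s)) p
    inv-bound : ∀ l → inv l ≤ length l * length l
    inv-bound []      = z≤n
    inv-bound (x ∷ l) = ℕ.+-mono-≤ (ℕ.≤-trans (List.length-filter _ l) (ℕ.n≤1+n _)) (ℕ.≤-trans (inv-bound l) (ℕ.*-monoʳ-≤ (length l) (ℕ.n≤1+n _)))
    bound : inv u′ ≤ length v * length v
    bound = ℕ.≤-trans (inv-bound u′) (ℕ.≤-reflexive (cong (λ m → m * m) (Perm.↭-length p′)))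
    continue : ∀ k → length v * length v ≤ k + inv u → reach k u v ≡ true
    continue zero    le = contradiction (ℕ.≤-trans bound le) (ℕ.<⇒≱ (ℕ.≤-reflexive (sym (Step-inv s))))
    continue (suc k) le with i , i∈ , a , e ← Step-ascent s = ∨-true⁺ {eqL u v} (inj₂ (any-true⁺ _ i∈ (∧-true⁺ a
      (cong (λ m → reach k m v) e ∙ reach-complete k u′ p′ sub′ (ℕ.≤-trans le (ℕ.≤-reflexive (sym (ℕ.+-suc k (inv u)) ∙ cong (k +_) (sym (Step-inv s)))))))))

-- Together with `weakLe-sound` this makes the weak order the inclusion of inversion sets, the form
-- in which it is used from here on.
weakLe-complete : ∀ {u v} → Unique v → u ↭ v → InvSub u v → weakLe u v ≡ true
weakLe-complete {u} {v} uv p sub = reach-complete uv (length u * length u) u p sub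
  (ℕ.≤-trans (ℕ.≤-reflexive (cong (λ m → m * m) (sym (Perm.↭-length p)))) (ℕ.m≤m+n _ _))

weakLe-sound : ∀ u v → weakLe u v ≡ true → u ↭ v × InvSub u v × (u ≡ v ⊎ inv u < inv v)
weakLe-sound u v = reach-sound (length u * length u) u v

-- Toggle symmetry

dropHead : ℕ → List ℕ → (List ℕ → ℕ) → ℕ
dropHead a []      k = 0
dropHead a (b ∷ l) k = if b <ᵇ a then k (b ∷ a ∷ l) else 0

dropDescent : List ℕ → (List ℕ → ℕ) → ℕ
dropDescent []      k = 0
dropDescent (a ∷ l) k = dropHead a l k + dropDescent l (λ m → k (a ∷ m))

dropDescent-cong : ∀ l {k k′ : List ℕ → ℕ} → (∀ m → Step m l → k m ≡ k′ m) → dropDescent l k ≡ dropDescent l k′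
dropDescent-cong []          e = refl
dropDescent-cong (a ∷ [])    e = refl
dropDescent-cong (a ∷ b ∷ l) {k} {k′} e = cong₂ _+_ head (dropDescent-cong (b ∷ l) (λ m s → e (a ∷ m) (there s)))
  where
  head : dropHead a (b ∷ l) k ≡ dropHead a (b ∷ l) k′
  head with b <ᵇ a in ba
  ... | true  = e _ (here (<ᵇ-sound {b} {a} ba))
  ... | false = refl

dropHead-+ : ∀ a l (k k′ : List ℕ → ℕ) → dropHead a l (λ m → k m + k′ m) ≡ dropHead a l k + dropHead a l k′
dropHead-+ a []      k k′ = refl
dropHead-+ a (b ∷ l) k k′ with b <ᵇ a
... | true  = refl
... | false = refl

dropDescent-+ : ∀ l (k k′ : List ℕ → ℕ) → dropDescent l (λ m → k m + k′ m) ≡ dropDescent l k + dropDescent l k′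
dropDescent-+ []      k k′ = refl
dropDescent-+ (a ∷ l) k k′ = cong₂ _+_ (dropHead-+ a l k k′) (dropDescent-+ l _ _) ∙ +-interchange (dropHead a l k) _ _ _

dropDescent-* : ∀ c l (k : List ℕ → ℕ) → dropDescent l (λ m → c * k m) ≡ c * dropDescent l k
dropDescent-* c []          k = sym (ℕ.*-zeroʳ c)
dropDescent-* c (a ∷ [])    k = sym (ℕ.*-zeroʳ c)
dropDescent-* c (a ∷ b ∷ l) k = cong₂ _+_ head (dropDescent-* c (b ∷ l) (λ m → k (a ∷ m))) ∙ sym (ℕ.*-distribˡ-+ c (dropHead a (b ∷ l) k) _)
  where
  head : dropHead a (b ∷ l) (λ m → c * k m) ≡ c * dropHead a (b ∷ l) k
  head with b <ᵇ a
  ... | true  = refl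
  ... | false = sym (ℕ.*-zeroʳ c)

dropDescent-0 : ∀ l → dropDescent l (λ _ → 0) ≡ 0
dropDescent-0 l = dropDescent-* 0 l (λ _ → 0)

-- An exchange of x with y is a Bruhat cover iff no entry between them lies strictly between x and y.
coverOf : ℕ → List ℕ → (ℕ → List ℕ → ℕ) → ℕ
coverOf x []      k = 0
coverOf x (b ∷ B) k = (if x <ᵇ b then k b (x ∷ B) else 0) + coverOf x B (λ y l → if (x <ᵇ b) ∧ (b <ᵇ y) then 0 else k y (b ∷ l))

coverOf-cong : ∀ x B {k k′ : ℕ → List ℕ → ℕ} → (∀ y l → y ∈ B → x < y → x ∈ l → k y l ≡ k′ y l) → coverOf x B k ≡ coverOf x B k′
coverOf-cong x []      e = refl
coverOf-cong x (b ∷ B) {k} {k′} e = cong₂ _+_ head (coverOf-cong x B tail)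
  where
  head : (if x <ᵇ b then k b (x ∷ B) else 0) ≡ (if x <ᵇ b then k′ b (x ∷ B) else 0)
  head with x <ᵇ b in xb
  ... | true  = e b (x ∷ B) (here refl) (<ᵇ-sound {x} {b} xb) (here refl)
  ... | false = refl
  tail : ∀ y l → y ∈ B → x < y → x ∈ l → (if (x <ᵇ b) ∧ (b <ᵇ y) then 0 else k y (b ∷ l)) ≡ (if (x <ᵇ b) ∧ (b <ᵇ y) then 0 else k′ y (b ∷ l))
  tail y l y∈ x<y x∈ = cong (λ m → if (x <ᵇ b) ∧ (b <ᵇ y) then 0 else m) (e y (b ∷ l) (there y∈) x<y (there x∈))

coverOf-+ : ∀ x B (k k′ : ℕ → List ℕ → ℕ) → coverOf x B (λ y l → k y l + k′ y l) ≡ coverOf x B k + coverOf x B k′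
coverOf-+ x []      k k′ = refl
coverOf-+ x (b ∷ B) k k′ = cong₂ _+_ (if-+ (x <ᵇ b)) (coverOf-cong x B (λ y l _ _ _ → if-+′ ((x <ᵇ b) ∧ (b <ᵇ y))) ∙ coverOf-+ x B _ _)
    ∙ +-interchange (if x <ᵇ b then k b (x ∷ B) else 0) _ _ _
  where
  if-+ : ∀ c {m n : ℕ} → (if c then m + n else 0) ≡ (if c then m else 0) + (if c then n else 0)
  if-+ true  = refl
  if-+ false = refl
  if-+′ : ∀ c {m n : ℕ} → (if c then 0 else m + n) ≡ (if c then 0 else m) + (if c then 0 else n)
  if-+′ true  = refl
  if-+′ false = refl

coverOf-0 : ∀ x B → coverOf x B (λ _ _ → 0) ≡ 0
coverOf-0 x []      = refl
coverOf-0 x (b ∷ B) = cong₂ _+_ (Bool.if-eta (x <ᵇ b)) (coverOf-cong x B (λ y l _ _ _ → Bool.if-eta ((x <ᵇ b) ∧ (b <ᵇ y))) ∙ coverOf-0 x B)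

coverOf-zero : ∀ x B {k : ℕ → List ℕ → ℕ} → (∀ y l → y ∈ B → x < y → x ∈ l → k y l ≡ 0) → coverOf x B k ≡ 0
coverOf-zero x B e = coverOf-cong x B e ∙ coverOf-0 x B

private
  <ᵇ-flip : ∀ {a b} → a ≢ b → (b <ᵇ a) ≡ not (a <ᵇ b)
  <ᵇ-flip {a} {b} a≢b with a <ᵇ b in ab
  ... | true  = <ᵇ-asym {a} {b} ab
  ... | false = <ᵇ-total {a} {b} a≢b ab

-- Cases by the relative order of x, b and c. For x < c < b the exchange of x with c turns the
-- descent b c into b x, while an exchange with a later y is obstructed by b and by c independently
-- of their order.
coverOf-dropHead : ∀ x b B (k : ℕ → List ℕ → ℕ) → Unique (x ∷ b ∷ B) →
  (if x <ᵇ b then dropHead x B (k b) else 0) + coverOf x B (λ y l → if (x <ᵇ b) ∧ (b <ᵇ y) then 0 else dropHead b l (k y)) ≡ dropHead b B (λ l → coverOf x l k)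
coverOf-dropHead x b []      k u = cong (_+ 0) (Bool.if-eta (x <ᵇ b))
coverOf-dropHead x b (c ∷ C) k ((x≢b ∷ x≢c ∷ x∉) ∷ (b≢c ∷ b∉) ∷ c∉ ∷ u)
  rewrite <ᵇ-flip x≢c | <ᵇ-flip b≢c with x <ᵇ b in xb | x <ᵇ c in xc | b <ᵇ c in bc
... | true  | true  | true  = coverOf-zero x C (λ y l _ _ _ → cong (λ m → if c <ᵇ y then 0 else m) (Bool.if-eta (b <ᵇ y)) ∙ Bool.if-eta (c <ᵇ y))
... | true  | true  | false = cong (k c (x ∷ b ∷ C) +_) (coverOf-cong x C (λ y l _ _ _ → if-comm (c <ᵇ y) (b <ᵇ y)))
  where
  if-comm : ∀ p q {m : ℕ} → (if p then 0 else if q then 0 else m) ≡ (if q then 0 else if p then 0 else m)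
  if-comm true  true  = refl
  if-comm true  false = refl
  if-comm false true  = refl
  if-comm false false = refl
... | true  | false | true  = false≢true xc (<ᵇ-trans {x} {b} {c} xb bc)
... | true  | false | false = refl
... | false | true  | true  = coverOf-zero x C (λ y l _ _ _ → Bool.if-eta (c <ᵇ y))
... | false | true  | false = false≢true xb (<ᵇ-trans {x} {c} {b} xc (<ᵇ-flip b≢c ∙ cong not bc))
... | false | false | true  = coverOf-0 x C
... | false | false | false = refl

coverOf-dropDescent : ∀ x B (k : ℕ → List ℕ → ℕ) → Unique (x ∷ B) →
  coverOf x B (λ y l → dropDescent l (k y)) ≡ dropDescent B (λ l → coverOf x l k)
coverOf-dropDescent x []      k u = refl
coverOf-dropDescent x (b ∷ B) k u@((x≢b ∷ x∉) ∷ b∉ ∷ u′) =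
  cong₂ _+_ (if-+ (x <ᵇ b) (dropHead x B (k b))) (coverOf-cong x B (λ y l _ _ _ → branch ((x <ᵇ b) ∧ (b <ᵇ y)) y l) ∙ coverOf-+ x B _ _)
  ∙ +-interchange (if x <ᵇ b then dropHead x B (k b) else 0) _ _ _
  ∙ cong₂ _+_ (coverOf-dropHead x b B k u)
      (cong₂ _+_ (sym (if-drop (x <ᵇ b))) (coverOf-dropDescent x B _ (x∉ ∷ u′)) ∙ sym (dropDescent-+ B _ _))
  where
  if-+ : ∀ c m {n} → (if c then m + n else 0) ≡ (if c then m else 0) + (if c then n else 0)
  if-+ true  m = refl
  if-+ false m = refl
  branch : ∀ c y l → (if c then 0 else dropDescent (b ∷ l) (k y))
    ≡ (if c then 0 else dropHead b l (k y)) + dropDescent l (λ m → if c then 0 else k y (b ∷ m))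
  branch true  y l = sym (dropDescent-0 l)
  branch false y l = refl
  if-drop : ∀ c → dropDescent B (λ l → if c then k b (x ∷ l) else 0) ≡ (if c then dropDescent B (λ l → k b (x ∷ l)) else 0)
  if-drop true  = refl
  if-drop false = dropDescent-0 B

module Weighted (γ : ℕ → ℕ → ℕ) where

  headDescent headAscent : ℕ → List ℕ → ℕ
  headDescent a []      = 0
  headDescent a (b ∷ l) = if b <ᵇ a then γ b a else 0
  headAscent a []       = 0
  headAscent a (b ∷ l)  = if a <ᵇ b then γ a b else 0

  descents ascents : List ℕ → ℕ
  descents []      = 0
  descents (a ∷ l) = headDescent a l + descents l
  ascents []      = 0
  ascents (a ∷ l) = headAscent a l + ascents l

  -- The up operator runs along all Bruhat covers, although `dropDescent` goes down in the weak
  -- order only.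
  bruhatUp : List ℕ → (List ℕ → ℕ) → ℕ
  bruhatUp []      g = 0
  bruhatUp (x ∷ B) g = coverOf x B (λ y l → γ x y * g (y ∷ l)) + bruhatUp B (λ l → g (x ∷ l))

  bruhatUp-+ : ∀ B (g g′ : List ℕ → ℕ) → bruhatUp B (λ l → g l + g′ l) ≡ bruhatUp B g + bruhatUp B g′
  bruhatUp-+ []      g g′ = refl
  bruhatUp-+ (x ∷ B) g g′ = cong₂ _+_ (coverOf-cong x B (λ y l _ _ _ → ℕ.*-distribˡ-+ (γ x y) (g (y ∷ l)) (g′ (y ∷ l))) ∙ coverOf-+ x B _ _) (bruhatUp-+ B _ _)
    ∙ +-interchange (coverOf x B (λ y l → γ x y * g (y ∷ l))) _ _ _

  bruhatUp-0 : ∀ B → bruhatUp B (λ _ → 0) ≡ 0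
  bruhatUp-0 []      = refl
  bruhatUp-0 (x ∷ B) = cong₂ _+_ (coverOf-zero x B (λ y l _ _ _ → ℕ.*-zeroʳ (γ x y))) (bruhatUp-0 B)

  private
    -- An ascent that is exchanged and then removed as a descent, or a descent that is removed and
    -- then exchanged back, returns to the list itself. These are the diagonal terms; the others
    -- match in pairs.
    junction-case : ∀ x B (g : List ℕ → ℕ) → Unique (x ∷ B) →
      (coverOf x B (λ y l → γ x y * dropHead y l g) + bruhatUp B (λ l → dropHead x l g)) + headDescent x B * g (x ∷ B)
      ≡ dropHead x B (λ l → bruhatUp l g) + headAscent x B * g (x ∷ B)
    junction-case x []      g u = refl
    junction-case x (b ∷ C) g ((x≢b ∷ x∉) ∷ b∉ ∷ u) rewrite <ᵇ-flip x≢b with x <ᵇ b in xb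
    ... | true = cong (λ m → m + 0) (cong₂ _+_
            (cong₂ _+_ (refl {x = γ x b * g (x ∷ b ∷ C)})
              (coverOf-zero x C (λ y l _ _ _ → nested (b <ᵇ y) (γ x y))))
            (cong₂ _+_ (coverOf-zero b C (λ y l _ b<y _ → cong (λ c → γ b y * (if c then g (y ∷ x ∷ l) else 0)) (<ᵇ-false {y} {x} (ℕ.<⇒≯ (ℕ.<-trans (<ᵇ-sound {x} {b} xb) b<y))) ∙ ℕ.*-zeroʳ (γ b y)))
              (bruhatUp-0 C)))
          ∙ rearrange (γ x b * g (x ∷ b ∷ C))
      where
      nested : ∀ c m {n} → (if c then 0 else m * (if c then n else 0)) ≡ 0
      nested true  m = refl
      nested false m = ℕ.*-zeroʳ m
      rearrange : ∀ a → a + 0 + 0 + 0 ≡ a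
      rearrange = solve-∀
    ... | false = cong₂ (λ p q → ((p + (q + bruhatUp C (λ l → g (b ∷ x ∷ l)))) + γ b x * g (x ∷ b ∷ C)))
            (coverOf-cong x C (λ y l _ x<y _ → cong (λ c → γ x y * (if c then g (b ∷ y ∷ l) else 0)) (<ᵇ-true {b} {y} (ℕ.<-trans b<x x<y))))
            (coverOf-cong b C (λ y l y∈ _ _ → cong (λ c → γ b y * (if c then g (y ∷ x ∷ l) else 0)) (<ᵇ-flip (All.lookup x∉ y∈)) ∙ push (x <ᵇ y) (γ b y)))
          ∙ rearrange (coverOf x C (λ y l → γ x y * g (b ∷ y ∷ l))) _ _ _
      where
      bx : (b <ᵇ x) ≡ true
      bx = <ᵇ-flip x≢b ∙ cong not xb
      b<x : b < x
      b<x = <ᵇ-sound {b} {x} bx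
      push : ∀ c m {n} → m * (if not c then n else 0) ≡ (if c then 0 else m * n)
      push true  m = ℕ.*-zeroʳ m
      push false m = refl
      rearrange : ∀ p q r s → ((p + (q + r)) + s) ≡ ((s + q) + (p + r)) + 0
      rearrange = solve-∀

  -- Down and up commute up to a diagonal term, as in a dual graded graph.
  commutator : ∀ v (g : List ℕ → ℕ) → Unique v →
    bruhatUp v (λ l → dropDescent l g) + descents v * g v ≡ dropDescent v (λ l → bruhatUp l g) + ascents v * g v
  commutator []      g u = refl
  commutator (x ∷ B) g u@(x∉ ∷ u′) =
    cong₂ _+_ (cong₂ _+_ (coverOf-cong x B (λ y l _ _ _ → ℕ.*-distribˡ-+ (γ x y) (dropHead y l g) _ ∙ cong (γ x y * dropHead y l g +_) (sym (dropDescent-* (γ x y) l (λ m → g (y ∷ m)))))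
                           ∙ coverOf-+ x B _ _ ∙ cong (coverOf x B (λ y l → γ x y * dropHead y l g) +_) (coverOf-dropDescent x B (λ y l → γ x y * g (y ∷ l)) u))
                         (bruhatUp-+ B _ _))
              (ℕ.*-distribʳ-+ (g (x ∷ B)) (headDescent x B) (descents B))
    ∙ rearrange₁ (coverOf x B (λ y l → γ x y * dropHead y l g)) _ _ _ _ _
    ∙ cong₂ (λ m n → m + (dropDescent B (λ l → coverOf x l (λ y l → γ x y * g (y ∷ l))) + n)) (junction-case x B g u) (commutator B (λ l → g (x ∷ l)) u′)
    ∙ rearrange₂ (dropHead x B (λ l → bruhatUp l g)) _ (dropDescent B (λ l → coverOf x l (λ y m → γ x y * g (y ∷ m)))) (dropDescent B (λ l → bruhatUp l (λ m → g (x ∷ m)))) _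
    ∙ cong₂ _+_ (cong (dropHead x B (λ l → bruhatUp l g) +_) (sym (dropDescent-+ B (λ l → coverOf x l (λ y m → γ x y * g (y ∷ m))) (λ l → bruhatUp l (λ m → g (x ∷ m)))))) (sym (ℕ.*-distribʳ-+ (g (x ∷ B)) (headAscent x B) (ascents B)))
    where
    rearrange₁ : ∀ a b c d e f → ((a + b) + (c + d)) + (e + f) ≡ ((a + c) + e) + (b + (d + f))
    rearrange₁ = solve-∀
    rearrange₂ : ∀ a b c d e → (a + b) + (c + (d + e)) ≡ (a + (c + d)) + (b + e)
    rearrange₂ = solve-∀

-- Lower and upper covers in weak order, weighted by the swapped values

downHead : ℕ → List ℕ → List (List ℕ)
downHead a []      = []
downHead a (b ∷ l) = if b <ᵇ a then [ b ∷ a ∷ l ] else []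

downs : List ℕ → List (List ℕ)
downs []      = []
downs (a ∷ l) = downHead a l ++ map (a ∷_) (downs l)

upHead : ℕ → List ℕ → List (List ℕ)
upHead a []      = []
upHead a (b ∷ l) = if a <ᵇ b then [ b ∷ a ∷ l ] else []

ups : List ℕ → List (List ℕ)
ups []      = []
ups (a ∷ l) = upHead a l ++ map (a ∷_) (ups l)

∈-downs⁻ : ∀ p {q} → q ∈ downs p → Step q p
∈-downs⁻ (a ∷ l) q∈ with Mem.∈-++⁻ (downHead a l) q∈
... | inj₂ q∈′ with m , m∈ , refl ← Mem.∈-map⁻ (a ∷_) q∈′ = there (∈-downs⁻ l m∈)
∈-downs⁻ (a ∷ b ∷ l) q∈ | inj₁ q∈′ with b <ᵇ a in ba
∈-downs⁻ (a ∷ b ∷ l) q∈ | inj₁ (here refl) | true = here (<ᵇ-sound {b} {a} ba)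

∈-downs⁺ : ∀ {p q} → Step q p → q ∈ downs p
∈-downs⁺ (here {x} {y} x<y) rewrite <ᵇ-true {x} {y} x<y = here refl
∈-downs⁺ (there {x} {l} {m} s) = Mem.∈-++⁺ʳ (downHead x m) (Mem.∈-map⁺ (x ∷_) (∈-downs⁺ s))

∈-ups⁻ : ∀ p {q} → q ∈ ups p → Step p q
∈-ups⁻ (a ∷ l) q∈ with Mem.∈-++⁻ (upHead a l) q∈
... | inj₂ q∈′ with m , m∈ , refl ← Mem.∈-map⁻ (a ∷_) q∈′ = there (∈-ups⁻ l m∈)
∈-ups⁻ (a ∷ b ∷ l) q∈ | inj₁ q∈′ with a <ᵇ b in ab
∈-ups⁻ (a ∷ b ∷ l) q∈ | inj₁ (here refl) | true = here (<ᵇ-sound {a} {b} ab)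

∈-ups⁺ : ∀ {p q} → Step p q → q ∈ ups p
∈-ups⁺ (here {x} {y} x<y) rewrite <ᵇ-true {x} {y} x<y = here refl
∈-ups⁺ (there {x} {l} {m} s) = Mem.∈-++⁺ʳ (upHead x l) (Mem.∈-map⁺ (x ∷_) (∈-ups⁺ s))

downs-unique : ∀ p → Unique (downs p)
downs-unique []      = []
downs-unique (a ∷ l) = Unique.++⁺ (single l) (Unique.map⁺ List.∷-injectiveʳ (downs-unique l))
    (λ (i , j) → let m , _ , v≡ = Mem.∈-map⁻ (a ∷_) j in apart l i v≡)
  where
  single : ∀ l → Unique (downHead a l)
  single []      = []
  single (b ∷ l) with b <ᵇ a
  ... | true  = [] ∷ []
  ... | false = []
  apart : ∀ l {v m} → v ∈ downHead a l → v ≢ a ∷ m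
  apart (b ∷ l) i e with b <ᵇ a in ba
  apart (b ∷ l) (here refl) e | true = ℕ.<⇒≢ (<ᵇ-sound {b} {a} ba) (List.∷-injectiveˡ e)

ups-unique : ∀ p → Unique (ups p)
ups-unique []      = []
ups-unique (a ∷ l) = Unique.++⁺ (single l) (Unique.map⁺ List.∷-injectiveʳ (ups-unique l))
    (λ (i , j) → let m , _ , v≡ = Mem.∈-map⁻ (a ∷_) j in apart l i v≡)
  where
  single : ∀ l → Unique (upHead a l)
  single []      = []
  single (b ∷ l) with a <ᵇ b
  ... | true  = [] ∷ []
  ... | false = []
  apart : ∀ l {v m} → v ∈ upHead a l → v ≢ a ∷ m
  apart (b ∷ l) i e with a <ᵇ b in ab
  apart (b ∷ l) (here refl) e | true = ℕ.<⇒≢ (<ᵇ-sound {a} {b} ab) (sym (List.∷-injectiveˡ e))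

∑-downs : ∀ p g → ∑ (downs p) g ≡ dropDescent p g
∑-downs []          g = refl
∑-downs (a ∷ [])    g = refl
∑-downs (a ∷ b ∷ l) g = ∑-++ (downHead a (b ∷ l)) _ g ∙ cong₂ _+_ head (∑-map (a ∷_) (downs (b ∷ l)) g ∙ ∑-downs (b ∷ l) (λ m → g (a ∷ m)))
  where
  head : ∑ (downHead a (b ∷ l)) g ≡ dropHead a (b ∷ l) g
  head with b <ᵇ a
  ... | true  = ℕ.+-identityʳ _
  ... | false = refl

module EdgeWeight (γ : ℕ → ℕ → ℕ) where
  open Weighted γ

  -- The swapped values of a step are read off at the first place where the two lists differ.
  edgeWeight : List ℕ → List ℕ → ℕ
  edgeWeight (a ∷ p) (b ∷ q) = if ⌊ a ≟ b ⌋ then edgeWeight p q else γ a b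
  edgeWeight _       _       = 0

  edgeWeight-≡ : ∀ a p q → edgeWeight (a ∷ p) (a ∷ q) ≡ edgeWeight p q
  edgeWeight-≡ a p q with a ≟ a
  ... | yes _   = refl
  ... | no  a≢a = contradiction refl a≢a

  edgeWeight-≢ : ∀ {a b} p q → a ≢ b → edgeWeight (a ∷ p) (b ∷ q) ≡ γ a b
  edgeWeight-≢ {a} {b} p q a≢b with a ≟ b
  ... | yes a≡b = contradiction a≡b a≢b
  ... | no  _   = refl

  ∑-downs-weight : ∀ q → ∑ (downs q) (λ p → edgeWeight p q) ≡ descents q
  ∑-downs-weight []          = refl
  ∑-downs-weight (a ∷ [])    = refl
  ∑-downs-weight (a ∷ b ∷ l) = ∑-++ (downHead a (b ∷ l)) _ _
      ∙ cong₂ _+_ head (∑-map (a ∷_) (downs (b ∷ l)) _ ∙ ∑-cong (downs (b ∷ l)) (λ m _ → edgeWeight-≡ a m (b ∷ l)) ∙ ∑-downs-weight (b ∷ l))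
    where
    head : ∑ (downHead a (b ∷ l)) (λ p → edgeWeight p (a ∷ b ∷ l)) ≡ headDescent a (b ∷ l)
    head with b <ᵇ a in ba
    ... | true  = ℕ.+-identityʳ _ ∙ edgeWeight-≢ (a ∷ l) (b ∷ l) (ℕ.<⇒≢ (<ᵇ-sound {b} {a} ba))
    ... | false = refl

  ∑-ups-weight : ∀ p → ∑ (ups p) (edgeWeight p) ≡ ascents p
  ∑-ups-weight []          = refl
  ∑-ups-weight (a ∷ [])    = refl
  ∑-ups-weight (a ∷ b ∷ l) = ∑-++ (upHead a (b ∷ l)) _ _
      ∙ cong₂ _+_ head (∑-map (a ∷_) (ups (b ∷ l)) _ ∙ ∑-cong (ups (b ∷ l)) (λ m _ → edgeWeight-≡ a (b ∷ l) m) ∙ ∑-ups-weight (b ∷ l))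
    where
    head : ∑ (upHead a (b ∷ l)) (edgeWeight (a ∷ b ∷ l)) ≡ headAscent a (b ∷ l)
    head with a <ᵇ b in ab
    ... | true  = ℕ.+-identityʳ _ ∙ edgeWeight-≢ (b ∷ l) (a ∷ l) (ℕ.<⇒≢ (<ᵇ-sound {a} {b} ab))
    ... | false = refl

  edgeWeight-Step : ∀ {p q} → Step p q → ∃₂ λ x y → x < y × edgeWeight p q ≡ γ x y × Before y x q × (∀ {a b} → Before a b q → Before a b p ⊎ (a ≡ y × b ≡ x))
  edgeWeight-Step (here {x} {y} {l} x<y) = x , y , x<y , edgeWeight-≢ (y ∷ l) (x ∷ l) (ℕ.<⇒≢ x<y) , here (here refl) , moved
    where
    moved : ∀ {a b} → Before a b (y ∷ x ∷ l) → Before a b (x ∷ y ∷ l) ⊎ (a ≡ y × b ≡ x)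
    moved (here (here refl)) = inj₂ (refl , refl)
    moved (here (there i))   = inj₁ (there (here i))
    moved (there (here i))   = inj₁ (here (there i))
    moved (there (there b))  = inj₁ (there (there b))
  edgeWeight-Step (there {c} {l} {m} s) with x , y , x<y , e , b , f ← edgeWeight-Step s =
    x , y , x<y , edgeWeight-≡ c l m ∙ e , there b
    , λ { (here i) → inj₁ (here (Perm.∈-resp-↭ (↭-sym (Step-↭ s)) i)) ; (there b′) → [ inj₁ ∘ there , inj₂ ]′ (f b′) }

-- Reduced words, 0-Hecke words and sums over maximal chains

reducedWords : ℕ → List ℕ → ℕ
reducedWords zero    v = heckeWords 0 v
reducedWords (suc k) v = dropDescent v (reducedWords k)

-- The sum of f over all elements of all maximal chains of the interval below v, which has rank k.
chainSum : (List ℕ → ℕ) → ℕ → List ℕ → ℕ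
chainSum f zero    v = f v * reducedWords 0 v
chainSum f (suc k) v = f v * reducedWords (suc k) v + dropDescent v (chainSum f k)

des : List ℕ → ℕ
des v = dropDescent v (λ _ → 1)

demazure-drop : ∀ l k → Down.demazure l k ≡ dropDescent l k + des l * k l
demazure-drop []          k = refl
demazure-drop (a ∷ [])    k = refl
demazure-drop (a ∷ b ∷ l) k = cong₂ _+_ head (demazure-drop (b ∷ l) (λ m → k (a ∷ m)))
    ∙ +-interchange (dropHead a (b ∷ l) k) _ _ _ ∙ cong (dropDescent (a ∷ b ∷ l) k +_) (sym (ℕ.*-distribʳ-+ (k (a ∷ b ∷ l)) (dropHead a (b ∷ l) (λ _ → 1)) _))
  where
  head : Down.swapHead a (b ∷ l) k ≡ dropHead a (b ∷ l) k + dropHead a (b ∷ l) (λ _ → 1) * k (a ∷ b ∷ l)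
  head with b <ᵇ a
  ... | true  = cong (k (b ∷ a ∷ l) +_) (sym (ℕ.+-identityʳ _))
  ... | false = refl

dropDescent-zero : ∀ v {g : List ℕ → ℕ} → (∀ m → Step m v → g m ≡ 0) → dropDescent v g ≡ 0
dropDescent-zero v e = dropDescent-cong v e ∙ dropDescent-0 v

heckeWords-low : ∀ k v → k < inv v → heckeWords k v ≡ 0
heckeWords-low zero    v k< = heckeWords-0 v k<
heckeWords-low (suc k) v k< = demazure-drop v (heckeWords k) ∙ cong₂ _+_
  (dropDescent-zero v (λ m s → heckeWords-low k m (s≤s⁻¹ (subst (suc k <_) (Step-inv s) k<))))
  (cong (des v *_) (heckeWords-low k v (ℕ.<-trans (ℕ.n<1+n k) k<)) ∙ ℕ.*-zeroʳ (des v))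

Step-rank : ∀ {m v k} → Step m v → inv v ≡ suc k → inv m ≡ k
Step-rank s e = ℕ.suc-injective (sym (Step-inv s) ∙ e)

heckeWords-reduced : ∀ k v → inv v ≡ k → heckeWords k v ≡ reducedWords k v
heckeWords-reduced zero    v e = refl
heckeWords-reduced (suc k) v e = demazure-drop v (heckeWords k)
  ∙ cong₂ _+_ (dropDescent-cong v (λ m s → heckeWords-reduced k m (Step-rank s e)))
      (cong (des v *_) (heckeWords-low k v (ℕ.≤-reflexive (sym e))) ∙ ℕ.*-zeroʳ (des v)) ∙ ℕ.+-identityʳ _

-- A word with one letter more than a reduced one has exactly one letter that is absorbed. This
-- happens exactly at a descent of the product reached so far, that is, at a marked down-cover of
-- one element of the chain.
heckeWords-next : ∀ k v → inv v ≡ k → heckeWords (suc k) v ≡ chainSum des k v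
heckeWords-next zero    v e = demazure-drop v (heckeWords 0)
  ∙ cong (_+ des v * heckeWords 0 v) (dropDescent-zero v (λ m s → contradiction (sym (Step-inv s) ∙ e) (λ ())))
heckeWords-next (suc k) v e = demazure-drop v (heckeWords (suc k))
  ∙ cong₂ _+_ (dropDescent-cong v (λ m s → heckeWords-next k m (Step-rank s e))) (cong (des v *_) (heckeWords-reduced (suc k) v e)) ∙ ℕ.+-comm _ (des v * reducedWords (suc k) v)

chainSum-1 : ∀ k v → chainSum (λ _ → 1) k v ≡ suc k * reducedWords k v
chainSum-1 zero    v = refl
chainSum-1 (suc k) v = cong₂ _+_ (ℕ.+-identityʳ _) (dropDescent-cong v (λ m _ → chainSum-1 k m) ∙ dropDescent-* (suc k) v (reducedWords k))

module _ (γ : ℕ → ℕ → ℕ) where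
  open Weighted γ

  bruhatUp-sorted : ∀ v → bruhatUp v (reducedWords 0) ≡ 0
  bruhatUp-sorted v = go [] v
    where
    go : ∀ as v → bruhatUp v (λ l → reducedWords 0 (as ʳ++ l)) ≡ 0
    go as []      = refl
    go as (x ∷ B) = cong₂ _+_ (coverOf-zero x B (λ y l _ x<y x∈ → cong (γ x y *_) (heckeWords-0 (as ʳ++ y ∷ l)
        (subst (λ m → 0 < inv m) (sym (List.ʳ++-defn as)) (inv-pos (reverse as) l x∈ x<y))) ∙ ℕ.*-zeroʳ (γ x y))) (go (x ∷ as) B)

  -- Going up from v exchanges a pair that is not inverted in v, where a weight supported on the
  -- inversions of v vanishes.
  bruhatUp-unsupported : ∀ v g → (∀ {x y} → Before x y v → x < y → γ x y ≡ 0) → bruhatUp v g ≡ 0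
  bruhatUp-unsupported []      g e = refl
  bruhatUp-unsupported (x ∷ B) g e =
    cong₂ _+_ (coverOf-zero x B (λ y l y∈ x<y _ → cong (_* g (y ∷ l)) (e (here y∈) x<y))) (bruhatUp-unsupported B _ (λ b → e (there b)))

  -- By `commutator`, ascents are traded for descents at every element of the chain. The up
  -- operators left over collect into one up step from v, followed by a chain that is one step
  -- longer.
  chainSum-ascents : ∀ k v → Unique v → chainSum ascents k v ≡ chainSum descents k v + bruhatUp v (reducedWords (suc k))
  chainSum-ascents zero    v u = cong (_+ ascents v * reducedWords 0 v) (sym (dropDescent-zero v (λ m _ → bruhatUp-sorted m)))
    ∙ sym (commutator v (reducedWords 0) u) ∙ ℕ.+-comm _ (descents v * reducedWords 0 v)
  chainSum-ascents (suc k) v u =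
    cong (ascents v * reducedWords (suc k) v +_) (dropDescent-cong v (λ m s → chainSum-ascents k m (Unique-↭ (↭-sym (Step-↭ s)) u)) ∙ dropDescent-+ v _ _)
    ∙ rearrange (ascents v * reducedWords (suc k) v) (dropDescent v (chainSum descents k)) _
    ∙ cong (dropDescent v (chainSum descents k) +_) (sym (commutator v (reducedWords (suc k)) u))
    ∙ rearrange′ (dropDescent v (chainSum descents k)) _ (descents v * reducedWords (suc k) v)
    where
    rearrange : ∀ a b c → a + (b + c) ≡ b + (c + a)
    rearrange = solve-∀
    rearrange′ : ∀ a b c → a + (b + c) ≡ (c + a) + b
    rearrange′ = solve-∀

-- Lower intervals of the weak order

Before? : ∀ x y l → Dec (Before x y l)
Before? x y []      = no λ ()
Before? x y (a ∷ l) with Before? x y l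
... | yes b = yes (there b)
... | no ¬b with x ≟ a | Any.any? (y ≟_) l
...   | yes refl | yes y∈ = yes (here y∈)
...   | yes refl | no y∉  = no λ { (here y∈) → y∉ y∈ ; (there b) → ¬b b }
...   | no x≢a   | _      = no λ { (here y∈) → x≢a refl ; (there b) → ¬b b }

module Interval (n : ℕ) (w : List ℕ) (w↭ : w ↭ upTo n) where

  W : FinPoset
  W = WeakInterval n w

  private
    E : List (List ℕ)
    E = elems W
    e : List ℕ
    e = upTo n
    w-unique : Unique w
    w-unique = perm-unique w↭

  no-inversions : ∀ {p q} → ¬ Inversion e p q
  no-inversions (q<p , b) = go (upTo-increasing n) q<p b
    where
    go : ∀ {l p q} → AllPairs _<_ l → q < p → ¬ Before p q l
    go (x< ∷ s) q<p (here q∈) = ℕ.<-asym q<p (All.lookup x< q∈)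
    go (x< ∷ s) q<p (there b) = go s q<p b

  inv-e : inv e ≡ 0
  inv-e = go (upTo-increasing n)
    where
    go : ∀ {l} → AllPairs _<_ l → inv l ≡ 0
    go []       = refl
    go {x ∷ l} (x< ∷ s) = cong₂ _+_ (smaller-none x l x<) (go s)

  ∈⁺ : ∀ {u} → u ↭ e → InvSub u w → u ∈ E
  ∈⁺ {u} p sub = Mem.∈-filter⁺ _ (∈-permsOf e p) (subst T (sym (∧-true⁺ {weakLe e u} (weakLe-complete (perm-unique p) (↭-sym p) (λ i → ⊥-elim (no-inversions i)))
    (weakLe-complete w-unique (↭-trans p (↭-sym w↭)) sub))) tt)

  ∈⁻ : ∀ {u} → u ∈ E → u ↭ e × InvSub u w
  ∈⁻ {u} u∈ with u∈′ , t ← Mem.∈-filter⁻ (λ u → Bool.T? (weakLe e u ∧ weakLe u w)) {xs = perms n} u∈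
    with _ , l ← ∧-true⁻ {weakLe e u} (Equivalence.to Bool.T-≡ t) = permsOf-↭ e u∈′ , proj₁ (proj₂ (weakLe-sound u w l))

  leq⁺ : ∀ {u v} → u ∈ E → v ∈ E → InvSub u v → leq W u v ≡ true
  leq⁺ u∈ v∈ sub = weakLe-complete (perm-unique (proj₁ (∈⁻ v∈))) (↭-trans (proj₁ (∈⁻ u∈)) (↭-sym (proj₁ (∈⁻ v∈)))) sub

  leq⁻ : ∀ {u v} → leq W u v ≡ true → InvSub u v
  leq⁻ {u} {v} l = proj₁ (proj₂ (weakLe-sound u v l))

  leq-strict : ∀ {u v} → leq W u v ≡ true → u ≡ v ⊎ inv u < inv v
  leq-strict {u} {v} l = proj₂ (proj₂ (weakLe-sound u v l))

  w∈ : w ∈ E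
  w∈ = ∈⁺ w↭ id

  e∈ : e ∈ E
  e∈ = ∈⁺ refl (λ i → ⊥-elim (no-inversions i))

  partialOrder : IsPartialOrder W
  partialOrder = record
    { unique  = Unique.filter⁺ _ (perms-unique n)
    ; ≤-refl  = λ x∈ → leq⁺ x∈ x∈ id
    ; ≤-anti  = λ {x} {y} x∈ y∈ a b → [ id , (λ i<j → [ sym , (λ j<i → contradiction j<i (ℕ.<⇒≯ i<j)) ]′ (leq-strict {y} {x} b)) ]′ (leq-strict {x} {y} a)
    ; ≤-trans = λ {x} {y} {z} x∈ y∈ z∈ a b → leq⁺ x∈ z∈ (leq⁻ {y} {z} b ∘ leq⁻ {x} {y} a) }

  inv-mono : ∀ {x y} → lt W x y ≡ true → inv x < inv y
  inv-mono {x} {y} l with a , b ← ∧-true⁻ {leq W x y} l with leq-strict {x} {y} a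
  ... | inj₂ i<j  = i<j
  ... | inj₁ refl = contradiction a (not-true⁻ b)

  private
    Step⇒lt : ∀ {q p} → q ∈ E → p ∈ E → Step q p → lt W q p ≡ true
    Step⇒lt {q} {p} q∈ p∈ s = ∧-true⁺ (leq⁺ q∈ p∈ (Step-InvSub s)) (not-true⁺ λ l →
      [ (λ { refl → ℕ.<-irrefl refl rise }) , (λ p<q → ℕ.<-asym p<q rise) ]′ (leq-strict {p} {q} l))
      where
      rise : inv q < inv p
      rise = ℕ.≤-reflexive (sym (Step-inv s))

  covers⁺ : ∀ {q p} → q ∈ E → p ∈ E → Step q p → covers W q p ≡ true
  covers⁺ {q} {p} q∈ p∈ s = ∧-true⁺ (Step⇒lt q∈ p∈ s) (not-true⁺ λ t → let r , _ , a = any-true⁻ _ E t ; b , c = ∧-true⁻ {lt W q r} a in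
    ℕ.<⇒≱ (inv-mono {q} {r} b) (s≤s⁻¹ (ℕ.≤-trans (inv-mono {r} {p} c) (ℕ.≤-reflexive (Step-inv s)))))

  -- The first step from q towards p would lie strictly between the two if it did not end at p.
  covers⁻ : ∀ {q p} → q ∈ E → p ∈ E → covers W q p ≡ true → Step q p
  covers⁻ {q} {p} q∈ p∈ c with l , n ← ∧-true⁻ {lt W q p} c with a , b ← ∧-true⁻ {leq W q p} l
    with r , s , sub ← step-towards (perm-unique (proj₁ (∈⁻ p∈))) (↭-trans (proj₁ (∈⁻ q∈)) (↭-sym (proj₁ (∈⁻ p∈)))) (leq⁻ {q} {p} a) (λ { refl → not-true⁻ b a })
    with List.≡-dec _≟_ r p
  ... | yes refl = s
  ... | no  r≢p  = contradiction (any-true⁺ _ r∈ (∧-true⁺ (Step⇒lt q∈ r∈ s) (∧-true⁺ (leq⁺ r∈ p∈ sub) (not-true⁺ λ p≤r →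
          r≢p (IsPartialOrder.≤-anti partialOrder r∈ p∈ (leq⁺ r∈ p∈ sub) p≤r))))) (not-true⁻ n)
    where
    r∈ : r ∈ E
    r∈ = ∈⁺ (↭-trans (↭-sym (Step-↭ s)) (proj₁ (∈⁻ q∈))) (proj₂ (∈⁻ p∈) ∘ sub)

  down∈ : ∀ {q p} → p ∈ E → Step q p → q ∈ E
  down∈ p∈ s = ∈⁺ (↭-trans (Step-↭ s) (proj₁ (∈⁻ p∈))) (proj₂ (∈⁻ p∈) ∘ Step-InvSub s)

  private
    filter⁻ : ∀ (f : List ℕ → Bool) {xs q} → q ∈ filterᵇ f xs → q ∈ xs × f q ≡ true
    filter⁻ f {xs} q∈ with a , t ← Mem.∈-filter⁻ (Bool.T? ∘ f) {xs = xs} q∈ = a , Equivalence.to Bool.T-≡ t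
    filter⁺ : ∀ (f : List ℕ → Bool) {xs q} → q ∈ xs → f q ≡ true → q ∈ filterᵇ f xs
    filter⁺ f q∈ t = Mem.∈-filter⁺ (Bool.T? ∘ f) q∈ (subst T (sym t) tt)

  lower-sum : ∀ {p} → p ∈ E → (g : List ℕ → ℕ) → ∑ E (λ q → ⟦ covers W q p ⟧ * g q) ≡ ∑ (downs p) g
  lower-sum {p} p∈ g = sym (∑-filterᵇ (λ q → covers W q p) E g) ∙ ∑-↭ g (unique-↭ (Unique.filter⁺ _ (IsPartialOrder.unique partialOrder)) (downs-unique p)
    (λ q∈ → let a , c = filter⁻ (λ q → covers W q p) q∈ in ∈-downs⁺ (covers⁻ a p∈ c))
    (λ q∈ → let s = ∈-downs⁻ p q∈ in filter⁺ _ (down∈ p∈ s) (covers⁺ (down∈ p∈ s) p∈ s)))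

  upper-sum : ∀ {p} → p ∈ E → (g : List ℕ → ℕ) → ∑ E (λ q → ⟦ covers W p q ⟧ * g q) ≡ ∑ (ups p) (λ q → ⟦ weakLe q w ⟧ * g q)
  upper-sum {p} p∈ g = sym (∑-filterᵇ (λ q → covers W p q) E g) ∙ ∑-↭ g (unique-↭ (Unique.filter⁺ _ (IsPartialOrder.unique partialOrder)) (Unique.filter⁺ _ (ups-unique p))
    (λ q∈ → let a , c = filter⁻ (λ q → covers W p q) q∈ in filter⁺ _ (∈-ups⁺ (covers⁻ p∈ a c)) (leq⁺ a w∈ (proj₂ (∈⁻ a))))
    (λ {q} q∈ → let a , c = filter⁻ (λ q → weakLe q w) q∈ ; s = ∈-ups⁻ p a ; i = ∈⁺ (↭-trans (↭-sym (Step-↭ s)) (proj₁ (∈⁻ p∈))) (leq⁻ {q} {w} c) in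
      filter⁺ _ i (covers⁺ p∈ i s)))
    ∙ ∑-filterᵇ (λ q → weakLe q w) (ups p) g

  downDeg-des : ∀ {p} → p ∈ E → downDeg W p ≡ des p
  downDeg-des {p} p∈ = count-∑ _ E ∙ ∑-cong E (λ q _ → sym (ℕ.*-identityʳ _)) ∙ lower-sum p∈ (λ _ → 1) ∙ ∑-downs p (λ _ → 1)

  private
    rank-0 : ∀ {p} → p ∈ E → inv p ≡ 0 → leq W p e ≡ true
    rank-0 p∈ i = leq⁺ p∈ e∈ (λ (q<p , b) → contradiction i (ℕ.>⇒≢ (positive q<p b)))
      where
      positive : ∀ {p q l} → q < p → Before p q l → 0 < inv l
      positive q<p (here q∈) = inv-pos [] _ q∈ q<p
      positive {l = a ∷ l} q<p (there b) = ℕ.≤-trans (positive q<p b) (ℕ.m≤n+m _ _)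

    rank-suc : ∀ {p k} → inv p ≡ suc k → leq W p e ≡ false
    rank-suc {p} i with leq W p e in l
    ... | false = refl
    ... | true with leq-strict {p} {e} l
    ...   | inj₁ refl = contradiction (sym i ∙ inv-e) (λ ())
    ...   | inj₂ p<e = contradiction (subst (inv p <_) inv-e p<e) (λ ())

    reducedWords-rec : ∀ {p} → p ∈ E → ∀ k → inv p ≡ k → reducedWords k p ≡ ⟦ leq W p e ⟧ + ∑ (downs p) (λ q → reducedWords (inv q) q)
    reducedWords-rec {p} p∈ zero i = base ∙ cong₂ _+_ (cong ⟦_⟧ (sym (rank-0 p∈ i))) (sym (∑-zero (downs p) (λ q q∈ → contradiction (sym (Step-inv (∈-downs⁻ p q∈)) ∙ i) (λ ()))))
      where
      base : heckeWords 0 p ≡ 1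
      base rewrite i = refl
    reducedWords-rec {p} p∈ (suc k) i = sym (∑-downs p (reducedWords k)) ∙ ∑-cong (downs p) (λ q q∈ → cong (λ j → reducedWords j q) (sym (Step-rank (∈-downs⁻ p q∈) i)))
      ∙ cong (_+ ∑ (downs p) (λ q → reducedWords (inv q) q)) (cong ⟦_⟧ (sym (rank-suc {p} i)))

    chainSum-rec : ∀ f {p} k → inv p ≡ k → chainSum f k p ≡ f p * reducedWords k p + ∑ (downs p) (λ q → chainSum f (inv q) q)
    chainSum-rec f {p} zero    i = sym (ℕ.+-identityʳ _) ∙ cong (f p * heckeWords 0 p +_) (sym (∑-zero (downs p) (λ q q∈ → contradiction (sym (Step-inv (∈-downs⁻ p q∈)) ∙ i) (λ ()))))
    chainSum-rec f {p} (suc k) i = cong (f p * reducedWords (suc k) p +_) (sym (∑-downs p (chainSum f k)) ∙ ∑-cong (downs p) (λ q q∈ → cong (λ j → chainSum f j q) (sym (Step-rank (∈-downs⁻ p q∈) i))))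

  -- `reducedWords` and `chainSum`, each taken at the rank of its argument, solve the two recursions
  -- of `through-sum`.
  through-chainSum : ∀ f → ∑ E (λ p → f p * numMaxChainsThrough W p) ≡ chainSum f (inv w) w
  through-chainSum f = through-sum W partialOrder inv (λ {x} {y} _ _ → inv-mono {x} {y}) w e w∈ e∈
    (λ x∈ → leq⁺ x∈ w∈ (proj₂ (∈⁻ x∈))) (λ x∈ → leq⁺ e∈ x∈ (λ i → ⊥-elim (no-inversions i)))
    f (λ p → reducedWords (inv p) p) (λ p → chainSum f (inv p) p)
    (λ {p} p∈ → reducedWords-rec p∈ (inv p) refl ∙ cong (⟦ leq W p e ⟧ +_) (sym (lower-sum p∈ (λ q → reducedWords (inv q) q))))
    (λ {p} p∈ → chainSum-rec f (inv p) refl ∙ cong (f p * reducedWords (inv p) p +_) (sym (lower-sum p∈ (λ q → chainSum f (inv q) q))))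

  EY-hecke : EY W ≡ frac (heckeWords (suc (inv w)) w) (suc (inv w) * heckeWords (inv w) w)
  EY-hecke = cong₂ frac
    (∑-cong E (λ p p∈ → cong (_* numMaxChainsThrough W p) (downDeg-des p∈)) ∙ through-chainSum des ∙ sym (heckeWords-next (inv w) w refl))
    (∑-cong E (λ p _ → sym (ℕ.+-identityʳ _)) ∙ through-chainSum (λ _ → 1) ∙ chainSum-1 (inv w) w ∙ cong (suc (inv w) *_) (sym (heckeWords-reduced (inv w) w refl)))

  -- Toggle symmetry: an inversion x < y of w is as often an ascent x y as a descent y x, both over
  -- the elements of the interval and over the elements of its maximal chains.
  module Toggle (γ : ℕ → ℕ → ℕ) (support : ∀ {x y} → x < y → ¬ Before y x w → γ x y ≡ 0) where
    open Weighted γ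
    open EdgeWeight γ

    upper-weight : ∀ {p} → p ∈ E → ∑ E (λ q → ⟦ covers W p q ⟧ * edgeWeight p q) ≡ ascents p
    upper-weight {p} p∈ = upper-sum p∈ (edgeWeight p) ∙ ∑-cong (ups p) (λ q q∈ → kept q (∈-ups⁻ p q∈)) ∙ ∑-ups-weight p
      where
      kept : ∀ q → Step p q → ⟦ weakLe q w ⟧ * edgeWeight p q ≡ edgeWeight p q
      kept q s with weakLe q w in l
      ... | true  = ℕ.+-identityʳ _
      -- A step that leaves the interval creates an inversion which w lacks, and γ is 0 there. So
      -- all ascents may be counted, whether or not they can be swapped within the interval.
      ... | false with x , y , x<y , e≡ , _ , f ← edgeWeight-Step s = sym (e≡ ∙ support x<y λ b → false≢true l
              (weakLe-complete w-unique (↭-trans (↭-sym (Step-↭ s)) (↭-trans (proj₁ (∈⁻ p∈)) (↭-sym w↭))) (sub b)))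
        where
        sub : Before y x w → InvSub q w
        sub b (j<i , c) = j<i , [ (λ c′ → proj₂ (proj₂ (∈⁻ p∈) (j<i , c′))) , (λ { (refl , refl) → b }) ]′ (f c)

    -- Both sides are the total γ-weight of the edges of the Hasse diagram.
    uniform : ∑ E ascents ≡ ∑ E descents
    uniform = ∑-cong E (λ p p∈ → sym (upper-weight p∈)) ∙ ∑-swap E E (λ p q → ⟦ covers W p q ⟧ * edgeWeight p q)
      ∙ ∑-cong E (λ q q∈ → lower-sum q∈ (λ p → edgeWeight p q) ∙ ∑-downs-weight q)

    maxChains-uniform : ∑ E (λ p → ascents p * numMaxChainsThrough W p) ≡ ∑ E (λ p → descents p * numMaxChainsThrough W p)
    maxChains-uniform = through-chainSum ascents ∙ chainSum-ascents γ (inv w) w w-unique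
      ∙ cong (chainSum descents (inv w) w +_) (bruhatUp-unsupported γ w _ (λ b x<y → support x<y (Before-asym w-unique b))) ∙ ℕ.+-identityʳ _ ∙ sym (through-chainSum descents)

  -- With the indicator of the inversions of w as γ, `ascents` is the up-degree within the interval
  -- and `descents` the down-degree, so toggle symmetry compares the two expectations.
  EY-dual : EY (dual W) ≡ EY W
  EY-dual = cong₂ frac
    (∑-cong E (λ p p∈ → cong₂ _*_ (upDeg p∈) (through-dual W p)) ∙ maxChains-uniform
      ∙ ∑-cong E (λ p p∈ → cong (_* numMaxChainsThrough W p) (descents-des p p∈ ∙ sym (downDeg-des p∈))))
    (∑-cong E (λ p _ → through-dual W p))
    where
    γ : ℕ → ℕ → ℕ
    γ x y = if ⌊ Before? y x w ⌋ then 1 else 0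
    γ-1 : ∀ {x y} → Before y x w → γ x y ≡ 1
    γ-1 {x} {y} b with Before? y x w
    ... | yes _ = refl
    ... | no ¬b = contradiction b ¬b
    γ-0 : ∀ {x y} → x < y → ¬ Before y x w → γ x y ≡ 0
    γ-0 {x} {y} _ ¬b with Before? y x w
    ... | yes b = contradiction b ¬b
    ... | no  _ = refl
    open Toggle γ γ-0
    open Weighted γ
    open EdgeWeight γ
    upDeg : ∀ {p} → p ∈ E → downDeg (dual W) p ≡ ascents p
    upDeg {p} p∈ = count-∑ _ E ∙ ∑-cong E (λ q q∈ → cong ⟦_⟧ (covers-dual W p q) ∙ full q q∈) ∙ upper-weight p∈
      where
      full : ∀ q → q ∈ E → ⟦ covers W p q ⟧ ≡ ⟦ covers W p q ⟧ * edgeWeight p q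
      full q q∈ with covers W p q in c
      ... | false = refl
      ... | true with x , y , x<y , e≡ , b , _ ← edgeWeight-Step (covers⁻ p∈ q∈ c) = sym (ℕ.+-identityʳ _ ∙ e≡ ∙ γ-1 (proj₂ (proj₂ (∈⁻ q∈) (x<y , b))))
    descents-des : ∀ p → p ∈ E → descents p ≡ des p
    descents-des p p∈ = go p (λ x<y b → γ-1 (proj₂ (proj₂ (∈⁻ p∈) (x<y , b))))
      where
      go : ∀ p → (∀ {x y} → x < y → Before y x p → γ x y ≡ 1) → descents p ≡ des p
      go []          h = refl
      go (a ∷ [])    h = refl
      go (a ∷ b ∷ l) h = cong₂ _+_ head (go (b ∷ l) (λ x<y c → h x<y (there c)))
        where
        head : headDescent a (b ∷ l) ≡ dropHead a (b ∷ l) (λ _ → 1)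
        head with b <ᵇ a in ba
        ... | true  = h (<ᵇ-sound {b} {a} ba) (here (here refl))
        ... | false = refl

-- Vexillary, Grassmannian and inverse Grassmannian permutations

indexOf-here : ∀ x l → indexOf x (x ∷ l) ≡ 0
indexOf-here x l rewrite eqL-refl {x ∷ []} refl = refl

indexOf-there : ∀ {v x} l → v ≢ x → indexOf v (x ∷ l) ≡ suc (indexOf v l)
indexOf-there {v} {x} l v≢x with eqL (v ∷ []) (x ∷ []) in e
... | true  = contradiction (List.∷-injectiveˡ (eqL-sound (v ∷ []) (x ∷ []) e)) v≢x
... | false = refl

at-indexOf : ∀ {v l} → v ∈ l → at l (indexOf v l) ≡ v
at-indexOf {v} {x ∷ l} v∈ with v ≟ x
... | yes refl = refl
... | no v≢x = at-indexOf (Any.tail v≢x v∈)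

indexOf-< : ∀ {v l} → v ∈ l → indexOf v l < length l
indexOf-< {v} {x ∷ l} v∈ with v ≟ x
... | yes refl = s≤s z≤n
... | no v≢x = s≤s (indexOf-< (Any.tail v≢x v∈))

indexOf-injective : ∀ {x y l} → x ∈ l → y ∈ l → indexOf x l ≡ indexOf y l → x ≡ y
indexOf-injective {l = l} x∈ y∈ e = sym (at-indexOf x∈) ∙ cong (at l) e ∙ at-indexOf y∈

Before-index : ∀ {x y l} → Unique l → Before x y l → indexOf x l < indexOf y l
Before-index {x} {y} {_ ∷ l} (x∉ ∷ u) (here y∈) rewrite indexOf-here x l | indexOf-there l (All.lookup x∉ y∈ ∘ sym) = s≤s z≤n
Before-index {x} {y} {a ∷ l} (a∉ ∷ u) (there b)
  rewrite indexOf-there l (All.lookup a∉ (Before-∈ˡ b) ∘ sym) | indexOf-there l (All.lookup a∉ (Before-∈ʳ b) ∘ sym) = s≤s (Before-index u b)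

index-Before : ∀ {x y l} → Unique l → x ∈ l → y ∈ l → indexOf x l < indexOf y l → Before x y l
index-Before u x∈ y∈ i<j with Before-total x∈ y∈ (λ { refl → ℕ.<-irrefl refl i<j })
... | inj₁ b = b
... | inj₂ b = contradiction (Before-index u b) (ℕ.<⇒≯ i<j)

at-∈ : ∀ {l i} → i < length l → at l i ∈ l
at-∈ {x ∷ l} {zero}  i<       = here refl
at-∈ {x ∷ l} {suc i} (s≤s i<) = there (at-∈ i<)

at-injective : ∀ {l i j} → Unique l → i < length l → j < length l → at l i ≡ at l j → i ≡ j
at-injective {x ∷ l} {zero}  {zero}  u        p       q       e = refl
at-injective {x ∷ l} {zero}  {suc j} (x∉ ∷ u) p       (s≤s q) e = contradiction e (All.lookup x∉ (at-∈ q))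
at-injective {x ∷ l} {suc i} {zero}  (x∉ ∷ u) (s≤s p) q       e = contradiction (sym e) (All.lookup x∉ (at-∈ p))
at-injective {x ∷ l} {suc i} {suc j} (x∉ ∷ u) (s≤s p) (s≤s q) e = cong suc (at-injective u p q e)

at-map : ∀ (f : ℕ → ℕ) l {i} → i < length l → at (map f l) i ≡ f (at l i)
at-map f (x ∷ l) {zero}  p       = refl
at-map f (x ∷ l) {suc i} (s≤s p) = at-map f l p

at-applyUpTo : ∀ (f : ℕ → ℕ) n {i} → i < n → at (applyUpTo f n) i ≡ f i
at-applyUpTo f (suc n) {zero}  p       = refl
at-applyUpTo f (suc n) {suc i} (s≤s p) = at-applyUpTo (f ∘ suc) n p

Inversion? : ∀ w p u → Dec (Inversion w p u)
Inversion? w p u with u <? p | Before? p u w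
... | yes a | yes b = yes (a , b)
... | no ¬a | _     = no (¬a ∘ proj₁)
... | _     | no ¬b = no (¬b ∘ proj₂)

-- If i comes before j and neither row contains the column of the other, then i u j t stand in this
-- order with u < i < t < j, which is a 2143 pattern.
vexillary-noCrossing : ∀ {w} → Unique w → Vexillary w → NoCrossing w
vexillary-noCrossing {w} uw vex {i} {j} {u} {t} iu jt with Inversion? w i t | Inversion? w j u
... | yes it | _      = inj₁ it
... | no _   | yes ju = inj₂ ju
... | no ¬it | no ¬ju = ⊥-elim ([ (λ b → forms-2143 iu jt ¬it ¬ju b) , (λ b → forms-2143 jt iu ¬ju ¬it b) ]′
        (Before-total (Before-∈ˡ (proj₂ iu)) (Before-∈ˡ (proj₂ jt)) (λ { refl → ¬it jt })))
  where
  irreflexive : ∀ {x} → ¬ Before x x w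
  irreflexive b = Before-asym uw b b
  forms-2143 : ∀ {i j u t} → Inversion w i u → Inversion w j t → ¬ Inversion w i t → ¬ Inversion w j u → ¬ Before i j w
  forms-2143 {i} {j} {u} {t} (u<i , iu) (t<j , jt) ¬it ¬ju ij = vex
      (indexOf i w , indexOf u w , indexOf j w , indexOf t w
      , Before-index uw iu , Before-index uw uj , Before-index uw jt , indexOf-< t∈
      , subst₃ (at-indexOf u∈) (at-indexOf i∈) u<i , subst₃ (at-indexOf i∈) (at-indexOf t∈) i<t , subst₃ (at-indexOf t∈) (at-indexOf j∈) t<j)
    where
    subst₃ : ∀ {a b c d} → a ≡ c → b ≡ d → c < d → a < b
    subst₃ refl refl p = p
    i∈ : i ∈ w
    i∈ = Before-∈ˡ iu
    u∈ : u ∈ w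
    u∈ = Before-∈ʳ iu
    j∈ : j ∈ w
    j∈ = Before-∈ˡ jt
    t∈ : t ∈ w
    t∈ = Before-∈ʳ jt
    it : Before i t w
    it = Before-trans uw ij jt
    i<t : i < t
    i<t = ℕ.≤∧≢⇒< (ℕ.≮⇒≥ (λ t<i → ¬it (t<i , it))) (λ { refl → irreflexive it })
    u<j : u < j
    u<j = ℕ.<-trans u<i (ℕ.<-trans i<t t<j)
    uj : Before u j w
    uj = [ id , (λ ju → ⊥-elim (¬ju (u<j , ju))) ]′ (Before-total u∈ j∈ (ℕ.<⇒≢ u<j))

single-descent : ∀ l → Grassmannian l → (∀ z → suc z < length l → at l z ≢ at l (suc z)) →
  ∃ λ i → ∀ x y → x < y → y < length l → ¬ (x ≤ i × i < y) → at l x < at l y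
single-descent l gr distinct with Any.any? (λ i → suc i <? length l ×-dec at l (suc i) <? at l i) (upTo (length l))
... | yes d with i , _ , di ← find d = i , λ x y x<y y< avoid → increasing x y x<y y< (λ z x≤z z<y dz → avoid (subst (λ j → x ≤ j × j < y) (gr z i dz di) (x≤z , z<y)))
  where
  increasing : ∀ x y → x < y → y < length l → (∀ z → x ≤ z → z < y → ¬ DescentAt l z) → at l x < at l y
  increasing x (suc y) (s≤s x≤y) y< nd with ℕ.m≤n⇒m<n∨m≡n x≤y
  ... | inj₁ x<y  = ℕ.<-trans (increasing x y x<y (ℕ.<-trans (ℕ.n<1+n y) y<) (λ z a b → nd z a (ℕ.<-trans b (ℕ.n<1+n y))))
                      (ℕ.≤∧≢⇒< (ℕ.≮⇒≥ (λ d → nd y x≤y ℕ.≤-refl (y< , d))) (distinct y y<))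
  ... | inj₂ refl = ℕ.≤∧≢⇒< (ℕ.≮⇒≥ (λ d → nd x ℕ.≤-refl ℕ.≤-refl (y< , d))) (distinct x y<)
-- Without a descent there is nothing to separate; the cut `length l` lies beyond all positions.
... | no ¬d = length l , λ x y x<y y< _ → increasing x y x<y y<
  where
  ascent : ∀ z → suc z < length l → at l z < at l (suc z)
  ascent z z< = ℕ.≤∧≢⇒< (ℕ.≮⇒≥ (λ d → ¬d (lose (Mem.∈-upTo⁺ (ℕ.<-trans (ℕ.n<1+n z) z<)) (z< , d)))) (distinct z z<)
  increasing : ∀ x y → x < y → y < length l → at l x < at l y
  increasing x (suc y) (s≤s x≤y) y< with ℕ.m≤n⇒m<n∨m≡n x≤y
  ... | inj₁ x<y  = ℕ.<-trans (increasing x y x<y (ℕ.<-trans (ℕ.n<1+n y) y<)) (ascent y y<)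
  ... | inj₂ refl = ascent x y<

-- Every inversion consists of a true entry before a false one. For an inverse Grassmannian
-- permutation the true entries are moreover the large ones, and for a Grassmannian permutation
-- they are the ones up to the descent.
record TwoColoured (c : ℕ → Bool) (w : List ℕ) : Set where
  field
    inversion-true  : ∀ {p u} → Inversion w p u → c p ≡ true
    inversion-false : ∀ {p u} → Inversion w p u → c u ≡ false

module _ {n : ℕ} {w : List ℕ} (w↭ : w ↭ upTo n) where

  private
    uw : Unique w
    uw = perm-unique w↭
    len : length w ≡ n
    len = Perm.↭-length w↭ ∙ List.length-upTo n
    ∈w : ∀ {x} → x < n → x ∈ w
    ∈w x<n = Perm.∈-resp-↭ (↭-sym w↭) (Mem.∈-upTo⁺ x<n)
    <n : ∀ {x} → x ∈ w → x < n
    <n x∈ = Mem.∈-upTo⁻ (Perm.∈-resp-↭ w↭ x∈)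
    length-inverse : length (inverse w) ≡ n
    length-inverse = List.length-map _ (upTo (length w)) ∙ List.length-upTo (length w) ∙ len
    at-inverse : ∀ {x} → x < n → at (inverse w) x ≡ indexOf x w
    at-inverse {x} x<n = at-map (λ v → indexOf v w) (upTo (length w)) (subst (x <_) (sym (List.length-upTo (length w) ∙ len)) x<n)
      ∙ cong (λ v → indexOf v w) (at-applyUpTo id (length w) (subst (x <_) (sym len) x<n))
    distinct : ∀ z → suc z < length (inverse w) → at (inverse w) z ≢ at (inverse w) (suc z)
    distinct z z< e = contradiction (indexOf-injective (∈w z<n) (∈w z+1<n) (sym (at-inverse z<n) ∙ e ∙ at-inverse z+1<n)) (ℕ.<⇒≢ (ℕ.n<1+n z))
      where
      z+1<n : suc z < n
      z+1<n = subst (suc z <_) length-inverse z<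
      z<n : z < n
      z<n = ℕ.<-trans (ℕ.n<1+n z) z+1<n

  grassmannian-colours : Grassmannian w → ∃ λ c → TwoColoured c w × (∀ {x y} → x ∈ w → y ∈ w → c y ≡ true → c x ≡ false → Before y x w)
  grassmannian-colours gr with i , inc ← single-descent w gr (λ z z< e → contradiction (at-injective uw (ℕ.<-trans (ℕ.n<1+n z) z<) z< e) (ℕ.<⇒≢ (ℕ.n<1+n z))) =
    c , record { inversion-true = λ {p} iv → <ᵇ-true {indexOf p w} {suc i} (s≤s (proj₁ (crossing iv))) ; inversion-false = λ {p} {u} iv → <ᵇ-false {indexOf u w} {suc i} (ℕ.<⇒≱ (s≤s (proj₂ (crossing iv)))) }
    , λ {x} {y} x∈ y∈ cy cx → index-Before uw y∈ x∈ (ℕ.<-≤-trans (<ᵇ-sound {indexOf y w} {suc i} cy) (ℕ.≮⇒≥ (<ᵇ-unsound {indexOf x w} {suc i} cx)))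
    where
    c : ℕ → Bool
    c y = indexOf y w <ᵇ suc i
    crossing : ∀ {p u} → Inversion w p u → indexOf p w ≤ i × i < indexOf u w
    crossing {p} {u} (u<p , b) with indexOf p w ≤? i | i <? indexOf u w
    ... | yes a | yes a′ = a , a′
    ... | no ¬a | _      = contradiction (below (¬a ∘ proj₁)) (ℕ.<⇒≯ u<p)
      where
      below : ¬ (indexOf p w ≤ i × i < indexOf u w) → p < u
      below n = subst₂ _<_ (at-indexOf (Before-∈ˡ b)) (at-indexOf (Before-∈ʳ b)) (inc _ _ (Before-index uw b) (indexOf-< (Before-∈ʳ b)) n)
    ... | yes _ | no ¬a  = contradiction (subst₂ _<_ (at-indexOf (Before-∈ˡ b)) (at-indexOf (Before-∈ʳ b)) (inc _ _ (Before-index uw b) (indexOf-< (Before-∈ʳ b)) (¬a ∘ proj₂))) (ℕ.<⇒≯ u<p)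

  inverseGrassmannian-colours : InverseGrassmannian w → ∃ λ c → TwoColoured c w × (∀ {x y} → c y ≡ true → c x ≡ false → x < y)
  inverseGrassmannian-colours gr with i , inc ← single-descent (inverse w) gr distinct =
    c , record { inversion-true = λ iv → <ᵇ-true {i} (proj₂ (crossing iv)) ; inversion-false = λ {p} {u} iv → <ᵇ-false {i} {u} (ℕ.≤⇒≯ (proj₁ (crossing iv))) }
    , λ {x} {y} cy cx → ℕ.≤-<-trans (ℕ.≮⇒≥ (<ᵇ-unsound {i} {x} cx)) (<ᵇ-sound {i} {y} cy)
    where
    c : ℕ → Bool
    c y = i <ᵇ y
    crossing : ∀ {p u} → Inversion w p u → u ≤ i × i < p
    crossing {p} {u} (u<p , b) with u ≤? i | i <? p
    ... | yes a | yes a′ = a , a′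
    ... | no ¬a | _      = contradiction (below (¬a ∘ proj₁)) (ℕ.<⇒≯ (Before-index uw b))
      where
      below : ¬ (u ≤ i × i < p) → indexOf u w < indexOf p w
      below n = subst₂ _<_ (at-inverse (<n (Before-∈ʳ b))) (at-inverse (<n (Before-∈ˡ b))) (inc u p u<p (subst (p <_) (sym length-inverse) (<n (Before-∈ˡ b))) n)
    ... | yes _ | no ¬a  = contradiction (subst₂ _<_ (at-inverse (<n (Before-∈ʳ b))) (at-inverse (<n (Before-∈ˡ b))) (inc u p u<p (subst (p <_) (sym length-inverse) (<n (Before-∈ˡ b))) (¬a ∘ proj₂))) (ℕ.<⇒≯ (Before-index uw b))

-- Adding fixed points

demazure-∷ʳ : ∀ v {z} (k : List ℕ → ℕ) → All (_< z) v → Down.demazure (v ++ [ z ]) k ≡ Down.demazure v (λ l → k (l ++ [ z ]))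
demazure-∷ʳ []          k []       = refl
demazure-∷ʳ (a ∷ [])    {z} k (a<z ∷ []) rewrite <ᵇ-false {z} {a} (ℕ.<⇒≯ a<z) = refl
demazure-∷ʳ (a ∷ b ∷ v) {z} k (_ ∷ ps) = cong (Down.swapHead a (b ∷ v) (λ l → k (l ++ [ z ])) +_) (demazure-∷ʳ (b ∷ v) (λ l → k (a ∷ l)) ps)

lehmer-∷ʳ : ∀ v {z} → All (_< z) v → lehmer (v ++ [ z ]) ≡ lehmer v ++ [ 0 ]
lehmer-∷ʳ []      []       = refl
lehmer-∷ʳ (a ∷ v) {z} (a<z ∷ ps) = cong₂ _∷_ (count-++ _ v [ z ] ∙ cong (smaller a v +_) (smaller-∷-≮ [] (ℕ.<⇒≯ a<z)) ∙ ℕ.+-identityʳ _) (lehmer-∷ʳ v ps)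

heckeWords-∷ʳ : ∀ k v {z} → All (_< z) v → heckeWords k (v ++ [ z ]) ≡ heckeWords k v
heckeWords-∷ʳ zero    v ps rewrite lehmer-∷ʳ v ps | sum-++ (lehmer v) [ 0 ] | ℕ.+-identityʳ (inv v) = refl
heckeWords-∷ʳ (suc k) v ps = demazure-∷ʳ v (heckeWords k) ps ∙ Down.demazure-cong v (λ l p → heckeWords-∷ʳ k l (Perm.All-resp-↭ (↭-sym p) ps))

noCrossing-∷ʳ : ∀ v {z} → All (_< z) v → NoCrossing v → NoCrossing (v ++ [ z ])
noCrossing-∷ʳ v {z} ps nc iu jt = [ inj₁ ∘ lift , inj₂ ∘ lift ]′ (nc (lower iu) (lower jt))
  where
  lift : ∀ {p u} → Inversion v p u → Inversion (v ++ [ z ]) p u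
  lift (u<p , b) = u<p , Before-++ˡ b
  lower : ∀ {p u} → Inversion (v ++ [ z ]) p u → Inversion v p u
  lower (u<p , b) with Before-++⁻ v b
  ... | inj₁ b′                     = u<p , b′
  ... | inj₂ (inj₁ (p∈ , here refl)) = contradiction u<p (ℕ.<⇒≯ (All.lookup ps p∈))
  ... | inj₂ (inj₂ (here ()))
  ... | inj₂ (inj₂ (there ()))

-- Fixed points bring w into a larger symmetric group, in which there is also room for an inverse
-- Grassmannian permutation with the same code up to order.
extend : ℕ → List ℕ → ℕ → List ℕ
extend n w zero    = w
extend n w (suc m) = extend n w m ++ [ n + m ]

module _ {n : ℕ} {w : List ℕ} (w↭ : w ↭ upTo n) where

  extend-↭ : ∀ m → extend n w m ↭ upTo (n + m)
  extend-↭ zero    = subst (λ k → w ↭ upTo k) (sym (ℕ.+-identityʳ n)) w↭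
  extend-↭ (suc m) = ↭-trans (Perm.++⁺ʳ [ n + m ] (extend-↭ m)) (↭-reflexive (List.upTo-∷ʳ (n + m) ∙ cong upTo (sym (ℕ.+-suc n m))))

  extend-< : ∀ m → All (_< n + m) (extend n w m)
  extend-< m = Perm.All-resp-↭ (↭-sym (extend-↭ m)) (All.tabulate Mem.∈-upTo⁻)

  heckeWords-extend : ∀ m k → heckeWords k (extend n w m) ≡ heckeWords k w
  heckeWords-extend zero    k = refl
  heckeWords-extend (suc m) k = heckeWords-∷ʳ k (extend n w m) (extend-< m) ∙ heckeWords-extend m k

  lehmer-extend : ∀ m → lehmer (extend n w m) ↭ lehmer w ++ replicate m 0
  lehmer-extend zero    = ↭-reflexive (sym (List.++-identityʳ (lehmer w)))
  lehmer-extend (suc m) = ↭-trans (↭-reflexive (lehmer-∷ʳ (extend n w m) (extend-< m)))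
    (↭-trans (Perm.++⁺ʳ [ 0 ] (lehmer-extend m)) (↭-trans (↭-reflexive (List.++-assoc (lehmer w) (replicate m 0) [ 0 ])) (Perm.++⁺ˡ (lehmer w) (↭-sym (Perm.∷↭∷ʳ 0 (replicate m 0))))))

  noCrossing-extend : ∀ m → NoCrossing w → NoCrossing (extend n w m)
  noCrossing-extend zero    nc = nc
  noCrossing-extend (suc m) nc = noCrossing-∷ʳ (extend n w m) (extend-< m) (noCrossing-extend m nc)

-- Lower intervals of Young's lattice

weaklyDecr-sound : ∀ l → weaklyDecr l ≡ true → Decreasing l
weaklyDecr-sound []          e = []
weaklyDecr-sound (x ∷ [])    e = [] ∷ []
weaklyDecr-sound (x ∷ y ∷ l) e = extend-decreasing (weaklyDecr-sound (y ∷ l) (proj₂ both))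
  where
  both : (y ≤ᵇ x) ≡ true × weaklyDecr (y ∷ l) ≡ true
  both = ∧-true⁻ e
  y≤x : y ≤ x
  y≤x = ℕ.≤ᵇ⇒≤ y x (Equivalence.from Bool.T-≡ (proj₁ both))
  extend-decreasing : Decreasing (y ∷ l) → Decreasing (x ∷ y ∷ l)
  extend-decreasing (q ∷ qs) = (y≤x ∷ All.map (λ z≤y → ℕ.≤-trans z≤y y≤x) q) ∷ q ∷ qs

weaklyDecr-complete : ∀ {l} → Decreasing l → weaklyDecr l ≡ true
weaklyDecr-complete []                     = refl
weaklyDecr-complete ([] ∷ [])              = refl
weaklyDecr-complete ((y≤x ∷ _) ∷ d@(_ ∷ _)) = ∧-true⁺ (Equivalence.to Bool.T-≡ (ℕ.≤⇒≤ᵇ y≤x)) (weaklyDecr-complete d)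

pointwiseLe-sound : ∀ l m → pointwiseLe l m ≡ true → Pointwise _≤_ l m
pointwiseLe-sound []      []      e = []
pointwiseLe-sound (x ∷ l) (y ∷ m) e with a , b ← ∧-true⁻ {x ≤ᵇ y} e = ℕ.≤ᵇ⇒≤ x y (Equivalence.from Bool.T-≡ a) ∷ pointwiseLe-sound l m b

pointwiseLe-complete : ∀ {l m} → Pointwise _≤_ l m → pointwiseLe l m ≡ true
pointwiseLe-complete []       = refl
pointwiseLe-complete (p ∷ ps) = ∧-true⁺ (Equivalence.to Bool.T-≡ (ℕ.≤⇒≤ᵇ p)) (pointwiseLe-complete ps)

boxes-sound : ∀ ν {μ} → μ ∈ boxes ν → Pointwise _≤_ μ ν
boxes-sound []      (here refl) = []
boxes-sound (l ∷ ν) μ∈ with m , m∈ , i ← find (Mem.∈-concatMap⁻ (λ m → map (m ∷_) (boxes ν)) {xs = upTo (suc l)} μ∈)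
  with μ′ , μ′∈ , refl ← Mem.∈-map⁻ (m ∷_) i = s≤s⁻¹ (Mem.∈-upTo⁻ m∈) ∷ boxes-sound ν μ′∈

boxes-complete : ∀ {μ ν} → Pointwise _≤_ μ ν → μ ∈ boxes ν
boxes-complete []       = here refl
boxes-complete {m ∷ μ} {l ∷ ν} (p ∷ ps) = Mem.∈-concatMap⁺ (λ m → map (m ∷_) (boxes ν)) {xs = upTo (suc l)} (lose (Mem.∈-upTo⁺ (s≤s p)) (Mem.∈-map⁺ (m ∷_) (boxes-complete ps)))

boxes-unique : ∀ ν → Unique (boxes ν)
boxes-unique []      = [] ∷ []
boxes-unique (l ∷ ν) = Unique.concat⁺ (All.map⁺ (All.tabulate λ _ → Unique.map⁺ List.∷-injectiveʳ (boxes-unique ν)))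
    (AllPairs.map⁺ (AllPairs.map disjoint (Unique.upTo⁺ (suc l))))
  where
  disjoint : ∀ {m k} → m ≢ k → Disjoint (map (m ∷_) (boxes ν)) (map (k ∷_) (boxes ν))
  disjoint {m} {k} m≢k (i , j) = let _ , _ , e = Mem.∈-map⁻ (m ∷_) i ; _ , _ , e′ = Mem.∈-map⁻ (k ∷_) j in m≢k (List.∷-injectiveˡ (sym e ∙ e′))

∈-young⁻ : ∀ ν {μ} → μ ∈ elems (YoungInterval ν) → Decreasing μ × Pointwise _≤_ μ ν
∈-young⁻ ν {μ} μ∈ with a , t ← Mem.∈-filter⁻ (Bool.T? ∘ weaklyDecr) {xs = boxes ν} μ∈ = weaklyDecr-sound μ (Equivalence.to Bool.T-≡ t) , boxes-sound ν a

∈-young⁺ : ∀ {ν μ} → Decreasing μ → Pointwise _≤_ μ ν → μ ∈ elems (YoungInterval ν)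
∈-young⁺ d p = Mem.∈-filter⁺ (Bool.T? ∘ weaklyDecr) (boxes-complete p) (Equivalence.from Bool.T-≡ (weaklyDecr-complete d))

young-unique : ∀ ν → Unique (elems (YoungInterval ν))
young-unique ν = Unique.filter⁺ _ (boxes-unique ν)

Pointwise-antisym : ∀ {l m} → Pointwise _≤_ l m → Pointwise _≤_ m l → l ≡ m
Pointwise-antisym []       []       = refl
Pointwise-antisym (p ∷ ps) (q ∷ qs) = cong₂ _∷_ (ℕ.≤-antisym p q) (Pointwise-antisym ps qs)

Pointwise-refl : ∀ l → Pointwise _≤_ l l
Pointwise-refl []      = []
Pointwise-refl (x ∷ l) = ℕ.≤-refl ∷ Pointwise-refl l

Pointwise-trans : ∀ {l m k} → Pointwise _≤_ l m → Pointwise _≤_ m k → Pointwise _≤_ l k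
Pointwise-trans []       []       = []
Pointwise-trans (p ∷ ps) (q ∷ qs) = ℕ.≤-trans p q ∷ Pointwise-trans ps qs

young-partialOrder : ∀ ν → IsPartialOrder (YoungInterval ν)
young-partialOrder ν = record
  { unique  = young-unique ν
  ; ≤-refl  = λ {x} _ → pointwiseLe-complete (Pointwise-refl x)
  ; ≤-anti  = λ {x} {y} _ _ a b → Pointwise-antisym (pointwiseLe-sound x y a) (pointwiseLe-sound y x b)
  ; ≤-trans = λ {x} {y} {z} _ _ _ a b → pointwiseLe-complete (Pointwise-trans (pointwiseLe-sound x y a) (pointwiseLe-sound y z b)) }

dual-partialOrder : ∀ {P} → IsPartialOrder P → IsPartialOrder (dual P)
dual-partialOrder po = record { unique = unique ; ≤-refl = ≤-refl ; ≤-anti = λ x∈ y∈ a b → ≤-anti x∈ y∈ b a ; ≤-trans = λ x∈ y∈ z∈ a b → ≤-trans z∈ y∈ x∈ b a }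
  where open IsPartialOrder po

map-unique : (f : X → Y) (xs : List X) → Unique xs → (∀ {x y} → x ∈ xs → y ∈ xs → f x ≡ f y → x ≡ y) → Unique (map f xs)
map-unique f []       []       inj = []
map-unique f (x ∷ xs) (x∉ ∷ u) inj = All.map⁺ (All.tabulate (λ y∈ e → All.lookup x∉ y∈ (inj (here refl) (there y∈) e))) ∷ map-unique f xs u (λ a b → inj (there a) (there b))

-- An order embedding is injective by antisymmetry, so the image and the list of partitions are both
-- free of duplicates and can be compared as sets.
≅-young : (P : FinPoset) → IsPartialOrder P → (ν : List ℕ) (to : Carrier P → List ℕ) →
  (∀ {p} → p ∈ elems P → Decreasing (to p) × Pointwise _≤_ (to p) ν) →
  (∀ {p q} → p ∈ elems P → q ∈ elems P → leq P p q ≡ true → Pointwise _≤_ (to p) (to q)) →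
  (∀ {p q} → p ∈ elems P → q ∈ elems P → Pointwise _≤_ (to p) (to q) → leq P p q ≡ true) →
  (∀ {μ} → Decreasing μ → Pointwise _≤_ μ ν → ∃ λ p → p ∈ elems P × to p ≡ μ) →
  P ≅ YoungInterval ν
≅-young P po ν to inside mono reflect surj = record
  { to = to
  ; elems↭ = unique-↭ (map-unique to (elems P) unique injective) (young-unique ν)
      (λ x∈ → let p , p∈ , e = Mem.∈-map⁻ to x∈ ; d , l = inside p∈ in subst (_∈ elems (YoungInterval ν)) (sym e) (∈-young⁺ d l))
      (λ x∈ → let d , l = ∈-young⁻ ν x∈ ; p , p∈ , e = surj d l in subst (_∈ map to (elems P)) e (Mem.∈-map⁺ to p∈))
  ; leq≡ = λ {p} {q} p∈ q∈ → Bool-ext (λ l → pointwiseLe-complete (mono p∈ q∈ l)) (λ l → reflect p∈ q∈ (pointwiseLe-sound (to p) (to q) l)) }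
  where
  open IsPartialOrder po
  injective : ∀ {x y} → x ∈ elems P → y ∈ elems P → to x ≡ to y → x ≡ y
  injective {x} {y} x∈ y∈ e = ≤-anti x∈ y∈ (reflect x∈ y∈ (subst (Pointwise _≤_ (to x)) e (Pointwise-refl (to x)))) (reflect y∈ x∈ (subst (λ l → Pointwise _≤_ l (to x)) e (Pointwise-refl (to x))))

zeros : ℕ → List ℕ
zeros j = replicate j 0

-- Codes contain zeros, which `shape` drops. A part bounded by 0 has only one possible value, so the
-- interval does not change.
young-zeros : ∀ λ′ j → YoungInterval λ′ ≅ YoungInterval (λ′ ++ zeros j)
young-zeros λ′ j = ≅-young (YoungInterval λ′) (young-partialOrder λ′) (λ′ ++ zeros j) (_++ zeros j)
    (λ p∈ → let d , l = ∈-young⁻ λ′ p∈ in pad-decreasing d , pad l)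
    (λ {p} {q} _ _ l → pad (pointwiseLe-sound p q l))
    (λ {p} {q} _ _ l → pointwiseLe-complete (unpad p q l))
    (λ {μ} d l → let κ , e , l′ = split λ′ μ l in κ , ∈-young⁺ (prefix κ (subst Decreasing e d)) l′ , sym e)
  where
  pad : ∀ {l m} → Pointwise _≤_ l m → Pointwise _≤_ (l ++ zeros j) (m ++ zeros j)
  pad []       = Pointwise-refl (zeros j)
  pad (p ∷ ps) = p ∷ pad ps
  unpad : ∀ l m → Pointwise _≤_ (l ++ zeros j) (m ++ zeros j) → Pointwise _≤_ l m
  unpad []      []      ps       = []
  unpad []      (y ∷ m) ps       = contradiction (Pointwise.Pointwise-length ps) (ℕ.<⇒≢ (s≤s (ℕ.≤-trans (ℕ.m≤n+m _ (length m)) (ℕ.≤-reflexive (sym (List.length-++ m))))))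
  unpad (x ∷ l) []      ps       = contradiction (sym (Pointwise.Pointwise-length ps)) (ℕ.<⇒≢ (s≤s (ℕ.≤-trans (ℕ.m≤n+m _ (length l)) (ℕ.≤-reflexive (sym (List.length-++ l))))))
  unpad (x ∷ l) (y ∷ m) (p ∷ ps) = p ∷ unpad l m ps
  pad-decreasing : ∀ {l} → Decreasing l → Decreasing (l ++ zeros j)
  pad-decreasing []       = zeros-decreasing j
    where
    zeros-decreasing : ∀ j → Decreasing (zeros j)
    zeros-decreasing zero    = []
    zeros-decreasing (suc j) = All.replicate⁺ j z≤n ∷ zeros-decreasing j
  pad-decreasing (p ∷ d) = All.++⁺ p (All.replicate⁺ j z≤n) ∷ pad-decreasing d
  prefix : ∀ l {m} → Decreasing (l ++ m) → Decreasing l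
  prefix []      d       = []
  prefix (x ∷ l) (p ∷ d) = All.++⁻ˡ l p ∷ prefix l d
  split : ∀ λ″ μ → Pointwise _≤_ μ (λ″ ++ zeros j) → ∃ λ κ → μ ≡ κ ++ zeros j × Pointwise _≤_ κ λ″
  split []       μ ps = [] , all-zero j ps , []
    where
    all-zero : ∀ j {μ} → Pointwise _≤_ μ (zeros j) → μ ≡ zeros j
    all-zero zero    []         = refl
    all-zero (suc j) (z≤n ∷ ps) = cong (0 ∷_) (all-zero j ps)
  split (x ∷ λ″) (m ∷ μ) (p ∷ ps) with κ , e , qs ← split λ″ μ ps = m ∷ κ , cong (m ∷_) e , p ∷ qs

nonzero : List ℕ → List ℕ
nonzero = filterᵇ (0 <ᵇ_)

nonzero-zeros : ∀ j → nonzero (zeros j) ≡ []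
nonzero-zeros zero    = refl
nonzero-zeros (suc j) = nonzero-zeros j

nonzero-decreasing : ∀ {ν} → Decreasing ν → Decreasing (nonzero ν)
nonzero-decreasing = AllPairs.filter⁺ _

decreasing-zeros : ∀ {ν} → Decreasing ν → ∃ λ j → ν ≡ nonzero ν ++ zeros j
decreasing-zeros []                = 0 , refl
decreasing-zeros {suc x ∷ ν} (p ∷ d) with j , e ← decreasing-zeros d = j , cong (suc x ∷_) e
decreasing-zeros {zero ∷ ν}  (p ∷ d) = suc (length ν) , cong (0 ∷_) (all-zero ν p) ∙ cong (_++ 0 ∷ zeros (length ν)) (sym (cong nonzero (all-zero ν p) ∙ nonzero-zeros (length ν)))
  where
  all-zero : ∀ ν → All (_≤ 0) ν → ν ≡ zeros (length ν)
  all-zero []      []         = refl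
  all-zero (x ∷ ν) (z≤n ∷ ps) = cong (0 ∷_) (all-zero ν ps)

young-nonzero : ∀ {ν} → Decreasing ν → YoungInterval (nonzero ν) ≅ YoungInterval ν
young-nonzero {ν} d with j , e ← decreasing-zeros d = subst (λ l → YoungInterval (nonzero ν) ≅ YoungInterval l) (sym e) (young-zeros (nonzero ν) j)

insertDecr-↭ : ∀ x l → insertDecr x l ↭ x ∷ l
insertDecr-↭ x []      = refl
insertDecr-↭ x (y ∷ l) with y ≤ᵇ x
... | true  = refl
... | false = ↭-trans (prep y (insertDecr-↭ x l)) (↭-swap y x refl)

sortDecr-↭ : ∀ l → sortDecr l ↭ l
sortDecr-↭ []      = refl
sortDecr-↭ (x ∷ l) = ↭-trans (insertDecr-↭ x (sortDecr l)) (prep x (sortDecr-↭ l))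

insertDecr-decreasing : ∀ x {l} → Decreasing l → Decreasing (insertDecr x l)
insertDecr-decreasing x []      = [] ∷ []
insertDecr-decreasing x {y ∷ l} (p ∷ d) with y ≤ᵇ x in yx
... | true  = (y≤x ∷ All.map (λ z≤y → ℕ.≤-trans z≤y y≤x) p) ∷ p ∷ d
  where
  y≤x : y ≤ x
  y≤x = ℕ.≤ᵇ⇒≤ y x (Equivalence.from Bool.T-≡ yx)
... | false = Perm.All-resp-↭ (↭-sym (insertDecr-↭ x l)) (x≤y ∷ p) ∷ insertDecr-decreasing x d
  where
  x≤y : x ≤ y
  x≤y = ℕ.≰⇒≥ (λ y≤x → false≢true yx (Equivalence.to Bool.T-≡ (ℕ.≤⇒≤ᵇ y≤x)))

sortDecr-decreasing : ∀ l → Decreasing (sortDecr l)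
sortDecr-decreasing []      = []
sortDecr-decreasing (x ∷ l) = insertDecr-decreasing x (sortDecr-decreasing l)

shape-nonzero : ∀ {w ν} j → lehmer w ↭ ν ++ zeros j → Decreasing ν → shape w ≡ nonzero ν
shape-nonzero {w} {ν} j p d = Decreasing-↭-≡ (nonzero-decreasing (sortDecr-decreasing (lehmer w))) (nonzero-decreasing d)
  (↭-trans (Perm.filter-↭ _ (↭-trans (sortDecr-↭ (lehmer w)) p)) (↭-reflexive (List.filter-++ _ ν (zeros j) ∙ cong (nonzero ν ++_) (nonzero-zeros j) ∙ List.++-identityʳ _)))

-- Two-coloured words as lattice paths

Before-snoc : ∀ {x y} l → x ∈ l → Before x y (l ++ [ y ])
Before-snoc l x∈ = Before-across x∈ (here refl)

Before-reverse : ∀ {x y l} → Before x y l → Before y x (reverse l)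
Before-reverse {x} {y} {_ ∷ l} (here y∈) rewrite List.unfold-reverse x l = Before-snoc (reverse l) (Any.reverse⁺ y∈)
Before-reverse {x} {y} {a ∷ l} (there b) rewrite List.unfold-reverse a l = Before-++ˡ (Before-reverse b)

Before-unreverse : ∀ {x y} l → Before x y (reverse l) → Before y x l
Before-unreverse l b = subst (Before _ _) (List.reverse-involutive l) (Before-reverse b)

AllPairs-Before : ∀ {R : ℕ → ℕ → Set} {l x y} → AllPairs R l → Before x y l → R x y
AllPairs-Before (p ∷ ps) (here y∈) = All.lookup p y∈
AllPairs-Before (p ∷ ps) (there b) = AllPairs-Before ps b

∈-filterᵇ⁻ : (f : X → Bool) {l : List X} {x : X} → x ∈ filterᵇ f l → x ∈ l × f x ≡ true
∈-filterᵇ⁻ f {l} x∈ with a , t ← Mem.∈-filter⁻ (Bool.T? ∘ f) {xs = l} x∈ = a , Equivalence.to Bool.T-≡ t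

∈-filterᵇ⁺ : (f : X → Bool) {l : List X} {x : X} → x ∈ l → f x ≡ true → x ∈ filterᵇ f l
∈-filterᵇ⁺ f x∈ t = Mem.∈-filter⁺ (Bool.T? ∘ f) x∈ (Equivalence.from Bool.T-≡ t)

filterᵇ-true : (f : X → Bool) (x : X) (l : List X) → f x ≡ true → filterᵇ f (x ∷ l) ≡ x ∷ filterᵇ f l
filterᵇ-true f x l e rewrite e = refl

filterᵇ-false : (f : X → Bool) (x : X) (l : List X) → f x ≡ false → filterᵇ f (x ∷ l) ≡ filterᵇ f l
filterᵇ-false f x l e rewrite e = refl

filterᵇ-Before : ∀ (f : ℕ → Bool) {l x y} → Before x y l → f x ≡ true → f y ≡ true → Before x y (filterᵇ f l)
filterᵇ-Before f {x ∷ l} (here y∈) fx fy rewrite filterᵇ-true f x l fx = here (∈-filterᵇ⁺ f y∈ fy)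
filterᵇ-Before f {a ∷ l} (there b) fx fy with f a
... | true  = there (filterᵇ-Before f b fx fy)
... | false = filterᵇ-Before f b fx fy

filterᵇ-AllPairs : ∀ (f : ℕ → Bool) {R : ℕ → ℕ → Set} l → (∀ {x y} → Before x y l → f x ≡ true → f y ≡ true → R x y) → AllPairs R (filterᵇ f l)
filterᵇ-AllPairs f []      h = []
filterᵇ-AllPairs f (a ∷ l) h with f a in fa
... | true  = All.tabulate (λ y∈ → let y∈l , fy = ∈-filterᵇ⁻ f y∈ in h (here y∈l) fa fy) ∷ filterᵇ-AllPairs f l (λ b → h (there b))
... | false = filterᵇ-AllPairs f l (λ b → h (there b))

unique-⊆-length : {xs ys : List X} → Unique xs → (∀ {x} → x ∈ xs → x ∈ ys) → length xs ≤ length ys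
unique-⊆-length []       sub = z≤n
unique-⊆-length {xs = x ∷ xs} (x∉ ∷ u) sub with P , Q , refl ← Mem.∈-∃++ (sub (here refl)) =
  ℕ.≤-trans (s≤s (unique-⊆-length u (λ {y} y∈ → rest (All.lookup x∉ y∈) (Mem.∈-++⁻ P (sub (there y∈)))))) (ℕ.≤-reflexive (sym (Perm.↭-length (Perm.shift x P Q))))
  where
  rest : ∀ {y} → x ≢ y → y ∈ P ⊎ y ∈ x ∷ Q → y ∈ P ++ Q
  rest x≢y (inj₁ i)           = Mem.∈-++⁺ˡ i
  rest x≢y (inj₂ (here e))    = contradiction (sym e) x≢y
  rest x≢y (inj₂ (there i))   = Mem.∈-++⁺ʳ P i

suffix-∈ : {x : X} (A₁ {A₂} B₁ {B₂} : List X) → A₁ ++ A₂ ≡ B₁ ++ B₂ → length A₂ ≤ length B₂ → x ∈ A₂ → x ∈ B₂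
suffix-∈ A₁       []       e le x∈ = subst (_ ∈_) e (Mem.∈-++⁺ʳ A₁ x∈)
suffix-∈ (a ∷ A₁) (b ∷ B₁) e le x∈ = suffix-∈ A₁ B₁ (List.∷-injectiveʳ e) le x∈
suffix-∈ []       (b ∷ B₁) refl le x∈ = contradiction le (ℕ.<⇒≱ (s≤s (ℕ.≤-trans (ℕ.m≤n+m _ (length B₁)) (ℕ.≤-reflexive (sym (List.length-++ B₁))))))

Before-mid : ∀ {x y} P {Q} → Unique (P ++ y ∷ Q) → Before y x (P ++ y ∷ Q) → x ∈ Q
Before-mid {x} {y} P {Q} u b with y∉ ∷ _ ← Unique-↭ (Perm.shift y P Q) u with Before-++⁻ P b
... | inj₁ b′                 = contradiction refl (All.lookup y∉ (Mem.∈-++⁺ˡ (Before-∈ˡ b′)))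
... | inj₂ (inj₁ (y∈ , _))    = contradiction refl (All.lookup y∉ (Mem.∈-++⁺ˡ y∈))
... | inj₂ (inj₂ (here x∈))   = x∈
... | inj₂ (inj₂ (there b′))  = contradiction refl (All.lookup y∉ (Mem.∈-++⁺ʳ P (Before-∈ˡ b′)))

Pointwise-map⁻ : (f g : ℕ → ℕ) (l : List ℕ) → Pointwise _≤_ (map f l) (map g l) → ∀ {y} → y ∈ l → f y ≤ g y
Pointwise-map⁻ f g (x ∷ l) (p ∷ ps) (here refl) = p
Pointwise-map⁻ f g (x ∷ l) (p ∷ ps) (there y∈)  = Pointwise-map⁻ f g l ps y∈

Pointwise-map⁺ : (f g : ℕ → ℕ) (l : List ℕ) → (∀ {y} → y ∈ l → f y ≤ g y) → Pointwise _≤_ (map f l) (map g l)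
Pointwise-map⁺ f g []      h = []
Pointwise-map⁺ f g (x ∷ l) h = h (here refl) ∷ Pointwise-map⁺ f g l (λ y∈ → h (there y∈))

module Coloured (c : ℕ → Bool) where

  trues falses : List ℕ → List ℕ
  trues  = filterᵇ c
  falses = filterᵇ (not ∘ c)

  not-false⁺ : ∀ {x} → c x ≡ false → (not ∘ c) x ≡ true
  not-false⁺ e = cong not e

  not-false⁻ : ∀ {x} → (not ∘ c) x ≡ true → c x ≡ false
  not-false⁻ {x} e with c x
  ... | false = refl

  falses-true : ∀ x l → c x ≡ true → falses (x ∷ l) ≡ falses l
  falses-true x l e = filterᵇ-false (not ∘ c) x l (cong not e)

  falses-false : ∀ x l → c x ≡ false → falses (x ∷ l) ≡ x ∷ falses l
  falses-false x l e = filterᵇ-true (not ∘ c) x l (cong not e)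

  -- For every true entry, the number of false entries after it: the partition cut out by the
  -- lattice path whose steps are the colours.
  colourCode : List ℕ → List ℕ
  colourCode []      = []
  colourCode (x ∷ l) = if c x then length (falses l) ∷ colourCode l else colourCode l

  falsesAfter : ℕ → List ℕ → ℕ
  falsesAfter y []      = 0
  falsesAfter y (x ∷ l) = if ⌊ y ≟ x ⌋ then length (falses l) else falsesAfter y l

  falsesAfter-here : ∀ y l → falsesAfter y (y ∷ l) ≡ length (falses l)
  falsesAfter-here y l with y ≟ y
  ... | yes _   = refl
  ... | no  y≢y = contradiction refl y≢y

  falsesAfter-there : ∀ {y x} l → y ≢ x → falsesAfter y (x ∷ l) ≡ falsesAfter y l
  falsesAfter-there {y} {x} l y≢x with y ≟ x
  ... | yes y≡x = contradiction y≡x y≢x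
  ... | no  _   = refl

  colourCode-map : ∀ l → Unique l → colourCode l ≡ map (λ y → falsesAfter y l) (trues l)
  colourCode-map []      u        = refl
  colourCode-map (x ∷ l) (x∉ ∷ u) with c x
  ... | true  = cong₂ _∷_ (sym (falsesAfter-here x l)) tail
    where
    tail : colourCode l ≡ map (λ y → falsesAfter y (x ∷ l)) (trues l)
    tail = colourCode-map l u ∙ List.map-cong-local (All.tabulate λ y∈ → sym (falsesAfter-there l (All.lookup x∉ (proj₁ (∈-filterᵇ⁻ c y∈)) ∘ sym)))
  ... | false = colourCode-map l u ∙ List.map-cong-local (All.tabulate λ y∈ → sym (falsesAfter-there l (All.lookup x∉ (proj₁ (∈-filterᵇ⁻ c y∈)) ∘ sym)))

  falsesAfter-mid : ∀ y P {Q} → Unique (P ++ y ∷ Q) → falsesAfter y (P ++ y ∷ Q) ≡ length (falses Q)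
  falsesAfter-mid y []      {Q} u        = falsesAfter-here y Q
  falsesAfter-mid y (x ∷ P) {Q} (x∉ ∷ u) = falsesAfter-there (P ++ y ∷ Q) (All.lookup x∉ (Mem.∈-++⁺ʳ P (here refl)) ∘ sym) ∙ falsesAfter-mid y P u

  module _ {p q : List ℕ} (up : Unique p) (uq : Unique q) (trues≡ : trues p ≡ trues q) (falses≡ : falses p ≡ falses q) where

    private
      ∈-trues : ∀ {y} → y ∈ p → c y ≡ true → y ∈ q
      ∈-trues y∈ cy = proj₁ (∈-filterᵇ⁻ c (subst (_ ∈_) trues≡ (∈-filterᵇ⁺ c y∈ cy)))

    colourCode-mono : (∀ {x y} → c y ≡ true → c x ≡ false → Before y x p → Before y x q) → Pointwise _≤_ (colourCode p) (colourCode q)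
    colourCode-mono h = subst₂ (Pointwise _≤_) (sym (colourCode-map p up)) (sym (colourCode-map q uq ∙ cong (map _) (sym trues≡)))
        (Pointwise-map⁺ (λ y → falsesAfter y p) (λ y → falsesAfter y q) (trues p) le)
      where
      le : ∀ {y} → y ∈ trues p → falsesAfter y p ≤ falsesAfter y q
      le {y} y∈ with y∈p , cy ← ∈-filterᵇ⁻ c {p} y∈ with P , Q , refl ← Mem.∈-∃++ y∈p with P′ , Q′ , refl ← Mem.∈-∃++ (∈-trues y∈p cy) =
        subst₂ _≤_ (sym (falsesAfter-mid y P up)) (sym (falsesAfter-mid y P′ uq)) (unique-⊆-length (Unique.filter⁺ _ (AllPairs.tail (Unique-++ʳ P up)))
          (λ x∈ → let x∈Q , cx = ∈-filterᵇ⁻ (not ∘ c) x∈ in ∈-filterᵇ⁺ (not ∘ c) (Before-mid P′ uq (h cy (not-false⁻ cx) (Before-++ʳ P (here x∈Q)))) cx))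

    -- Both words list the false entries in the same order, so those after y form a suffix of one
    -- common list, and their number determines which they are.
    colourCode-reflect : Pointwise _≤_ (colourCode p) (colourCode q) → ∀ {x y} → c y ≡ true → c x ≡ false → Before y x p → Before y x q
    colourCode-reflect le {x} {y} cy cx b with P , Q , refl ← Mem.∈-∃++ (Before-∈ˡ b) with P′ , Q′ , refl ← Mem.∈-∃++ (∈-trues (Before-∈ˡ b) cy) =
      Before-++ʳ P′ (here (proj₁ (∈-filterᵇ⁻ (not ∘ c) (suffix-∈ (falses P) (falses P′) same shorter (∈-filterᵇ⁺ (not ∘ c) (Before-mid P up b) (not-false⁺ {x} cx))))))
      where
      same : falses P ++ falses Q ≡ falses P′ ++ falses Q′
      same = cong (falses P ++_) (sym (falses-true y Q cy)) ∙ sym (List.filter-++ _ P (y ∷ Q)) ∙ falses≡ ∙ List.filter-++ _ P′ (y ∷ Q′) ∙ cong (falses P′ ++_) (falses-true y Q′ cy)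
      shorter : length (falses Q) ≤ length (falses Q′)
      shorter = subst₂ _≤_ (falsesAfter-mid y P up) (falsesAfter-mid y P′ uq)
        (Pointwise-map⁻ (λ y → falsesAfter y p) (λ y → falsesAfter y q) (trues p)
          (subst₂ (Pointwise _≤_) (colourCode-map p up) (colourCode-map q uq ∙ cong (map _) (sym trues≡)) le)
          (∈-filterᵇ⁺ c (Before-∈ˡ b) cy))

  colourCode-bound : ∀ l → All (_≤ length (falses l)) (colourCode l)
  colourCode-bound []      = []
  colourCode-bound (x ∷ l) with c x
  ... | true  = ℕ.≤-refl ∷ colourCode-bound l
  ... | false = All.map (λ p → ℕ.≤-trans p (ℕ.n≤1+n _)) (colourCode-bound l)

  colourCode-decreasing : ∀ l → Decreasing (colourCode l)
  colourCode-decreasing []      = []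
  colourCode-decreasing (x ∷ l) with c x
  ... | true  = colourCode-bound l ∷ colourCode-decreasing l
  ... | false = colourCode-decreasing l

  length-colourCode : ∀ l → length (colourCode l) ≡ length (trues l)
  length-colourCode []      = refl
  length-colourCode (x ∷ l) with c x
  ... | true  = cong suc (length-colourCode l)
  ... | false = length-colourCode l

  shuffle-↭ : ∀ l → l ↭ falses l ++ trues l
  shuffle-↭ []      = refl
  shuffle-↭ (x ∷ l) with c x
  ... | true  = ↭-trans (prep x (shuffle-↭ l)) (↭-sym (Perm.shift x (falses l) (trues l)))
  ... | false = prep x (shuffle-↭ l)

  -- The shuffle of the false entries α and the true entries β with colour code μ.
  build : List ℕ → List ℕ → List ℕ → List ℕ
  build α []      _       = α
  build α (y ∷ β) []      = α ++ y ∷ β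
  build α (y ∷ β) (m ∷ μ) = take (length α ∸ m) α ++ y ∷ build (drop (length α ∸ m) α) β μ

  private
    trues-none : ∀ {α} → All (λ x → c x ≡ false) α → trues α ≡ []
    trues-none []                 = refl
    trues-none {x ∷ α} (p ∷ ps) rewrite p = trues-none ps
    falses-all : ∀ {α} → All (λ x → c x ≡ false) α → falses α ≡ α
    falses-all []                 = refl
    falses-all {x ∷ α} (p ∷ ps) rewrite p = cong (x ∷_) (falses-all ps)
    colourCode-falses : ∀ {α l} → All (λ x → c x ≡ false) α → colourCode (α ++ l) ≡ colourCode l
    colourCode-falses []               = refl
    colourCode-falses {x ∷ α} (p ∷ ps) rewrite p = colourCode-falses ps

  record IsShuffle (α β μ l : List ℕ) : Set where
    field
      trues≡  : trues l ≡ β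
      falses≡ : falses l ≡ α
      code≡   : colourCode l ≡ μ

  build-shuffle : ∀ α β μ → All (λ x → c x ≡ false) α → All (λ y → c y ≡ true) β → length μ ≡ length β →
    Decreasing μ → All (_≤ length α) μ → IsShuffle α β μ (build α β μ)
  build-shuffle α []      []      pα []       e d b = record { trues≡ = trues-none pα ; falses≡ = falses-all pα ; code≡ = cong colourCode (sym (List.++-identityʳ α)) ∙ colourCode-falses pα }
  build-shuffle α (y ∷ β) (m ∷ μ) pα (py ∷ pβ) e (dm ∷ d) (m≤ ∷ b) = record
    { trues≡  = List.filter-++ _ A₁ _ ∙ cong₂ _++_ (trues-none (All.take⁺ k pα)) (filterᵇ-true c y rest py ∙ cong (y ∷_) R.trues≡)
    ; falses≡ = List.filter-++ _ A₁ _ ∙ cong₂ _++_ (falses-all (All.take⁺ k pα)) (falses-true y rest py ∙ R.falses≡) ∙ List.take++drop≡id k α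
    ; code≡   = colourCode-falses (All.take⁺ k pα) ∙ cong (λ t → if t then length (falses rest) ∷ colourCode rest else colourCode rest) py
                ∙ cong₂ _∷_ (cong length R.falses≡ ∙ size) R.code≡ }
    where
    k : ℕ
    k = length α ∸ m
    A₁ rest : List ℕ
    A₁   = take k α
    rest = build (drop k α) β μ
    size : length (drop k α) ≡ m
    size = List.length-drop k α ∙ ℕ.m∸[m∸n]≡n m≤
    module R = IsShuffle (build-shuffle (drop k α) β μ (All.drop⁺ k pα) pβ (ℕ.suc-injective e) d (All.map (λ p → ℕ.≤-trans p (ℕ.≤-reflexive (sym size))) dm))

module _ {n : ℕ} {w : List ℕ} (w↭ : w ↭ upTo n) {c : ℕ → Bool} (coloured : TwoColoured c w) where

  open Interval n w w↭
  open TwoColoured coloured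
  open Coloured c

  private
    e : List ℕ
    e = upTo n

    unique∈ : ∀ {p} → p ∈ elems W → Unique p
    unique∈ p∈ = perm-unique (proj₁ (∈⁻ p∈))

    -- Two entries of one colour are never an inversion of w, hence never an inversion of an element
    -- below w.
    increasing : ∀ {p} → p ∈ elems W → ∀ (f : ℕ → Bool) → (∀ {x y} → f x ≡ true → f y ≡ true → c x ≡ c y) → AllPairs _<_ (filterᵇ f p)
    increasing {p} p∈ f same = filterᵇ-AllPairs f p ascending
      where
      ascending : ∀ {x y} → Before x y p → f x ≡ true → f y ≡ true → x < y
      ascending {x} {y} b fx fy with ℕ.<-cmp x y
      ... | tri< x<y _ _ = x<y
      ... | tri≈ _ refl _ = ⊥-elim (Before-asym (unique∈ p∈) b b)
      ... | tri> _ _ y<x = false≢true (inversion-false (proj₂ (∈⁻ p∈) (y<x , b))) (sym (same fx fy) ∙ inversion-true (proj₂ (∈⁻ p∈) (y<x , b)))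

    same-filter : ∀ {p} → p ∈ elems W → ∀ (f : ℕ → Bool) → (∀ {x y} → f x ≡ true → f y ≡ true → c x ≡ c y) → filterᵇ f p ≡ filterᵇ f e
    same-filter p∈ f same = AllPairs-↭-≡ (λ a b → contradiction b (ℕ.<-asym a)) (increasing p∈ f same) (increasing e∈ f same) (Perm.filter-↭ _ (proj₁ (∈⁻ p∈)))

    all-trues : ∀ l → All (λ y → c y ≡ true) (trues l)
    all-trues l = All.tabulate (λ y∈ → proj₂ (∈-filterᵇ⁻ c {l} y∈))

    all-falses : ∀ l → All (λ x → c x ≡ false) (falses l)
    all-falses l = All.tabulate (λ {x} x∈ → not-false⁻ {x} (proj₂ (∈-filterᵇ⁻ (not ∘ c) {l} x∈)))

    Pointwise-All : ∀ {k l m} → Pointwise _≤_ l m → All (_≤ k) m → All (_≤ k) l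
    Pointwise-All []       []       = []
    Pointwise-All (p ∷ ps) (q ∷ qs) = ℕ.≤-trans p q ∷ Pointwise-All ps qs

    shuffle : ∀ α β ν {μ} → All (λ x → c x ≡ false) α → All (λ y → c y ≡ true) β → length ν ≡ length β → All (_≤ length α) ν →
      Decreasing μ → Pointwise _≤_ μ ν → IsShuffle α β μ (build α β μ)
    shuffle α β ν {μ} pα pβ len bound d le = build-shuffle α β μ pα pβ (Pointwise.Pointwise-length le ∙ len) d (Pointwise-All le bound)

  trues-e : ∀ {p} → p ∈ elems W → trues p ≡ trues e
  trues-e p∈ = same-filter p∈ c (λ a b → a ∙ sym b)

  falses-e : ∀ {p} → p ∈ elems W → falses p ≡ falses e
  falses-e p∈ = same-filter p∈ (not ∘ c) (λ {x} {y} a b → not-false⁻ {x} a ∙ sym (not-false⁻ {y} b))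

  -- In the inverse Grassmannian case an element of the interval is determined by the lattice
  -- path of its colours.
  inverseGrassmannian-≅ : (∀ {x y} → c y ≡ true → c x ≡ false → x < y) → W ≅ YoungInterval (colourCode w)
  inverseGrassmannian-≅ low = ≅-young W partialOrder (colourCode w) colourCode
      (λ {p} p∈ → colourCode-decreasing p , mono p∈ w∈ (leq⁺ p∈ w∈ (proj₂ (∈⁻ p∈))))
      mono
      (λ p∈ q∈ le → leq⁺ p∈ q∈ (λ (u<p , b) → u<p , reflect p∈ q∈ le (inversion-true (proj₂ (∈⁻ p∈) (u<p , b))) (inversion-false (proj₂ (∈⁻ p∈) (u<p , b))) b))
      surjective
    where
    same-trues : ∀ {p q} → p ∈ elems W → q ∈ elems W → trues p ≡ trues q
    same-trues p∈ q∈ = trues-e p∈ ∙ sym (trues-e q∈)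
    same-falses : ∀ {p q} → p ∈ elems W → q ∈ elems W → falses p ≡ falses q
    same-falses p∈ q∈ = falses-e p∈ ∙ sym (falses-e q∈)
    mono : ∀ {p q} → p ∈ elems W → q ∈ elems W → leq W p q ≡ true → Pointwise _≤_ (colourCode p) (colourCode q)
    mono {p} {q} p∈ q∈ l = colourCode-mono (unique∈ p∈) (unique∈ q∈) (same-trues p∈ q∈) (same-falses p∈ q∈) (λ cy cx b → proj₂ (leq⁻ {p} {q} l (low cy cx , b)))
    reflect : ∀ {p q} → p ∈ elems W → q ∈ elems W → Pointwise _≤_ (colourCode p) (colourCode q) → ∀ {x y} → c y ≡ true → c x ≡ false → Before y x p → Before y x q
    reflect p∈ q∈ = colourCode-reflect (unique∈ p∈) (unique∈ q∈) (same-trues p∈ q∈) (same-falses p∈ q∈)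
    surjective : ∀ {μ} → Decreasing μ → Pointwise _≤_ μ (colourCode w) → ∃ λ p → p ∈ elems W × colourCode p ≡ μ
    surjective {μ} d le = p , ∈⁺ p↭ sub , code≡
      where
      p : List ℕ
      p = build (falses e) (trues e) μ
      open IsShuffle (shuffle (falses e) (trues e) (colourCode w) {μ} (all-falses e) (all-trues e)
        (length-colourCode w ∙ cong length (trues-e w∈)) (All.map (λ q → ℕ.≤-trans q (ℕ.≤-reflexive (cong length (falses-e w∈)))) (colourCode-bound w)) d le)
      p↭ : p ↭ e
      p↭ = ↭-trans (shuffle-↭ p) (↭-trans (↭-reflexive (cong₂ _++_ falses≡ trues≡)) (↭-sym (shuffle-↭ e)))
      sub : InvSub p w
      sub {a} {b} (b<a , ab) with c a in ca | c b in cb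
      ... | true  | true  = contradiction b<a (ℕ.<-asym (AllPairs-Before (subst (AllPairs _<_) (sym trues≡) (increasing e∈ c (λ a b → a ∙ sym b))) (filterᵇ-Before c ab ca cb)))
      ... | false | false = contradiction b<a (ℕ.<-asym (AllPairs-Before (subst (AllPairs _<_) (sym falses≡) (increasing e∈ (not ∘ c) (λ {x} {y} a b → not-false⁻ {x} a ∙ sym (not-false⁻ {y} b))))
                                (filterᵇ-Before (not ∘ c) ab (cong not ca) (cong not cb))))
      ... | false | true  = contradiction b<a (ℕ.<-asym (low cb ca))
      ... | true  | false = b<a , colourCode-reflect (perm-unique p↭) w-unique′ (trues≡ ∙ sym (trues-e w∈)) (falses≡ ∙ sym (falses-e w∈)) (subst (λ l → Pointwise _≤_ l (colourCode w)) (sym code≡) le) ca cb ab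
        where
        w-unique′ : Unique w
        w-unique′ = perm-unique w↭

  -- In the Grassmannian case the reversed elements are shuffles, and going up removes cells.
  grassmannian-≅ : (∀ {x y} → x ∈ w → y ∈ w → c y ≡ true → c x ≡ false → Before y x w) → dual W ≅ YoungInterval (colourCode (reverse e))
  grassmannian-≅ first = ≅-young (dual W) (dual-partialOrder partialOrder) (colourCode (reverse e)) (λ p → colourCode (reverse p))
      (λ {p} p∈ → colourCode-decreasing (reverse p) , mono p∈ e∈ (leq⁺ e∈ p∈ (λ i → ⊥-elim (no-inversions i))))
      mono
      (λ {p} {q} p∈ q∈ le → leq⁺ q∈ p∈ (λ {a} {b} i → reflect p∈ q∈ le i))
      surjective
    where
    unique-reverse : ∀ {p} → p ∈ elems W → Unique (reverse p)
    unique-reverse {p} p∈ = Unique-↭ (↭-sym (Perm.↭-reverse p)) (unique∈ p∈)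
    filter-reverse : ∀ (f : ℕ → Bool) l → filterᵇ f (reverse l) ≡ reverse (filterᵇ f l)
    filter-reverse f []      = refl
    filter-reverse f (x ∷ l) = cong (filterᵇ f) (List.unfold-reverse x l) ∙ List.filter-++ _ (reverse l) [ x ] ∙ cong (_++ filterᵇ f [ x ]) (filter-reverse f l) ∙ last
      where
      last : reverse (filterᵇ f l) ++ filterᵇ f [ x ] ≡ reverse (filterᵇ f (x ∷ l))
      last with f x
      ... | true  = sym (List.unfold-reverse x (filterᵇ f l))
      ... | false = List.++-identityʳ _
    same-trues : ∀ {p q} → p ∈ elems W → q ∈ elems W → trues (reverse p) ≡ trues (reverse q)
    same-trues {p} {q} p∈ q∈ = filter-reverse c p ∙ cong reverse (trues-e p∈ ∙ sym (trues-e q∈)) ∙ sym (filter-reverse c q)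
    same-falses : ∀ {p q} → p ∈ elems W → q ∈ elems W → falses (reverse p) ≡ falses (reverse q)
    same-falses {p} {q} p∈ q∈ = filter-reverse _ p ∙ cong reverse (falses-e p∈ ∙ sym (falses-e q∈)) ∙ sym (filter-reverse _ q)
    ∈↔ : ∀ {p q x} → p ∈ elems W → q ∈ elems W → x ∈ p → x ∈ q
    ∈↔ p∈ q∈ x∈ = Perm.∈-resp-↭ (↭-trans (proj₁ (∈⁻ p∈)) (↭-sym (proj₁ (∈⁻ q∈)))) x∈
    mono : ∀ {p q} → p ∈ elems W → q ∈ elems W → leq W q p ≡ true → Pointwise _≤_ (colourCode (reverse p)) (colourCode (reverse q))
    mono {p} {q} p∈ q∈ l = colourCode-mono (unique-reverse p∈) (unique-reverse q∈) (same-trues p∈ q∈) (same-falses p∈ q∈) keep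
      where
      keep : ∀ {x y} → c y ≡ true → c x ≡ false → Before y x (reverse p) → Before y x (reverse q)
      keep {x} {y} cy cx b = Before-reverse ([ id , exclude ]′ (Before-total (∈↔ p∈ q∈ (Before-∈ˡ xy)) (∈↔ p∈ q∈ (Before-∈ʳ xy)) x≢y))
        where
        xy : Before x y p
        xy = Before-unreverse p b
        x≢y : x ≢ y
        x≢y refl = false≢true cx cy
        exclude : Before y x q → Before x y q
        exclude yx with ℕ.<-cmp x y
        ... | tri< x<y _ _ = ⊥-elim (Before-asym (unique∈ p∈) xy (proj₂ (leq⁻ {q} {p} l (x<y , yx))))
        ... | tri≈ _ x≡y _ = contradiction x≡y x≢y
        ... | tri> _ _ y<x = false≢true cx (inversion-true (proj₂ (∈⁻ p∈) (y<x , xy)))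
    reflect : ∀ {p q} → p ∈ elems W → q ∈ elems W → Pointwise _≤_ (colourCode (reverse p)) (colourCode (reverse q)) → InvSub q p
    reflect {p} {q} p∈ q∈ le {a} {b} (b<a , ab) = b<a , [ id , exclude ]′ (Before-total (∈↔ q∈ p∈ (Before-∈ˡ ab)) (∈↔ q∈ p∈ (Before-∈ʳ ab)) (ℕ.>⇒≢ b<a))
      where
      i : Inversion w a b
      i = proj₂ (∈⁻ q∈) (b<a , ab)
      exclude : Before b a p → Before a b p
      exclude ba = ⊥-elim (Before-asym (unique∈ q∈) ab (Before-unreverse q
        (colourCode-reflect (unique-reverse p∈) (unique-reverse q∈) (same-trues p∈ q∈) (same-falses p∈ q∈) le (inversion-true i) (inversion-false i) (Before-reverse ba))))
    surjective : ∀ {μ} → Decreasing μ → Pointwise _≤_ μ (colourCode (reverse e)) → ∃ λ p → p ∈ elems W × colourCode (reverse p) ≡ μ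
    surjective {μ} d le = reverse r , ∈⁺ p↭ sub , cong colourCode (List.reverse-involutive r) ∙ code≡
      where
      ē r : List ℕ
      ē = reverse e
      r = build (falses ē) (trues ē) μ
      open IsShuffle (shuffle (falses ē) (trues ē) (colourCode ē) {μ} (all-falses ē) (all-trues ē) (length-colourCode ē) (colourCode-bound ē) d le)
      r↭ : r ↭ e
      r↭ = ↭-trans (shuffle-↭ r) (↭-trans (↭-reflexive (cong₂ _++_ falses≡ trues≡)) (↭-trans (↭-sym (shuffle-↭ ē)) (Perm.↭-reverse e)))
      p↭ : reverse r ↭ e
      p↭ = ↭-trans (Perm.↭-reverse r) r↭
      descending : ∀ (f : ℕ → Bool) → AllPairs _<_ (filterᵇ f e) → filterᵇ f r ≡ filterᵇ f ē → ∀ {a b} → Before b a r → f a ≡ true → f b ≡ true → a < b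
      descending f inc same ba fa fb = AllPairs-Before inc (Before-unreverse (filterᵇ f e) (subst (Before _ _) (same ∙ filter-reverse f e) (filterᵇ-Before f ba fb fa)))
      ∈w : ∀ {x} → x ∈ r → x ∈ w
      ∈w x∈ = Perm.∈-resp-↭ (↭-trans r↭ (↭-sym w↭)) x∈
      sub : InvSub (reverse r) w
      sub {a} {b} (b<a , ab) with ba ← Before-unreverse r ab with c a in ca | c b in cb
      ... | true  | true  = contradiction b<a (ℕ.<-asym (descending c (increasing e∈ c (λ a b → a ∙ sym b)) trues≡ ba ca cb))
      ... | false | false = contradiction b<a (ℕ.<-asym (descending (not ∘ c) (increasing e∈ (not ∘ c) (λ {x} {y} a b → not-false⁻ {x} a ∙ sym (not-false⁻ {y} b))) falses≡ ba (cong not ca) (cong not cb)))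
      ... | true  | false = b<a , first (∈w (Before-∈ˡ ba)) (∈w (Before-∈ʳ ba)) ca cb
      ... | false | true  = ⊥-elim (no-inversions (b<a , Before-unreverse e
            (colourCode-reflect (perm-unique r↭) (unique-reverse e∈) trues≡ falses≡ (subst (λ l → Pointwise _≤_ l (colourCode ē)) (sym code≡) le) cb ca ba) ) )

module _ (c : ℕ → Bool) where
  open Coloured c

  zeros-shift : ∀ l j → 0 ∷ l ++ zeros j ↭ l ++ zeros (suc j)
  zeros-shift l j = ↭-sym (Perm.shift 0 l (zeros j))

  -- The inverse Grassmannian case: every false entry that follows a true one is smaller, so the
  -- code of a true entry counts the false entries after it. A false entry has code 0.
  lehmer-colourCode : ∀ l → (∀ {x y} → Before x y l → c x ≡ true → c y ≡ false → y < x) →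
    (∀ {x y} → Inversion l x y → c x ≡ true × c y ≡ false) → lehmer l ↭ colourCode l ++ zeros (length (falses l))
  lehmer-colourCode []      low two = refl
  lehmer-colourCode (x ∷ l) low two with c x in cx | lehmer-colourCode l (λ b → low (there b)) (λ (i , b) → two (i , there b))
  ... | true  | ih rewrite count-cong (_<ᵇ x) (not ∘ c) l (λ v v∈ → Bool-ext
                       (λ lt → cong not (proj₂ (two (<ᵇ-sound {v} {x} lt , here v∈))))
                       (λ nc → <ᵇ-true {v} {x} (low (here v∈) cx (not-false⁻ {v} nc)))) = prep _ ih
  ... | false | ih rewrite count-none (_<ᵇ x) l (λ v v∈ → <ᵇ-false {v} {x} (λ lt → false≢true cx (proj₁ (two (lt , here v∈))))) =
    ↭-trans (prep 0 ih) (zeros-shift (colourCode l) (length (falses l)))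

  private
    sparse : (ℕ → ℕ) → ℕ → ℕ
    sparse f x = if c x then f x else 0

    sparse-↭ : ∀ f l → map (sparse f) l ↭ map f (trues l) ++ zeros (length (falses l))
    sparse-↭ f []      = refl
    sparse-↭ f (x ∷ l) with c x
    ... | true  = prep (f x) (sparse-↭ f l)
    ... | false = ↭-trans (prep 0 (sparse-↭ f l)) (zeros-shift (map f (trues l)) (length (falses l)))

    smallerFalses : List ℕ → ℕ → ℕ
    smallerFalses w x = count (λ v → not (c v) ∧ (v <ᵇ x)) w

    lehmer-sparse : ∀ P l → (∀ {x y} → Inversion (P ++ l) x y → c y ≡ false × c x ≡ true) →
      (∀ {x y} → Before y x (P ++ l) → c x ≡ true → c y ≡ true) → lehmer l ≡ map (sparse (smallerFalses (P ++ l))) l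
    lehmer-sparse P []      two first = refl
    lehmer-sparse P (x ∷ l) two first = cong₂ _∷_ head (subst (λ m → lehmer l ≡ map (sparse (smallerFalses m)) l) shift
        (lehmer-sparse (P ++ [ x ]) l (λ i → two (subst (λ m → Inversion m _ _) shift i)) (λ b → first (subst (Before _ _) shift b))))
      where
      shift : (P ++ [ x ]) ++ l ≡ P ++ x ∷ l
      shift = List.++-assoc P [ x ] l
      head : smaller x l ≡ sparse (smallerFalses (P ++ x ∷ l)) x
      head with c x in cx
      ... | false = count-none (_<ᵇ x) l (λ v v∈ → <ᵇ-false {v} {x} (λ lt → false≢true cx (proj₂ (two (lt , Before-++ʳ P (here v∈))))))
      ... | true  = sym (count-++ _ P (x ∷ l) ∙ cong₂ _+_
            (count-none _ P (λ v v∈ → cong (λ b → not b ∧ (v <ᵇ x)) (first (Before-across v∈ (here refl)) cx)))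
            (count-∷ _ x l ∙ cong₂ _+_ (cong (λ b → ⟦ not (c x) ∧ b ⟧) (<ᵇ-false {x} {x} (ℕ.n≮n x)) ∙ cong ⟦_⟧ (Bool.∧-zeroʳ (not (c x))))
              (count-cong _ _ l (λ v v∈ → below v v∈ (v <ᵇ x) refl))))
        where
        below : ∀ v → v ∈ l → ∀ b → (v <ᵇ x) ≡ b → not (c v) ∧ b ≡ b
        below v v∈ false e = Bool.∧-zeroʳ (not (c v))
        below v v∈ true  e = cong (λ b → not b ∧ true) (proj₁ (two (<ᵇ-sound {v} {x} e , Before-++ʳ P (here v∈))))

  -- The Grassmannian case: the true entries come first, so the code of a true entry counts all
  -- smaller false values. In the reversed identity these are exactly the false entries after it.
  lehmer-colourCode-reverse : ∀ {n w} → w ↭ upTo n → TwoColoured c w → (∀ {x y} → x ∈ w → y ∈ w → c y ≡ true → c x ≡ false → Before y x w) →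
    lehmer w ↭ colourCode (reverse (upTo n)) ++ zeros (length (falses w))
  lehmer-colourCode-reverse {n} {w} w↭ coloured first = ↭-trans (↭-reflexive (lehmer-sparse [] w (λ i → inversion-false i , inversion-true i) initial))
      (↭-trans (sparse-↭ f w) (Perm.++⁺ʳ (zeros (length (falses w))) (↭-trans (Perm.map⁺ f (Perm.filter-↭ _ w↭ē)) (↭-reflexive (sym codes)))))
    where
    open TwoColoured coloured
    f : ℕ → ℕ
    f = smallerFalses w
    uw : Unique w
    uw = perm-unique w↭
    ē : List ℕ
    ē = reverse (upTo n)
    w↭ē : w ↭ ē
    w↭ē = ↭-trans w↭ (↭-sym (Perm.↭-reverse (upTo n)))
    uē : Unique ē
    uē = Unique-↭ w↭ē uw
    initial : ∀ {x y} → Before y x w → c x ≡ true → c y ≡ true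
    initial {x} {y} b cx with c y in cy
    ... | true  = refl
    ... | false = ⊥-elim (Before-asym uw b (first (Before-∈ˡ b) (Before-∈ʳ b) cx cy))
    after : ∀ {y} → y ∈ ē → falsesAfter y ē ≡ f y
    after {y} y∈ with P , Q , e ← Mem.∈-∃++ y∈ = cong (falsesAfter y) e ∙ falsesAfter-mid y P (subst Unique e uē)
        ∙ sym (count-↭ _ (↭-trans w↭ē (↭-reflexive e)) ∙ count-++ _ P (y ∷ Q) ∙ cong₂ _+_
          (count-none _ P (λ v v∈ → cong (not (c v) ∧_) (<ᵇ-false {v} {y} (ℕ.<⇒≯ (descending e (Before-across v∈ (here refl))))) ∙ Bool.∧-zeroʳ (not (c v))))
          (count-∷ _ y Q ∙ cong₂ _+_ (cong (λ b → ⟦ not (c y) ∧ b ⟧) (<ᵇ-false {y} {y} (ℕ.n≮n y)) ∙ cong ⟦_⟧ (Bool.∧-zeroʳ (not (c y))))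
            (count-cong _ (not ∘ c) Q (λ v v∈ → cong (not (c v) ∧_) (<ᵇ-true {v} {y} (descending e (Before-++ʳ P (here v∈)))) ∙ Bool.∧-identityʳ (not (c v))))))
      where
      descending : ∀ {l a b} → ē ≡ l → Before a b l → b < a
      descending refl b = AllPairs-Before (upTo-increasing n) (Before-unreverse (upTo n) b)
    codes : colourCode ē ≡ map f (trues ē)
    codes = colourCode-map ē uē ∙ List.map-cong-local (All.tabulate (λ y∈ → after (proj₁ (∈-filterᵇ⁻ c {ē} y∈))))

  twoColoured : ∀ l → Unique l → AllPairs _<_ (trues l) → AllPairs _<_ (falses l) → (∀ {x y} → c y ≡ true → c x ≡ false → x < y) → TwoColoured c l
  twoColoured l u inc-t inc-f low = record { inversion-true = λ i → proj₁ (colours i) ; inversion-false = λ i → proj₂ (colours i) }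
    where
    colours : ∀ {p u} → Inversion l p u → c p ≡ true × c u ≡ false
    colours {p} {u} (u<p , b) with c p in cp | c u in cu
    ... | true  | false = refl , refl
    ... | true  | true  = contradiction u<p (ℕ.<-asym (AllPairs-Before inc-t (filterᵇ-Before c b cp cu)))
    ... | false | false = contradiction u<p (ℕ.<-asym (AllPairs-Before inc-f (filterᵇ-Before (not ∘ c) b (cong not cp) (cong not cu))))
    ... | false | true  = contradiction u<p (ℕ.<-asym (low cu cp))

  -- The rows are nested: a true entry that comes earlier is inverted with every false entry that
  -- follows the later one.
  twoColoured-noCrossing : ∀ {l} → Unique l → TwoColoured c l → (∀ {x y} → c y ≡ true → c x ≡ false → x < y) → NoCrossing l
  twoColoured-noCrossing {l} ul coloured low {i} {j} {u} {t} iu jt with i ≟ j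
  ... | yes refl = inj₁ jt
  ... | no  i≢j  = [ (λ ij → inj₁ (low (inversion-true iu) (inversion-false jt) , Before-trans ul ij (proj₂ jt)))
                   , (λ ji → inj₂ (low (inversion-true jt) (inversion-false iu) , Before-trans ul ji (proj₂ iu))) ]′
                   (Before-total (Before-∈ˡ (proj₂ iu)) (Before-∈ˡ (proj₂ jt)) i≢j)
    where open TwoColoured coloured

applyUpTo-++ : ∀ (f : ℕ → X) m n → applyUpTo f (m + n) ≡ applyUpTo f m ++ applyUpTo (λ i → f (m + i)) n
applyUpTo-++ f zero    n = refl
applyUpTo-++ f (suc m) n = cong (f 0 ∷_) (applyUpTo-++ (f ∘ suc) m n)

module InverseGrassmannianOf (k m : ℕ) (ν : List ℕ) (len : length ν ≡ m) (dec : Decreasing ν) (bound : All (_≤ k) ν) where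

  colour : ℕ → Bool
  colour v = not (v <ᵇ k)

  open Coloured colour

  low : ∀ {x y} → colour y ≡ true → colour x ≡ false → x < y
  low {x} {y} cy cx = ℕ.<-≤-trans (<ᵇ-sound {x} {k} (Bool.not-injective cx)) (ℕ.≮⇒≥ (<ᵇ-unsound {y} {k} (Bool.not-injective cy)))

  α β : List ℕ
  α = upTo k
  β = applyUpTo (k +_) m

  -- Its code is ν followed by zeros and its interval is that of ν, which makes it the model of
  -- Young's lattice within the weak order.
  perm : List ℕ
  perm = build α β ν

  private
    false-α : All (λ x → colour x ≡ false) α
    false-α = All.tabulate λ {x} x∈ → cong not (<ᵇ-true {x} {k} (Mem.∈-upTo⁻ x∈))
    true-β : All (λ y → colour y ≡ true) β
    true-β = All.applyUpTo⁺₂ (k +_) m (λ i → cong not (<ᵇ-false {k + i} {k} (ℕ.m+n≮m k i)))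
    shuffled : IsShuffle α β ν perm
    shuffled = build-shuffle α β ν false-α true-β (len ∙ sym (List.length-applyUpTo (k +_) m)) dec (All.map (λ p → ℕ.≤-trans p (ℕ.≤-reflexive (sym (List.length-upTo k)))) bound)

  open IsShuffle shuffled public

  perm-↭ : perm ↭ upTo (k + m)
  perm-↭ = ↭-trans (shuffle-↭ perm) (↭-reflexive (cong₂ _++_ falses≡ trues≡ ∙ sym (applyUpTo-++ id k m)))

  coloured : TwoColoured colour perm
  coloured = twoColoured colour perm (perm-unique perm-↭)
    (subst (AllPairs _<_) (sym trues≡) (AllPairs.applyUpTo⁺₁ (k +_) m (λ i<j _ → ℕ.+-monoʳ-< k i<j)))
    (subst (AllPairs _<_) (sym falses≡) (upTo-increasing k)) low

  weak≅young : WeakInterval (k + m) perm ≅ YoungInterval ν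
  weak≅young = subst (λ μ → WeakInterval (k + m) perm ≅ YoungInterval μ) code≡ (inverseGrassmannian-≅ perm-↭ coloured low)

  noCrossing : NoCrossing perm
  noCrossing = twoColoured-noCrossing colour (perm-unique perm-↭) coloured low

  lehmer-perm : lehmer perm ↭ ν ++ zeros k
  lehmer-perm = subst₂ (λ μ j → lehmer perm ↭ μ ++ zeros j) code≡ (cong length falses≡ ∙ List.length-upTo k)
    (lehmer-colourCode colour perm (λ _ cx cy → low cx cy) (λ i → inversion-true i , inversion-false i))
    where open TwoColoured coloured

sum-zeros : ∀ j → sum (zeros j) ≡ 0
sum-zeros zero    = refl
sum-zeros (suc j) = sum-zeros j

inv-code : ∀ {w ν} j → lehmer w ↭ ν ++ zeros j → inv w ≡ sum ν
inv-code {w} {ν} j p = sum-↭ p ∙ sum-++ ν (zeros j) ∙ cong (sum ν +_) (sum-zeros j) ∙ ℕ.+-identityʳ _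

lehmer-bound : ∀ l → All (_≤ length l) (lehmer l)
lehmer-bound []      = []
lehmer-bound (x ∷ l) = ℕ.≤-trans (List.length-filter _ l) (ℕ.n≤1+n _) ∷ All.map (λ p → ℕ.≤-trans p (ℕ.n≤1+n _)) (lehmer-bound l)

length-lehmer : ∀ l → length (lehmer l) ≡ length l
length-lehmer []      = refl
length-lehmer (x ∷ l) = cong suc (length-lehmer l)

≅-sym-EX : ∀ {P Q} → P ≅ Q → EX Q ≡ EX P
≅-sym-EX i = sym (Isomorphism.EX-≅ i)

module VexillaryPermutation {n : ℕ} {w : List ℕ} (w↭ : w ↭ upTo n) where

  private
    uw : Unique w
    uw = perm-unique w↭
    len : length w ≡ n
    len = Perm.↭-length w↭ ∙ List.length-upTo n
    ν : List ℕ
    ν = sortDecr (lehmer w)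
    -- The code of w has n entries, none above n, so n true and n false values leave enough room.
    module G = InverseGrassmannianOf n n ν (Perm.↭-length (sortDecr-↭ (lehmer w)) ∙ length-lehmer w ∙ len) (sortDecr-decreasing (lehmer w))
      (Perm.All-resp-↭ (↭-sym (sortDecr-↭ (lehmer w))) (subst (λ m → All (_≤ m) (lehmer w)) len (lehmer-bound w)))

  -- Both w, extended by fixed points, and the inverse Grassmannian permutation of the same code
  -- have the same numbers of 0-Hecke words.
  EY-young-weak : Vexillary w → EY (YoungInterval (shape w)) ≡ EY (WeakInterval n w)
  EY-young-weak vex = Isomorphism.EY-≅ (young-nonzero (sortDecr-decreasing (lehmer w))) ∙ sym (Isomorphism.EY-≅ G.weak≅young)
      ∙ Interval.EY-hecke (n + n) G.perm G.perm-↭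
      ∙ cong₂ frac (words (suc (inv G.perm)) ∙ cong (λ k → heckeWords (suc k) w) same-inv)
          (cong₂ (λ k m → suc k * m) same-inv (words (inv G.perm) ∙ cong (λ k → heckeWords k w) same-inv))
      ∙ sym (Interval.EY-hecke n w w↭)
    where
    same-inv : inv G.perm ≡ inv w
    same-inv = inv-code n G.lehmer-perm ∙ sum-↭ (sortDecr-↭ (lehmer w))
    words : ∀ k → heckeWords k G.perm ≡ heckeWords k w
    words k = sym (heckeWords-vexillary (perm-unique (extend-↭ w↭ n)) (noCrossing-extend w↭ n (vexillary-noCrossing uw vex)) G.noCrossing
      (↭-trans (extend-↭ w↭ n) (↭-sym G.perm-↭)) (↭-trans (lehmer-extend w↭ n) (↭-trans (Perm.++⁺ʳ (zeros n) (↭-sym (sortDecr-↭ (lehmer w)))) (↭-sym G.lehmer-perm))) k)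
      ∙ heckeWords-extend w↭ n k

  -- The isomorphism with Young's lattice reverses the order, and `EX-dual` compensates for this.
  EX-young-grassmannian : Grassmannian w → EX (YoungInterval (shape w)) ≡ EX (WeakInterval n w)
  EX-young-grassmannian gr with c , coloured , first ← grassmannian-colours w↭ gr =
    cong (EX ∘ YoungInterval) (shape-nonzero {w} (length (Coloured.falses c w)) (lehmer-colourCode-reverse c w↭ coloured first) dec)
    ∙ Isomorphism.EX-≅ (young-nonzero dec) ∙ ≅-sym-EX (grassmannian-≅ w↭ coloured first) ∙ EX-dual (WeakInterval n w)
    where
    dec : Decreasing (Coloured.colourCode c (reverse (upTo n)))
    dec = Coloured.colourCode-decreasing c (reverse (upTo n))

  EX-young-inverseGrassmannian : InverseGrassmannian w → EX (YoungInterval (shape w)) ≡ EX (WeakInterval n w)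
  EX-young-inverseGrassmannian gr with c , coloured , low ← inverseGrassmannian-colours w↭ gr =
    cong (EX ∘ YoungInterval) (shape-nonzero {w} (length (Coloured.falses c w)) (lehmer-colourCode c w (λ _ cx cy → low cx cy)
      (λ i → TwoColoured.inversion-true coloured i , TwoColoured.inversion-false coloured i)) (Coloured.colourCode-decreasing c w))
    ∙ Isomorphism.EX-≅ (young-nonzero (Coloured.colourCode-decreasing c w)) ∙ ≅-sym-EX (inverseGrassmannian-≅ w↭ coloured low)

-- Rectangular staircases

frac-≡ : ∀ m n p q → 0 < n → 0 < q → m * q ≡ p * n → frac m n ≡ frac p q
frac-≡ m (suc n) p (suc q) _ _ e = ℚ.fromℚᵘ-cong {mkℚᵘ (ℤ.+ m) n} {mkℚᵘ (ℤ.+ p) q}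
  (*≡* (sym (ℤ.pos-* m (suc q)) ∙ cong ℤ.+_ e ∙ ℤ.pos-* p (suc n)))

range : ℕ → ℕ → List ℕ
range s zero    = []
range s (suc n) = s ∷ range (suc s) n

range-applyUpTo : ∀ (f : ℕ → ℕ) s n → (∀ i → f i ≡ s + i) → applyUpTo f n ≡ range s n
range-applyUpTo f s zero    e = refl
range-applyUpTo f s (suc n) e = cong₂ _∷_ (e 0 ∙ ℕ.+-identityʳ s) (range-applyUpTo (f ∘ suc) (suc s) n (λ i → e (suc i) ∙ ℕ.+-suc s i))

upTo-range : ∀ n → upTo n ≡ range 0 n
upTo-range n = range-applyUpTo id 0 n (λ _ → refl)

range-position : ∀ A {x B} s n → A ++ x ∷ B ≡ range s n → s + length A ≡ x × length A + suc (length B) ≡ n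
range-position []      s (suc n) e with refl ← List.∷-injectiveˡ e = ℕ.+-identityʳ s , cong suc (cong length (List.∷-injectiveʳ e) ∙ length-range (suc s) n)
  where
  length-range : ∀ s n → length (range s n) ≡ n
  length-range s zero    = refl
  length-range s (suc n) = cong suc (length-range (suc s) n)
range-position (a ∷ A) s (suc n) e with i , j ← range-position A (suc s) n (List.∷-injectiveʳ e) = ℕ.+-suc s (length A) ∙ i , cong suc j

data Adjacent (x y : ℕ) : List ℕ → Set where
  here  : ∀ {l} → Adjacent x y (x ∷ y ∷ l)
  there : ∀ {a l} → Adjacent x y l → Adjacent x y (a ∷ l)

Adjacent-Before : ∀ {x y l} → Adjacent x y l → Before x y l
Adjacent-Before here      = here (here refl)
Adjacent-Before (there a) = there (Adjacent-Before a)

Adjacent-split : ∀ {x y l} → Adjacent x y l → ∃₂ λ P Q → l ≡ P ++ x ∷ y ∷ Q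
Adjacent-split (here {l}) = [] , l , refl
Adjacent-split (there {a} s) with P , Q , e ← Adjacent-split s = a ∷ P , Q , cong (a ∷_) e

dropDescent-≥ : ∀ {m v} (g : List ℕ → ℕ) → Step m v → g m ≤ dropDescent v g
dropDescent-≥ {m} {v} g s = ℕ.≤-trans (member (downs v) (∈-downs⁺ s)) (ℕ.≤-reflexive (∑-downs v g))
  where
  member : ∀ l → m ∈ l → g m ≤ ∑ l g
  member (x ∷ l) (here refl) = ℕ.m≤m+n (g x) _
  member (x ∷ l) (there i)   = ℕ.≤-trans (member l i) (ℕ.m≤n+m _ (g x))

find-descent : ∀ v → Unique v → (∃ λ m → Step m v) ⊎ AllPairs _<_ v
find-descent []          u = inj₂ []
find-descent (x ∷ [])    u = inj₂ ([] ∷ [])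
find-descent (x ∷ y ∷ v) ((x≢y ∷ _) ∷ u) with find-descent (y ∷ v) u
... | inj₁ (m , s)   = inj₁ (x ∷ m , there s)
... | inj₂ (p ∷ ps) with ℕ.<-cmp x y
...   | tri< x<y _ _ = inj₂ ((x<y ∷ All.map (ℕ.<-trans x<y) p) ∷ p ∷ ps)
...   | tri≈ _ x≡y _ = contradiction x≡y x≢y
...   | tri> _ _ y<x = inj₁ (y ∷ x ∷ v , here y<x)

reducedWords-pos : ∀ k v → Unique v → inv v ≡ k → 0 < reducedWords k v
reducedWords-pos zero    v u e rewrite e = s≤s z≤n
reducedWords-pos (suc k) v u e with find-descent v u
... | inj₁ (m , s) = ℕ.≤-trans (reducedWords-pos k m (Unique-↭ (↭-sym (Step-↭ s)) u) (Step-rank s e)) (dropDescent-≥ (reducedWords k) s)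
... | inj₂ inc = contradiction (sym (sorted inc) ∙ e) (λ ())
  where
  sorted : ∀ {l} → AllPairs _<_ l → inv l ≡ 0
  sorted []       = refl
  sorted {x ∷ l} (x< ∷ s) = cong₂ _+_ (smaller-none x l x<) (sorted s)

module IntervalExpectation (n : ℕ) (w : List ℕ) (w↭ : w ↭ upTo n) where
  open Interval n w w↭

  EX-frac : ∀ p q → 0 < q → ∑ (elems W) des * q ≡ p * length (elems W) → EX W ≡ frac p q
  EX-frac p q q>0 e = cong (λ m → frac m (length (elems W))) (∑-cong (elems W) (λ v v∈ → downDeg-des v∈)) ∙ frac-≡ _ _ p q (nonempty w∈) q>0 e
    where
    nonempty : ∀ {l : List (List ℕ)} → w ∈ l → 0 < length l
    nonempty (here _)  = s≤s z≤n
    nonempty (there _) = s≤s z≤n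

  EY-frac : ∀ p q → 0 < q → ∑ (elems W) (λ v → des v * numMaxChainsThrough W v) * q ≡ p * ∑ (elems W) (numMaxChainsThrough W) → EY W ≡ frac p q
  EY-frac p q q>0 e = cong (λ m → frac m (∑ (elems W) (numMaxChainsThrough W))) (∑-cong (elems W) (λ v v∈ → cong (_* numMaxChainsThrough W v) (downDeg-des v∈)))
      ∙ frac-≡ _ _ p q positive q>0 e
    where
    positive : 0 < ∑ (elems W) (numMaxChainsThrough W)
    positive = subst (0 <_) (sym (∑-cong (elems W) (λ _ _ → sym (ℕ.+-identityʳ _)) ∙ through-chainSum (λ _ → 1) ∙ chainSum-1 (inv w) w))
      (ℕ.<-≤-trans (reducedWords-pos (inv w) w (perm-unique w↭) refl) (ℕ.m≤m+n _ _))

length-≡-∑ : (xs : List X) → length xs ≡ ∑ xs (λ _ → 1)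
length-≡-∑ []       = refl
length-≡-∑ (x ∷ xs) = cong suc (length-≡-∑ xs)

-- The rectangular staircase with k = d - 1, in a form that recurses on the number of blocks.
stair : ℕ → ℕ → ℕ → List ℕ
stair a b zero    = []
stair a b (suc k) = replicate a (suc k * b) ++ stair a b k

rectStaircase-stair : ∀ k a b → rectStaircase (suc k) a b ≡ stair a b k
rectStaircase-stair k a b = cong (concatMap (λ i → replicate a (i * b))) (List.reverse-applyUpTo suc k) ∙ go k
  where
  go : ∀ k → concatMap (λ i → replicate a (i * b)) (applyDownFrom suc k) ≡ stair a b k
  go zero    = refl
  go (suc k) = cong (replicate a (suc k * b) ++_) (go k)

stair-bound : ∀ a b k → All (_≤ k * b) (stair a b k)
stair-bound a b zero    = []
stair-bound a b (suc k) = All.++⁺ (All.replicate⁺ a ℕ.≤-refl) (All.map (λ p → ℕ.≤-trans p (ℕ.m≤n+m (k * b) b)) (stair-bound a b k))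

stair-decreasing : ∀ a b k → Decreasing (stair a b k)
stair-decreasing a b zero    = []
stair-decreasing a b (suc k) = go a
  where
  go : ∀ c → Decreasing (replicate c (suc k * b) ++ stair a b k)
  go zero    = stair-decreasing a b k
  go (suc c) = All.++⁺ (All.replicate⁺ c ℕ.≤-refl) (All.map (λ p → ℕ.≤-trans p (ℕ.m≤n+m (k * b) b)) (stair-bound a b k)) ∷ go c

length-stair : ∀ a b k → length (stair a b k) ≡ k * a
length-stair a b zero    = refl
length-stair a b (suc k) = List.length-++ (replicate a _) ∙ cong₂ _+_ (List.length-replicate a) (length-stair a b k)

at-++ʳ : ∀ l m i → at (l ++ m) (length l + i) ≡ at m i
at-++ʳ []      m i = refl
at-++ʳ (x ∷ l) m i = at-++ʳ l m i

at-replicate : ∀ c v l {i} → i < c → at (replicate c v ++ l) i ≡ v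
at-replicate (suc c) v l {zero}  p       = refl
at-replicate (suc c) v l {suc i} (s≤s p) = at-replicate c v l p

stair-head : ∀ a b k → 0 < a → 0 < k → at (stair a b k) 0 ≡ k * b
stair-head a b (suc k) a>0 _ = at-replicate a (suc k * b) (stair a b k) a>0

stair-skip : ∀ a b k i → at (stair a b (suc k)) (a + i) ≡ at (stair a b k) i
stair-skip a b k i = cong (λ c → at (stair a b (suc k)) (c + i)) (sym (List.length-replicate a)) ∙ at-++ʳ (replicate a (suc k * b)) (stair a b k) i

-- The inner corners of the staircase lie on its diagonal.
stair-corner : ∀ a b k j → 0 < a → suc j < k * a → at (stair a b k) (suc j) < at (stair a b k) j →
  a * at (stair a b k) (suc j) + b * suc j ≡ a * (k * b)
stair-corner a b (suc k) j a>0 j< drop< with ℕ.<-cmp (suc j) a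
... | tri< sj<a _ _ = contradiction (at-replicate a _ _ sj<a ∙ sym (at-replicate a _ _ (ℕ.<-trans (ℕ.n<1+n j) sj<a))) (ℕ.<⇒≢ drop<)
... | tri≈ _ refl _ = cong (λ v → a * v + b * suc j) (skip′ ∙ stair-head a b k a>0 (positive k j<)) ∙ arith a b k
  where
  skip′ : at (stair a b (suc k)) (suc j) ≡ at (stair a b k) 0
  skip′ = cong (at (stair a b (suc k))) (sym (ℕ.+-identityʳ a)) ∙ stair-skip a b k 0
  positive : ∀ k → a < suc k * a → 0 < k
  positive zero    p = contradiction p (ℕ.<-irrefl (sym (ℕ.+-identityʳ a)))
  positive (suc k) p = s≤s z≤n
  arith : ∀ a b k → a * (k * b) + b * a ≡ a * (suc k * b)
  arith = solve-∀
... | tri> _ _ (s≤s a≤j) with i , refl ← ℕ.m≤n⇒∃[o]m+o≡n a≤j =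
  cong₂ (λ v s → a * v + b * s) (cong (at (stair a b (suc k))) (sym (ℕ.+-suc a i)) ∙ skip (suc i)) (sym (ℕ.+-suc a i))
  ∙ arith a b (at (stair a b k) (suc i)) (suc i)
  ∙ cong (_+ b * a) (stair-corner a b k i a>0 (ℕ.+-cancelˡ-< a (suc i) (k * a) (subst (_< suc k * a) (sym (ℕ.+-suc a i)) j<))
      (subst₂ _<_ (cong (at (stair a b (suc k))) (sym (ℕ.+-suc a i)) ∙ skip (suc i)) (skip i) drop<))
  ∙ arith′ a b k
  where
  skip : ∀ i → at (stair a b (suc k)) (a + i) ≡ at (stair a b k) i
  skip = stair-skip a b k
  arith : ∀ a b v s → a * v + b * (a + s) ≡ (a * v + b * s) + b * a
  arith = solve-∀
  arith′ : ∀ a b k → a * (k * b) + b * a ≡ a * (suc k * b)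
  arith′ = solve-∀

Pointwise-at : ∀ {l m} → Pointwise _≤_ l m → ∀ i → at l i ≤ at m i
Pointwise-at []       i       = z≤n
Pointwise-at (p ∷ ps) zero    = p
Pointwise-at (p ∷ ps) (suc i) = Pointwise-at ps i

-- Follow the lattice path of colours of a list whose false entries are 0, …, K - 1 and whose true
-- entries are K, …, K + m - 1. At a turn after i false and j true entries the weights
-- a (i + 1) and b j telescope.
module LatticePath (a b K m : ℕ) (area : b * m ≡ a * K) (c : ℕ → Bool) (low : ∀ {x y} → c y ≡ true → c x ≡ false → x < y)
  (γ⁺ γ⁻ : ℕ → ℕ → ℕ) (mono⁺ : ∀ {x y} → c x ≡ c y → γ⁺ x y ≡ 0) (mono⁻ : ∀ {x y} → c x ≡ c y → γ⁻ x y ≡ 0) where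

  open Coloured c
  private
    module ⁺ = Weighted γ⁺
    module ⁻ = Weighted γ⁻

  -- The telescoping quantity, for an entry x preceded by i false and j true entries. The signed
  -- weight a (i + 1) - b j of a turn is split between `γ⁺` and `γ⁻` so that no subtraction of the
  -- two is needed.
  potential : ℕ → ℕ → ℕ → ℕ
  potential x i j = if c x then a * i else b * j

  private
    range-∷ : ∀ {x l s n} → x ∷ l ≡ range s n → x ≡ s × ∃ λ n′ → n ≡ suc n′ × l ≡ range (suc s) n′
    range-∷ {n = suc n} e = List.∷-injectiveˡ e , n , refl , List.∷-injectiveʳ e

    ascend : ∀ {x y} l {p p′ V} → x < y → γ⁺ x y + p ≡ γ⁻ x y + p′ →
      ((a + b) * des (y ∷ l) + ⁺.ascents (y ∷ l) + ⁻.descents (y ∷ l)) + p′ ≡ (⁺.descents (y ∷ l) + ⁻.ascents (y ∷ l)) + V →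
      ((a + b) * des (x ∷ y ∷ l) + ⁺.ascents (x ∷ y ∷ l) + ⁻.descents (x ∷ y ∷ l)) + p ≡ (⁺.descents (x ∷ y ∷ l) + ⁻.ascents (x ∷ y ∷ l)) + V
    ascend {x} {y} l {p} {p′} {V} x<y e f rewrite <ᵇ-true {x} {y} x<y | <ᵇ-false {y} {x} (ℕ.<⇒≯ x<y) =
      regroup ((a + b) * des (y ∷ l)) (γ⁺ x y) (⁺.ascents (y ∷ l)) (⁻.descents (y ∷ l)) p
      ∙ cong ((a + b) * des (y ∷ l) + ⁺.ascents (y ∷ l) + ⁻.descents (y ∷ l) +_) e
      ∙ push ((a + b) * des (y ∷ l) + ⁺.ascents (y ∷ l) + ⁻.descents (y ∷ l)) (γ⁻ x y) p′ ∙ cong (γ⁻ x y +_) f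
      ∙ pull (γ⁻ x y) (⁺.descents (y ∷ l)) (⁻.ascents (y ∷ l)) V
      where
      regroup : ∀ d g s t p → (d + (g + s) + t) + p ≡ (d + s + t) + (g + p)
      regroup = solve-∀
      push : ∀ d g p → d + (g + p) ≡ g + (d + p)
      push = solve-∀
      pull : ∀ g s t v → g + (s + t + v) ≡ s + (g + t) + v
      pull = solve-∀

    descend : ∀ {x y} l {p p′ V} → y < x → (a + b) + γ⁻ y x + p ≡ γ⁺ y x + p′ →
      ((a + b) * des (y ∷ l) + ⁺.ascents (y ∷ l) + ⁻.descents (y ∷ l)) + p′ ≡ (⁺.descents (y ∷ l) + ⁻.ascents (y ∷ l)) + V →
      ((a + b) * des (x ∷ y ∷ l) + ⁺.ascents (x ∷ y ∷ l) + ⁻.descents (x ∷ y ∷ l)) + p ≡ (⁺.descents (x ∷ y ∷ l) + ⁻.ascents (x ∷ y ∷ l)) + V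
    descend {x} {y} l {p} {p′} {V} y<x e f rewrite <ᵇ-true {y} {x} y<x | <ᵇ-false {x} {y} (ℕ.<⇒≯ y<x) =
      regroup (a + b) (des (y ∷ l)) (⁺.ascents (y ∷ l)) (γ⁻ y x) (⁻.descents (y ∷ l)) p
      ∙ cong ((a + b) * des (y ∷ l) + ⁺.ascents (y ∷ l) + ⁻.descents (y ∷ l) +_) e
      ∙ push ((a + b) * des (y ∷ l) + ⁺.ascents (y ∷ l) + ⁻.descents (y ∷ l)) (γ⁺ y x) p′ ∙ cong (γ⁺ y x +_) f
      ∙ pull (γ⁺ y x) (⁺.descents (y ∷ l)) (⁻.ascents (y ∷ l)) V
      where
      regroup : ∀ c d s g t p → (c * (1 + d) + s + (g + t)) + p ≡ (c * d + s + t) + (c + g + p)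
      regroup = solve-∀
      push : ∀ d g p → d + (g + p) ≡ g + (d + p)
      push = solve-∀
      pull : ∀ g s t v → g + (s + t + v) ≡ (g + s) + t + v
      pull = solve-∀

  record Rest (l : List ℕ) (i j : ℕ) : Set where
    constructor rest
    field
      {#falses #trues} : ℕ
      falses≡ : falses l ≡ range i #falses
      trues≡  : trues l ≡ range (K + j) #trues
      K≡      : i + #falses ≡ K
      m≡      : j + #trues ≡ m

  private
    rest-false : ∀ {x l i j} → c x ≡ false → Rest (x ∷ l) i j → x ≡ i × Rest l (suc i) j
    rest-false {x} {l} {i} {j} cx (rest f t k m′) with refl , _ , refl , e ← range-∷ (sym (falses-false x l cx) ∙ f) =
      refl , rest e (sym (filterᵇ-false c x l cx) ∙ t) (sym (ℕ.+-suc x _) ∙ k) m′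

    rest-true : ∀ {x l i j} → c x ≡ true → Rest (x ∷ l) i j → x ≡ K + j × Rest l i (suc j)
    rest-true {x} {l} {i} {j} cx (rest f t k m′) with refl , n , refl , e ← range-∷ (sym (filterᵇ-true c x l cx) ∙ t) =
      refl , rest (sym (falses-true x l cx) ∙ f) (e ∙ cong (λ s → range s n) (sym (ℕ.+-suc K j))) k (sym (ℕ.+-suc j n) ∙ m′)

    rest-[] : ∀ {i j} → Rest [] i j → i ≡ K × j ≡ m
    rest-[] (rest {zero} {zero} _ _ k m′) = sym (ℕ.+-identityʳ _) ∙ k , sym (ℕ.+-identityʳ _) ∙ m′

    potential-true : ∀ {x i j} → c x ≡ true → potential x i j ≡ a * i
    potential-true {x} {i} {j} e = cong (λ t → if t then a * i else b * j) e
    potential-false : ∀ {x i j} → c x ≡ false → potential x i j ≡ b * j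
    potential-false {x} {i} {j} e = cong (λ t → if t then a * i else b * j) e

  -- The potential is constant along a run of one colour. At an ascent from false to true it grows
  -- from b j to a (i + 1), that is, by the weight of the turn. At a descent from true to false it
  -- changes from a i to b (j + 1), that is, by a + b minus the weight. So each descent contributes
  -- a + b. At the end the value is a K for either colour, by `area`.
  path-sum : ∀ x l i j → Rest (x ∷ l) i j →
    (∀ {u v} → Adjacent u v (x ∷ l) → c u ≡ false → c v ≡ true → γ⁺ u v + b * (v ∸ K) ≡ γ⁻ u v + a * suc u) →
    (∀ {u v} → Adjacent u v (x ∷ l) → c u ≡ true → c v ≡ false → γ⁺ v u ≡ a * suc v × γ⁻ v u ≡ b * (u ∸ K)) →
    ((a + b) * des (x ∷ l) + ⁺.ascents (x ∷ l) + ⁻.descents (x ∷ l)) + potential x i j ≡ (⁺.descents (x ∷ l) + ⁻.ascents (x ∷ l)) + a * K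
  path-sum x [] i j r hA hD rewrite ℕ.*-zeroʳ (a + b) = final (c x) refl
    where
    final : ∀ t → c x ≡ t → potential x i j ≡ a * K
    final true  cx = potential-true {x} cx ∙ cong (a *_) (proj₁ (rest-[] (proj₂ (rest-true cx r))))
    final false cx = potential-false {x} cx ∙ cong (b *_) (proj₂ (rest-[] (proj₂ (rest-false cx r)))) ∙ area
  path-sum x (y ∷ l) i j r hA hD = step (c x) (c y) refl refl
    where
    ih : ∀ {i j} → Rest (y ∷ l) i j → ((a + b) * des (y ∷ l) + ⁺.ascents (y ∷ l) + ⁻.descents (y ∷ l)) + potential y i j ≡ (⁺.descents (y ∷ l) + ⁻.ascents (y ∷ l)) + a * K
    ih {i} {j} r = path-sum y l i j r (hA ∘ there) (hD ∘ there)
    step : ∀ s t → c x ≡ s → c y ≡ t → ((a + b) * des (x ∷ y ∷ l) + ⁺.ascents (x ∷ y ∷ l) + ⁻.descents (x ∷ y ∷ l)) + potential x i j ≡ (⁺.descents (x ∷ y ∷ l) + ⁻.ascents (x ∷ y ∷ l)) + a * K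
    step true true cx cy with x≡ , r′ ← rest-true cx r with y≡ , _ ← rest-true cy r′ =
      ascend l (subst₂ _<_ (sym x≡) (sym y≡) (ℕ.+-monoʳ-< K (ℕ.n<1+n j)))
        (cong₂ _+_ (mono⁺ (cx ∙ sym cy)) (potential-true {x} cx ∙ sym (potential-true {y} cy)) ∙ cong (_+ potential y i (suc j)) (sym (mono⁻ (cx ∙ sym cy)))) (ih r′)
    step false false cx cy with x≡ , r′ ← rest-false cx r with y≡ , _ ← rest-false cy r′ =
      ascend l (subst₂ _<_ (sym x≡) (sym y≡) (ℕ.n<1+n i))
        (cong₂ _+_ (mono⁺ (cx ∙ sym cy)) (potential-false {x} cx ∙ sym (potential-false {y} cy)) ∙ cong (_+ potential y (suc i) j) (sym (mono⁻ (cx ∙ sym cy)))) (ih r′)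
    step false true cx cy with x≡ , r′ ← rest-false cx r with y≡ , _ ← rest-true cy r′ =
      ascend l (low cy cx)
        (cong (γ⁺ x y +_) (potential-false {x} cx ∙ cong (b *_) (sym (cong (_∸ K) y≡ ∙ ℕ.m+n∸m≡n K j))) ∙ hA here cx cy
          ∙ cong (γ⁻ x y +_) (cong (λ i → a * suc i) x≡ ∙ sym (potential-true {y} cy))) (ih r′)
    step true false cx cy with x≡ , r′ ← rest-true cx r with y≡ , _ ← rest-false cy r′ =
      descend l (low cx cy)
        (cong₂ (λ g p → (a + b) + g + p) (proj₂ (hD here cx cy) ∙ cong (b *_) (cong (_∸ K) x≡ ∙ ℕ.m+n∸m≡n K j)) (potential-true {x} cx)
          ∙ turn a b i j ∙ cong₂ _+_ (cong (λ i → a * suc i) (sym y≡) ∙ sym (proj₁ (hD here cx cy))) (sym (potential-false {y} cy))) (ih r′)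
      where
      turn : ∀ a b i j → (a + b) + b * j + a * i ≡ a * suc i + b * suc j
      turn = solve-∀

area : ∀ a b k → b * (k * a) ≡ a * (k * b)
area = solve-∀

module RectangularStaircase (k a b : ℕ) (a>0 : 0 < a) (b>0 : 0 < b) where

  private
    K m : ℕ
    K = k * b
    m = k * a
    λ′ : List ℕ
    λ′ = stair a b k
    module G = InverseGrassmannianOf K m λ′ (length-stair a b k) (stair-decreasing a b k) (stair-bound a b k)
    c : ℕ → Bool
    c = G.colour
    w : List ℕ
    w = G.perm
    w↭ : w ↭ upTo (K + m)
    w↭ = G.perm-↭

  open Interval (K + m) w w↭
  open Coloured c
  open TwoColoured G.coloured

  private
    E : List (List ℕ)
    E = elems W

    unique∈ : ∀ {p} → p ∈ E → Unique p
    unique∈ p∈ = perm-unique (proj₁ (∈⁻ p∈))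

    trues-p : ∀ {p} → p ∈ E → trues p ≡ G.β
    trues-p p∈ = trues-e w↭ G.coloured p∈ ∙ sym (trues-e w↭ G.coloured w∈) ∙ G.trues≡

    falses-p : ∀ {p} → p ∈ E → falses p ≡ range 0 K
    falses-p p∈ = falses-e w↭ G.coloured p∈ ∙ sym (falses-e w↭ G.coloured w∈) ∙ G.falses≡ ∙ upTo-range K

    row : ∀ {p} → p ∈ E → ∀ {j} → j < m → at (colourCode p) j ≡ falsesAfter (K + j) p
    row {p} p∈ {j} j<m = cong (λ l → at l j) (colourCode-map p (unique∈ p∈) ∙ cong (map (λ y → falsesAfter y p)) (trues-p p∈))
      ∙ at-map (λ y → falsesAfter y p) G.β (subst (j <_) (sym (List.length-applyUpTo (K +_) m)) j<m) ∙ cong (λ y → falsesAfter y p) (at-applyUpTo (K +_) m j<m)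

    row≤ : ∀ {p} → p ∈ E → ∀ {j} → j < m → falsesAfter (K + j) p ≤ at λ′ j
    row≤ {p} p∈ {j} j<m = subst₂ _≤_ (row p∈ j<m) (cong (λ l → at l j) G.code≡) (Pointwise-at
      (colourCode-mono (unique∈ p∈) (unique∈ w∈) (trues-p p∈ ∙ sym (trues-p w∈)) (falses-p p∈ ∙ sym (falses-p w∈)) (λ cy cx b → proj₂ (proj₂ (∈⁻ p∈) (G.low cy cx , b)))) j)

    trues-sorted : ∀ {p x y} → p ∈ E → c x ≡ true → c y ≡ true → Before x y p → x < y
    trues-sorted p∈ cx cy b = AllPairs-Before (subst (AllPairs _<_) (sym (trues-p p∈)) (AllPairs.applyUpTo⁺₁ (K +_) m (λ i<j _ → ℕ.+-monoʳ-< K i<j))) (filterᵇ-Before c b cx cy)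

    -- An ascent that cannot be toggled sits at an inner corner of the staircase: the row of y is
    -- full, while the row before it reaches further. By `stair-corner` such corners are on the
    -- diagonal, where the signed weight is 0.
    corner : ∀ {p} → p ∈ E → ∀ {x y} → Adjacent x y p → c x ≡ false → c y ≡ true → ¬ Before y x w → b * (y ∸ K) ≡ a * suc x
    corner {p} p∈ {x} {y} adj cx cy ¬yx with P , Q , refl ← Adjacent-split adj
      with j , j<m , refl ← Mem.∈-applyUpTo⁻ (K +_) (subst (y ∈_) (trues-p p∈) (∈-filterᵇ⁺ c (Before-∈ʳ (Adjacent-Before adj)) cy)) =
        conclude j j<m refl
      where
      up : Unique (P ++ x ∷ y ∷ Q)
      up = unique∈ p∈
      reassoc : P ++ x ∷ y ∷ Q ≡ (P ++ [ x ]) ++ y ∷ Q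
      reassoc = sym (List.++-assoc P [ x ] (y ∷ Q))
      after-p : falsesAfter y (P ++ x ∷ y ∷ Q) ≡ length (falses Q)
      after-p = cong (falsesAfter y) reassoc ∙ falsesAfter-mid y (P ++ [ x ]) (subst Unique reassoc up)
      falses-split : falses P ++ x ∷ falses Q ≡ range 0 K
      falses-split = cong (falses P ++_) (sym (falses-false x (y ∷ Q) cx ∙ cong (x ∷_) (falses-true y Q cy))) ∙ sym (List.filter-++ _ P (x ∷ y ∷ Q)) ∙ falses-p p∈
      position : x + suc (length (falses Q)) ≡ K
      position with e₁ , e₂ ← range-position (falses P) 0 K falses-split = cong (_+ suc (length (falses Q))) (sym e₁) ∙ e₂
      in-P′ : ∀ P′ Q′ → w ≡ P′ ++ y ∷ Q′ → x ∈ P′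
      in-P′ P′ Q′ e with Mem.∈-++⁻ P′ (subst (x ∈_) e (Perm.∈-resp-↭ (↭-trans (proj₁ (∈⁻ p∈)) (↭-sym w↭)) (Before-∈ˡ (Adjacent-Before adj))))
      ... | inj₁ i = i
      ... | inj₂ (here refl) = false≢true cx cy
      ... | inj₂ (there i)   = contradiction (subst (Before y x) (sym e) (Before-++ʳ P′ (here i))) ¬yx
      after-w : falsesAfter y w ≤ length (falses Q)
      after-w with P′ , Q′ , e ← Mem.∈-∃++ (Perm.∈-resp-↭ (↭-trans (proj₁ (∈⁻ p∈)) (↭-sym w↭)) (Before-∈ʳ (Adjacent-Before adj)))
        with A , B , e′ ← Mem.∈-∃++ (∈-filterᵇ⁺ (not ∘ c) (in-P′ P′ Q′ e) (not-false⁺ {x} cx)) = subst (_≤ length (falses Q)) (sym (cong (falsesAfter y) e ∙ falsesAfter-mid y P′ (subst Unique e (unique∈ w∈)))) bounded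
        where
        whole : A ++ x ∷ (B ++ falses Q′) ≡ range 0 K
        whole = sym (List.++-assoc A (x ∷ B) (falses Q′)) ∙ cong (_++ falses Q′) (sym e′) ∙ cong (falses P′ ++_) (sym (falses-true y Q′ cy)) ∙ sym (List.filter-++ _ P′ (y ∷ Q′)) ∙ cong falses (sym e) ∙ falses-p w∈
        bounded : length (falses Q′) ≤ length (falses Q)
        bounded with e₁ , e₂ ← range-position A 0 K whole = ℕ.≤-trans (ℕ.≤-trans (ℕ.m≤n+m _ (length B)) (ℕ.≤-reflexive (sym (List.length-++ B))))
          (ℕ.≤-reflexive (ℕ.suc-injective (ℕ.+-cancelˡ-≡ x _ _ (cong (_+ suc (length (B ++ falses Q′))) (sym e₁) ∙ e₂ ∙ sym position))))
      conclude : ∀ j → j < m → y ≡ K + j → b * (y ∸ K) ≡ a * suc x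
      conclude j j<m y≡ = cong (λ v → b * (v ∸ K)) y≡ ∙ cong (b *_) (ℕ.m+n∸m≡n K j) ∙ diagonal j j<m y≡
        where
        height : ∀ j → j < m → y ≡ K + j → at λ′ j ≡ length (falses Q)
        height j j<m y≡ = ℕ.≤-antisym (subst (_≤ length (falses Q)) (cong (λ v → falsesAfter v w) y≡ ∙ sym (row w∈ j<m) ∙ cong (λ l → at l j) G.code≡) after-w)
          (subst (_≤ at λ′ j) (cong (λ v → falsesAfter v (P ++ x ∷ y ∷ Q)) (sym y≡) ∙ after-p) (row≤ p∈ j<m))
        diagonal : ∀ j → j < m → y ≡ K + j → b * j ≡ a * suc x
        -- The first row is full only if no false entry precedes y, but x does.
        diagonal zero j<m y≡ = contradiction (sym (height 0 j<m y≡) ∙ stair-head a b k a>0 (positive k j<m)) (ℕ.<⇒≢ (ℕ.≤-trans (ℕ.m≤n+m _ x) (ℕ.≤-reflexive position)))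
          where
          positive : ∀ k → 0 < k * a → 0 < k
          positive (suc k) _ = s≤s z≤n
        diagonal (suc j) j<m y≡ = sym (ℕ.+-cancelˡ-≡ (a * at λ′ (suc j)) _ _
            (sym (ℕ.*-distribˡ-+ a (at λ′ (suc j)) (suc x)) ∙ cong (a *_) (ℕ.+-comm (at λ′ (suc j)) (suc x) ∙ cong (suc x +_) (height (suc j) j<m y≡) ∙ sym (ℕ.+-suc x _) ∙ position)
            ∙ sym (stair-corner a b k j a>0 j<m (ℕ.≤-trans (s≤s (ℕ.≤-reflexive (height (suc j) j<m y≡))) (ℕ.≤-trans previous (row≤ p∈ (ℕ.<-trans (ℕ.n<1+n j) j<m)))))))
          where
          y′ : ℕ
          y′ = K + j
          y′<y : y′ < y
          y′<y = subst (y′ <_) (sym y≡) (ℕ.+-monoʳ-< K (ℕ.n<1+n j))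
          y′-true : y′ ∈ P ++ x ∷ y ∷ Q × c y′ ≡ true
          y′-true = ∈-filterᵇ⁻ c (subst (y′ ∈_) (sym (trues-p p∈)) (Mem.∈-applyUpTo⁺ (K +_) (ℕ.<-trans (ℕ.n<1+n j) j<m)))
          y′∈P : y′ ∈ P
          y′∈P with Mem.∈-++⁻ P (proj₁ y′-true)
          ... | inj₁ i                  = i
          ... | inj₂ (here e)           = false≢true cx (cong c (sym e) ∙ proj₂ y′-true)
          ... | inj₂ (there (here e))   = contradiction e (ℕ.<⇒≢ y′<y)
          ... | inj₂ (there (there i))  = contradiction (trues-sorted p∈ cy (proj₂ y′-true) (Before-++ʳ P (there (here i)))) (ℕ.<⇒≯ y′<y)
          previous : suc (length (falses Q)) ≤ falsesAfter y′ (P ++ x ∷ y ∷ Q)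
          previous with P₁ , P₂ , e ← Mem.∈-∃++ y′∈P = subst (suc (length (falses Q)) ≤_) (sym (cong (falsesAfter y′) whole ∙ falsesAfter-mid y′ P₁ (subst Unique whole up) ∙ cong length (List.filter-++ _ P₂ (x ∷ y ∷ Q)) ∙ List.length-++ (falses P₂) ∙ cong (length (falses P₂) +_) (cong length (falses-false x (y ∷ Q) cx ∙ cong (x ∷_) (falses-true y Q cy)))))
              (ℕ.m≤n+m _ _)
            where
            whole : P ++ x ∷ y ∷ Q ≡ P₁ ++ y′ ∷ P₂ ++ x ∷ y ∷ Q
            whole = cong (_++ x ∷ y ∷ Q) e ∙ List.++-assoc P₁ (y′ ∷ P₂) (x ∷ y ∷ Q)

    inverted : ℕ → ℕ → Bool
    inverted x y = (not (c x) ∧ c y) ∧ ⌊ Before? y x w ⌋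

    -- Weights are confined to pairs inverted in w, as toggle symmetry requires. For the pair of i
    -- and K + j their difference is a (i + 1) - b j.
    γ⁺ γ⁻ : ℕ → ℕ → ℕ
    γ⁺ x y = if inverted x y then a * suc x else 0
    γ⁻ x y = if inverted x y then b * (y ∸ K) else 0

    inverted-yes : ∀ {x y} → c x ≡ false → c y ≡ true → Before y x w → inverted x y ≡ true
    inverted-yes {x} {y} cx cy b rewrite cx | cy with Before? y x w
    ... | yes _ = refl
    ... | no ¬b = contradiction b ¬b

    inverted-no : ∀ {x y} → ¬ Before y x w → inverted x y ≡ false
    inverted-no {x} {y} ¬b with Before? y x w
    ... | yes b = contradiction b ¬b
    ... | no _  = Bool.∧-zeroʳ _

    inverted-same : ∀ {x y} → c x ≡ c y → inverted x y ≡ false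
    inverted-same {x} {y} e rewrite e with c y
    ... | true  = refl
    ... | false = refl

    module ⁺ = Weighted γ⁺
    module ⁻ = Weighted γ⁻

    pointwise : ∀ p → p ∈ E → (a + b) * des p + ⁺.ascents p + ⁻.descents p ≡ (⁺.descents p + ⁻.ascents p) + a * K
    pointwise [] p∈ rewrite ℕ.*-zeroʳ (a + b) = sym (cong (a *_) (empty K (falses-p p∈)) ∙ ℕ.*-zeroʳ a)
      where
      empty : ∀ K → [] ≡ range 0 K → K ≡ 0
      empty zero _ = refl
    pointwise (x ∷ l) p∈ = sym (ℕ.+-identityʳ _) ∙ cong ((a + b) * des (x ∷ l) + ⁺.ascents (x ∷ l) + ⁻.descents (x ∷ l) +_) (sym start)
        ∙ path-sum x l 0 0 (rest (falses-p p∈) (trues-p p∈ ∙ range-applyUpTo (K +_) (K + 0) m (λ i → cong (_+ i) (sym (ℕ.+-identityʳ K)))) refl refl) ascent descent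
      where
      open LatticePath a b K m (area a b k) c G.low γ⁺ γ⁻
        (λ {x} {y} e → cong (λ t → if t then a * suc x else 0) (inverted-same {x} {y} e))
        (λ {x} {y} e → cong (λ t → if t then b * (y ∸ K) else 0) (inverted-same {x} {y} e))
      start : potential x 0 0 ≡ 0
      start = cong₂ (λ m n → if c x then m else n) (ℕ.*-zeroʳ a) (ℕ.*-zeroʳ b) ∙ Bool.if-eta (c x)
      ascent : ∀ {u v} → Adjacent u v (x ∷ l) → c u ≡ false → c v ≡ true → γ⁺ u v + b * (v ∸ K) ≡ γ⁻ u v + a * suc u
      ascent {u} {v} adj cu cv with Before? v u w
      ... | yes b′ = cong (λ t → (if t then a * suc u else 0) + b * (v ∸ K)) on ∙ ℕ.+-comm (a * suc u) _ ∙ cong (λ t → (if t then b * (v ∸ K) else 0) + a * suc u) (sym on)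
        where
        on : (not (c u) ∧ c v) ∧ true ≡ true
        on rewrite cu | cv = refl
      ... | no ¬b = cong (λ t → (if t then a * suc u else 0) + b * (v ∸ K)) off ∙ corner p∈ adj cu cv ¬b ∙ cong (λ t → (if t then b * (v ∸ K) else 0) + a * suc u) (sym off)
        where
        off : (not (c u) ∧ c v) ∧ false ≡ false
        off = Bool.∧-zeroʳ _
      descent : ∀ {u v} → Adjacent u v (x ∷ l) → c u ≡ true → c v ≡ false → γ⁺ v u ≡ a * suc v × γ⁻ v u ≡ b * (u ∸ K)
      descent {u} {v} adj cu cv = cong (λ t → if t then a * suc v else 0) on , cong (λ t → if t then b * (u ∸ K) else 0) on
        where
        on : inverted v u ≡ true
        on = inverted-yes cv cu (proj₂ (proj₂ (∈⁻ p∈) (G.low cu cv , Adjacent-Before adj)))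

    module T⁺ = Toggle γ⁺ (λ {x} {y} _ ¬b → cong (λ t → if t then a * suc x else 0) (inverted-no {x} {y} ¬b))
    module T⁻ = Toggle γ⁻ (λ {x} {y} _ ¬b → cong (λ t → if t then b * (y ∸ K) else 0) (inverted-no {x} {y} ¬b))

    -- The identity `pointwise` holds for each single path, so it can be averaged against any M for
    -- which toggle symmetry holds. The weighted terms then cancel, and a + b times the expected
    -- number of descents is a K = k a b.
    expectation : (M : List ℕ → ℕ) → ∑ E (λ p → ⁺.ascents p * M p) ≡ ∑ E (λ p → ⁺.descents p * M p) → ∑ E (λ p → ⁻.ascents p * M p) ≡ ∑ E (λ p → ⁻.descents p * M p) →
      ∑ E (λ p → des p * M p) * (a + b) ≡ (k * a * b) * ∑ E M
    expectation M t⁺ t⁻ = ℕ.+-cancelʳ-≡ (S⁺ + S⁻) _ _ (cong (_+ (S⁺ + S⁻)) (ℕ.*-comm S (a + b) ∙ sym (∑-* (a + b) E (λ p → des p * M p))) ∙ cong₂ (λ m n → ∑ E (λ p → (a + b) * (des p * M p)) + (m + n)) (sym t⁺) refl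
        ∙ cong (∑ E (λ p → (a + b) * (des p * M p)) +_) (sym (∑-+ E (λ p → ⁺.ascents p * M p) (λ p → ⁻.descents p * M p))) ∙ sym (∑-+ E _ _)
        ∙ ∑-cong E (λ p p∈ → expand (a + b) (des p) (⁺.ascents p) (⁻.descents p) (M p) ∙ cong (_* M p) (pointwise p p∈) ∙ collect (⁺.descents p) (⁻.ascents p) (a * K) (M p))
        ∙ ∑-+ E _ _ ∙ cong₂ _+_ (∑-* (a * K) E M ∙ cong (_* ∑ E M) (area′ a b k)) (∑-+ E (λ p → ⁺.descents p * M p) (λ p → ⁻.ascents p * M p) ∙ cong (S⁺ +_) t⁻))
      where
      S S⁺ S⁻ : ℕ
      S  = ∑ E (λ p → des p * M p)
      S⁺ = ∑ E (λ p → ⁺.descents p * M p)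
      S⁻ = ∑ E (λ p → ⁻.descents p * M p)
      expand : ∀ c d s t m → c * (d * m) + (s * m + t * m) ≡ (c * d + s + t) * m
      expand = solve-∀
      collect : ∀ s t v m → ((s + t) + v) * m ≡ v * m + (s * m + t * m)
      collect = solve-∀
      area′ : ∀ a b k → a * (k * b) ≡ k * a * b
      area′ = solve-∀

    a+b>0 : 0 < a + b
    a+b>0 = ℕ.≤-trans a>0 (ℕ.m≤m+n a b)

    iso : W ≅ YoungInterval λ′
    iso = G.weak≅young

    EX-W : EX W ≡ frac (k * a * b) (a + b)
    EX-W = IntervalExpectation.EX-frac (K + m) w w↭ (k * a * b) (a + b) a+b>0
      (cong (_* (a + b)) (∑-cong E (λ p _ → sym (ℕ.*-identityʳ (des p)))) ∙ expectation (λ _ → 1) (scale ⁺.ascents ⁺.descents T⁺.uniform) (scale ⁻.ascents ⁻.descents T⁻.uniform)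
        ∙ cong ((k * a * b) *_) (sym (length-≡-∑ E)))
      where
      scale : (f g : List ℕ → ℕ) → ∑ E f ≡ ∑ E g → ∑ E (λ p → f p * 1) ≡ ∑ E (λ p → g p * 1)
      scale f g e = ∑-cong E (λ p _ → ℕ.*-identityʳ (f p)) ∙ e ∙ sym (∑-cong E (λ p _ → ℕ.*-identityʳ (g p)))

    EY-W : EY W ≡ frac (k * a * b) (a + b)
    EY-W = IntervalExpectation.EY-frac (K + m) w w↭ (k * a * b) (a + b) a+b>0 (expectation (numMaxChainsThrough W) T⁺.maxChains-uniform T⁻.maxChains-uniform)

  EX-stair : EX (YoungInterval (stair a b k)) ≡ frac (k * a * b) (a + b)
  EX-stair = ≅-sym-EX iso ∙ EX-W

  EY-stair : EY (YoungInterval (stair a b k)) ≡ frac (k * a * b) (a + b)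
  EY-stair = sym (Isomorphism.EY-≅ iso) ∙ EY-W

  EY-stair-dual : EY (dual (YoungInterval (stair a b k))) ≡ frac (k * a * b) (a + b)
  EY-stair-dual = sym (Isomorphism.EY-≅ (≅-dual iso)) ∙ EY-dual ∙ EY-W

-- Dominant permutations and forests

data Forest : Set where
  leaf : Forest
  node : Forest → Forest → Forest

size : Forest → ℕ
size leaf       = 0
size (node L R) = size R + suc (size L)

-- A 132-avoiding word decomposes around its largest entry as L n R with all of L above all of R.
-- Its interval in weak order consists of the linear extensions of the forest with a root n over
-- the forest of L, next to the forest of R.
word : Forest → ℕ → List ℕ
word leaf       o = []
word (node L R) o = word L (o + size R) ++ (o + size R + size L) ∷ word R o

code : Forest → List ℕ
code leaf       = []
code (node L R) = map (size R +_) (code L) ++ size R ∷ code R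

range-++ : ∀ s m n → range s (m + n) ≡ range s m ++ range (s + m) n
range-++ s zero    n = cong (λ t → range t n) (sym (ℕ.+-identityʳ s))
range-++ s (suc m) n = cong (s ∷_) (range-++ (suc s) m n ∙ cong (λ t → range (suc s) m ++ range t n) (sym (ℕ.+-suc s m)))

range-bounds : ∀ s n → All (λ v → s ≤ v × v < s + n) (range s n)
range-bounds s zero    = []
range-bounds s (suc n) = (ℕ.≤-refl , ℕ.m<m+n s (s≤s z≤n)) ∷ All.map (λ (p , q) → ℕ.<⇒≤ p , ℕ.<-≤-trans q (ℕ.≤-reflexive (sym (ℕ.+-suc s n)))) (range-bounds (suc s) n)

range-unique : ∀ s n → Unique (range s n)
range-unique s zero    = []
range-unique s (suc n) = All.map (λ (p , _) → ℕ.<⇒≢ p) (range-bounds (suc s) n) ∷ range-unique (suc s) n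

word-↭ : ∀ F o → word F o ↭ range o (size F)
word-↭ leaf       o = refl
word-↭ (node L R) o = ↭-trans (Perm.++⁺ (word-↭ L (o + size R)) (prep _ (word-↭ R o)))
  (↭-trans (Perm.shift (o + size R + size L) (range (o + size R) (size L)) (range o (size R)))
  (↭-trans (prep _ (Perm.++-comm (range (o + size R) (size L)) (range o (size R))))
  (↭-trans (↭-sym (↭-trans (↭-reflexive (sym (List.++-assoc (range o (size R)) (range (o + size R) (size L)) _))) (↭-sym (Perm.∷↭∷ʳ (o + size R + size L) (range o (size R) ++ range (o + size R) (size L))))))
    (↭-reflexive (sym (range-++ o (size R) (suc (size L)) ∙ cong (range o (size R) ++_) (cong (range (o + size R)) (ℕ.+-comm 1 (size L)) ∙ range-++ (o + size R) (size L) 1)))))))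

word-bounds : ∀ F o → All (λ v → o ≤ v × v < o + size F) (word F o)
word-bounds F o = Perm.All-resp-↭ (↭-sym (word-↭ F o)) (range-bounds o (size F))

word-unique : ∀ F o → Unique (word F o)
word-unique F o = Unique-↭ (↭-sym (word-↭ F o)) (range-unique o (size F))

smaller-all : ∀ x l → All (_< x) l → smaller x l ≡ length l
smaller-all x []      []       = refl
smaller-all x (y ∷ l) (p ∷ ps) = smaller-∷-< l p ∙ cong suc (smaller-all x l ps)

prefixCode-shift : ∀ k as {bs} → (∀ a → a ∈ as → smaller a bs ≡ k) → prefixCode as bs ≡ map (k +_) (lehmer as)
prefixCode-shift k []            h = refl
prefixCode-shift k (a ∷ as) {bs} h = cong₂ _∷_ (count-++ _ as bs ∙ cong (smaller a as +_) (h a (here refl)) ∙ ℕ.+-comm (smaller a as) k) (prefixCode-shift k as (λ x x∈ → h x (there x∈)))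

length-word : ∀ F o → length (word F o) ≡ size F
length-word F o = Perm.↭-length (word-↭ F o) ∙ go o (size F)
  where
  go : ∀ s n → length (range s n) ≡ n
  go s zero    = refl
  go s (suc n) = cong suc (go (suc s) n)

lehmer-word : ∀ F o → lehmer (word F o) ≡ code F
lehmer-word leaf       o = refl
lehmer-word (node L R) o = lehmer-++ (word L (o + size R)) (root ∷ word R o) ∙ cong₂ _++_
    (prefixCode-shift (size R) (word L (o + size R)) (λ a a∈ → smaller-∷-≮ (word R o) (ℕ.<⇒≯ (proj₂ (All.lookup (word-bounds L (o + size R)) a∈)))
        ∙ smaller-all a (word R o) (All.map (λ (_ , q) → ℕ.<-≤-trans q (proj₁ (All.lookup (word-bounds L (o + size R)) a∈))) (word-bounds R o)) ∙ length-word R o)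
      ∙ cong (map (size R +_)) (lehmer-word L (o + size R)))
    (cong₂ _∷_ (smaller-all root (word R o) (All.map (λ (_ , q) → ℕ.<-≤-trans q (ℕ.m≤m+n (o + size R) (size L))) (word-bounds R o)) ∙ length-word R o) (lehmer-word R o))
  where
  root : ℕ
  root = o + size R + size L

-- Linear extensions of forests as shuffles

shuffles : List ℕ → List ℕ → List (List ℕ)
shuffles []      q       = [ q ]
shuffles (x ∷ p) []      = [ x ∷ p ]
shuffles (x ∷ p) (y ∷ q) = map (x ∷_) (shuffles p (y ∷ q)) ++ map (y ∷_) (shuffles (x ∷ p) q)

module _ (c : ℕ → Bool) where
  open Coloured c

  no-falses : ∀ {p} → All (λ x → c x ≡ true) p → falses p ≡ []
  no-falses []                = refl
  no-falses {x ∷ p} (cx ∷ ps) = falses-true x p cx ∙ no-falses ps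

  all-true : ∀ {p} → All (λ x → c x ≡ true) p → trues p ≡ p
  all-true []                = refl
  all-true {x ∷ p} (cx ∷ ps) = filterᵇ-true c x p cx ∙ cong (x ∷_) (all-true ps)

  no-trues : ∀ {p} → All (λ x → c x ≡ false) p → trues p ≡ []
  no-trues []                = refl
  no-trues {x ∷ p} (cx ∷ ps) = filterᵇ-false c x p cx ∙ no-trues ps

  all-false : ∀ {p} → All (λ x → c x ≡ false) p → falses p ≡ p
  all-false []                = refl
  all-false {x ∷ p} (cx ∷ ps) = falses-false x p cx ∙ cong (x ∷_) (all-false ps)

  shuffles-colours : ∀ p q {u} → All (λ x → c x ≡ true) p → All (λ y → c y ≡ false) q → u ∈ shuffles p q → trues u ≡ p × falses u ≡ q
  shuffles-colours []      q       ps qs (here refl) = no-trues qs , all-false qs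
  shuffles-colours (x ∷ p) []      ps qs (here refl) = all-true ps , no-falses ps
  shuffles-colours (x ∷ p) (y ∷ q) (cx ∷ ps) (cy ∷ qs) u∈ with Mem.∈-++⁻ (map (x ∷_) (shuffles p (y ∷ q))) u∈
  ... | inj₁ i with v , v∈ , refl ← Mem.∈-map⁻ (x ∷_) i with t , f ← shuffles-colours p (y ∷ q) ps (cy ∷ qs) v∈ =
    filterᵇ-true c x v cx ∙ cong (x ∷_) t , falses-true x v cx ∙ f
  ... | inj₂ i with v , v∈ , refl ← Mem.∈-map⁻ (y ∷_) i with t , f ← shuffles-colours (x ∷ p) q (cx ∷ ps) qs v∈ =
    filterᵇ-false c y v cy ∙ t , falses-false y v cy ∙ cong (y ∷_) f

  shuffles-complete : ∀ u → u ∈ shuffles (trues u) (falses u)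
  shuffles-complete []      = here refl
  shuffles-complete (x ∷ u) with c x
  ... | true  = left (falses u) (shuffles-complete u)
    where
    left : ∀ q → u ∈ shuffles (trues u) q → x ∷ u ∈ shuffles (x ∷ trues u) q
    left []      u∈ = here (cong (x ∷_) (single (trues u) u∈))
      where
      single : ∀ p → u ∈ shuffles p [] → u ≡ p
      single []      (here e) = e
      single (_ ∷ _) (here e) = e
    left (y ∷ q) u∈ = Mem.∈-++⁺ˡ (Mem.∈-map⁺ (x ∷_) u∈)
  ... | false = right (trues u) (shuffles-complete u)
    where
    right : ∀ p → u ∈ shuffles p (falses u) → x ∷ u ∈ shuffles p (x ∷ falses u)
    right []      (here e) = here (cong (x ∷_) e)
    right (y ∷ p) u∈       = Mem.∈-++⁺ʳ (map (y ∷_) (shuffles p (x ∷ falses u))) (Mem.∈-map⁺ (x ∷_) u∈)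

  shuffles-unique : ∀ p q → All (λ x → c x ≡ true) p → All (λ y → c y ≡ false) q → Unique (shuffles p q)
  shuffles-unique []      q       ps qs = [] ∷ []
  shuffles-unique (x ∷ p) []      ps qs = [] ∷ []
  shuffles-unique (x ∷ p) (y ∷ q) (cx ∷ ps) (cy ∷ qs) = Unique.++⁺ (Unique.map⁺ List.∷-injectiveʳ (shuffles-unique p (y ∷ q) ps (cy ∷ qs)))
    (Unique.map⁺ List.∷-injectiveʳ (shuffles-unique (x ∷ p) q (cx ∷ ps) qs))
    (λ (i , j) → let _ , _ , e = Mem.∈-map⁻ (x ∷_) i ; _ , _ , e′ = Mem.∈-map⁻ (y ∷_) j in false≢true cy (cong c (List.∷-injectiveˡ (sym e′ ∙ e)) ∙ cx))

linearExtensions : Forest → ℕ → List (List ℕ)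
linearExtensions leaf       o = [ [] ]
linearExtensions (node L R) o =
  concatMap (λ p → concatMap (λ q → shuffles (p ++ [ o + size R + size L ]) q) (linearExtensions R o)) (linearExtensions L (o + size R))

module Node (L R : Forest) (o : ℕ) where

  bottom root : ℕ
  bottom = o + size R
  root   = bottom + size L

  w wL wR : List ℕ
  wL = word L bottom
  wR = word R o
  w  = word (node L R) o

  upper : ℕ → Bool
  upper v = not (v <ᵇ bottom)

  open Coloured upper

  upper⁺ : ∀ {v} → bottom ≤ v → upper v ≡ true
  upper⁺ {v} p = cong not (<ᵇ-false {v} {bottom} (ℕ.≤⇒≯ p))

  lower⁺ : ∀ {v} → v < bottom → upper v ≡ false
  lower⁺ {v} p = cong not (<ᵇ-true {v} {bottom} p)

  low : ∀ {x y} → upper y ≡ true → upper x ≡ false → x < y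
  low {x} {y} cy cx = ℕ.<-≤-trans (<ᵇ-sound {x} {bottom} (Bool.not-injective cx)) (ℕ.≮⇒≥ (<ᵇ-unsound {y} {bottom} (Bool.not-injective cy)))

  upper-wL : All (λ v → upper v ≡ true) (wL ++ [ root ])
  upper-wL = All.++⁺ (All.map (λ (p , _) → upper⁺ p) (word-bounds L bottom)) (upper⁺ (ℕ.m≤m+n bottom (size L)) ∷ [])

  lower-wR : All (λ v → upper v ≡ false) wR
  lower-wR = All.map (λ (_ , q) → lower⁺ q) (word-bounds R o)

  w-split : w ≡ (wL ++ [ root ]) ++ wR
  w-split = sym (List.++-assoc wL [ root ] wR)

  trues-w : trues w ≡ wL ++ [ root ]
  trues-w = cong trues w-split ∙ List.filter-++ _ (wL ++ [ root ]) wR ∙ cong₂ _++_ (all-true upper upper-wL) (no-trues upper lower-wR) ∙ List.++-identityʳ _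

  falses-w : falses w ≡ wR
  falses-w = cong falses w-split ∙ List.filter-++ _ (wL ++ [ root ]) wR ∙ cong₂ _++_ (no-falses upper upper-wL) (all-false upper lower-wR)

  root-last : ∀ {p s t} → All (_< root) p → t < s → Before s t (p ++ [ root ]) → Before s t p
  root-last {p} small t<s b with Before-++⁻ p b
  ... | inj₁ b′                      = b′
  ... | inj₂ (inj₁ (s∈ , here refl)) = contradiction t<s (ℕ.<⇒≯ (All.lookup small s∈))
  ... | inj₂ (inj₂ (here ()))
  ... | inj₂ (inj₂ (there ()))

  below-root : ∀ {p} → p ↭ wL → All (_< root) p
  below-root p↭ = Perm.All-resp-↭ (↭-sym p↭) (All.map proj₂ (word-bounds L bottom))

  -- All entries of L and the root stand above and before those of R in w, so between the two words
  -- either order is allowed. Within each word the inversions are controlled by the parts.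
  ∈-node⁺ : ∀ {p q u} → p ↭ wL → InvSub p wL → q ↭ wR → InvSub q wR → u ∈ shuffles (p ++ [ root ]) q → u ↭ w × InvSub u w
  ∈-node⁺ {p} {q} {u} p↭ p-sub q↭ q-sub u∈ = u↭w , sub
    where
    colours : trues u ≡ p ++ [ root ] × falses u ≡ q
    colours = shuffles-colours upper (p ++ [ root ]) q (Perm.All-resp-↭ (Perm.++⁺ʳ [ root ] (↭-sym p↭)) upper-wL) (Perm.All-resp-↭ (↭-sym q↭) lower-wR) u∈
    u↭w : u ↭ w
    u↭w = ↭-trans (shuffle-↭ u) (↭-trans (↭-reflexive (cong₂ _++_ (proj₂ colours) (proj₁ colours)))
      (↭-trans (Perm.++⁺ (↭-trans q↭ (↭-reflexive (sym falses-w))) (↭-trans (Perm.++⁺ʳ [ root ] p↭) (↭-reflexive (sym trues-w)))) (↭-sym (shuffle-↭ w))))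
    sub : InvSub u w
    sub {s} {t} (t<s , b) with upper s in us | upper t in ut
    ... | true  | true  = t<s , subst (Before s t) (sym w-split) (Before-++ˡ (Before-++ˡ (proj₂ (p-sub (t<s , root-last (below-root p↭) t<s (subst (Before s t) (proj₁ colours) (filterᵇ-Before upper b us ut)))))))
    ... | false | false = t<s , subst (Before s t) (sym w-split) (Before-++ʳ (wL ++ [ root ]) (proj₂ (q-sub (t<s , subst (Before s t) (proj₂ colours) (filterᵇ-Before (not ∘ upper) b (cong not us) (cong not ut))))))
    ... | false | true  = contradiction t<s (ℕ.<⇒≯ (low ut us))
    ... | true  | false = t<s , subst (Before s t) (sym w-split) (Before-across
          (subst (s ∈_) trues-w (∈-filterᵇ⁺ upper (Perm.∈-resp-↭ u↭w (Before-∈ˡ b)) us)) (subst (t ∈_) falses-w (∈-filterᵇ⁺ (not ∘ upper) (Perm.∈-resp-↭ u↭w (Before-∈ʳ b)) (cong not ut))))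

  ∈-node⁻ : ∀ {u} → u ↭ w → InvSub u w → ∃₂ λ p q → (p ↭ wL × InvSub p wL) × (q ↭ wR × InvSub q wR) × u ∈ shuffles (p ++ [ root ]) q
  ∈-node⁻ {u} u↭ sub = split (trues u) refl
    where
    uu : Unique u
    uu = Unique-↭ (↭-sym u↭) (word-unique (node L R) o)
    trues↭ : trues u ↭ wL ++ [ root ]
    trues↭ = ↭-trans (Perm.filter-↭ _ u↭) (↭-reflexive trues-w)
    falses↭ : falses u ↭ wR
    falses↭ = ↭-trans (Perm.filter-↭ _ u↭) (↭-reflexive falses-w)
    inversion-in-u : ∀ (f : ℕ → Bool) {s t} → Before s t (filterᵇ f u) → Before s t u
    inversion-in-u f {s} {t} b with ms , _ ← ∈-filterᵇ⁻ f (Before-∈ˡ b) | mt , _ ← ∈-filterᵇ⁻ f (Before-∈ʳ b)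
      with Before-total ms mt (λ { refl → Before-asym (Unique.filter⁺ _ uu) b b })
    ... | inj₁ b′ = b′
    ... | inj₂ b′ = ⊥-elim (Before-asym (Unique.filter⁺ _ uu) b (filterᵇ-Before f b′ (proj₂ (∈-filterᵇ⁻ f {u} (Before-∈ʳ b))) (proj₂ (∈-filterᵇ⁻ f {u} (Before-∈ˡ b)))))
    inversion-trues : ∀ {s t} → t < s → Before s t (trues u) → Before s t (wL ++ [ root ])
    inversion-trues {s} {t} t<s b = subst (Before s t) trues-w (filterᵇ-Before upper (proj₂ (sub (t<s , inversion-in-u upper b)))
      (proj₂ (∈-filterᵇ⁻ upper {u} (Before-∈ˡ b))) (proj₂ (∈-filterᵇ⁻ upper {u} (Before-∈ʳ b))))
    inversion-falses : ∀ {s t} → t < s → Before s t (falses u) → Before s t wR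
    inversion-falses {s} {t} t<s b = subst (Before s t) falses-w (filterᵇ-Before (not ∘ upper) (proj₂ (sub (t<s , inversion-in-u (not ∘ upper) b)))
      (proj₂ (∈-filterᵇ⁻ (not ∘ upper) {u} (Before-∈ˡ b))) (proj₂ (∈-filterᵇ⁻ (not ∘ upper) {u} (Before-∈ʳ b))))
    split : ∀ l → trues u ≡ l → ∃₂ λ p q → (p ↭ wL × InvSub p wL) × (q ↭ wR × InvSub q wR) × u ∈ shuffles (p ++ [ root ]) q
    split l e with P , Q , refl ← Mem.∈-∃++ (subst (root ∈_) e (Perm.∈-resp-↭ (↭-sym trues↭) (Mem.∈-++⁺ʳ wL (here refl)))) = finish Q refl
      where
      finish : ∀ Q′ → Q ≡ Q′ → ∃₂ λ p q → (p ↭ wL × InvSub p wL) × (q ↭ wR × InvSub q wR) × u ∈ shuffles (p ++ [ root ]) q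
      finish [] refl = P , falses u , (P↭ , P-sub) , (falses↭ , (λ (t<s , b) → t<s , inversion-falses t<s b)) , subst (λ l → u ∈ shuffles l (falses u)) e (shuffles-complete upper u)
        where
        P↭ : P ↭ wL
        P↭ = Perm.drop-∷ (↭-trans (Perm.∷↭∷ʳ root P) (↭-trans (↭-reflexive (sym e)) (↭-trans trues↭ (↭-sym (Perm.∷↭∷ʳ root wL)))))
        P-sub : InvSub P wL
        P-sub {s} {t} (t<s , b) = t<s , root-last (below-root refl) t<s (inversion-trues t<s (subst (Before s t) (sym e) (Before-++ˡ b)))
      -- An entry t of L after the root would be an inversion that w lacks.
      finish (t ∷ Q′) refl = ⊥-elim (Before-asym uL (inversion-trues t<root root-t) (Before-across t∈wL (here refl)))
        where
        uL : Unique (wL ++ [ root ])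
        uL = subst Unique trues-w (Unique.filter⁺ _ (word-unique (node L R) o))
        root-t : Before root t (trues u)
        root-t = subst (Before root t) (sym e) (Before-++ʳ P (here (here refl)))
        t≢root : t ≢ root
        t≢root refl = Before-asym (Unique.filter⁺ _ uu) root-t root-t
        t∈wL : t ∈ wL
        t∈wL with Mem.∈-++⁻ wL (Perm.∈-resp-↭ trues↭ (Before-∈ʳ root-t))
        ... | inj₁ i        = i
        ... | inj₂ (here i) = contradiction i t≢root
        t<root : t < root
        t<root = All.lookup (below-root refl) t∈wL

linearExtensions-sound : ∀ F o {u} → u ∈ linearExtensions F o → u ↭ word F o × InvSub u (word F o)
linearExtensions-sound leaf       o (here refl) = refl , id
linearExtensions-sound (node L R) o u∈
  with p , p∈ , i ← find (Mem.∈-concatMap⁻ (λ p → concatMap (λ q → shuffles (p ++ [ o + size R + size L ]) q) (linearExtensions R o)) {xs = linearExtensions L (o + size R)} u∈)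
  with q , q∈ , j ← find (Mem.∈-concatMap⁻ (λ q → shuffles (p ++ [ o + size R + size L ]) q) {xs = linearExtensions R o} i)
  with p↭ , p-sub ← linearExtensions-sound L (o + size R) p∈ | q↭ , q-sub ← linearExtensions-sound R o q∈ = Node.∈-node⁺ L R o p↭ p-sub q↭ q-sub j

linearExtensions-complete : ∀ F o {u} → u ↭ word F o → InvSub u (word F o) → u ∈ linearExtensions F o
linearExtensions-complete leaf       o u↭ sub with refl ← Perm.↭-empty-inv u↭ = here refl
linearExtensions-complete (node L R) o u↭ sub with p , q , (p↭ , p-sub) , (q↭ , q-sub) , u∈ ← Node.∈-node⁻ L R o u↭ sub =
  Mem.∈-concatMap⁺ _ {xs = linearExtensions L (o + size R)} (lose (linearExtensions-complete L (o + size R) p↭ p-sub)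
    (Mem.∈-concatMap⁺ _ {xs = linearExtensions R o} (lose (linearExtensions-complete R o q↭ q-sub) u∈)))

concatMap-unique : (f : X → List Y) (xs : List X) → Unique xs → (∀ {x} → x ∈ xs → Unique (f x)) →
  (∀ {x x′ y} → x ∈ xs → x′ ∈ xs → y ∈ f x → y ∈ f x′ → x ≡ x′) → Unique (concatMap f xs)
concatMap-unique f []       []       uf inj = []
concatMap-unique f (x ∷ xs) (x∉ ∷ u) uf inj = Unique.++⁺ (uf (here refl)) (concatMap-unique f xs u (uf ∘ there) (λ a b → inj (there a) (there b)))
  (λ (i , j) → let x′ , x′∈ , k = find (Mem.∈-concatMap⁻ f {xs = xs} j) in All.lookup x∉ x′∈ (inj (here refl) (there x′∈) i k))

linearExtensions-unique : ∀ F o → Unique (linearExtensions F o)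
linearExtensions-unique leaf       o = [] ∷ []
linearExtensions-unique (node L R) o = concatMap-unique _ (linearExtensions L bottom) (linearExtensions-unique L bottom)
    (λ p∈ → concatMap-unique _ (linearExtensions R o) (linearExtensions-unique R o) (λ q∈ → shuffles-unique upper _ _ (upper-p p∈) (lower-q q∈))
      (λ q∈ q′∈ i j → sym (proj₂ (colours p∈ q∈ i)) ∙ proj₂ (colours p∈ q′∈ j)))
    (λ {p} {p′} p∈ p′∈ i j → let q , q∈ , i′ = find (Mem.∈-concatMap⁻ (λ q → shuffles (p ++ [ root ]) q) {xs = linearExtensions R o} i)
                                 q′ , q′∈ , j′ = find (Mem.∈-concatMap⁻ (λ q → shuffles (p′ ++ [ root ]) q) {xs = linearExtensions R o} j) in
      List.++-cancelʳ [ root ] p p′ (sym (proj₁ (colours p∈ q∈ i′)) ∙ proj₁ (colours p′∈ q′∈ j′)))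
  where
  open Node L R o
  upper-p : ∀ {p} → p ∈ linearExtensions L bottom → All (λ v → upper v ≡ true) (p ++ [ root ])
  upper-p p∈ = Perm.All-resp-↭ (Perm.++⁺ʳ [ root ] (↭-sym (proj₁ (linearExtensions-sound L bottom p∈)))) upper-wL
  lower-q : ∀ {q} → q ∈ linearExtensions R o → All (λ v → upper v ≡ false) q
  lower-q q∈ = Perm.All-resp-↭ (↭-sym (proj₁ (linearExtensions-sound R o q∈))) lower-wR
  colours : ∀ {p q u} → p ∈ linearExtensions L bottom → q ∈ linearExtensions R o → u ∈ shuffles (p ++ [ root ]) q → Coloured.trues upper u ≡ p ++ [ root ] × Coloured.falses upper u ≡ q
  colours {p} {q} p∈ q∈ = shuffles-colours upper (p ++ [ root ]) q (upper-p p∈) (lower-q q∈)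

-- The number of shuffles of words of lengths i and j.
binomial : ℕ → ℕ → ℕ
binomial zero    j       = 1
binomial (suc i) zero    = 1
binomial (suc i) (suc j) = binomial i (suc j) + binomial (suc i) j

binomial-0 : ∀ i → binomial i 0 ≡ 1
binomial-0 zero    = refl
binomial-0 (suc i) = refl

-- Among the shuffles of words of lengths i and j, those keeping a given adjacency of the first or
-- of the second word.
keepˡ keepʳ : ℕ → ℕ → ℕ
keepˡ zero    j = 0
keepˡ (suc i) j = binomial i j
keepʳ i zero    = 0
keepʳ i (suc j) = binomial i j

-- The number of adjacencies of a letter of the first word followed by one of the second.
crossings : ℕ → ℕ → ℕ
crossings zero    j       = 0
crossings (suc i) zero    = 0
crossings (suc i) (suc j) = crossings i (suc j) + crossings (suc i) j + binomial i j

binomial-ratio : ∀ i j → suc j * binomial i (suc j) ≡ suc i * binomial (suc i) j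
binomial-ratio zero    zero    = refl
binomial-ratio zero    (suc j) = cong suc (binomial-ratio zero j ∙ ℕ.+-identityʳ _) ∙ sym (ℕ.+-identityʳ _)
binomial-ratio (suc i) zero    = ℕ.+-identityʳ _ ∙ cong₂ _+_ (sym (ℕ.+-identityʳ _) ∙ binomial-ratio i zero) refl ∙ ℕ.+-comm (suc i * 1) 1
binomial-ratio (suc i) (suc j) = ℕ.*-distribˡ-+ (suc (suc j)) (binomial i (suc (suc j))) (binomial (suc i) (suc j))
  ∙ cong (_+ suc (suc j) * binomial (suc i) (suc j)) (binomial-ratio i (suc j))
  ∙ shift i j (binomial (suc i) (suc j))
  ∙ cong (suc (suc i) * binomial (suc i) (suc j) +_) (binomial-ratio (suc i) j)
  ∙ sym (ℕ.*-distribˡ-+ (suc (suc i)) (binomial (suc i) (suc j)) (binomial (suc (suc i)) j))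
  where
  shift : ∀ i j m → suc i * m + suc (suc j) * m ≡ suc (suc i) * m + suc j * m
  shift = solve-∀

binomial-absorbˡ : ∀ i j → (suc i + j) * binomial i j ≡ suc i * binomial (suc i) j
binomial-absorbˡ i zero    = cong₂ _*_ (ℕ.+-identityʳ (suc i)) (binomial-0 i)
binomial-absorbˡ i (suc j) = expand i j (binomial i (suc j)) ∙ cong (suc i * binomial i (suc j) +_) (binomial-ratio i j)
  ∙ sym (ℕ.*-distribˡ-+ (suc i) (binomial i (suc j)) (binomial (suc i) j))
  where
  expand : ∀ i j m → (suc i + suc j) * m ≡ suc i * m + suc j * m
  expand = solve-∀

binomial-absorbʳ : ∀ i j → (i + suc j) * binomial i j ≡ suc j * binomial i (suc j)
binomial-absorbʳ i j = cong (_* binomial i j) (ℕ.+-suc i j) ∙ binomial-absorbˡ i j ∙ sym (binomial-ratio i j)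

-- Gluing two adjacent letters leaves a word of length i - 1, so the claim is an absorption identity
-- for binomial coefficients: an adjacency survives in the fraction i / (i + j) of all shuffles.
keepˡ-mean : ∀ i j → (i + j) * keepˡ i j ≡ i * binomial i j
keepˡ-mean zero    j = ℕ.*-zeroʳ j
keepˡ-mean (suc i) j = binomial-absorbˡ i j

keepʳ-mean : ∀ i j → (i + j) * keepʳ i j ≡ j * binomial i j
keepʳ-mean i zero    = ℕ.*-zeroʳ (i + 0)
keepʳ-mean i (suc j) = binomial-absorbʳ i j

-- A crossing glues one letter of each word. The other letters form a shuffle of words of lengths i
-- and j, and the glued pair can be put into any of its i + j + 1 gaps.
crossings-binomial : ∀ i j → crossings (suc i) (suc j) ≡ suc (i + j) * binomial i j
crossings-binomial zero    zero    = refl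
crossings-binomial zero    (suc j) = cong (_+ 1) (crossings-binomial zero j) ∙ arith j
  where
  arith : ∀ j → suc j * 1 + 1 ≡ suc (suc j) * 1
  arith = solve-∀
crossings-binomial (suc i) zero    = cong (λ m → m + 0 + 1) (crossings-binomial i zero ∙ cong (suc (i + 0) *_) (binomial-0 i)) ∙ arith i
  where
  arith : ∀ i → suc (i + 0) * 1 + 0 + 1 ≡ suc (suc i + 0) * 1
  arith = solve-∀
crossings-binomial (suc i) (suc j) = cong₂ (λ m n → m + n + binomial (suc i) (suc j)) (crossings-binomial i (suc j)) (crossings-binomial (suc i) j)
  ∙ arith i j (binomial i (suc j)) (binomial (suc i) j)
  where
  arith : ∀ i j m n → suc (i + suc j) * m + suc (suc i + j) * n + (m + n) ≡ suc (suc i + suc j) * (m + n)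
  arith = solve-∀

crossings-mean : ∀ i j → (i + j) * crossings i j ≡ i * j * binomial i j
crossings-mean zero    j       = ℕ.*-zeroʳ j
crossings-mean (suc i) zero    = ℕ.*-zeroʳ (suc i + 0) ∙ sym (cong (_* 1) (ℕ.*-zeroʳ (suc i)))
crossings-mean (suc i) (suc j) = cong ((suc i + suc j) *_) (crossings-binomial i j ∙ binomial-absorbʳ′ ) ∙ swap₃ (suc i + suc j) (suc j) (binomial i (suc j))
  ∙ cong (suc j *_) (binomial-absorbˡ i (suc j)) ∙ swap₄ (suc j) (suc i) (binomial (suc i) (suc j))
  where
  binomial-absorbʳ′ : suc (i + j) * binomial i j ≡ suc j * binomial i (suc j)
  binomial-absorbʳ′ = cong (_* binomial i j) (sym (ℕ.+-suc i j)) ∙ binomial-absorbʳ i j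
  swap₃ : ∀ a b c → a * (b * c) ≡ b * (a * c)
  swap₃ = solve-∀
  swap₄ : ∀ a b c → a * (b * c) ≡ b * a * c
  swap₄ = solve-∀

shuffles-count : ∀ p q → ∑ (shuffles p q) (λ _ → 1) ≡ binomial (length p) (length q)
shuffles-count []      q       = refl
shuffles-count (x ∷ p) []      = refl
shuffles-count (x ∷ p) (y ∷ q) = ∑-++ (map (x ∷_) (shuffles p (y ∷ q))) _ _
  ∙ cong₂ _+_ (∑-map (x ∷_) (shuffles p (y ∷ q)) _ ∙ shuffles-count p (y ∷ q)) (∑-map (y ∷_) (shuffles (x ∷ p) q) _ ∙ shuffles-count (x ∷ p) q)

headDrop : ℕ → List ℕ → ℕ
headDrop x l = dropHead x l (λ _ → 1)

∑-if : ∀ t (xs : List X) → ∑ xs (λ _ → if t then 1 else 0) ≡ (if t then 1 else 0) * ∑ xs (λ _ → 1)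
∑-if true  xs = sym (ℕ.+-identityʳ _)
∑-if false xs = ∑-0 xs

shuffles-headˡ : ∀ x p y q → y < x → ∑ (shuffles p (y ∷ q)) (headDrop x) ≡ headDrop x p * keepˡ (length p) (suc (length q)) + binomial (length p) (length q)
shuffles-headˡ x []      y q y<x rewrite <ᵇ-true {y} {x} y<x = refl
shuffles-headˡ x (z ∷ p) y q y<x = ∑-++ (map (z ∷_) (shuffles p (y ∷ q))) _ (headDrop x) ∙ cong₂ _+_
  (∑-map (z ∷_) (shuffles p (y ∷ q)) (headDrop x) ∙ ∑-if (z <ᵇ x) (shuffles p (y ∷ q)) ∙ cong ((if z <ᵇ x then 1 else 0) *_) (shuffles-count p (y ∷ q)))
  (∑-map (y ∷_) (shuffles (z ∷ p) q) (headDrop x) ∙ cong (λ t → ∑ (shuffles (z ∷ p) q) (λ _ → if t then 1 else 0)) (<ᵇ-true {y} {x} y<x) ∙ shuffles-count (z ∷ p) q)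

shuffles-headʳ : ∀ x p y q → y < x → ∑ (shuffles (x ∷ p) q) (headDrop y) ≡ headDrop y q * keepʳ (suc (length p)) (length q)
shuffles-headʳ x p y []      y<x rewrite <ᵇ-false {x} {y} (ℕ.<⇒≯ y<x) = refl
shuffles-headʳ x p y (z ∷ q) y<x = ∑-++ (map (x ∷_) (shuffles p (z ∷ q))) _ (headDrop y) ∙ cong₂ _+_
  (∑-map (x ∷_) (shuffles p (z ∷ q)) (headDrop y) ∙ cong (λ t → ∑ (shuffles p (z ∷ q)) (λ _ → if t then 1 else 0)) (<ᵇ-false {x} {y} (ℕ.<⇒≯ y<x)) ∙ ∑-0 (shuffles p (z ∷ q)))
  (∑-map (z ∷_) (shuffles (x ∷ p) q) (headDrop y) ∙ ∑-if (z <ᵇ y) (shuffles (x ∷ p) q) ∙ cong ((if z <ᵇ y then 1 else 0) *_) (shuffles-count (x ∷ p) q))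

-- A descent of a shuffle is a surviving descent of p or of q, or a crossing from p to q. As p lies
-- above q, crossings from q to p are ascents.
shuffles-des : ∀ p q → (∀ {x y} → x ∈ p → y ∈ q → y < x) →
  ∑ (shuffles p q) des ≡ des p * keepˡ (length p) (length q) + des q * keepʳ (length p) (length q) + crossings (length p) (length q)
shuffles-des []      []      h = refl
shuffles-des []      (y ∷ q) h = rearrange (des (y ∷ q))
  where
  rearrange : ∀ d → d + 0 ≡ d * 1 + 0
  rearrange = solve-∀
shuffles-des (x ∷ p) []      h rewrite binomial-0 (length p) = rearrange (des (x ∷ p))
  where
  rearrange : ∀ d → d + 0 ≡ d * 1 + 0 + 0
  rearrange = solve-∀
shuffles-des (x ∷ p) (y ∷ q) h = ∑-++ (map (x ∷_) (shuffles p (y ∷ q))) _ des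
    ∙ cong₂ _+_ (∑-map (x ∷_) (shuffles p (y ∷ q)) des ∙ ∑-+ (shuffles p (y ∷ q)) (headDrop x) des
                  ∙ cong₂ _+_ (shuffles-headˡ x p y q (h (here refl) (here refl))) (shuffles-des p (y ∷ q) (λ i → h (there i))))
                (∑-map (y ∷_) (shuffles (x ∷ p) q) des ∙ ∑-+ (shuffles (x ∷ p) q) (headDrop y) des
                  ∙ cong₂ _+_ (shuffles-headʳ x p y q (h (here refl) (here refl))) (shuffles-des (x ∷ p) q (λ i j → h i (there j))))
    ∙ combine p q
  where
  combine : ∀ p q → (headDrop x p * keepˡ (length p) (suc (length q)) + binomial (length p) (length q)
        + (des p * keepˡ (length p) (suc (length q)) + des (y ∷ q) * binomial (length p) (length q) + crossings (length p) (suc (length q))))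
      + (headDrop y q * keepʳ (suc (length p)) (length q) + (des (x ∷ p) * binomial (length p) (length q) + des q * keepʳ (suc (length p)) (length q) + crossings (suc (length p)) (length q)))
    ≡ des (x ∷ p) * binomial (length p) (suc (length q)) + des (y ∷ q) * binomial (suc (length p)) (length q)
      + (crossings (length p) (suc (length q)) + crossings (suc (length p)) (length q) + binomial (length p) (length q))
  combine []       []       = refl
  combine []       (y′ ∷ q) = arith (headDrop y (y′ ∷ q)) (des (y′ ∷ q)) (binomial 1 (length q)) (crossings 1 (suc (length q)))
    where
    arith : ∀ h d b c → 1 + ((h + d) * 1 + 0) + (h * b + (d * b + c)) ≡ (h + d) * (1 + b) + (c + 1)
    arith = solve-∀
  combine (x′ ∷ p) []       = arith (headDrop x (x′ ∷ p)) (des (x′ ∷ p)) (binomial (length p) 1) (crossings (suc (length p)) 1)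
    where
    arith : ∀ h d b c → (h * b + 1 + (d * b + 0 + c)) + ((h + d) * 1 + 0 + 0) ≡ (h + d) * (b + 1) + 0 + (c + 0 + 1)
    arith = solve-∀
  combine (x′ ∷ p) (y′ ∷ q) = arith (headDrop x (x′ ∷ p)) (des (x′ ∷ p)) (headDrop y (y′ ∷ q)) (des (y′ ∷ q)) (binomial (length p) (suc (suc (length q)))) (binomial (suc (length p)) (suc (length q))) (binomial (suc (suc (length p))) (length q))
      (crossings (suc (length p)) (suc (suc (length q)))) (crossings (suc (suc (length p))) (suc (length q)))
    where
    arith : ∀ h d g e b₁ b₂ b₃ c₁ c₂ → (h * b₁ + b₂ + (d * b₁ + (g + e) * b₂ + c₁)) + (g * b₃ + ((h + d) * b₂ + e * b₃ + c₂)) ≡ (h + d) * (b₁ + b₂) + (g + e) * (b₂ + b₃) + (c₁ + c₂ + b₂)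
    arith = solve-∀

∑-concatMap : (f : X → List Y) (xs : List X) (g : Y → ℕ) → ∑ (concatMap f xs) g ≡ ∑ xs (λ x → ∑ (f x) g)
∑-concatMap f []       g = refl
∑-concatMap f (x ∷ xs) g = ∑-++ (f x) (concatMap f xs) g ∙ cong (∑ (f x) g +_) (∑-concatMap f xs g)

des-∷ʳ : ∀ p {r} → All (_< r) p → des (p ++ [ r ]) ≡ des p
des-∷ʳ []          []       = refl
des-∷ʳ (a ∷ [])    {r} (a<r ∷ []) rewrite <ᵇ-false {r} {a} (ℕ.<⇒≯ a<r) = refl
des-∷ʳ (a ∷ b ∷ p) (_ ∷ ps) = cong (headDrop a (b ∷ p) +_) (des-∷ʳ (b ∷ p) ps)

-- The expected number of descents of a linear extension is s / t.
HasMean : Forest → ℕ → ℕ → ℕ → Set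
HasMean F o s t = ∑ (linearExtensions F o) des * t ≡ s * ∑ (linearExtensions F o) (λ _ → 1)

leaf-mean : ∀ o t → HasMean leaf o 0 t
leaf-mean o t = refl

-- Let l = size L + 1 and r = size R; the root at the end of a word for L creates no descent there.
-- Descents of the two parts survive with probabilities l / (l + r) and r / (l + r), and l r / (l +
-- r) crossings are expected. The hypothesis on s is the resulting equation without denominators.
node-mean : ∀ L R o {sL sR s t} → HasMean L (o + size R) sL t → HasMean R o sR t →
  suc (size L) * sL + size R * sR + suc (size L) * size R * t ≡ (suc (size L) + size R) * s → HasMean (node L R) o s t
node-mean L R o {sL} {sR} {s} {t} mL mR e = ℕ.*-cancelˡ-≡ _ _ N
    (cong (λ m → N * (m * t)) sum-des ∙ arith₁ N t (eL * eR) (dL * eR) (eL * dR) (keepˡ l r) (keepʳ l r) (crossings l r)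
    ∙ cong₃ (λ a b c → dL * eR * t * a + eL * dR * t * b + eL * eR * t * c) (keepˡ-mean l r) (keepʳ-mean l r) (crossings-mean l r)
    ∙ arith₂ l r t B eL eR dL dR
    ∙ cong₂ (λ a b → B * (l * eR * a + r * eL * b + l * r * t * (eL * eR))) mL mR
    ∙ arith₃ l r t B eL eR sL sR ∙ cong (λ m → B * (eL * eR) * m) e ∙ arith₄ B (eL * eR) N s ∙ cong (λ m → N * (s * m)) (sym sum-1))
  where
  open Node L R o
  l r N B eL eR dL dR : ℕ
  l = suc (size L)
  r = size R
  N = l + r
  B = binomial l r
  eL = ∑ (linearExtensions L bottom) (λ _ → 1)
  eR = ∑ (linearExtensions R o) (λ _ → 1)
  dL = ∑ (linearExtensions L bottom) des
  dR = ∑ (linearExtensions R o) des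
  cong₃ : ∀ {a a′ b b′ c c′} (f : ℕ → ℕ → ℕ → ℕ) → a ≡ a′ → b ≡ b′ → c ≡ c′ → f a b c ≡ f a′ b′ c′
  cong₃ f refl refl refl = refl
  length-p : ∀ {p} → p ∈ linearExtensions L bottom → length (p ++ [ root ]) ≡ l
  length-p {p} p∈ = List.length-++ p ∙ ℕ.+-comm (length p) 1 ∙ cong suc (Perm.↭-length (proj₁ (linearExtensions-sound L bottom p∈)) ∙ length-word L bottom)
  length-q : ∀ {q} → q ∈ linearExtensions R o → length q ≡ r
  length-q q∈ = Perm.↭-length (proj₁ (linearExtensions-sound R o q∈)) ∙ length-word R o
  above : ∀ {p q} → p ∈ linearExtensions L bottom → q ∈ linearExtensions R o → ∀ {x y} → x ∈ p ++ [ root ] → y ∈ q → y < x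
  above {p} p∈ q∈ x∈ y∈ = low (All.lookup upper-wL (Perm.∈-resp-↭ (Perm.++⁺ʳ [ root ] (proj₁ (linearExtensions-sound L bottom p∈))) x∈))
    (All.lookup lower-wR (Perm.∈-resp-↭ (proj₁ (linearExtensions-sound R o q∈)) y∈))
  double : ∀ (f g : List ℕ → ℕ) a b c → ∑ (linearExtensions L bottom) (λ p → ∑ (linearExtensions R o) (λ q → f p * a + g q * b + c))
    ≡ ∑ (linearExtensions L bottom) f * eR * a + eL * ∑ (linearExtensions R o) g * b + eL * eR * c
  double f g a b c = ∑-cong (linearExtensions L bottom) (λ p _ → ∑-+ (linearExtensions R o) (λ q → f p * a + g q * b) (λ _ → c)
        ∙ cong₂ _+_ (∑-+ (linearExtensions R o) (λ _ → f p * a) (λ q → g q * b) ∙ cong₂ _+_ (∑-const (linearExtensions R o) (f p * a)) (∑-factor (linearExtensions R o) g b)) (∑-const (linearExtensions R o) c)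
        ∙ arith (f p) a eR (∑ (linearExtensions R o) g * b) c)
      ∙ ∑-+ (linearExtensions L bottom) (λ p → f p * (a * eR)) (λ _ → ∑ (linearExtensions R o) g * b + c * eR)
      ∙ cong₂ _+_ (∑-factor (linearExtensions L bottom) f (a * eR)) (∑-const (linearExtensions L bottom) _)
      ∙ arith′ (∑ (linearExtensions L bottom) f) a eR (∑ (linearExtensions R o) g) b c eL
    where
    ∑-factor : (xs : List (List ℕ)) (f : List ℕ → ℕ) (a : ℕ) → ∑ xs (λ x → f x * a) ≡ ∑ xs f * a
    ∑-factor xs f a = ∑-cong xs (λ x _ → ℕ.*-comm (f x) a) ∙ ∑-* a xs f ∙ ℕ.*-comm a (∑ xs f)
    ∑-const : (xs : List (List ℕ)) (a : ℕ) → ∑ xs (λ _ → a) ≡ a * ∑ xs (λ _ → 1)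
    ∑-const xs a = ∑-cong xs (λ _ _ → sym (ℕ.*-identityʳ a)) ∙ ∑-* a xs (λ _ → 1)
    arith : ∀ f a e g c → (f * a * e + g) + c * e ≡ f * (a * e) + (g + c * e)
    arith = solve-∀
    arith′ : ∀ f a e g b c d → f * (a * e) + (g * b + c * e) * d ≡ f * e * a + d * g * b + d * e * c
    arith′ = solve-∀
  expand : ∀ g → ∑ (linearExtensions (node L R) o) g ≡ ∑ (linearExtensions L bottom) (λ p → ∑ (linearExtensions R o) (λ q → ∑ (shuffles (p ++ [ root ]) q) g))
  expand g = ∑-concatMap _ (linearExtensions L bottom) g ∙ ∑-cong (linearExtensions L bottom) (λ p _ → ∑-concatMap (shuffles (p ++ [ root ])) (linearExtensions R o) g)
  sum-des : ∑ (linearExtensions (node L R) o) des ≡ dL * eR * keepˡ l r + eL * dR * keepʳ l r + eL * eR * crossings l r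
  sum-des = expand des ∙ ∑-cong (linearExtensions L bottom) (λ p p∈ → ∑-cong (linearExtensions R o) (λ q q∈ → shuffles-des (p ++ [ root ]) q (above p∈ q∈)
        ∙ cong₂ (λ i j → des (p ++ [ root ]) * keepˡ i j + des q * keepʳ i j + crossings i j) (length-p p∈) (length-q q∈)
        ∙ cong (λ d → d * keepˡ l r + des q * keepʳ l r + crossings l r) (des-∷ʳ p (below-root (proj₁ (linearExtensions-sound L bottom p∈))))))
    ∙ double des des (keepˡ l r) (keepʳ l r) (crossings l r)
  sum-1 : ∑ (linearExtensions (node L R) o) (λ _ → 1) ≡ B * (eL * eR)
  sum-1 = expand (λ _ → 1) ∙ ∑-cong (linearExtensions L bottom) (λ p p∈ → ∑-cong (linearExtensions R o) (λ q q∈ → shuffles-count (p ++ [ root ]) q ∙ cong₂ binomial (length-p p∈) (length-q q∈)))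
    ∙ double (λ _ → 0) (λ _ → 0) 0 0 B ∙ cong₂ (λ m n → m + n + eL * eR * B) (ℕ.*-zeroʳ (∑ (linearExtensions L bottom) (λ _ → 0) * eR)) (ℕ.*-zeroʳ (eL * ∑ (linearExtensions R o) (λ _ → 0))) ∙ ℕ.*-comm (eL * eR) B
  arith₁ : ∀ N t x y z a b c → N * ((y * a + z * b + x * c) * t) ≡ y * t * (N * a) + z * t * (N * b) + x * t * (N * c)
  arith₁ = solve-∀
  arith₂ : ∀ l r t B eL eR dL dR → dL * eR * t * (l * B) + eL * dR * t * (r * B) + eL * eR * t * (l * r * B) ≡ B * (l * eR * (dL * t) + r * eL * (dR * t) + l * r * t * (eL * eR))
  arith₂ = solve-∀
  arith₃ : ∀ l r t B eL eR sL sR → B * (l * eR * (sL * eL) + r * eL * (sR * eR) + l * r * t * (eL * eR)) ≡ B * (eL * eR) * (l * sL + r * sR + l * r * t)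
  arith₃ = solve-∀
  arith₄ : ∀ B x N s → B * x * (N * s) ≡ N * (s * (B * x))
  arith₄ = solve-∀

-- A chain of c further maximal elements above the forest F.
atop : ℕ → Forest → Forest
atop zero    F = F
atop (suc c) F = node (atop c F) leaf

size-atop : ∀ c F → size (atop c F) ≡ c + size F
size-atop zero    F = refl
size-atop (suc c) F = cong suc (size-atop c F)

code-atop : ∀ c F → code (atop c F) ≡ code F ++ zeros c
code-atop zero    F = sym (List.++-identityʳ (code F))
code-atop (suc c) F = cong (_++ [ 0 ]) (List.map-id (code (atop c F)) ∙ code-atop c F) ∙ List.++-assoc (code F) (zeros c) [ 0 ]
  ∙ cong (code F ++_) (snoc c)
  where
  snoc : ∀ c → zeros c ++ [ 0 ] ≡ zeros (suc c)
  snoc zero    = refl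
  snoc (suc c) = cong (0 ∷_) (snoc c)

atop-mean : ∀ c F o {s t} → HasMean F o s t → HasMean (atop c F) o s t
atop-mean zero    F o h = h
atop-mean (suc c) F o {s} {t} h = node-mean (atop c F) leaf o {s} {0} {s} {t} (subst (λ o → HasMean (atop c F) o s t) (sym (ℕ.+-identityʳ o)) (atop-mean c F o {s} {t} h)) (leaf-mean o t)
  (arith (size (atop c F)) s t)
  where
  arith : ∀ l s t → suc l * s + 0 + suc l * 0 * t ≡ (suc l + 0) * s
  arith = solve-∀


replicate-∷ : ∀ n (v : ℕ) l → replicate n v ++ v ∷ l ≡ replicate (suc n) v ++ l
replicate-∷ zero    v l = refl
replicate-∷ (suc n) v l = cong (v ∷_) (replicate-∷ n v l)

zeros-++ : ∀ m n → zeros m ++ zeros n ≡ zeros (m + n)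
zeros-++ zero    n = refl
zeros-++ (suc m) n = cong (0 ∷_) (zeros-++ m n)

map-+-zeros : ∀ v n → map (v +_) (zeros n) ≡ replicate n v
map-+-zeros v zero    = refl
map-+-zeros v (suc n) = cong₂ _∷_ (ℕ.+-identityʳ v) (map-+-zeros v n)

map-+-replicate : ∀ u v n → map (u +_) (replicate n v) ≡ replicate n (u + v)
map-+-replicate u v zero    = refl
map-+-replicate u v (suc n) = cong (u + v ∷_) (map-+-replicate u v n)

record StairForest (a b k : ℕ) : Set where
  field
    forest : Forest
    zeros# : ℕ
    code≡  : code forest ≡ stair a b k ++ zeros zeros#
    mean   : ∀ o → HasMean forest o (k * a * b) (a + b)

-- For a ≤ b the forest grows by a chain of length a next to a copy of itself below a chain of
-- length b - a.
module Wide (a′ e : ℕ) where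
  private
    a b : ℕ
    a = suc a′
    b = a + e

  forest : ℕ → Forest
  -- These a elements add only zeros to the code, but with e more atop they give the first side
  -- forest size b, as `size-rest` requires.
  forest zero    = atop a leaf
  forest (suc j) = node (atop a′ leaf) (atop e (forest j))

  size-chain : ∀ c → size (atop c leaf) ≡ c
  size-chain c = size-atop c leaf ∙ ℕ.+-identityʳ c

  size-forest : ∀ j → size (forest j) ≡ j * b + a
  size-forest zero    = size-chain a
  size-forest (suc j) = cong₂ (λ m n → m + suc n) (size-atop e (forest j) ∙ cong (e +_) (size-forest j)) (size-chain a′) ∙ arith a′ e (j * (suc a′ + e))
    where
    arith : ∀ a′ e m → e + (m + suc a′) + suc a′ ≡ suc a′ + e + m + suc a′
    arith = solve-∀

  size-rest : ∀ j → size (atop e (forest j)) ≡ suc j * b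
  size-rest j = size-atop e (forest j) ∙ cong (e +_) (size-forest j) ∙ arith a′ e (j * b)
    where
    arith : ∀ a′ e m → e + (m + suc a′) ≡ suc a′ + e + m
    arith = solve-∀

  code-forest : ∀ j → code (forest j) ≡ stair a b j ++ zeros (j * e + a)
  code-forest zero    = code-atop a leaf
  code-forest (suc j) = cong₂ (λ l r → map (r +_) l ++ r ∷ code (atop e (forest j))) (code-atop a′ leaf) (size-rest j)
    ∙ cong₂ (λ l m → l ++ suc j * b ∷ m) (map-+-zeros (suc j * b) a′) (code-atop e (forest j) ∙ cong (_++ zeros e) (code-forest j)
        ∙ List.++-assoc (stair a b j) _ _ ∙ cong (stair a b j ++_) (zeros-++ (j * e + a) e ∙ cong zeros (arith (j * e) a e)))
    ∙ replicate-∷ a′ (suc j * b) _ ∙ sym (List.++-assoc (replicate a (suc j * b)) (stair a b j) _)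
    where
    arith : ∀ m a e → m + a + e ≡ e + m + a
    arith = solve-∀

  mean-forest : ∀ j o → HasMean (forest j) o (j * a * b) (a + b)
  mean-forest zero    o = atop-mean a leaf o {0} {a + b} (leaf-mean o (a + b))
  mean-forest (suc j) o = node-mean (atop a′ leaf) (atop e (forest j)) o {0} {j * a * b} {suc j * a * b} {a + b}
    (atop-mean a′ leaf (o + size (atop e (forest j))) {0} {a + b} (leaf-mean (o + size (atop e (forest j))) (a + b))) (atop-mean e (forest j) o {j * a * b} {a + b} (mean-forest j o))
    (cong₂ (λ l r → suc l * 0 + r * (j * a * b) + suc l * r * (a + b)) (size-chain a′) (size-rest j) ∙ arith a′ e j ∙ cong₂ (λ l r → (suc l + r) * (suc j * a * b)) (sym (size-chain a′)) (sym (size-rest j)))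
    where
    arith : ∀ a′ e j → suc a′ * 0 + (suc j * (suc a′ + e)) * (j * suc a′ * (suc a′ + e)) + suc a′ * (suc j * (suc a′ + e)) * (suc a′ + (suc a′ + e)) ≡ (suc a′ + suc j * (suc a′ + e)) * (suc j * suc a′ * (suc a′ + e))
    arith = solve-∀

  stairForest : ∀ k → StairForest a b k
  stairForest k = record { forest = forest k ; zeros# = k * e + a ; code≡ = code-forest k ; mean = mean-forest k }

-- For a > b the roles of the two sides are exchanged.
module Tall (b e : ℕ) where
  private
    a : ℕ
    a = b + suc e

  forest : ℕ → Forest
  forest zero    = atop b leaf
  forest (suc j) = node (atop e (forest j)) (atop b leaf)

  size-chain : size (atop b leaf) ≡ b
  size-chain = size-atop b leaf ∙ ℕ.+-identityʳ b

  size-forest : ∀ j → size (forest j) ≡ j * a + b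
  size-forest zero    = size-chain
  size-forest (suc j) = cong₂ (λ m n → m + suc n) size-chain (size-atop e (forest j) ∙ cong (e +_) (size-forest j)) ∙ arith b e (j * (b + suc e))
    where
    arith : ∀ b e m → b + suc (e + (m + b)) ≡ b + suc e + m + b
    arith = solve-∀

  size-rest : ∀ j → suc (size (atop e (forest j))) ≡ suc j * a
  size-rest j = cong suc (size-atop e (forest j) ∙ cong (e +_) (size-forest j)) ∙ arith b e (j * a)
    where
    arith : ∀ b e m → suc (e + (m + b)) ≡ b + suc e + m
    arith = solve-∀

  stair-shift : ∀ j → stair a b (suc j) ≡ map (b +_) (stair a b j) ++ replicate a b
  stair-shift zero    = List.++-identityʳ _ ∙ cong (replicate a) (ℕ.+-identityʳ b)
  stair-shift (suc j) = cong (replicate a (suc (suc j) * b) ++_) (stair-shift j) ∙ sym (List.++-assoc (replicate a (suc (suc j) * b)) _ _)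
    ∙ cong (_++ replicate a b) (cong (_++ map (b +_) (stair a b j)) (sym (map-+-replicate b (suc j * b) a)) ∙ sym (List.map-++ (b +_) (replicate a (suc j * b)) (stair a b j)))

  code-forest : ∀ j → code (forest j) ≡ stair a b j ++ zeros b
  code-forest zero    = code-atop b leaf
  code-forest (suc j) = cong₂ (λ r m → map (r +_) (code (atop e (forest j))) ++ r ∷ m) size-chain (code-atop b leaf)
    ∙ cong (λ l → map (b +_) l ++ b ∷ zeros b) (code-atop e (forest j) ∙ cong (_++ zeros e) (code-forest j) ∙ List.++-assoc (stair a b j) (zeros b) (zeros e) ∙ cong (stair a b j ++_) (zeros-++ b e))
    ∙ cong (_++ b ∷ zeros b) (List.map-++ (b +_) (stair a b j) (zeros (b + e)) ∙ cong (map (b +_) (stair a b j) ++_) (map-+-zeros b (b + e)))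
    ∙ List.++-assoc (map (b +_) (stair a b j)) _ _
    ∙ cong (map (b +_) (stair a b j) ++_) (replicate-∷ (b + e) b (zeros b) ∙ cong (λ c → replicate c b ++ zeros b) (sym (ℕ.+-suc b e)))
    ∙ sym (List.++-assoc (map (b +_) (stair a b j)) (replicate a b) (zeros b)) ∙ cong (_++ zeros b) (sym (stair-shift j))

  mean-forest : ∀ j o → HasMean (forest j) o (j * a * b) (a + b)
  mean-forest zero    o = atop-mean b leaf o {0} {a + b} (leaf-mean o (a + b))
  mean-forest (suc j) o = node-mean (atop e (forest j)) (atop b leaf) o {j * a * b} {0} {suc j * a * b} {a + b}
    (atop-mean e (forest j) (o + size (atop b leaf)) {j * a * b} {a + b} (mean-forest j (o + size (atop b leaf)))) (atop-mean b leaf o {0} {a + b} (leaf-mean o (a + b)))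
    (cong₂ (λ l r → l * (j * a * b) + r * 0 + l * r * (a + b)) (size-rest j) size-chain ∙ arith b e j ∙ cong₂ (λ l r → (l + r) * (suc j * a * b)) (sym (size-rest j)) (sym size-chain))
    where
    arith : ∀ b e j → (suc j * (b + suc e)) * (j * (b + suc e) * b) + b * 0 + (suc j * (b + suc e)) * b * (b + suc e + b) ≡ (suc j * (b + suc e) + b) * (suc j * (b + suc e) * b)
    arith = solve-∀

  stairForest : ∀ k → StairForest a b k
  stairForest k = record { forest = forest k ; zeros# = b ; code≡ = code-forest k ; mean = mean-forest k }

-- Dominant permutations of staircase shape

dominant-no132 : ∀ {w} → Unique w → Dominant w → No132 [] w
dominant-no132 {w} uw dom = go [] w refl
  where
  go : ∀ as B → as ʳ++ B ≡ w → No132 as B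
  go as []      e = tt
  go as (r ∷ B) e = avoid , go (r ∷ as) B e
    where
    e′ : reverse as ++ r ∷ B ≡ w
    e′ = sym (List.ʳ++-defn as) ∙ e
    avoid : ∀ {z x} → z ∈ as → x ∈ B → z < x → ¬ x < r
    avoid {z} {x} z∈ x∈ z<x x<r = dom (indexOf z w , indexOf r w , indexOf x w , Before-index uw zr , Before-index uw rx , indexOf-< (Before-∈ʳ rx)
        , subst₂ _<_ (sym (at-indexOf (Before-∈ˡ zr))) (sym (at-indexOf (Before-∈ʳ rx))) z<x
        , subst₂ _<_ (sym (at-indexOf (Before-∈ʳ rx))) (sym (at-indexOf (Before-∈ˡ rx))) x<r)
      where
      zr : Before z r w
      zr = subst (Before z r) e′ (Before-across (Any.reverse⁺ z∈) (here refl))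
      rx : Before r x w
      rx = subst (Before r x) e′ (Before-++ʳ (reverse as) (here x∈))

-- A code entry counts some of the entries after it. Applied to the end of the first or of the last
-- block of the staircase, this bounds n from below, so that the forest fits.
lehmer-room : ∀ l X {c Y} → lehmer l ≡ X ++ c ∷ Y → c ≤ length Y
lehmer-room (x ∷ l) []      refl = ℕ.≤-trans (List.length-filter _ l) (ℕ.≤-reflexive (sym (length-lehmer l)))
lehmer-room (x ∷ l) (c ∷ X) e    = lehmer-room l X (List.∷-injectiveʳ e)

module DominantStaircase {n : ℕ} {w : List ℕ} (w↭ : w ↭ upTo n) (dominant : Dominant w) {a b k : ℕ} (shape≡ : shape w ≡ stair a b k) where

  private
    uw : Unique w
    uw = perm-unique w↭
    decreasing : Decreasing (lehmer w)
    decreasing = lehmer-decreasing [] w uw (dominant-no132 uw dominant)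

  lehmer-stair : ∃ λ z → lehmer w ≡ stair a b k ++ zeros z
  lehmer-stair with z , e ← decreasing-zeros decreasing =
    z , e ∙ cong (_++ zeros z) (sym (shape-nonzero {w} 0 (↭-reflexive (sym (List.++-identityʳ (lehmer w)))) decreasing) ∙ shape≡)

  length-code : ∀ {z} → lehmer w ≡ stair a b k ++ zeros z → n ≡ k * a + z
  length-code {z} e = sym (List.length-upTo n) ∙ sym (Perm.↭-length w↭) ∙ sym (length-lehmer w) ∙ cong length e ∙ List.length-++ (stair a b k) ∙ cong₂ _+_ (length-stair a b k) (List.length-replicate z)

  -- A dominant permutation is determined by its code, so w is the word of the forest, topped up by
  -- fixed points to size n. The interval then consists of its linear extensions.
  EX-forest : (F : StairForest a b k) → size (StairForest.forest F) ≤ n → 0 < a + b → EX (WeakInterval n w) ≡ frac (k * a * b) (a + b)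
  EX-forest F small positive with z , e ← lehmer-stair with c , c+ ← ℕ.m≤n⇒∃[o]m+o≡n small =
    IntervalExpectation.EX-frac n w w↭ (k * a * b) (a + b) positive
      (cong (_* (a + b)) (∑-↭ des elems↭) ∙ atop-mean c forest 0 {k * a * b} {a + b} (mean 0) ∙ cong (k * a * b *_) (sym (length-≡-∑ (elems (WeakInterval n w)) ∙ ∑-↭ (λ _ → 1) elems↭)))
    where
    open StairForest F
    G : Forest
    G = atop c forest
    size-G : size G ≡ n
    size-G = size-atop c forest ∙ ℕ.+-comm c (size forest) ∙ c+
    word↭ : word G 0 ↭ upTo n
    word↭ = ↭-trans (word-↭ G 0) (↭-reflexive (cong (range 0) size-G ∙ sym (upTo-range n)))
    code-G : code G ≡ stair a b k ++ zeros (zeros# + c)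
    code-G = code-atop c forest ∙ cong (_++ zeros c) code≡ ∙ List.++-assoc (stair a b k) _ _ ∙ cong (stair a b k ++_) (zeros-++ zeros# c)
    same-zeros : zeros# + c ≡ z
    same-zeros = ℕ.+-cancelˡ-≡ (k * a) _ _ (sym (cong₂ _+_ (length-stair a b k) (List.length-replicate (zeros# + c))) ∙ sym (List.length-++ (stair a b k)) ∙ cong length (sym code-G)
      ∙ cong length (sym (lehmer-word G 0)) ∙ length-lehmer (word G 0) ∙ length-word G 0 ∙ size-G ∙ length-code e)
    w≡ : w ≡ word G 0
    w≡ = lehmer-injective (↭-trans w↭ (↭-sym word↭)) (e ∙ cong (λ z → stair a b k ++ zeros z) (sym same-zeros) ∙ sym code-G ∙ sym (lehmer-word G 0))
    open Interval n w w↭ using (∈⁺; ∈⁻; partialOrder)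
    elems↭ : elems (WeakInterval n w) ↭ linearExtensions G 0
    elems↭ = unique-↭ (IsPartialOrder.unique partialOrder) (linearExtensions-unique G 0)
      (λ u∈ → let p , sub = ∈⁻ u∈ in linearExtensions-complete G 0 (↭-trans p (↭-sym word↭)) (subst (InvSub _) w≡ sub))
      (λ u∈ → let p , sub = linearExtensions-sound G 0 u∈ in ∈⁺ (↭-trans p word↭) (subst (InvSub _) (sym w≡) sub))

EX-dominant : ∀ {n w} → w ↭ upTo n → Dominant w → ∀ a b k → 0 < a → 0 < b → shape w ≡ stair a b k → EX (WeakInterval n w) ≡ frac (k * a * b) (a + b)
-- The chains `Wide.forest` and `Tall.forest` at 0 need not fit into n, whereas the empty forest
-- does.
EX-dominant w↭ dom a b zero a>0 b>0 e =
  DominantStaircase.EX-forest w↭ dom {a} {b} {0} e (record { forest = leaf ; zeros# = 0 ; code≡ = refl ; mean = λ o → leaf-mean o (a + b) }) z≤n (ℕ.≤-trans a>0 (ℕ.m≤m+n a b))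
EX-dominant {n} {w} w↭ dom (suc a′) b (suc k) a>0 b>0 e with suc a′ ≤? b
... | yes a≤b with r , refl ← ℕ.m≤n⇒∃[o]m+o≡n a≤b = EX-forest (Wide.stairForest a′ r (suc k)) (fits lehmer-stair) (s≤s z≤n)
  where
  open DominantStaircase w↭ dom {suc a′} {suc a′ + r} {suc k} e
  fits : (∃ λ z → lehmer w ≡ stair (suc a′) (suc a′ + r) (suc k) ++ zeros z) → size (Wide.forest a′ r (suc k)) ≤ n
  fits (z , e′) = ℕ.≤-trans (ℕ.≤-reflexive (Wide.size-forest a′ r (suc k) ∙ ℕ.+-comm _ (suc a′)))
    (ℕ.≤-trans (ℕ.+-monoʳ-≤ (suc a′) room) (ℕ.≤-reflexive (sym (ℕ.+-assoc (suc a′) (k * suc a′) z) ∙ sym (length-code e′))))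
    where
    rest : List ℕ
    rest = stair (suc a′) (suc a′ + r) k ++ zeros z
    room : suc k * (suc a′ + r) ≤ k * suc a′ + z
    room = ℕ.≤-trans (lehmer-room w (replicate a′ (suc k * (suc a′ + r))) {suc k * (suc a′ + r)} {rest}
        (e′ ∙ List.++-assoc (replicate (suc a′) _) (stair (suc a′) (suc a′ + r) k) (zeros z) ∙ sym (replicate-∷ a′ _ rest)))
      (ℕ.≤-reflexive (List.length-++ (stair (suc a′) (suc a′ + r) k) ∙ cong₂ _+_ (length-stair (suc a′) (suc a′ + r) k) (List.length-replicate z)))
... | no a≰b with r , eq ← ℕ.m≤n⇒∃[o]m+o≡n (ℕ.≰⇒> a≰b) = tall (suc a′) (sym (ℕ.+-suc b r ∙ eq)) e
  where
  tall : ∀ a → a ≡ b + suc r → shape w ≡ stair a b (suc k) → EX (WeakInterval n w) ≡ frac (suc k * a * b) (a + b)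
  tall _ refl e = EX-forest (Tall.stairForest b r (suc k)) (fits lehmer-stair) (ℕ.≤-trans b>0 (ℕ.m≤n+m b (b + suc r)))
    where
    open DominantStaircase w↭ dom {b + suc r} {b} {suc k} e
    fits : (∃ λ z → lehmer w ≡ stair (b + suc r) b (suc k) ++ zeros z) → size (Tall.forest b r (suc k)) ≤ n
    fits (z , e′) = ℕ.≤-trans (ℕ.≤-reflexive (Tall.size-forest b r (suc k))) (ℕ.≤-trans (ℕ.+-monoʳ-≤ (suc k * (b + suc r)) room) (ℕ.≤-reflexive (sym (length-code e′))))
      where
      X′ : List ℕ
      X′ = map (b +_) (stair (b + suc r) b k)
      room : b ≤ z
      room = ℕ.≤-trans (lehmer-room w (X′ ++ replicate (b + r) b) {b} {zeros z}
          (e′ ∙ cong (_++ zeros z) (Tall.stair-shift b r k) ∙ List.++-assoc X′ _ _ ∙ cong (X′ ++_) (cong (λ c → replicate c b ++ zeros z) (ℕ.+-suc b r) ∙ sym (replicate-∷ (b + r) b (zeros z))) ∙ sym (List.++-assoc X′ _ _)))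
        (ℕ.≤-reflexive (List.length-replicate z))

-- Coincidence of expectations for vexillary permutations

theorem1p1 : (n : ℕ) (w lam : List ℕ) → w ↭ upTo n → Vexillary w → shape w ≡ lam →
    (EY (YoungInterval lam) ≡ EY (WeakInterval n w))
    × ((Grassmannian w ⊎ InverseGrassmannian w) → EX (YoungInterval lam) ≡ EX (WeakInterval n w))
    × ((d a b : ℕ) → 1 ≤ d → 1 ≤ a → 1 ≤ b → lam ≡ rectStaircase d a b →
    (Dominant w ⊎ Grassmannian w ⊎ InverseGrassmannian w) →
    (IsCDE (YoungInterval lam) × EX (YoungInterval lam) ≡ frac ((d ∸ 1) * a * b) (a + b))
    × (IsCDE (WeakInterval n w) × EX (WeakInterval n w) ≡ frac ((d ∸ 1) * a * b) (a + b))
    × (IsCDE (dual (YoungInterval lam)) × EX (dual (YoungInterval lam)) ≡ frac ((d ∸ 1) * a * b) (a + b))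
    × (IsCDE (dual (WeakInterval n w)) × EX (dual (WeakInterval n w)) ≡ frac ((d ∸ 1) * a * b) (a + b)))
theorem1p1 n w lam w↭ vexillary refl = EY-equal , EX-equal , staircase
  where
  open VexillaryPermutation w↭
  young weak : FinPoset
  young = YoungInterval (shape w)
  weak  = WeakInterval n w

  EY-equal : EY young ≡ EY weak
  EY-equal = EY-young-weak vexillary

  EX-equal : Grassmannian w ⊎ InverseGrassmannian w → EX young ≡ EX weak
  EX-equal = [ EX-young-grassmannian , EX-young-inverseGrassmannian ]′

  staircase : (d a b : ℕ) → 1 ≤ d → 1 ≤ a → 1 ≤ b → shape w ≡ rectStaircase d a b → Dominant w ⊎ Grassmannian w ⊎ InverseGrassmannian w →
    (IsCDE young × EX young ≡ frac ((d ∸ 1) * a * b) (a + b))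
    × (IsCDE weak × EX weak ≡ frac ((d ∸ 1) * a * b) (a + b))
    × (IsCDE (dual young) × EX (dual young) ≡ frac ((d ∸ 1) * a * b) (a + b))
    × (IsCDE (dual weak) × EX (dual weak) ≡ frac ((d ∸ 1) * a * b) (a + b))
  staircase (suc k) a b _ a>0 b>0 e class =
    (EX-young ∙ sym EY-young , EX-young) , (EX-weak ∙ sym EY-weak , EX-weak)
    , (EX-dual young ∙ EX-young ∙ sym EY-young-dual , EX-dual young ∙ EX-young)
    , (EX-dual weak ∙ EX-weak ∙ sym (Interval.EY-dual n w w↭ ∙ EY-weak) , EX-dual weak ∙ EX-weak)
    where
    open RectangularStaircase k a b a>0 b>0
    shape≡ : shape w ≡ stair a b k
    shape≡ = e ∙ rectStaircase-stair k a b
    EX-young : EX young ≡ frac (k * a * b) (a + b)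
    EX-young = cong (EX ∘ YoungInterval) shape≡ ∙ EX-stair
    EY-young : EY young ≡ frac (k * a * b) (a + b)
    EY-young = cong (EY ∘ YoungInterval) shape≡ ∙ EY-stair
    EY-young-dual : EY (dual young) ≡ frac (k * a * b) (a + b)
    EY-young-dual = cong (EY ∘ dual ∘ YoungInterval) shape≡ ∙ EY-stair-dual
    EY-weak : EY weak ≡ frac (k * a * b) (a + b)
    EY-weak = sym EY-equal ∙ EY-young
    EX-weak : EX weak ≡ frac (k * a * b) (a + b)
    EX-weak = [ (λ dominant → EX-dominant w↭ dominant a b k a>0 b>0 shape≡) , (λ gr → sym (EX-equal gr) ∙ EX-young) ]′ class
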